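{- Let $\lambda,\mu$ be partitions of $n$ and let $a_{\lambda\mu}(t)$ be the coefficient of the monomial symmetric function $m_\mu$ in $\tilde H_\lambda(x;t)$, i.e. $\tilde H_\lambda(x;t)=\sum_\mu a_{\lambda\mu}(t)m_\mu$. Then $$a_{\lambda\mu}(t)=\sum_\theta t^{w(\theta)},$$ where the sum is over all tabloids $\theta$ of shape $\lambda$ and content $\mu$.
   Context: $\tilde H_\lambda(x;t)=\sum_\nu\tilde K_{\nu\lambda}(t)s_\nu$ is the modified Hall–Littlewood polynomial, where $\tilde K_{\nu\lambda}(t)=\sum_{\mathcal T}t^{\mathrm{cocharge}(\mathcal T)}$ over semistandard Young tableaux $\mathcal T$ of shape $\nu$ and content $\lambda$ (equivalently $t^{n(\lambda)}K_{\nu\lambda}(t^{ -1})$, $K_{\nu\lambda}$ the Kostka–Foulkes polynomial, $n(\lambda)=\sum_i(i-1)\lambda_i$). Young diagrams are in English notation. A tabloid of shape $\lambda$ and content $\mu$ is a filling of the Young diagram of $\lambda$ containing exactly $\mu_i$ entries equal to $i$ for each $i$, whose rows are weakly increasing from left to right (no condition on columns). For a tabloid $\theta$, $w(\theta)$ is the number of pairs of cells with entries $i>k$ such that (1) the cell of $i$ is either below the cell of $k$ in the same column or in a column strictly to the left of $k$'s column, and (2) if there is a box immediately to the right of $k$'s cell, filled with $j$, then $i\le j$. -}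

module Defs where

open import Data.Nat using (ℕ; zero; suc; _+_; _*_; _∸_; _≥_; _>_; _≡ᵇ_; _<ᵇ_; _≤ᵇ_; _⊔_; _⊓_)
open import Data.Bool using (Bool; true; false; _∧_; _∨_; if_then_else_; not)
open import Data.Nat.ListAction using (sum)
open import Data.List using (List; []; _∷_; map; concatMap; concat; filter; length; upTo; reverse; zip; foldr; _++_)
open import Data.List.Relation.Unary.All using (All)
open import Data.List.Relation.Unary.Linked using (Linked)
open import Data.Maybe using (Maybe; just; nothing)
open import Data.Product using (_×_; _,_; proj₁; proj₂)
open import Relation.Binary.PropositionalEquality using (_≡_)
open import Relation.Nullary.Decidable using (does)
open import Data.Nat.Properties using (_≟_)

IsPartition : List ℕ → Set
IsPartition p = All (λ x → x > 0) p × Linked _≥_ p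

-- All partitions of n (each listed once), parts bounded by b.
-- The first argument is fuel (n suffices).
partsLe : ℕ → ℕ → ℕ → List (List ℕ)
partsLe zero    zero    b = [] ∷ []
partsLe zero    (suc n) b = []
partsLe (suc f) zero    b = [] ∷ []
partsLe (suc f) (suc n) b =
  concatMap (λ k → map (suc k ∷_) (partsLe f (suc n ∸ suc k) (suc k)))
            (upTo (suc n ⊓ b))

partitions : ℕ → List (List ℕ)
partitions n = partsLe n n n

-- Fillings.  A filling of a shape (list of row lengths) is a list of rows
-- (English notation, top row first), each row a list of entries.

between : ℕ → ℕ → List ℕ
between lo hi = map (lo +_) (upTo (suc hi ∸ lo))

incRows : ℕ → ℕ → ℕ → List (List ℕ)
incRows zero    lo hi = [] ∷ []
incRows (suc L) lo hi = concatMap (λ x → map (x ∷_) (incRows L x hi)) (between lo hi)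

rowFillings : List ℕ → ℕ → List (List (List ℕ))
rowFillings []      hi = [] ∷ []
rowFillings (L ∷ s) hi =
  concatMap (λ r → map (r ∷_) (rowFillings s hi)) (incRows L 1 hi)

count : ℕ → List ℕ → ℕ
count i ws = length (filter (λ x → i ≟ x) ws)

contentOk : ℕ → List ℕ → List ℕ → Bool
contentOk i []       ws = true
contentOk i (m ∷ ms) ws = (count i ws ≡ᵇ m) ∧ contentOk (suc i) ms ws

hasContent : List ℕ → List (List ℕ) → Bool
hasContent mu F = contentOk 1 mu (concat F)

tabloids : List ℕ → List ℕ → List (List (List ℕ))
tabloids la mu = filter (λ F → Data.Bool._≟_ (hasContent mu F) true)
                        (rowFillings la (length mu))

strictBelow : List ℕ → List ℕ → Bool
strictBelow as       []       = true
strictBelow []       (_ ∷ _)  = false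
strictBelow (a ∷ as) (b ∷ bs) = (a <ᵇ b) ∧ strictBelow as bs

colStrict : List (List ℕ) → Bool
colStrict []             = true
colStrict (r ∷ [])       = true
colStrict (r ∷ r' ∷ rs)  = strictBelow r r' ∧ colStrict (r' ∷ rs)

ssyt : List ℕ → List ℕ → List (List (List ℕ))
ssyt nu la = filter (λ F → Data.Bool._≟_ (colStrict F) true) (tabloids nu la)

-- Kostka number K_{nu mu}: number of SSYT of shape nu and content mu
-- (= coefficient of m_mu in s_nu).
kostka : List ℕ → List ℕ → ℕ
kostka nu mu = length (ssyt nu mu)

-- Cocharge (Lascoux–Schützenberger).
-- Reading word of a tableau: rows from bottom to top, each left to right.

readingWord : List (List ℕ) → List ℕ
readingWord F = concat (reverse F)

Entry : Set
Entry = ℕ × ℕ   -- (position, letter)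

indexed : ℕ → List ℕ → List Entry
indexed p []       = []
indexed p (x ∷ xs) = (p , x) ∷ indexed (suc p) xs

maxPos : ℕ → (ℕ → Bool) → List Entry → Maybe ℕ
maxPos l P [] = nothing
maxPos l P ((q , x) ∷ es) with maxPos l P es | (l ≡ᵇ x) ∧ P q
... | r        | false = r
... | nothing  | true  = just q
... | just q'  | true  = just (q ⊔ q')

removePos : ℕ → List Entry → List Entry
removePos q [] = []
removePos q ((p , x) ∷ es) = if p ≡ᵇ q then es else (p , x) ∷ removePos q es

-- Continue a standard subword: previous letter k-1 was at position p with
-- cocharge index idx; find letter k scanning leftwards cyclically.
-- The index increases by 1 when k is found to the left of k-1 (no wrap).
-- Returns (sum of indices of letters k, k+1, ...) and remaining entries.
subword : ℕ → ℕ → ℕ → ℕ → List Entry → ℕ × List Entry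
subword zero    k p idx es = 0 , es
subword (suc f) k p idx es with maxPos k (λ q → q <ᵇ p) es
... | just q  = let r = subword f (suc k) q (suc idx) (removePos q es)
                in (suc idx + proj₁ r) , proj₂ r
... | nothing with maxPos k (λ _ → true) es
...   | nothing = 0 , es
...   | just q  = let r = subword f (suc k) q idx (removePos q es)
                  in (idx + proj₁ r) , proj₂ r

-- cocharge of a word (with partition content): sum over the standard
-- subwords extracted starting from the rightmost 1 (which has index 0).
cochargeE : ℕ → List Entry → ℕ
cochargeE zero    es = 0
cochargeE (suc f) es with maxPos 1 (λ _ → true) es
... | nothing = 0
... | just q  = let r = subword (length es) 2 q 0 (removePos q es)
                in proj₁ r + cochargeE f (proj₂ r)

cocharge : List (List ℕ) → ℕ
cocharge T = let w = readingWord T in cochargeE (length w) (indexed 0 w)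

-- Polynomials in t with ℕ coefficients are represented by their
-- coefficient functions ℕ → ℕ.  genPoly xs s = Σ_{x ∈ xs} t^{s x}.

genPoly : {A : Set} → List A → (A → ℕ) → ℕ → ℕ
genPoly xs s k = length (filter (λ x → s x ≟ k) xs)

Ktilde : List ℕ → List ℕ → ℕ → ℕ
Ktilde nu la = genPoly (ssyt nu la) cocharge

-- a_{la mu}(t): coefficient of m_mu in H~_la = Σ_{nu ⊢ n} K~_{nu la}(t) s_nu,
-- using s_nu = Σ_mu K_{nu mu} m_mu.
aCoeff : ℕ → List ℕ → List ℕ → ℕ → ℕ
aCoeff n la mu k = sum (map (λ nu → Ktilde nu la k * kostka nu mu) (partitions n))

Cell : Set
Cell = ℕ × ℕ × ℕ   -- (row, column, entry), 0-indexed rows/columns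

rowCells : ℕ → ℕ → List ℕ → List Cell
rowCells r c []       = []
rowCells r c (x ∷ xs) = (r , c , x) ∷ rowCells r (suc c) xs

cellsFrom : ℕ → List (List ℕ) → List Cell
cellsFrom r []       = []
cellsFrom r (x ∷ xs) = rowCells r 0 x ++ cellsFrom (suc r) xs

cells : List (List ℕ) → List Cell
cells = cellsFrom 0

lookup2 : List (List ℕ) → ℕ → ℕ → Maybe ℕ
lookup2 []       r       c       = nothing
lookup2 (x ∷ xs) (suc r) c       = lookup2 xs r c
lookup2 (x ∷ xs) zero    c       = go x c
  where
  go : List ℕ → ℕ → Maybe ℕ
  go []       c       = nothing
  go (y ∷ ys) zero    = just y
  go (y ∷ ys) (suc c) = go ys c

wPair : List (List ℕ) → Cell → Cell → Bool
wPair θ (r1 , c1 , i) (r2 , c2 , k) =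
  (k <ᵇ i) ∧ (((c1 ≡ᵇ c2) ∧ (r2 <ᵇ r1)) ∨ (c1 <ᵇ c2)) ∧ rightOk (lookup2 θ r2 (suc c2))
  where
  rightOk : Maybe ℕ → Bool
  rightOk nothing  = true
  rightOk (just j) = i ≤ᵇ j

wStat : List (List ℕ) → ℕ
wStat θ = let cs = cells θ in
  sum (map (λ p → length (filter (λ q → Data.Bool._≟_ (wPair θ p q) true) cs)) cs)

module Submission where

-- Both sides are compared at t = 1, 2, 3, …, as integers.  Row insertion respects the cocharge, so by the
-- Pieri rule the left-hand side is the sum of t^cocharge(w) over the words w = B₁ B₂ … of content λ whose
-- blocks Bᵢ are weakly increasing of length μᵢ (WS).  On the tabloid side, removing the largest entries
-- cuts a row β down to α for every row, with a factor t^stat, which gives a recursion (FF).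
--
-- The sums over words obey three rules: blocks may be permuted (row insertion), letters 1 in the first
-- block with a 1 in it can be dropped as long as the content stays a partition, and a word 1ˣ v preceded by
-- y ∌ 1 can be rotated to v y with all letters lowered, which costs |y|.  The last two rest on describing the
-- cocharge by least fixpoints of maps on the states of a particle system.  Prolonging the first block
-- shows that these rules determine the sums by induction on the number of rows of λ (family-unique).
--
-- FF obeys the same rules.  The only difficult one is the first: the operators H u that cut rows commute.
-- They are inverse to operators E (⊖ u) that shorten each row by at most one, and the product of two E's
-- on rows of equal length is visibly symmetric.

-- Standard subwords are extracted one after another, and a Knuth move or a rotation may change all
-- of them. The total number of wraps survives: if each subword is the path of a particle, it does
-- not matter which of several particles at a station moves, so only the action of the word on
-- occupation numbers counts. The wraps are the particles waiting at the end of a word that is read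
-- cyclically, and the cocharge is a fixed weight minus their totals. Other fixed states can contain
-- particles that never move, hence least fixpoints.
--
-- On the tabloid side the symmetry in the content is hidden because a row may lose many cells. The
-- variable `u` collects strips of all sizes, and `E (⊖ u)` inverts `H u` as the signed series of
-- elementary symmetric functions inverts that of the complete ones. For `E` only runs of rows of
-- equal length need a computation.
--
-- A sum is determined by the rules because it is one term in the expansion of a sum with one more
-- block: with enough letters 1 that block can be moved behind all others and everything else
-- peeled, while the remaining terms take more out of the other rows.

open import Defs
open import Data.Nat using (ℕ; zero; suc; _+_; _*_; _∸_; _≤_; _<_; _≥_; _>_; z≤n; s≤s; z<s; s<s; s≤s⁻¹; _⊓_; _≡ᵇ_; _<ᵇ_; _≤ᵇ_; _≤?_; _<?_)
open import Data.Nat.Properties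
open import Data.Nat.ListAction using (sum)
import Data.Nat.ListAction.Properties as LAP
open import Data.Integer using (ℤ; 0ℤ; 1ℤ) renaming (+_ to pos; _+_ to _⊕_; _*_ to _⊗_; -_ to ⊖_; _^_ to _^ᶻ_)
import Data.Integer.Properties as ℤP
import Data.Integer.Tactic.RingSolver as ℤR
import Data.Nat.Tactic.RingSolver as ℕR
open import Data.List using (List; []; _∷_; _++_; map; concat; concatMap; filter; length; upTo; replicate; reverse; [_])
import Data.List.Properties as LP
open import Data.List.Relation.Unary.All as All using (All; []; _∷_)
import Data.List.Relation.Unary.All.Properties as AllP
open import Data.List.Relation.Unary.Any using (here; there)
open import Data.List.Relation.Unary.AllPairs using ([]; _∷_)
open import Data.List.Relation.Unary.Linked using (Linked; []; [-]; _∷_; linked?)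
open import Data.List.Relation.Unary.Unique.Propositional using (Unique)
import Data.List.Relation.Unary.Unique.Propositional.Properties as UP
open import Data.List.Membership.Propositional using (_∈_; _∉_; find)
open import Data.List.Membership.Propositional.Properties
open import Data.List.Relation.Binary.Permutation.Propositional using (_↭_; prep; swap; ↭-refl; ↭-sym; ↭-trans)
import Data.List.Relation.Binary.Permutation.Propositional as Perm
import Data.List.Relation.Binary.Permutation.Propositional.Properties as PermP
open import Data.List.Relation.Binary.Pointwise using (Pointwise; []; _∷_)
import Data.List.Relation.Binary.Pointwise as PW
open import Data.Product using (_×_; _,_; proj₁; proj₂; Σ; ∃-syntax)
open import Data.Sum using (_⊎_; inj₁; inj₂; [_,_]′)
open import Data.Empty using (⊥; ⊥-elim)
open import Data.Unit using (⊤; tt)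
open import Data.Maybe using (Maybe; just; nothing)
open import Data.Bool using (Bool; true; false; _∧_; _∨_; if_then_else_; T)
import Data.Bool.Properties as BP
open import Relation.Nullary using (Dec; yes; no; ¬_; does; _×-dec_)
open import Relation.Binary.PropositionalEquality
open import Function using (_∘_; id)
open import Tactic.MonoidSolver using (solve)
open import Tactic.Cong using (cong!)
open ≡-Reasoning

-- Finite sums

private variable
  𝒜 ℬ 𝒞 : Set

∑ : List 𝒜 → (𝒜 → ℤ) → ℤ
∑ []       f = 0ℤ
∑ (x ∷ xs) f = f x ⊕ ∑ xs f

∑-cong : (xs : List 𝒜) {f g : 𝒜 → ℤ} → (∀ x → f x ≡ g x) → ∑ xs f ≡ ∑ xs g
∑-cong []       e = refl
∑-cong (x ∷ xs) e = cong₂ _⊕_ (e x) (∑-cong xs e)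

∑-cong∈ : (xs : List 𝒜) {f g : 𝒜 → ℤ} → (∀ {x} → x ∈ xs → f x ≡ g x) → ∑ xs f ≡ ∑ xs g
∑-cong∈ []       e = refl
∑-cong∈ (x ∷ xs) e = cong₂ _⊕_ (e (here refl)) (∑-cong∈ xs (e ∘ there))

∑-++ : (xs ys : List 𝒜) (f : 𝒜 → ℤ) → ∑ (xs ++ ys) f ≡ ∑ xs f ⊕ ∑ ys f
∑-++ []       ys f = sym (ℤP.+-identityˡ _)
∑-++ (x ∷ xs) ys f = trans (cong (f x ⊕_) (∑-++ xs ys f)) (sym (ℤP.+-assoc (f x) _ _))

∑-map : (h : 𝒜 → ℬ) (xs : List 𝒜) (f : ℬ → ℤ) → ∑ (map h xs) f ≡ ∑ xs (f ∘ h)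
∑-map h []       f = refl
∑-map h (x ∷ xs) f = cong (f (h x) ⊕_) (∑-map h xs f)

∑-bind : (F : 𝒜 → List ℬ) (xs : List 𝒜) (f : ℬ → ℤ) →
         ∑ (concatMap F xs) f ≡ ∑ xs (λ x → ∑ (F x) f)
∑-bind F []       f = refl
∑-bind F (x ∷ xs) f = trans (∑-++ (F x) (concatMap F xs) f) (cong (∑ (F x) f ⊕_) (∑-bind F xs f))

∑-bindmap : (c : 𝒜 → ℬ → 𝒞) (F : 𝒜 → List ℬ) (xs : List 𝒜) (f : 𝒞 → ℤ) →
            ∑ (concatMap (λ x → map (c x) (F x)) xs) f ≡ ∑ xs (λ x → ∑ (F x) (f ∘ c x))
∑-bindmap c F xs f = trans (∑-bind (λ x → map (c x) (F x)) xs f) (∑-cong xs (λ x → ∑-map (c x) (F x) f))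

∑-0 : (xs : List 𝒜) → ∑ xs (λ _ → 0ℤ) ≡ 0ℤ
∑-0 []       = refl
∑-0 (x ∷ xs) = trans (ℤP.+-identityˡ _) (∑-0 xs)

⊕-interchange : ∀ a b c d → (a ⊕ b) ⊕ (c ⊕ d) ≡ (a ⊕ c) ⊕ (b ⊕ d)
⊕-interchange = ℤR.solve-∀

∑-⊕ : (xs : List 𝒜) (f g : 𝒜 → ℤ) → ∑ xs (λ x → f x ⊕ g x) ≡ ∑ xs f ⊕ ∑ xs g
∑-⊕ []       f g = refl
∑-⊕ (x ∷ xs) f g = trans (cong ((f x ⊕ g x) ⊕_) (∑-⊕ xs f g)) (⊕-interchange (f x) (g x) _ _)

∑-⊗ : (xs : List 𝒜) (c : ℤ) (f : 𝒜 → ℤ) → ∑ xs (λ x → c ⊗ f x) ≡ c ⊗ ∑ xs f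
∑-⊗ []       c f = sym (ℤP.*-zeroʳ c)
∑-⊗ (x ∷ xs) c f = trans (cong (c ⊗ f x ⊕_) (∑-⊗ xs c f)) (sym (ℤP.*-distribˡ-+ c (f x) _))

∑-swap : (xs : List 𝒜) (ys : List ℬ) (f : 𝒜 → ℬ → ℤ) →
         ∑ xs (λ x → ∑ ys (f x)) ≡ ∑ ys (λ y → ∑ xs (λ x → f x y))
∑-swap []       ys f = sym (∑-0 ys)
∑-swap (x ∷ xs) ys f =
  trans (cong (∑ ys (f x) ⊕_) (∑-swap xs ys f)) (sym (∑-⊕ ys (f x) (λ y → ∑ xs (λ x → f x y))))

∑-↭ : {xs ys : List 𝒜} (f : 𝒜 → ℤ) → xs ↭ ys → ∑ xs f ≡ ∑ ys f
∑-↭ f Perm.refl          = refl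
∑-↭ f (prep x p)         = cong (f x ⊕_) (∑-↭ f p)
∑-↭ f (swap x y p)       = trans (cong (λ z → f x ⊕ (f y ⊕ z)) (∑-↭ f p)) (lem (f x) (f y) _)
  where
  lem : ∀ a b c → a ⊕ (b ⊕ c) ≡ b ⊕ (a ⊕ c)
  lem = ℤR.solve-∀
∑-↭ f (Perm.trans p q)   = trans (∑-↭ f p) (∑-↭ f q)

infixr 5 _▹_
_▹_ : Bool → ℤ → ℤ
true  ▹ x = x
false ▹ x = 0ℤ

▹-∧ : ∀ b c x → (b ∧ c) ▹ x ≡ b ▹ c ▹ x
▹-∧ true  c x = refl
▹-∧ false c x = refl

▹-0 : ∀ b → b ▹ 0ℤ ≡ 0ℤ
▹-0 true  = refl
▹-0 false = refl

▹-⊗ : ∀ b c x → c ⊗ (b ▹ x) ≡ b ▹ (c ⊗ x)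
▹-⊗ true  c x = refl
▹-⊗ false c x = ℤP.*-zeroʳ c

▹-comm : ∀ b c x → b ▹ c ▹ x ≡ c ▹ b ▹ x
▹-comm true  c x = refl
▹-comm false c x = sym (▹-0 c)

∑-▹ : (xs : List 𝒜) (b : Bool) (f : 𝒜 → ℤ) → ∑ xs (λ x → b ▹ f x) ≡ b ▹ ∑ xs f
∑-▹ xs true  f = refl
∑-▹ xs false f = ∑-0 xs

∑-filter : {P : 𝒜 → Set} (P? : ∀ x → Dec (P x)) (xs : List 𝒜) (f : 𝒜 → ℤ) →
           ∑ (filter P? xs) f ≡ ∑ xs (λ x → does (P? x) ▹ f x)
∑-filter P? []       f = refl
∑-filter P? (x ∷ xs) f with P? x
... | yes _ = cong (f x ⊕_) (∑-filter P? xs f)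
... | no  _ = trans (∑-filter P? xs f) (sym (ℤP.+-identityˡ _))

∑-filterᵇ : (p : 𝒜 → Bool) (xs : List 𝒜) (f : 𝒜 → ℤ) →
            ∑ (filter (λ x → Data.Bool._≟_ (p x) true) xs) f ≡ ∑ xs (λ x → p x ▹ f x)
∑-filterᵇ p xs f = trans (∑-filter (λ x → Data.Bool._≟_ (p x) true) xs f) (∑-cong xs (λ x → cong (_▹ f x) (lem (p x))))
  where
  lem : ∀ b → does (Data.Bool._≟_ b true) ≡ b
  lem true  = refl
  lem false = refl

Unique-resp-↭ : {xs ys : List 𝒜} → xs ↭ ys → Unique xs → Unique ys
Unique-resp-↭ Perm.refl        u = u
Unique-resp-↭ (prep x p)       (x∉ ∷ u) = PermP.All-resp-↭ p x∉ ∷ Unique-resp-↭ p u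
Unique-resp-↭ (swap x y p)     ((x≢y ∷ x∉) ∷ y∉ ∷ u) =
  ((x≢y ∘ sym) ∷ PermP.All-resp-↭ p y∉) ∷ PermP.All-resp-↭ p x∉ ∷ Unique-resp-↭ p u
Unique-resp-↭ (Perm.trans p q) u = Unique-resp-↭ q (Unique-resp-↭ p u)

extract : {x : 𝒜} {xs : List 𝒜} → x ∈ xs → ∃[ ys ] xs ↭ x ∷ ys
extract {x = x} x∈ with ∈-∃++ x∈
... | ys , zs , refl = ys ++ zs , PermP.shift x ys zs

-- Induction on `xs`: a permutation brings `g x` to the front of `ys`, and the two inverse laws show
-- that `g` and `h` restrict to what remains.
∑-bij : (xs : List 𝒜) (ys : List ℬ) (g : 𝒜 → ℬ) (h : ℬ → 𝒜) → Unique xs → Unique ys →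
        (∀ {x} → x ∈ xs → g x ∈ ys × h (g x) ≡ x) →
        (∀ {y} → y ∈ ys → h y ∈ xs × g (h y) ≡ y) →
        {f : 𝒜 → ℤ} {f′ : ℬ → ℤ} → (∀ {x} → x ∈ xs → f x ≡ f′ (g x)) → ∑ xs f ≡ ∑ ys f′
∑-bij []       []       g h ux uy gx hy e = refl
∑-bij []       (y ∷ ys) g h ux uy gx hy e with hy (here refl)
... | () , _
∑-bij (x ∷ xs) ys g h (x∉ ∷ ux) uy gx hy {f} {f′} e with extract (proj₁ (gx (here refl)))
... | ys′ , p with Unique-resp-↭ p uy
... | y∉ ∷ uy′ =
  trans (cong₂ _⊕_ (e (here refl)) (∑-bij xs ys′ g h ux uy′ gx′ hy′ (e ∘ there))) (sym (∑-↭ f′ p))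
  where
  gx′ : ∀ {x′} → x′ ∈ xs → g x′ ∈ ys′ × h (g x′) ≡ x′
  gx′ {x′} m with PermP.∈-resp-↭ p (proj₁ (gx (there m)))
  ... | there m′ = m′ , proj₂ (gx (there m))
  ... | here eq  = ⊥-elim (All.lookup x∉ m (trans (sym (proj₂ (gx (here refl)))) (trans (cong h (sym eq)) (proj₂ (gx (there m))))))
  hy′ : ∀ {y} → y ∈ ys′ → h y ∈ xs × g (h y) ≡ y
  hy′ {y} m with hy (PermP.∈-resp-↭ (↭-sym p) (there m))
  ... | there m′ , eq = m′ , eq
  ... | here m′ , eq  = ⊥-elim (All.lookup y∉ m (trans (cong g (sym m′)) eq))

module Bind {𝒜 ℬ 𝒞 : Set} (c : 𝒜 → ℬ → 𝒞)
            (inj : ∀ {x x′ y y′} → c x y ≡ c x′ y′ → x ≡ x′ × y ≡ y′) (F : 𝒜 → List ℬ) where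
  bind : List 𝒜 → List 𝒞
  bind = concatMap (λ x → map (c x) (F x))

  bind⁺ : ∀ {xs x y} → x ∈ xs → y ∈ F x → c x y ∈ bind xs
  bind⁺ {xs} {x} x∈ y∈ = ∈-concatMap⁺ (λ x → map (c x) (F x)) (Data.List.Relation.Unary.Any.map (λ { refl → ∈-map⁺ (c x) y∈ }) x∈)

  bind⁻ : ∀ {xs z} → z ∈ bind xs → ∃[ x ] ∃[ y ] (x ∈ xs × y ∈ F x × z ≡ c x y)
  bind⁻ {xs} z∈ with find (∈-concatMap⁻ (λ x → map (c x) (F x)) {xs = xs} z∈)
  ... | x , x∈ , z∈′ with ∈-map⁻ (c x) z∈′
  ... | y , y∈ , eq = x , y , x∈ , y∈ , eq

  bind-unique : ∀ {xs} → Unique xs → (∀ x → Unique (F x)) → Unique (bind xs)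
  bind-unique {[]} u uF = []
  bind-unique {x ∷ xs} (x∉ ∷ u) uF =
    UP.++⁺ (UP.map⁺ (λ e → proj₂ (inj e)) (uF x)) (bind-unique u uF) disj
    where
    disj : ∀ {z} → z ∈ map (c x) (F x) × z ∈ bind xs → ⊥
    disj (m₁ , m₂) with ∈-map⁻ (c x) m₁ | bind⁻ {xs} m₂
    ... | y , y∈ , refl | x′ , y′ , x′∈ , y′∈ , eq = All.lookup x∉ x′∈ (proj₁ (inj eq))

∷-inj : ∀ {x x′ : 𝒜} {y y′ : List 𝒜} → x ∷ y ≡ x′ ∷ y′ → x ≡ x′ × y ≡ y′
∷-inj refl = refl , refl

-- The pair `(r , 0)` comes last; `∑-splits-last` relies on this order.
splits : ℕ → List (ℕ × ℕ)
splits zero    = (0 , 0) ∷ []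
splits (suc r) = (0 , suc r) ∷ map (λ p → suc (proj₁ p) , proj₂ p) (splits r)

splits⁻ : ∀ {r b j} → (b , j) ∈ splits r → b + j ≡ r
splits⁻ {zero}  (here refl) = refl
splits⁻ {suc r} (here refl) = refl
splits⁻ {suc r} (there m) with ∈-map⁻ _ m
... | _ , m′ , refl = cong suc (splits⁻ m′)

splits⁺ : ∀ b j → (b , j) ∈ splits (b + j)
splits⁺ zero    zero    = here refl
splits⁺ zero    (suc j) = here refl
splits⁺ (suc b) j       = there (∈-map⁺ _ (splits⁺ b j))

splits-unique : ∀ r → Unique (splits r)
splits-unique zero    = [] ∷ []
splits-unique (suc r) =
  AllP.map⁺ (All.tabulate (λ _ ())) ∷ UP.map⁺ (λ { refl → refl }) (splits-unique r)

vecs : ℕ → ℕ → List (List ℕ)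
vecs zero    zero    = [] ∷ []
vecs zero    (suc r) = []
vecs (suc N) r       = concatMap (λ p → map (proj₁ p ∷_) (vecs N (proj₂ p))) (splits r)

∑-vecs : ∀ N r (f : List ℕ → ℤ) →
         ∑ (vecs (suc N) r) f ≡ ∑ (splits r) (λ p → ∑ (vecs N (proj₂ p)) (λ v → f (proj₁ p ∷ v)))
∑-vecs N r f = ∑-bindmap (λ p v → proj₁ p ∷ v) (λ p → vecs N (proj₂ p)) (splits r) f

vecs⁺ : ∀ v → v ∈ vecs (length v) (sum v)
vecs⁺ []      = here refl
vecs⁺ (x ∷ v) =
  ∈-concatMap⁺ (λ p → map (proj₁ p ∷_) (vecs (length v) (proj₂ p)))
    (Data.List.Relation.Unary.Any.map (λ { refl → ∈-map⁺ (x ∷_) (vecs⁺ v) }) (splits⁺ x (sum v)))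

vecs⁻ : ∀ {N r v} → v ∈ vecs N r → length v ≡ N × sum v ≡ r
vecs⁻ {zero}  {zero}  (here refl) = refl , refl
vecs⁻ {suc N} {r} v∈ with find (∈-concatMap⁻ (λ p → map (proj₁ p ∷_) (vecs N (proj₂ p))) {xs = splits r} v∈)
... | (b , j) , p∈ , v∈′ with ∈-map⁻ (b ∷_) v∈′
... | w , w∈ , refl with vecs⁻ {N} {j} w∈
... | refl , refl = refl , splits⁻ p∈

vecs-unique : ∀ N r → Unique (vecs N r)
vecs-unique zero    zero    = [] ∷ []
vecs-unique zero    (suc r) = []
vecs-unique (suc N) r       = go (splits-unique r) splits⁻
  where
  go : ∀ {ps} → Unique ps → (∀ {b j} → (b , j) ∈ ps → b + j ≡ r) →
       Unique (concatMap (λ p → map (proj₁ p ∷_) (vecs N (proj₂ p))) ps)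
  go {[]} _ _ = []
  go {(b , j) ∷ ps} (p∉ ∷ u) s =
    UP.++⁺ (UP.map⁺ (λ e → proj₂ (∷-inj e)) (vecs-unique N j)) (go u (s ∘ there)) disj
    where
    disj : ∀ {z} → z ∈ map (b ∷_) (vecs N j) × z ∈ concatMap (λ p → map (proj₁ p ∷_) (vecs N (proj₂ p))) ps → ⊥
    disj (m₁ , m₂) with ∈-map⁻ (b ∷_) m₁ | find (∈-concatMap⁻ (λ p → map (proj₁ p ∷_) (vecs N (proj₂ p))) {xs = ps} m₂)
    ... | v , v∈ , refl | (b′ , j′) , p∈ , m₃ with ∈-map⁻ (b′ ∷_) m₃
    ... | v′ , v′∈ , refl =
      All.lookup p∉ p∈ (cong (b ,_) (+-cancelˡ-≡ b j j′ (trans (s (here refl)) (sym (s (there p∈))))))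

-- The particle system

-- A state records the number of particles waiting at stations 0, 1, 2, …; the letter suc k moves
-- one particle from station k to the next station, or out of the list.
inj : ℕ → List ℕ → List ℕ
inj k       []      = []
inj zero    (x ∷ s) = suc x ∷ s
inj (suc k) (x ∷ s) = x ∷ inj k s

step : ℕ → List ℕ → List ℕ
step k       []          = []
step zero    (zero ∷ s)  = zero ∷ s
step zero    (suc x ∷ s) = x ∷ inj zero s
step (suc k) (x ∷ s)     = x ∷ step k s

letter : ℕ → List ℕ → List ℕ
letter zero    s = s
letter (suc k) s = step k s

-- The rightmost letter acts first, so a particle travels leftwards through the word, in the
-- direction in which standard subwords are read.
run : List ℕ → List ℕ → List ℕ
run []      s = s
run (x ∷ w) s = letter x (run w s)

run-++ : ∀ u v s → run (u ++ v) s ≡ run u (run v s)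
run-++ []      v s = refl
run-++ (x ∷ u) v s = cong (letter x) (run-++ u v s)

length-inj : ∀ k s → length (inj k s) ≡ length s
length-inj k       []      = refl
length-inj zero    (x ∷ s) = refl
length-inj (suc k) (x ∷ s) = cong suc (length-inj k s)

length-step : ∀ k s → length (step k s) ≡ length s
length-step k       []          = refl
length-step zero    (zero ∷ s)  = refl
length-step zero    (suc x ∷ s) = cong suc (length-inj zero s)
length-step (suc k) (x ∷ s)     = cong suc (length-step k s)

length-letter : ∀ x s → length (letter x s) ≡ length s
length-letter zero    s = refl
length-letter (suc k) s = length-step k s

length-run : ∀ w s → length (run w s) ≡ length s
length-run []      s = refl
length-run (x ∷ w) s = trans (length-letter x (run w s)) (length-run w s)

inj-comm : ∀ i k s → inj i (inj k s) ≡ inj k (inj i s)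
inj-comm i       k       []      = refl
inj-comm zero    zero    (x ∷ s) = refl
inj-comm zero    (suc k) (x ∷ s) = refl
inj-comm (suc i) zero    (x ∷ s) = refl
inj-comm (suc i) (suc k) (x ∷ s) = cong (x ∷_) (inj-comm i k s)

-- Particles at one station are indistinguishable: a letter that meets an additional particle can be
-- taken to move that one, whatever else waits there. This makes it possible to follow one standard
-- subword independently of the others.
step-inj : ∀ k s → step k (inj k s) ≡ inj (suc k) s
step-inj k       []      = refl
step-inj zero    (x ∷ s) = refl
step-inj (suc k) (x ∷ s) = cong (x ∷_) (step-inj k s)

step-inj-≢ : ∀ k i s → k ≢ i → step k (inj i s) ≡ inj i (step k s)
step-inj-≢ k       i       []          ne = refl
step-inj-≢ zero    zero    (x ∷ s)     ne = ⊥-elim (ne refl)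
step-inj-≢ zero    (suc i) (zero ∷ s)  ne = refl
step-inj-≢ zero    (suc i) (suc x ∷ s) ne = cong (x ∷_) (inj-comm zero i s)
step-inj-≢ (suc k) zero    (x ∷ s)     ne = refl
step-inj-≢ (suc k) (suc i) (x ∷ s)     ne = cong (x ∷_) (step-inj-≢ k i s (ne ∘ cong suc))

run-inj : ∀ k w s → suc k ∉ w → run w (inj k s) ≡ inj k (run w s)
run-inj k []          s n = refl
run-inj k (zero ∷ w)  s n = run-inj k w s (n ∘ there)
run-inj k (suc x ∷ w) s n =
  trans (cong (step x) (run-inj k w s (n ∘ there)))
        (step-inj-≢ x k (run w s) (λ e → n (here (cong suc (sym e)))))

step-comm : ∀ k d s → step k (step (suc (suc k) + d) s) ≡ step (suc (suc k) + d) (step k s)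
step-comm k       d []              = refl
step-comm zero    d (zero ∷ s)      = refl
step-comm zero    d (suc x ∷ [])    = refl
step-comm zero    d (suc x ∷ y ∷ s) = refl
step-comm (suc k) d (x ∷ s)         = cong (x ∷_) (step-comm k d s)

step-yyx : ∀ x s → step (suc x) (step (suc x) (step x s)) ≡ step (suc x) (step x (step (suc x) s))
step-yyx x       []                  = refl
step-yyx zero    (zero ∷ s)          = refl
step-yyx zero    (suc a ∷ [])        = refl
step-yyx zero    (suc a ∷ zero ∷ s)  = refl
step-yyx zero    (suc a ∷ suc b ∷ s) = refl
step-yyx (suc x) (a ∷ s)             = cong (a ∷_) (step-yyx x s)

step-xzx : ∀ x s → step x (step (suc x) (step x s)) ≡ step (suc x) (step x (step x s))
step-xzx x       []                       = refl
step-xzx zero    (zero ∷ [])              = refl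
step-xzx zero    (zero ∷ zero ∷ s)        = refl
step-xzx zero    (zero ∷ suc b ∷ s)       = refl
step-xzx zero    (suc zero ∷ [])          = refl
step-xzx zero    (suc zero ∷ b ∷ s)       = refl
step-xzx zero    (suc (suc a) ∷ [])       = refl
step-xzx zero    (suc (suc a) ∷ b ∷ s)    = refl
step-xzx (suc x) (a ∷ s)                  = cong (a ∷_) (step-xzx x s)

letter-comm : ∀ {x z} → suc x < z → ∀ s → letter x (letter z s) ≡ letter z (letter x s)
letter-comm {zero}  {z}     p s = refl
letter-comm {suc k} {suc z} (s≤s p) s with m≤n⇒∃[o]m+o≡n p
... | d , refl = step-comm k d s

-- Letters that are not neighbours act on disjoint pairs of stations, so `x` and `z` commute unless
-- `z` is `suc x`. Then `y` must be `z`, and `step-yyx` remains.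
knuth₁ : ∀ {x y z} → x < y → y ≤ z → ∀ s →
         letter y (letter z (letter x s)) ≡ letter y (letter x (letter z s))
knuth₁ {x} {y} {z} x<y y≤z s with suc x <? z
... | yes p = cong (letter y) (sym (letter-comm p s))
... | no ¬p with ≤-antisym (≤-trans y≤z (≮⇒≥ ¬p)) x<y | ≤-antisym (≮⇒≥ ¬p) (≤-trans x<y y≤z)
knuth₁ {zero}  x<y y≤z s | no ¬p | refl | refl = refl
knuth₁ {suc x} x<y y≤z s | no ¬p | refl | refl = step-yyx x s

-- As for `knuth₁`, except that the neighbouring case forces `y` to be `x`.
knuth₂ : ∀ {x y z} → x ≤ y → y < z → ∀ s →
         letter x (letter z (letter y s)) ≡ letter z (letter x (letter y s))
knuth₂ {x} {y} {z} x≤y y<z s with suc x <? z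
... | yes p = letter-comm p _
... | no ¬p with ≤-antisym (s≤s⁻¹ (≤-trans y<z (≮⇒≥ ¬p))) x≤y | ≤-antisym (≮⇒≥ ¬p) (≤-trans (s≤s x≤y) y<z)
  where open Data.Nat using (s≤s⁻¹)
knuth₂ {zero}  x≤y y<z s | no ¬p | refl | refl = refl
knuth₂ {suc x} x≤y y<z s | no ¬p | refl | refl = step-xzx x s

infix 4 _≤ˢ_
_≤ˢ_ : List ℕ → List ℕ → Set
_≤ˢ_ = Pointwise _≤_

≤ˢ-refl : ∀ {s} → s ≤ˢ s
≤ˢ-refl = PW.refl ≤-refl

≤ˢ-trans : ∀ {s s′ s″} → s ≤ˢ s′ → s′ ≤ˢ s″ → s ≤ˢ s″
≤ˢ-trans = PW.transitive ≤-trans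

≤ˢ-antisym : ∀ {s s′} → s ≤ˢ s′ → s′ ≤ˢ s → s ≡ s′
≤ˢ-antisym []       []       = refl
≤ˢ-antisym (p ∷ ps) (q ∷ qs) = cong₂ _∷_ (≤-antisym p q) (≤ˢ-antisym ps qs)

≤ˢ-inj : ∀ k s → s ≤ˢ inj k s
≤ˢ-inj k       []      = []
≤ˢ-inj zero    (x ∷ s) = n≤1+n x ∷ ≤ˢ-refl
≤ˢ-inj (suc k) (x ∷ s) = ≤-refl ∷ ≤ˢ-inj k s

inj-mono : ∀ k {s s′} → s ≤ˢ s′ → inj k s ≤ˢ inj k s′
inj-mono k       []       = []
inj-mono zero    (p ∷ ps) = s≤s p ∷ ps
inj-mono (suc k) (p ∷ ps) = p ∷ inj-mono k ps

inj-cancel : ∀ k {s s′} → inj k s ≤ˢ inj k s′ → s ≤ˢ s′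
inj-cancel k       {[]}    {[]}     p = []
inj-cancel zero    {[]}    {_ ∷ _}  ()
inj-cancel (suc k) {[]}    {_ ∷ _}  ()
inj-cancel zero    {_ ∷ _} {[]}     ()
inj-cancel (suc k) {_ ∷ _} {[]}     ()
inj-cancel zero    {x ∷ s} {y ∷ s′} (s≤s p ∷ ps) = p ∷ ps
inj-cancel (suc k) {x ∷ s} {y ∷ s′} (p ∷ ps) = p ∷ inj-cancel k ps

inj-≤⇒inj : ∀ k {s q} → inj k s ≤ˢ q → ∃[ r ] q ≡ inj k r
inj-≤⇒inj k       {[]}    []         = [] , refl
inj-≤⇒inj zero    {x ∷ s} (_∷_ {y = suc y} {ys = ys} p ps) = y ∷ ys , refl
inj-≤⇒inj (suc k) {x ∷ s} (_∷_ {y = y} p ps) with inj-≤⇒inj k ps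
... | r , refl = y ∷ r , refl

-- The critical case is a particle that moves in the larger state only. It leaves a station at which
-- the smaller state has nothing, and at the next station it only raises the bound.
step-mono : ∀ k {s s′} → s ≤ˢ s′ → step k s ≤ˢ step k s′
step-mono k    []                                           = []
step-mono zero (_∷_ {zero}  {zero}  p ps)                   = p ∷ ps
step-mono zero (_∷_ {zero}  {suc y} p ps)                   = z≤n ∷ ≤ˢ-trans ps (≤ˢ-inj zero _)
step-mono zero (_∷_ {suc x} {suc y} (s≤s p) ps)             = p ∷ inj-mono zero ps
step-mono (suc k) (p ∷ ps)                                  = p ∷ step-mono k ps

run-mono : ∀ w {s s′} → s ≤ˢ s′ → run w s ≤ˢ run w s′
run-mono []          p = p
run-mono (zero ∷ w)  p = run-mono w p
run-mono (suc k ∷ w) p = step-mono k (run-mono w p)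

sum-inj : ∀ k s → k < length s → sum (inj k s) ≡ suc (sum s)
sum-inj zero    (x ∷ s) p       = refl
sum-inj (suc k) (x ∷ s) (s≤s p) = trans (cong (x +_) (sum-inj k s p)) (+-suc x (sum s))

inj-out : ∀ k s → length s ≤ k → inj k s ≡ s
inj-out k       []      p       = refl
inj-out (suc k) (x ∷ s) (s≤s p) = cong (x ∷_) (inj-out k s p)

tl : List ℕ → List ℕ
tl []      = []
tl (x ∷ s) = s

tl-inj : ∀ k s → tl (inj (suc k) s) ≡ inj k (tl s)
tl-inj k []      = refl
tl-inj k (x ∷ s) = refl

tl-mono : ∀ {s s′} → s ≤ˢ s′ → tl s ≤ˢ tl s′
tl-mono []       = []
tl-mono (p ∷ ps) = ps

-- The length `j` ends the system after letter `suc j`, so only steps up to that letter are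
-- followed. Existence is never proved in general: the instances are built along the standard
-- subwords.
Lfp : (List ℕ → List ℕ) → ℕ → List ℕ → Set
Lfp Φ j Ω = length Ω ≡ j × Φ Ω ≡ Ω × (∀ q → length q ≡ j → Φ q ≤ˢ q → Ω ≤ˢ q)

Lfp-cong : ∀ {Φ Ψ j Ω} → (∀ s → length s ≡ j → Φ s ≡ Ψ s) → Lfp Φ j Ω → Lfp Ψ j Ω
Lfp-cong {Ω = Ω} e (l , f , m) =
  l , trans (sym (e Ω l)) f , λ q lq p → m q lq (subst (_≤ˢ q) (sym (e q lq)) p)

Lfp-unique : ∀ {Φ j Ω Ω′} → Lfp Φ j Ω → Lfp Φ j Ω′ → Ω ≡ Ω′
Lfp-unique {Ω = Ω} {Ω′} (l , f , m) (l′ , f′ , m′) =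
  ≤ˢ-antisym (m Ω′ l′ (subst (_≤ˢ Ω′) (sym f′) ≤ˢ-refl)) (m′ Ω l (subst (_≤ˢ Ω) (sym f) ≤ˢ-refl))

-- One reading of a cyclic word: `n` new particles start at station 0, and `s` are those left
-- waiting by the previous reading.
pass : List ℕ → ℕ → List ℕ → List ℕ
pass w n s = tl (run w (n ∷ s))

-- Letter counts, positions and the search for the next letter

count-∷-≡ : ∀ i w → count i (i ∷ w) ≡ suc (count i w)
count-∷-≡ i w = cong length (LP.filter-accept (i ≟_) refl)

count-∷-≢ : ∀ {i x} w → i ≢ x → count i (x ∷ w) ≡ count i w
count-∷-≢ {i} w ne = cong length (LP.filter-reject (i ≟_) ne)

count-++ : ∀ i u v → count i (u ++ v) ≡ count i u + count i v
count-++ i u v = trans (cong length (LP.filter-++ (i ≟_) u v)) (LP.length-++ (filter (i ≟_) u))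

count-∉ : ∀ i w → i ∉ w → count i w ≡ 0
count-∉ i []      n = refl
count-∉ i (x ∷ w) n = trans (count-∷-≢ w (λ { refl → n (here refl) })) (count-∉ i w (n ∘ there))

count-mid-≡ : ∀ i u v → count i (u ++ i ∷ v) ≡ suc (count i (u ++ v))
count-mid-≡ i u v = trans (count-++ i u (i ∷ v)) (trans (cong (count i u +_) (count-∷-≡ i v))
  (trans (+-suc _ _) (cong suc (sym (count-++ i u v)))))

count-mid-≢ : ∀ {i x} u v → i ≢ x → count i (u ++ x ∷ v) ≡ count i (u ++ v)
count-mid-≢ {i} {x} u v ne = trans (count-++ i u (x ∷ v)) (trans (cong (count i u +_) (count-∷-≢ v ne)) (sym (count-++ i u v)))

lets : List Entry → List ℕ
lets = map proj₂

lets-++ : ∀ u v → lets (u ++ v) ≡ lets u ++ lets v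
lets-++ = LP.map-++ proj₂

data Ascending : List Entry → Set where
  []  : Ascending []
  _∷_ : ∀ {e es} → All (λ e′ → proj₁ e < proj₁ e′) es → Ascending es → Ascending (e ∷ es)

ascending-split : ∀ l {e r} → Ascending (l ++ e ∷ r) →
  All (λ e′ → proj₁ e′ < proj₁ e) l × All (λ e′ → proj₁ e < proj₁ e′) r × Ascending (l ++ r)
ascending-split []      (p ∷ a) = [] , p , a
ascending-split (d ∷ l) (p ∷ a) with ascending-split l a
... | x , y , z = (All.head (AllP.++⁻ʳ l p) ∷ x) , y ,
                  (AllP.++⁺ (AllP.++⁻ˡ l p) (All.tail (AllP.++⁻ʳ l p)) ∷ z)

indexed-ascending : ∀ p w → Ascending (indexed p w)
indexed-ascending p w = go p w
  where
  later : ∀ {q} p w → q < p → All (λ e → q < proj₁ e) (indexed p w)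
  later p []      lt = []
  later p (x ∷ w) lt = lt ∷ later (suc p) w (m≤n⇒m≤1+n lt)
  go : ∀ p w → Ascending (indexed p w)
  go p []      = []
  go p (x ∷ w) = later (suc p) w ≤-refl ∷ go (suc p) w

lets-indexed : ∀ p w → lets (indexed p w) ≡ w
lets-indexed p []      = refl
lets-indexed p (x ∷ w) = cong (x ∷_) (lets-indexed (suc p) w)

≡ᵇ-refl : ∀ n → (n ≡ᵇ n) ≡ true
≡ᵇ-refl zero    = refl
≡ᵇ-refl (suc n) = ≡ᵇ-refl n

≢⇒≡ᵇ-false : ∀ {m n} → m ≢ n → (m ≡ᵇ n) ≡ false
≢⇒≡ᵇ-false {m} {n} ne with m ≡ᵇ n in e
... | true  = ⊥-elim (ne (≡ᵇ⇒≡ m n (subst T (sym e) tt)))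
... | false = refl

≡ᵇ-true⇒≡ : ∀ {m n} → (m ≡ᵇ n) ≡ true → m ≡ n
≡ᵇ-true⇒≡ {m} {n} e = ≡ᵇ⇒≡ m n (subst T (sym e) tt)

≡ᵇ-false⇒≢ : ∀ {m n} → (m ≡ᵇ n) ≡ false → m ≢ n
≡ᵇ-false⇒≢ {m} e refl with trans (sym (≡ᵇ-refl m)) e
... | ()

<⇒<ᵇ-true : ∀ {m n} → m < n → (m <ᵇ n) ≡ true
<⇒<ᵇ-true {m} {n} p with m <ᵇ n | <⇒<ᵇ p
... | true | _ = refl

≮⇒<ᵇ-false : ∀ {m n} → ¬ (m < n) → (m <ᵇ n) ≡ false
≮⇒<ᵇ-false {m} {n} p with m <ᵇ n in e
... | true  = ⊥-elim (p (<ᵇ⇒< m n (subst T (sym e) tt)))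
... | false = refl

≤⇒≮ᵇ : ∀ {m n} → m ≤ n → (n <ᵇ m) ≡ false
≤⇒≮ᵇ le = ≮⇒<ᵇ-false (≤⇒≯ le)

>⇒≰ᵇ : ∀ {m n} → n < m → (m ≤ᵇ n) ≡ false
>⇒≰ᵇ {suc m} lt = ≤⇒≮ᵇ (s≤s⁻¹ lt)

anyPos : ℕ → Bool
anyPos _ = true

maxPos-nothing : ∀ k es → maxPos k anyPos es ≡ nothing → k ∉ lets es
maxPos-nothing k ((q , x) ∷ es) e m with maxPos k anyPos es in e′ | (k ≡ᵇ x) ∧ true in b
maxPos-nothing k ((q , x) ∷ es) e (here refl) | _       | false with trans (sym (cong (_∧ true) (≡ᵇ-refl k))) b
... | ()
maxPos-nothing k ((q , x) ∷ es) e (there m)   | r       | false = maxPos-nothing k es (trans e′ e) m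
maxPos-nothing k ((q , x) ∷ es) () m          | nothing | true
maxPos-nothing k ((q , x) ∷ es) () m          | just _  | true

maxPos-just : ∀ k es {q} → Ascending es → maxPos k anyPos es ≡ just q →
  ∃[ l ] ∃[ r ] (es ≡ l ++ (q , k) ∷ r × k ∉ lets r)
maxPos-just k ((p , x) ∷ es) (lt ∷ a) e with maxPos k anyPos es in e′ | (k ≡ᵇ x) ∧ true in b
... | just q′ | false with maxPos-just k es a (trans e′ e)
...   | l , r , refl , n = (p , x) ∷ l , r , refl , n
maxPos-just k ((p , x) ∷ es) (lt ∷ a) refl | nothing | true with ≡ᵇ-true⇒≡ {k} {x} (trans (sym (BP.∧-identityʳ _)) b)
... | refl = [] , es , refl , maxPos-nothing k es e′
maxPos-just k ((p , x) ∷ es) (lt ∷ a) refl | just q′ | true with maxPos-just k es a e′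
... | l , r , refl , n =
  (p , x) ∷ l , r , cong (λ z → (p , x) ∷ l ++ (z , k) ∷ r) (sym (m≤n⇒m⊔n≡n (<⇒≤ (All.head (AllP.++⁻ʳ l lt))))) , n

maxPos-before : ∀ k p l r → All (λ e → proj₁ e < p) l → All (λ e → p < proj₁ e) r →
  maxPos k (λ q → q <ᵇ p) (l ++ r) ≡ maxPos k anyPos l
maxPos-before k p [] r [] pr = go r pr
  where
  go : ∀ r → All (λ e → p < proj₁ e) r → maxPos k (λ q → q <ᵇ p) r ≡ nothing
  go []            []        = refl
  go ((q , x) ∷ r) (lt ∷ pr) rewrite ≮⇒<ᵇ-false (<⇒≯ lt) | BP.∧-zeroʳ (k ≡ᵇ x) = go r pr
maxPos-before k p ((q , x) ∷ l) r (lt ∷ pl) pr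
  rewrite maxPos-before k p l r pl pr | <⇒<ᵇ-true lt = refl

maxPos-skip : ∀ k l r → k ∉ lets l → maxPos k anyPos (l ++ r) ≡ maxPos k anyPos r
maxPos-skip k []            r n = refl
maxPos-skip k ((q , x) ∷ l) r n
  rewrite maxPos-skip k l r (n ∘ there) | ≢⇒≡ᵇ-false {k} {x} (n ∘ here) = refl

removePos-mid : ∀ l {q x} r → All (λ e → proj₁ e < q) l → removePos q (l ++ (q , x) ∷ r) ≡ l ++ r
removePos-mid []            {q} r []        rewrite ≡ᵇ-refl q = refl
removePos-mid ((p , y) ∷ l) {q} r (lt ∷ pl) rewrite ≢⇒≡ᵇ-false (<⇒≢ lt) = cong ((p , y) ∷_) (removePos-mid l r pl)

-- The pass of a word that is cut at some place, where one extra particle joins station k.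
pass⁺ : List ℕ → List ℕ → ℕ → ℕ → List ℕ → List ℕ
pass⁺ l r k n s = tl (run l (inj k (run r (n ∷ s))))

-- One of the `suc n` particles is singled out. It makes its first move at the rightmost 1, which is
-- where a standard subword begins.
pass⁺-start : ∀ l r n s → 1 ∉ r → pass (l ++ 1 ∷ r) (suc n) s ≡ pass⁺ l r 1 n s
pass⁺-start l r n s 1∉ = cong tl (begin
  run (l ++ 1 ∷ r) (suc n ∷ s)                ≡⟨ run-++ l (1 ∷ r) _ ⟩
  run l (step 0 (run r (inj 0 (n ∷ s))))      ≡⟨ cong (run l ∘ step 0) (run-inj 0 r (n ∷ s) 1∉) ⟩
  run l (step 0 (inj 0 (run r (n ∷ s))))      ≡⟨ cong (run l) (step-inj 0 (run r (n ∷ s))) ⟩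
  run l (inj 1 (run r (n ∷ s)))               ∎)

-- The occurrence used by the additional particle disappears from the word. Following the particle
-- and extracting the letter are the same operation.
pass⁺-left : ∀ l₁ l₂ r k n s → suc k ∉ l₂ →
  pass⁺ (l₁ ++ suc k ∷ l₂) r k n s ≡ pass⁺ l₁ (l₂ ++ r) (suc k) n s
pass⁺-left l₁ l₂ r k n s k∉ = cong tl (begin
  run (l₁ ++ suc k ∷ l₂) (inj k z)   ≡⟨ run-++ l₁ (suc k ∷ l₂) _ ⟩
  run l₁ (step k (run l₂ (inj k z))) ≡⟨ cong (run l₁ ∘ step k) (run-inj k l₂ z k∉) ⟩
  run l₁ (step k (inj k (run l₂ z))) ≡⟨ cong (run l₁) (step-inj k (run l₂ z)) ⟩
  run l₁ (inj (suc k) (run l₂ z))    ≡⟨ cong (run l₁ ∘ inj (suc k)) (sym (run-++ l₂ r _)) ⟩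
  run l₁ (inj (suc k) (run (l₂ ++ r) (n ∷ s))) ∎)
  where z = run r (n ∷ s)

pass⁺-hold : ∀ l r k n s → suc (suc k) ∉ l →
  pass⁺ l r (suc k) n s ≡ inj k (tl (run l (run r (n ∷ s))))
pass⁺-hold l r k n s k∉ = trans (cong tl (run-inj (suc k) l _ k∉)) (tl-inj k (run l (run r (n ∷ s))))

-- The additional particle finds no letter on its left and waits at the end of the word. The one in
-- `inj k s` has come in from the previous reading and takes the rightmost `suc (suc k)`.
pass⁺-right : ∀ l r₁ r₂ k n s → suc (suc k) ∉ l → suc (suc k) ∉ r₂ →
  pass⁺ l (r₁ ++ suc (suc k) ∷ r₂) (suc k) n (inj k s) ≡ inj k (pass⁺ (l ++ r₁) r₂ (suc (suc k)) n s)
pass⁺-right l r₁ r₂ k n s k∉l k∉r = trans (pass⁺-hold l (r₁ ++ suc (suc k) ∷ r₂) k n (inj k s) k∉l) (cong (inj k ∘ tl) (begin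
  run l (run (r₁ ++ suc (suc k) ∷ r₂) (inj (suc k) (n ∷ s)))          ≡⟨ cong (run l) (run-++ r₁ _ _) ⟩
  run l (run r₁ (step (suc k) (run r₂ (inj (suc k) (n ∷ s)))))        ≡⟨ cong (run l ∘ run r₁ ∘ step (suc k)) (run-inj (suc k) r₂ _ k∉r) ⟩
  run l (run r₁ (step (suc k) (inj (suc k) (run r₂ (n ∷ s)))))        ≡⟨ cong (run l ∘ run r₁) (step-inj (suc k) _) ⟩
  run l (run r₁ (inj (suc (suc k)) (run r₂ (n ∷ s))))                 ≡⟨ sym (run-++ l r₁ _) ⟩
  run (l ++ r₁) (inj (suc (suc k)) (run r₂ (n ∷ s)))                  ∎))

-- A prefixpoint of the left-hand side already contains the particle that waits at station suc k
-- across the end of the word, so the least fixpoints correspond under inj k.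
Lfp-right : ∀ l r₁ r₂ k n j Ω → suc (suc k) ∉ l → suc (suc k) ∉ r₂ →
  Lfp (pass⁺ (l ++ r₁) r₂ (suc (suc k)) n) j Ω →
  Lfp (pass⁺ l (r₁ ++ suc (suc k) ∷ r₂) (suc k) n) j (inj k Ω)
Lfp-right l r₁ r₂ k n j Ω k∉l k∉r (len , fix , least) =
  trans (length-inj k Ω) len ,
  trans (pass⁺-right l r₁ r₂ k n Ω k∉l k∉r) (cong (inj k) fix) ,
  least′
  where
  least′ : ∀ q → length q ≡ j → pass⁺ l (r₁ ++ suc (suc k) ∷ r₂) (suc k) n q ≤ˢ q → inj k Ω ≤ˢ q
  least′ q lq p with inj-≤⇒inj k (subst (_≤ˢ q) (pass⁺-hold l (r₁ ++ suc (suc k) ∷ r₂) k n q k∉l) p)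
  ... | q′ , refl = inj-mono k (least q′ (trans (sym (length-inj k q′)) lq)
                      (inj-cancel k (subst (_≤ˢ inj k q′) (pass⁺-right l r₁ r₂ k n q′ k∉l k∉r) p)))

pass⁺-out : ∀ l r k n s → length s < k → pass⁺ l r k n s ≡ pass (l ++ r) n s
pass⁺-out l r k n s p = cong tl (trans
  (cong (run l) (inj-out k _ (subst (_≤ k) (sym (length-run r (n ∷ s))) p))) (sym (run-++ l r _)))

sumFrom : ℕ → ℕ → (ℕ → ℕ) → ℕ
sumFrom κ zero    g = 0
sumFrom κ (suc h) g = g κ + sumFrom (suc κ) h g

sumFrom-cong : ∀ κ h {f g} → (∀ j → κ ≤ j → j < κ + h → f j ≡ g j) → sumFrom κ h f ≡ sumFrom κ h g
sumFrom-cong κ zero    e = refl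
sumFrom-cong κ (suc h) e =
  cong₂ _+_ (e κ ≤-refl (m<m+n κ (s≤s z≤n)))
            (sumFrom-cong (suc κ) h (λ j p q → e j (<⇒≤ p) (subst (j <_) (sym (+-suc κ h)) q)))

sumFrom-+ : ∀ κ h f g → sumFrom κ h (λ j → f j + g j) ≡ sumFrom κ h f + sumFrom κ h g
sumFrom-+ κ zero    f g = refl
sumFrom-+ κ (suc h) f g = trans (cong (f κ + g κ +_) (sumFrom-+ (suc κ) h f g)) (lem (f κ) (g κ) _ _)
  where
  lem : ∀ a b c d → a + b + (c + d) ≡ (a + c) + (b + d)
  lem = ℕR.solve-∀

sumFrom-zero : ∀ κ h {f} → (∀ j → κ ≤ j → f j ≡ 0) → sumFrom κ h f ≡ 0
sumFrom-zero κ zero    e = refl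
sumFrom-zero κ (suc h) e = cong₂ _+_ (e κ ≤-refl) (sumFrom-zero (suc κ) h (λ j p → e j (<⇒≤ p)))

sumFrom-split : ∀ κ h h′ f → sumFrom κ (h + h′) f ≡ sumFrom κ h f + sumFrom (κ + h) h′ f
sumFrom-split κ zero    h′ f = cong (λ z → sumFrom z h′ f) (sym (+-identityʳ κ))
sumFrom-split κ (suc h) h′ f = trans (cong (f κ +_) (trans (sumFrom-split (suc κ) h h′ f)
  (cong (λ z → sumFrom (suc κ) h f + sumFrom z h′ f) (sym (+-suc κ h))))) (sym (+-assoc (f κ) _ _))

-- The sum of `i + 1` up to `i + h`: the indices of `h` further letters of a subword if no step
-- wraps.
tri : ℕ → ℕ → ℕ
tri i zero    = 0
tri i (suc h) = suc i + tri (suc i) h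

tri-suc : ∀ i h → tri (suc i) h ≡ tri i h + h
tri-suc i zero    = refl
tri-suc i (suc h) = trans (cong (suc (suc i) +_) (tri-suc (suc i) h)) (lem i (tri (suc i) h) h)
  where
  lem : ∀ i t h → suc (suc i) + (t + h) ≡ suc i + t + suc h
  lem = ℕR.solve-∀

wrapAt : ℕ → ℕ → ℕ
wrapAt k j = if k <ᵇ j then 1 else 0

-- Cocharge and least fixpoints

-- What the remainder of one standard subword contributes: wraps j is the number of its steps, among
-- those to letters at most suc j, that continue from the right end of the word.
record Column (κ idx : ℕ) (es l r : List Entry) (S : ℕ) (es′ : List Entry) : Set where
  field
    height : ℕ
    wraps : ℕ → ℕ
    asc : Ascending es′
    wraps-0 : ∀ j → j ≤ κ → wraps j ≡ 0
    index : S + sumFrom (suc κ) height wraps ≡ tri idx height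
    count-in : ∀ j → κ < j → j ≤ κ + height → count (suc j) (lets es) ≡ suc (count (suc j) (lets es′))
    count-out : ∀ j → j ≤ κ ⊎ κ + height < j → count (suc j) (lets es) ≡ count (suc j) (lets es′)
    exhausted : count (suc (suc (κ + height))) (lets es) ≡ 0
    transfer : ∀ n j Ω → j ≤ κ + height → Lfp (pass (lets es′) n) j Ω →
      ∃[ Ω′ ] (Lfp (pass⁺ (lets l) (lets r) (suc κ) n) j Ω′ × sum Ω′ ≡ sum Ω + wraps j)

wrapAt-≤ : ∀ {κ j} → j ≤ κ → wrapAt κ j ≡ 0
wrapAt-≤ p rewrite ≮⇒<ᵇ-false (≤⇒≯ p) = refl

wrapAt-> : ∀ {κ j} → κ < j → wrapAt κ j ≡ 1
wrapAt-> p rewrite <⇒<ᵇ-true p = refl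

sumFrom-wrapAt : ∀ κ m h → κ < m → sumFrom m h (wrapAt κ) ≡ h
sumFrom-wrapAt κ m zero    p = refl
sumFrom-wrapAt κ m (suc h) p = cong₂ _+_ (wrapAt-> p) (sumFrom-wrapAt κ (suc m) h (m≤n⇒m≤1+n p))

sum-inj-wrapAt : ∀ κ Ω j → length Ω ≡ j → sum (inj κ Ω) ≡ sum Ω + wrapAt κ j
sum-inj-wrapAt κ Ω j refl with κ <? length Ω
... | yes p rewrite wrapAt-> p | sum-inj κ Ω p = +-comm 1 (sum Ω)
... | no ¬p rewrite wrapAt-≤ (≮⇒≥ ¬p) | inj-out κ Ω (≮⇒≥ ¬p) = sym (+-identityʳ _)

-- At the end of the subword the additional particle sits at station `suc κ`, outside a system with
-- `j ≤ κ`, and changes nothing.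
column-stop : ∀ κ idx es l r → Ascending es → es ≡ l ++ r → suc (suc κ) ∉ lets es → Column κ idx es l r 0 es
column-stop κ idx es l r a refl k∉ = record
  { height = 0
  ; wraps = λ _ → 0
  ; asc = a
  ; wraps-0 = λ _ _ → refl
  ; index = refl
  ; count-in = λ j p q → ⊥-elim (<⇒≱ p (subst (j ≤_) (+-identityʳ κ) q))
  ; count-out = λ _ _ → refl
  ; exhausted = trans (cong (λ z → count (suc (suc z)) (lets es)) (+-identityʳ κ)) (count-∉ _ (lets es) k∉)
  ; transfer = λ n j Ω p lf → Ω , Lfp-cong (λ s e → trans (cong (λ w → pass w n s) (lets-++ l r))
      (sym (pass⁺-out (lets l) (lets r) (suc κ) n s (s≤s (subst (_≤ κ) (sym e) (subst (j ≤_) (+-identityʳ κ) p)))))) lf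
      , sym (+-identityʳ _)
  }

module Extend {κ : ℕ} {es es⁻ : List Entry} (u v : List ℕ)
              (eu : lets es ≡ u ++ suc (suc κ) ∷ v) (ev : lets es⁻ ≡ u ++ v) where
  same : ∀ j → j ≢ suc κ → count (suc j) (lets es) ≡ count (suc j) (lets es⁻)
  same j ne = trans (cong (count (suc j)) eu) (trans (count-mid-≢ u v (ne ∘ suc-injective)) (cong (count (suc j)) (sym ev)))

  module _ {idx′ : ℕ} {l r : List Entry} {S : ℕ} {es′ : List Entry} (C : Column (suc κ) idx′ es⁻ l r S es′) where
    open Column C

    ext-in : ∀ j → κ < j → j ≤ κ + suc height → count (suc j) (lets es) ≡ suc (count (suc j) (lets es′))
    ext-in j p q with j ≟ suc κ
    ... | yes refl = trans (cong (count (suc j)) eu) (trans (count-mid-≡ (suc j) u v)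
                       (cong suc (trans (cong (count (suc j)) (sym ev)) (count-out j (inj₁ ≤-refl)))))
    ... | no ne = trans (same j ne) (count-in j (≤∧≢⇒< p (ne ∘ sym)) (subst (j ≤_) (+-suc κ height) q))

    ext-out : ∀ j → j ≤ κ ⊎ κ + suc height < j → count (suc j) (lets es) ≡ count (suc j) (lets es′)
    ext-out j (inj₁ p) = trans (same j (<⇒≢ (s≤s p))) (count-out j (inj₁ (m≤n⇒m≤1+n p)))
    ext-out j (inj₂ p) = trans (same j λ { refl → <⇒≱ p (subst (_≤ κ + suc height) (+-comm κ 1) (+-monoʳ-≤ κ (s≤s z≤n))) })
                               (count-out j (inj₂ (subst (_< j) (+-suc κ height) p)))

    ext-exhausted : count (suc (suc (κ + suc height))) (lets es) ≡ 0
    ext-exhausted = trans (same (suc (κ + suc height)) (λ e → <⇒≢ (m<m+n κ (s≤s z≤n)) (sym (suc-injective e))))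
      (trans (cong (λ z → count (suc (suc z)) (lets es⁻)) (+-suc κ height)) exhausted)

-- The cases are those of `subword`. A letter on the left is met during the same reading and raises
-- the index. Otherwise the particle waits at the end of the word, which adds one to the fixpoint
-- for every cutoff `j` beyond `κ`.
subword-column : ∀ f κ p idx es l r → length es ≤ f → Ascending es → es ≡ l ++ r →
  All (λ e → proj₁ e < p) l → All (λ e → p < proj₁ e) r →
  Column κ idx es l r (proj₁ (subword f (suc (suc κ)) p idx es)) (proj₂ (subword f (suc (suc κ)) p idx es))
subword-column zero κ p idx [] l r len a eq pl pr = column-stop κ idx [] l r a eq (λ ())
subword-column (suc f) κ p idx es l r len a eq pl pr
  with maxPos (suc (suc κ)) (λ q → q <ᵇ p) es in e₁
subword-column (suc f) κ p idx .(l ++ r) l r len a refl pl pr | just q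
  with maxPos-just (suc (suc κ)) l (prefix l r a) (trans (sym (maxPos-before (suc (suc κ)) p l r pl pr)) e₁)
  where
  prefix : ∀ l r → Ascending (l ++ r) → Ascending l
  prefix []      r a       = []
  prefix (e ∷ l) r (x ∷ a) = AllP.++⁻ˡ l x ∷ prefix l r a
... | l₁ , l₂ , refl , k∉ = record
  { height = suc height ; wraps = wraps ; asc = asc
  ; wraps-0 = λ j q → wraps-0 j (m≤n⇒m≤1+n q)
  ; index = trans (cong (λ z → suc idx + S′ + (z + sumFrom (suc (suc κ)) height wraps)) (wraps-0 (suc κ) ≤-refl))
                  (trans (+-assoc (suc idx) S′ _) (cong (suc idx +_) index))
  ; count-in = X.ext-in C ; count-out = X.ext-out C ; exhausted = X.ext-exhausted C
  ; transfer = λ n j Ω q lf → let (Ω′ , lf′ , s′) = transfer n j Ω (subst (j ≤_) (+-suc κ height) q) lf in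
      Ω′ , Lfp-cong (λ s _ → trans (cong (λ w → pass⁺ (lets l₁) w (suc (suc κ)) n s) (lets-++ l₂ r))
             (trans (sym (pass⁺-left (lets l₁) (lets l₂) (lets r) (suc κ) n s k∉))
                    (cong (λ w → pass⁺ w (lets r) (suc κ) n s) (sym (lets-++ l₁ _))))) lf′ , s′
  }
  where
  es⁰ = (l₁ ++ (q , suc (suc κ)) ∷ l₂) ++ r
  eq′ : es⁰ ≡ l₁ ++ (q , suc (suc κ)) ∷ l₂ ++ r
  eq′ = LP.++-assoc l₁ _ r
  parts = ascending-split l₁ (subst Ascending eq′ a)
  es⁻ = removePos q es⁰
  eq⁻ : es⁻ ≡ l₁ ++ l₂ ++ r
  eq⁻ = trans (cong (removePos q) eq′) (removePos-mid l₁ (l₂ ++ r) (proj₁ parts))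
  len⁻ : length es⁻ ≤ f
  len⁻ = ≤-pred (subst (_≤ suc f) (trans (cong length eq′) (trans (LP.length-++ l₁) (trans (+-suc (length l₁) _)
           (cong suc (trans (sym (LP.length-++ l₁)) (cong length (sym eq⁻))))))) len)
  C = subword-column f (suc κ) q (suc idx) es⁻ l₁ (l₂ ++ r) len⁻ (subst Ascending (sym eq⁻) (proj₂ (proj₂ parts))) eq⁻
        (proj₁ parts) (proj₁ (proj₂ parts))
  open Column C
  S′ = proj₁ (subword f (suc (suc (suc κ))) q (suc idx) es⁻)
  module X = Extend {κ} {es⁰} {es⁻} (lets l₁) (lets (l₂ ++ r)) (trans (cong lets eq′) (lets-++ l₁ _)) (trans (cong lets eq⁻) (lets-++ l₁ _))
subword-column (suc f) κ p idx es l r len a eq pl pr | nothing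
  with maxPos (suc (suc κ)) (λ _ → true) es in e₂
subword-column (suc f) κ p idx es l r len a eq pl pr | nothing | nothing =
  column-stop κ idx es l r a eq (maxPos-nothing _ es e₂)
subword-column (suc f) κ p idx .(l ++ r) l r len a refl pl pr | nothing | just q
  with maxPos-just (suc (suc κ)) r (suffix l r a) (trans (sym (maxPos-skip (suc (suc κ)) l r k∉l)) e₂)
  where
  suffix : ∀ l r → Ascending (l ++ r) → Ascending r
  suffix []      r a       = a
  suffix (e ∷ l) r (x ∷ a) = suffix l r a
  k∉l : suc (suc κ) ∉ lets l
  k∉l = maxPos-nothing _ l (trans (sym (maxPos-before (suc (suc κ)) p l r pl pr)) e₁)
... | r₁ , r₂ , refl , k∉ = record
  { height = suc height ; wraps = λ j → wraps j + wrapAt κ j ; asc = asc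
  ; wraps-0 = λ j q → cong₂ _+_ (wraps-0 j (m≤n⇒m≤1+n q)) (wrapAt-≤ q)
  ; index = index′
  ; count-in = X.ext-in C ; count-out = X.ext-out C ; exhausted = X.ext-exhausted C
  ; transfer = λ n j Ω q lf → let (Ω′ , lf′ , s′) = transfer n j Ω (subst (j ≤_) (+-suc κ height) q) lf in
      inj κ Ω′ ,
      subst (λ w → Lfp (pass⁺ (lets l) w (suc κ) n) j (inj κ Ω′)) (sym (lets-++ r₁ _))
        (Lfp-right (lets l) (lets r₁) (lets r₂) κ n j Ω′ k∉l k∉
          (subst (λ w → Lfp (pass⁺ w (lets r₂) (suc (suc κ)) n) j Ω′) (lets-++ l r₁) lf′)) ,
      trans (sum-inj-wrapAt κ Ω′ j (proj₁ lf′)) (trans (cong (_+ wrapAt κ j) s′) (+-assoc (sum Ω) _ _))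
  }
  where
  k∉l : suc (suc κ) ∉ lets l
  k∉l = maxPos-nothing _ l (trans (sym (maxPos-before (suc (suc κ)) p l _ pl pr)) e₁)
  es⁰ = l ++ r₁ ++ (q , suc (suc κ)) ∷ r₂
  eq′ : es⁰ ≡ (l ++ r₁) ++ (q , suc (suc κ)) ∷ r₂
  eq′ = sym (LP.++-assoc l r₁ _)
  parts = ascending-split (l ++ r₁) (subst Ascending eq′ a)
  es⁻ = removePos q es⁰
  eq⁻ : es⁻ ≡ (l ++ r₁) ++ r₂
  eq⁻ = trans (cong (removePos q) eq′) (removePos-mid (l ++ r₁) r₂ (proj₁ parts))
  len⁻ : length es⁻ ≤ f
  len⁻ = ≤-pred (subst (_≤ suc f) (trans (cong length eq′) (trans (LP.length-++ (l ++ r₁)) (trans (+-suc (length (l ++ r₁)) _)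
           (cong suc (trans (sym (LP.length-++ (l ++ r₁))) (cong length (sym eq⁻))))))) len)
  C = subword-column f (suc κ) q idx es⁻ (l ++ r₁) r₂ len⁻ (subst Ascending (sym eq⁻) (proj₂ (proj₂ parts))) eq⁻
        (proj₁ parts) (proj₁ (proj₂ parts))
  open Column C
  S′ = proj₁ (subword f (suc (suc (suc κ))) q idx es⁻)
  module X = Extend {κ} {es⁰} {es⁻} (lets (l ++ r₁)) (lets r₂) (trans (cong lets eq′) (lets-++ (l ++ r₁) _)) (trans (cong lets eq⁻) (lets-++ (l ++ r₁) _))
  h = height
  -- A wrap lowers the index of this letter and of every later one by one. Summed over the cutoffs,
  -- `wrapAt κ` makes up for exactly this loss.
  index′ : idx + S′ + ((wraps (suc κ) + wrapAt κ (suc κ)) + sumFrom (suc (suc κ)) h (λ j → wraps j + wrapAt κ j)) ≡ suc idx + tri (suc idx) h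
  index′ = begin
    idx + S′ + ((wraps (suc κ) + wrapAt κ (suc κ)) + sumFrom (suc (suc κ)) h (λ j → wraps j + wrapAt κ j))
      ≡⟨ cong₂ (λ x y → idx + S′ + (x + y)) (cong₂ _+_ (wraps-0 (suc κ) ≤-refl) (wrapAt-> {κ} ≤-refl))
           (trans (sumFrom-+ (suc (suc κ)) h wraps (wrapAt κ)) (cong (sumFrom (suc (suc κ)) h wraps +_) (sumFrom-wrapAt κ _ h (m≤n⇒m≤1+n ≤-refl)))) ⟩
    idx + S′ + suc (sumFrom (suc (suc κ)) h wraps + h)
      ≡⟨ lem idx S′ _ h ⟩
    suc idx + ((S′ + sumFrom (suc (suc κ)) h wraps) + h)
      ≡⟨ cong (λ z → suc idx + (z + h)) index ⟩
    suc idx + (tri idx h + h)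
      ≡⟨ cong (suc idx +_) (sym (tri-suc idx h)) ⟩
    suc idx + tri (suc idx) h ∎
    where
    lem : ∀ i s x h → i + s + suc (x + h) ≡ suc i + ((s + x) + h)
    lem = ℕR.solve-∀

step-zeros : ∀ k n → step k (replicate n 0) ≡ replicate n 0
step-zeros k       zero    = refl
step-zeros zero    (suc n) = refl
step-zeros (suc k) (suc n) = cong (0 ∷_) (step-zeros k n)

run-zeros : ∀ w n → run w (replicate n 0) ≡ replicate n 0
run-zeros []          n = refl
run-zeros (zero ∷ w)  n = run-zeros w n
run-zeros (suc k ∷ w) n = trans (cong (step k) (run-zeros w n)) (step-zeros k n)

zeros-≤ˢ : ∀ q → replicate (length q) 0 ≤ˢ q
zeros-≤ˢ []      = []
zeros-≤ˢ (x ∷ q) = z≤n ∷ zeros-≤ˢ q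

sum-zeros : ∀ n → sum (replicate n 0) ≡ 0
sum-zeros zero    = refl
sum-zeros (suc n) = sum-zeros n

Lfp-zeros : ∀ w j → Lfp (pass w 0) j (replicate j 0)
Lfp-zeros w j = LP.length-replicate j , cong tl (run-zeros w (suc j)) , λ { q refl _ → zeros-≤ˢ q }

Charged : List ℕ → (ℕ → ℕ) → (ℕ → ℕ) → Set
Charged w lam c = ∀ j → ∃[ Ω ] (Lfp (pass w (lam j)) j Ω × sum Ω ≡ c j)

sumFrom-id : ∀ i h → sumFrom (suc i) h id ≡ tri i h
sumFrom-id i zero    = refl
sumFrom-id i (suc h) = cong (suc i +_) (sumFrom-id (suc i) h)

-- Each subword contains every letter up to its height once, so extracting it removes a column from
-- the diagram of `lam`. The right-hand side is the value that the cocharge would have without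
-- wraps, and every wrap is recorded by a waiting particle.
link : ∀ f es lam N → Ascending es → (∀ j → count (suc j) (lets es) ≡ lam j) →
  (∀ j → lam (suc j) ≤ lam j) → (∀ j → N ≤ j → lam j ≡ 0) → lam 0 ≤ f →
  ∃[ c ] (Charged (lets es) lam c × cochargeE f es + sumFrom 0 N c ≡ sumFrom 0 N (λ j → j * lam j))
link f es lam N a cnt dec out fuel with maxPos 1 anyPos es in e₁
link f es lam N a cnt dec out fuel | nothing =
  (λ _ → 0) , (λ j → replicate j 0 , subst (λ n → Lfp (pass (lets es) n) j (replicate j 0)) (sym (lam0 j)) (Lfp-zeros (lets es) j) , sum-zeros j) ,
  trans (cong₂ _+_ (none f) (sumFrom-zero 0 N (λ _ _ → refl)))
        (sym (sumFrom-zero 0 N (λ j _ → trans (cong (j *_) (lam0 j)) (*-zeroʳ j))))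
  where
  lam0 : ∀ j → lam j ≡ 0
  lam0 zero    = trans (sym (cnt 0)) (count-∉ 1 (lets es) (maxPos-nothing 1 es e₁))
  lam0 (suc j) = n≤0⇒n≡0 (subst (lam (suc j) ≤_) (lam0 j) (dec j))
  none : ∀ f → cochargeE f es ≡ 0
  none zero    = refl
  none (suc f) rewrite e₁ = refl
link f es lam N a cnt dec out fuel | just q with maxPos-just 1 es a e₁
link zero .(l ++ (q , 1) ∷ r) lam N a cnt dec out fuel | just q | l , r , refl , 1∉ =
  ⊥-elim (n≮0 (subst (_≤ 0) (trans (sym (cnt 0)) (trans (cong (count 1) (lets-++ l _)) (count-mid-≡ 1 (lets l) (lets r)))) fuel))
link (suc f) .(l ++ (q , 1) ∷ r) lam N a cnt dec out fuel | just q | l , r , refl , 1∉ rewrite e₁ =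
  c , charged , total
  where
  es = l ++ (q , 1) ∷ r
  es⁻ = removePos q es
  parts = ascending-split l a
  eq⁻ : es⁻ ≡ l ++ r
  eq⁻ = removePos-mid l r (proj₁ parts)
  len⁻ : length es⁻ ≤ length es
  len⁻ = subst₂ _≤_ (cong length (sym eq⁻)) refl (subst₂ _≤_ (sym (LP.length-++ l)) (sym (LP.length-++ l)) (+-monoʳ-≤ (length l) (n≤1+n _)))
  C = subword-column (length es) 0 q 0 es⁻ l r len⁻ (subst Ascending (sym eq⁻) (proj₂ (proj₂ parts))) eq⁻ (proj₁ parts) (proj₁ (proj₂ parts))
  S = proj₁ (subword (length es) 2 q 0 es⁻)
  es′ = proj₂ (subword (length es) 2 q 0 es⁻)
  open Column C
  h = height
  lam′ : ℕ → ℕ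
  lam′ j = count (suc j) (lets es′)
  cnt⁻ : ∀ j → lam (suc j) ≡ count (suc (suc j)) (lets es⁻)
  cnt⁻ j = trans (sym (cnt (suc j))) (trans (cong (count (suc (suc j))) (lets-++ l _))
             (trans (count-mid-≢ (lets l) (lets r) (λ ())) (cong (count (suc (suc j))) (trans (sym (lets-++ l r)) (cong lets (sym eq⁻))))))
  low : ∀ j → j ≤ h → lam j ≡ suc (lam′ j)
  low zero    p = trans (sym (cnt 0)) (trans (cong (count 1) (lets-++ l _)) (trans (count-mid-≡ 1 (lets l) (lets r))
                    (cong suc (trans (cong (count 1) (trans (sym (lets-++ l r)) (cong lets (sym eq⁻)))) (count-out 0 (inj₁ z≤n))))))
  low (suc j) p = trans (cnt⁻ j) (count-in (suc j) (s≤s z≤n) p)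
  -- The subword stops only when its next letter no longer occurs; as `lam` decreases, no larger
  -- letter occurs either.
  high : ∀ j → h < j → lam j ≡ 0
  high (suc j) p with m≤n⇒∃[o]m+o≡n p
  ... | d , refl = go d
    where
    go : ∀ d → lam (suc h + d) ≡ 0
    go zero    = trans (cong lam (+-identityʳ (suc h))) (trans (cnt⁻ h) exhausted)
    go (suc d) = n≤0⇒n≡0 (subst₂ _≤_ (cong lam (sym (+-suc (suc h) d))) (go d) (dec (suc h + d)))
  high′ : ∀ j → h < j → lam′ j ≡ 0
  high′ (suc j) p = trans (sym (count-out (suc j) (inj₂ p))) (trans (sym (cnt⁻ j)) (high (suc j) p))
  dec′ : ∀ j → lam′ (suc j) ≤ lam′ j
  dec′ j with suc j ≤? h
  ... | yes p = ≤-pred (subst₂ _≤_ (low (suc j) p) (low j (<⇒≤ p)) (dec j))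
  ... | no ¬p = subst (_≤ lam′ j) (sym (high′ (suc j) (≰⇒> ¬p))) z≤n
  out′ : ∀ j → N ≤ j → lam′ j ≡ 0
  out′ j p with j ≤? h
  ... | yes q with trans (sym (out j p)) (low j q)
  ... | ()
  out′ j p | no ¬q = high′ j (≰⇒> ¬q)
  h<N : h < N
  h<N with h <? N
  ... | yes p = p
  ... | no ¬p with trans (sym (out h (≮⇒≥ ¬p))) (low h ≤-refl)
  ... | ()
  IH = link f es′ lam′ N asc (λ _ → refl) dec′ out′ (≤-pred (subst (_≤ suc f) (low 0 z≤n) fuel))
  c′ = proj₁ IH
  charged′ = proj₁ (proj₂ IH)
  c : ℕ → ℕ
  c j = if j <ᵇ suc h then c′ j + wraps j else 0
  c-low : ∀ j → j ≤ h → c j ≡ c′ j + wraps j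
  c-low j p rewrite <⇒<ᵇ-true (s≤s p) = refl
  c-high : ∀ j → h < j → c j ≡ 0
  c-high j p rewrite ≮⇒<ᵇ-false (≤⇒≯ p) = refl
  c′-high : ∀ j → h < j → c′ j ≡ 0
  c′-high j p = let (Ω , lf , s) = charged′ j in
    trans (sym s) (trans (cong sum (Lfp-unique (subst (λ n → Lfp (pass (lets es′) n) j Ω) (high′ j p) lf) (Lfp-zeros (lets es′) j))) (sum-zeros j))
  charged : Charged (lets es) lam c
  charged j with j ≤? h
  ... | no ¬p = replicate j 0 , subst (λ n → Lfp (pass (lets es) n) j (replicate j 0)) (sym (high j (≰⇒> ¬p))) (Lfp-zeros (lets es) j) ,
                trans (sum-zeros j) (sym (c-high j (≰⇒> ¬p)))
  ... | yes p = let (Ω′ , lf′ , s′) = charged′ j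
                    (Ω , lf , s) = transfer (lam′ j) j Ω′ p lf′ in
    Ω , Lfp-cong (λ x _ → trans (sym (pass⁺-start (lets l) (lets r) (lam′ j) x 1∉))
                   (trans (cong (λ w → pass w (suc (lam′ j)) x) (sym (lets-++ l _))) (cong (λ n → pass (lets es) n x) (sym (low j p))))) lf ,
    trans s (trans (cong (_+ wraps j) s′) (sym (c-low j p)))
  total : S + cochargeE f es′ + sumFrom 0 N c ≡ sumFrom 0 N (λ j → j * lam j)
  total with m≤n⇒∃[o]m+o≡n h<N
  ... | d , refl = begin
    S + x + sumFrom 0 (suc h + d) c
      ≡⟨ cong (S + x +_) (cut c (λ j → c-high j)) ⟩
    S + x + sumFrom 0 (suc h) c
      ≡⟨ cong (S + x +_) (trans (sumFrom-cong 0 (suc h) (λ j _ p → c-low j (≤-pred p))) (sumFrom-+ 0 (suc h) c′ wraps)) ⟩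
    S + x + (sumFrom 0 (suc h) c′ + (wraps 0 + sumFrom 1 h wraps))
      ≡⟨ cong (λ z → S + x + (sumFrom 0 (suc h) c′ + (z + sumFrom 1 h wraps))) (wraps-0 0 z≤n) ⟩
    S + x + (sumFrom 0 (suc h) c′ + sumFrom 1 h wraps)
      ≡⟨ lem S x (sumFrom 0 (suc h) c′) _ ⟩
    x + sumFrom 0 (suc h) c′ + (S + sumFrom 1 h wraps)
      ≡⟨ cong₂ (λ y z → x + y + z) (sym (cut c′ c′-high)) (trans index (sym (sumFrom-id 0 h))) ⟩
    x + sumFrom 0 (suc h + d) c′ + sumFrom 1 h id
      ≡⟨ cong (_+ sumFrom 1 h id) (proj₂ (proj₂ IH)) ⟩
    sumFrom 0 (suc h + d) (λ j → j * lam′ j) + sumFrom 1 h id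
      ≡⟨ cong (_+ sumFrom 1 h id) (cut (λ j → j * lam′ j) (λ j p → trans (cong (j *_) (high′ j p)) (*-zeroʳ j))) ⟩
    sumFrom 0 (suc h) (λ j → j * lam′ j) + sumFrom 0 (suc h) id
      ≡⟨ sym (sumFrom-+ 0 (suc h) (λ j → j * lam′ j) id) ⟩
    sumFrom 0 (suc h) (λ j → j * lam′ j + j)
      ≡⟨ sumFrom-cong 0 (suc h) (λ j _ p → trans (+-comm _ j) (trans (sym (*-suc j (lam′ j))) (cong (j *_) (sym (low j (≤-pred p)))))) ⟩
    sumFrom 0 (suc h) (λ j → j * lam j)
      ≡⟨ sym (cut (λ j → j * lam j) (λ j p → trans (cong (j *_) (high j p)) (*-zeroʳ j))) ⟩
    sumFrom 0 (suc h + d) (λ j → j * lam j) ∎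
    where
    x = cochargeE f es′
    cut : ∀ g → (∀ j → h < j → g j ≡ 0) → sumFrom 0 (suc h + d) g ≡ sumFrom 0 (suc h) g
    cut g z = trans (sumFrom-split 0 (suc h) d g) (trans (cong (sumFrom 0 (suc h) g +_) (sumFrom-zero (suc h) d (λ j p → z j p))) (+-identityʳ _))
    lem : ∀ a b c e → a + b + (c + e) ≡ b + c + (a + e)
    lem = ℕR.solve-∀

-- Invariance of the cocharge: Knuth moves, dropping a letter 1, rotation

nth : List ℕ → ℕ → ℕ
nth []       j       = 0
nth (x ∷ la) zero    = x
nth (x ∷ la) (suc j) = nth la j

nth-out : ∀ la j → length la ≤ j → nth la j ≡ 0
nth-out []       j       p       = refl
nth-out (x ∷ la) (suc j) (s≤s p) = nth-out la j p

Content : List ℕ → List ℕ → Set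
Content w la = ∀ j → count (suc j) w ≡ nth la j

Decreasing : List ℕ → Set
Decreasing la = ∀ j → nth la (suc j) ≤ nth la j

cc : List ℕ → ℕ
cc w = cochargeE (length w) (indexed 0 w)

cc-charge : ∀ w la → Decreasing la → Content w la →
  ∃[ c ] (Charged w (nth la) c × cc w + sumFrom 0 (length la) c ≡ sumFrom 0 (length la) (λ j → j * nth la j))
cc-charge w la dec con =
  subst (λ v → ∃[ c ] (Charged v (nth la) c × cc w + sumFrom 0 (length la) c ≡ sumFrom 0 (length la) (λ j → j * nth la j)))
    (lets-indexed 0 w)
    (link (length w) (indexed 0 w) (nth la) (length la) (indexed-ascending 0 w)
      (λ j → trans (cong (count (suc j)) (lets-indexed 0 w)) (con j)) dec (nth-out la)
      (subst (_≤ length w) (con 0) (LP.length-filter (1 ≟_) w)))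

-- The first part of the content has weight 0 in the total, and the state for `j ≡ 0` is empty. The
-- contents may therefore differ in their first parts, and only the readings with the later parts
-- have to agree.
cc-cong : ∀ w w′ la la′ → Decreasing la → Decreasing la′ → Content w la → Content w′ la′ →
  length la ≡ length la′ → (∀ j → nth la (suc j) ≡ nth la′ (suc j)) →
  (∀ j s → pass w (nth la (suc j)) s ≡ pass w′ (nth la (suc j)) s) → cc w ≡ cc w′
cc-cong w w′ la la′ dec dec′ con con′ el en e with cc-charge w la dec con | cc-charge w′ la′ dec′ con′
... | c , ch , t | c′ , ch′ , t′ = +-cancelʳ-≡ (sumFrom 0 (length la) c) (cc w) (cc w′)
  (trans t (trans (trans (sumFrom-cong 0 (length la) weights) (cong (λ n → sumFrom 0 n (λ j → j * nth la′ j)) el))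
    (trans (sym t′) (cong (cc w′ +_) (trans (cong (λ n → sumFrom 0 n c′) (sym el)) (sumFrom-cong 0 (length la) (λ j _ _ → same j)))))))
  where
  weights : ∀ j → 0 ≤ j → j < length la → j * nth la j ≡ j * nth la′ j
  weights zero    _ _ = refl
  weights (suc j) _ _ = cong (suc j *_) (en j)
  none : ∀ {v lam d} → Charged v lam d → d 0 ≡ 0
  none {v} {lam} {d} D with D 0
  ... | [] , _ , s = sym s
  same : ∀ j → c′ j ≡ c j
  same zero    = trans (none {w′} {nth la′} ch′) (sym (none {w} {nth la} ch))
  same (suc j) = let (Ω , lf , s) = ch (suc j); (Ω′ , lf′ , s′) = ch′ (suc j) in
    trans (sym s′) (trans (cong sum (Lfp-unique lf′ (subst (λ n → Lfp (pass w′ n) (suc j) Ω) (en j) (Lfp-cong (λ x _ → e j x) lf)))) s)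

cc-run : ∀ w w′ la → Decreasing la → Content w la → Content w′ la → (∀ s → run w s ≡ run w′ s) → cc w ≡ cc w′
cc-run w w′ la dec con con′ e =
  cc-cong w w′ la la dec dec con con′ refl (λ _ → refl) (λ j s → cong tl (e (nth la (suc j) ∷ s)))

run-head : ∀ w n s → ∃[ s′ ] (run w (n ∷ s) ≡ (n ∸ count 1 w) ∷ s′)
run-head []                n s = s , refl
run-head (zero ∷ w)        n s = run-head w n s
run-head (suc (suc k) ∷ w) n s with run-head w n s
... | s′ , e = step k s′ , cong (step (suc k)) e
run-head (suc zero ∷ w)    n s with run-head w n s
... | s′ , e = proj₁ (fire (n ∸ count 1 w)) , trans (cong (step 0) e) (trans (proj₂ (fire (n ∸ count 1 w)))
    (cong (_∷ proj₁ (fire (n ∸ count 1 w))) (trans (∸-+-assoc n (count 1 w) 1) (cong (n ∸_) (+-comm _ 1)))))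
  where
  fire : ∀ a → ∃[ s″ ] (step 0 (a ∷ s′) ≡ (a ∸ 1) ∷ s″)
  fire zero    = s′ , refl
  fire (suc a) = inj zero s′ , refl

run-used : ∀ w n s → n ≤ count 1 w → ∃[ s′ ] (run w (n ∷ s) ≡ 0 ∷ s′)
run-used w n s p with run-head w n s
... | s′ , e = s′ , trans e (cong (_∷ s′) (m≤n⇒m∸n≡0 p))

-- In each relevant reading at most `m` particles start, and `v` contains `m` ones. Hence station 0
-- is empty when the leftmost 1 is reached, and this letter does nothing.
cc-peel : ∀ y v m la → 1 ∉ y → Decreasing (m ∷ la) → Content (y ++ 1 ∷ v) (suc m ∷ la) → cc (y ++ 1 ∷ v) ≡ cc (y ++ v)
cc-peel y v m la 1∉ dec con =
  cc-cong (y ++ 1 ∷ v) (y ++ v) (suc m ∷ la) (m ∷ la) dec′ dec con con′ refl (λ _ → refl) same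
  where
  dec′ : Decreasing (suc m ∷ la)
  dec′ zero    = m≤n⇒m≤1+n (dec 0)
  dec′ (suc j) = dec (suc j)
  con′ : Content (y ++ v) (m ∷ la)
  con′ zero    = suc-injective (trans (sym (count-mid-≡ 1 y v)) (con 0))
  con′ (suc j) = trans (sym (count-mid-≢ y v (λ ()))) (con (suc j))
  cnt : count 1 v ≡ m
  cnt = trans (sym (cong (_+ count 1 v) (count-∉ 1 y 1∉))) (trans (sym (count-++ 1 y v)) (con′ 0))
  bound : ∀ j → nth la j ≤ m
  bound zero    = dec 0
  bound (suc j) = ≤-trans (dec (suc j)) (bound j)
  same : ∀ j s → pass (y ++ 1 ∷ v) (nth la j) s ≡ pass (y ++ v) (nth la j) s
  same j s with run-used v (nth la j) s (subst (nth la j ≤_) (sym cnt) (bound j))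
  ... | s′ , e = cong tl (trans (run-++ y (1 ∷ v) _) (trans (cong (run y) (trans (cong (step 0) e) (sym e))) (sym (run-++ y v _))))

addHead : ℕ → List ℕ → List ℕ
addHead n []      = []
addHead n (x ∷ s) = (n + x) ∷ s

run-shift : ∀ w n s → 0 ∉ w → run (map suc w) (n ∷ s) ≡ n ∷ run w s
run-shift []          n s z = refl
run-shift (zero ∷ w)  n s z = ⊥-elim (z (here refl))
run-shift (suc k ∷ w) n s z = cong (step (suc k)) (run-shift w n s (z ∘ there))

run-replicate-suc : ∀ x s → run (replicate (suc x) 1) s ≡ run (replicate x 1) (step 0 s)
run-replicate-suc zero    s = refl
run-replicate-suc (suc x) s = cong (step 0) (run-replicate-suc x s)

run-ones : ∀ x n a s → n ≤ x → run (replicate x 1) (n ∷ a ∷ s) ≡ 0 ∷ (n + a) ∷ s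
run-ones zero    zero    a s p = refl
run-ones (suc x) zero    a s p = cong (step 0) (run-ones x zero a s z≤n)
run-ones (suc x) (suc n) a s (s≤s p) = trans (run-replicate-suc x (suc n ∷ a ∷ s))
  (trans (run-ones x n (suc a) s p) (cong (λ z → 0 ∷ z ∷ s) (+-suc n a)))

sum-step-≥ : ∀ k s → suc k ≢ length s → sum s ≤ sum (step k s)
sum-step-≥ k       []              ne = z≤n
sum-step-≥ zero    (zero ∷ s)      ne = ≤-refl
sum-step-≥ zero    (suc x ∷ [])    ne = ⊥-elim (ne refl)
sum-step-≥ zero    (suc x ∷ y ∷ s) ne = ≤-reflexive (sym (+-suc x (y + sum s)))
sum-step-≥ (suc k) (x ∷ s)         ne = +-monoʳ-≤ x (sum-step-≥ k s (ne ∘ cong suc))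

sum-step-≥1 : ∀ k s → sum s ≤ suc (sum (step k s))
sum-step-≥1 k       []              = z≤n
sum-step-≥1 zero    (zero ∷ s)      = n≤1+n _
sum-step-≥1 zero    (suc x ∷ [])    = ≤-refl
sum-step-≥1 zero    (suc x ∷ y ∷ s) = s≤s (+-monoʳ-≤ x (n≤1+n _))
sum-step-≥1 (suc k) (x ∷ s)         = subst (x + sum s ≤_) (+-suc x _) (+-monoʳ-≤ x (sum-step-≥1 k s))

-- Particles leave the system only by the letter `j`, which moves one out of the last station.
sum-run-≥ : ∀ w s j → length s ≡ j → 0 ∉ w → sum s ≤ sum (run w s) + count j w
sum-run-≥ []          s j e z = m≤m+n _ _
sum-run-≥ (zero ∷ w)  s j e z = ⊥-elim (z (here refl))
sum-run-≥ (suc k ∷ w) s j e z with j ≟ suc k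
... | yes refl = ≤-trans (sum-run-≥ w s j e (z ∘ there))
   (subst (sum (run w s) + count j w ≤_) (sym (trans (cong (sum (step k (run w s)) +_) (count-∷-≡ (suc k) w)) (+-suc _ _)))
     (+-monoˡ-≤ (count j w) (sum-step-≥1 k (run w s))))
... | no ne = ≤-trans (sum-run-≥ w s j e (z ∘ there))
   (+-mono-≤ (sum-step-≥ k (run w s) (λ q → ne (trans (sym e) (trans (sym (length-run w s)) (sym q))))) (≤-reflexive (sym (count-∷-≢ w ne))))

sumFrom-const : ∀ κ h c → sumFrom (suc κ) h c ≡ sumFrom κ h (c ∘ suc)
sumFrom-const κ zero    c = refl
sumFrom-const κ (suc h) c = cong (c (suc κ) +_) (sumFrom-const (suc κ) h c)

Letters : ℕ → List ℕ → Set
Letters N = All (λ x → 1 ≤ x × x ≤ N)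

Letters-0∉ : ∀ {N w} → Letters N w → 0 ∉ w
Letters-0∉ (p ∷ ps) (here refl) with proj₁ p
... | ()
Letters-0∉ (p ∷ ps) (there m) = Letters-0∉ ps m

sumFrom-indicator : ∀ κ h x → κ < x → x ≤ κ + h → sumFrom (suc κ) h (λ j → count j (x ∷ [])) ≡ 1
sumFrom-indicator κ zero    x p q = ⊥-elim (<⇒≱ p (subst (x ≤_) (+-identityʳ κ) q))
sumFrom-indicator κ (suc h) x p q with x ≟ suc κ
... | yes refl = cong₂ _+_ (count-∷-≡ (suc κ) []) (trans (sumFrom-cong (suc (suc κ)) h {g = λ _ → 0} (λ j r _ → count-∷-≢ [] (λ e → <⇒≢ r (sym e)))) (sumFrom-zero (suc (suc κ)) h (λ _ _ → refl)))
... | no ne = cong₂ _+_ (count-∷-≢ [] (ne ∘ sym)) (sumFrom-indicator (suc κ) h x (≤∧≢⇒< p (ne ∘ sym)) (subst (x ≤_) (+-suc κ h) q))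

sumFrom-count : ∀ N w → Letters N w → sumFrom 0 N (λ j → count (suc j) w) ≡ length w
sumFrom-count N []      []       = sumFrom-zero 0 N (λ _ _ → refl)
sumFrom-count N (x ∷ w) (p ∷ ps) =
  trans (sumFrom-cong 0 N (λ j _ _ → count-++ (suc j) (x ∷ []) w))
  (trans (sumFrom-+ 0 N (λ j → count (suc j) (x ∷ [])) (λ j → count (suc j) w))
    (cong₂ _+_ (trans (sym (sumFrom-const 0 N (λ j → count j (x ∷ [])))) (sumFrom-indicator 0 N x (proj₁ p) (proj₂ p))) (sumFrom-count N w ps)))

module Base (x : ℕ) (la y v : List ℕ) (Ly : Letters (length la) y) (Lv : Letters (length la) v)
            (dec : Decreasing (x ∷ la)) (con′ : Content (v ++ y) la) where
  w = map suc y ++ replicate x 1 ++ map suc v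

  bound : ∀ j → nth la j ≤ x
  bound zero    = dec 0
  bound (suc j) = ≤-trans (dec (suc j)) (bound j)

  -- Shifted letters leave station 0 alone, and the `x` ones in the middle empty it into station 1,
  -- as `x` bounds all parts. So a reading of `w` consists of a reading of `v`, the arrival of new
  -- particles and a reading of `y`.
  round : ∀ i s → length s ≡ suc i → pass w (nth la i) s ≡ run y (addHead (nth la i) (run v s))
  round i s ls with run v s | run-shift v (nth la i) s (Letters-0∉ Lv) | length-run v s
  ... | []     | e | l with trans l ls
  ... | ()
  round i s ls | z ∷ zs | e | l = cong tl (begin
    run w (nth la i ∷ s)
      ≡⟨ run-++ (map suc y) _ _ ⟩
    run (map suc y) (run (replicate x 1 ++ map suc v) (nth la i ∷ s))
      ≡⟨ cong (run (map suc y)) (trans (run-++ (replicate x 1) _ _) (cong (run (replicate x 1)) e)) ⟩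
    run (map suc y) (run (replicate x 1) (nth la i ∷ z ∷ zs))
      ≡⟨ cong (run (map suc y)) (run-ones x (nth la i) z zs (bound i)) ⟩
    run (map suc y) (0 ∷ (nth la i + z) ∷ zs)
      ≡⟨ run-shift y 0 _ (Letters-0∉ Ly) ⟩
    0 ∷ run y ((nth la i + z) ∷ zs) ∎)

  -- Conjugating the pass by the suffix v turns it into the pass of the rotated, shifted word.
  lfp : ∀ i Ω → Lfp (pass (v ++ y) (nth la i)) i Ω →
        ∃[ Ω′ ] (Lfp (pass w (nth la i)) (suc i) Ω′ × sum Ω′ ≡ sum Ω + count (suc i) v)
  lfp i Ω (len , fix , least) = Ω′ , (len′ , fix′ , least′) , total
    where
    n = nth la i
    Ω′ = run y (n ∷ Ω)
    len′ : length Ω′ ≡ suc i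
    len′ = trans (length-run y (n ∷ Ω)) (cong suc len)
    cnt : count 1 (v ++ y) ≡ nth la 0
    cnt = con′ 0
    low : ∀ i → nth la i ≤ nth la 0
    low zero    = ≤-refl
    low (suc i) = ≤-trans (dec (suc i)) (low i)
    used : ∀ s → run (v ++ y) (n ∷ s) ≡ 0 ∷ pass (v ++ y) n s
    used s with run-used (v ++ y) n s (subst (n ≤_) (sym cnt) (low i))
    ... | s′ , e = trans e (cong (λ z → 0 ∷ tl z) (sym e))
    back : run v Ω′ ≡ 0 ∷ Ω
    back = trans (sym (run-++ v y (n ∷ Ω))) (trans (used Ω) (cong (0 ∷_) fix))
    fix′ : pass w n Ω′ ≡ Ω′
    fix′ = trans (round i Ω′ len′) (cong (run y) (trans (cong (addHead n) back) (cong (_∷ Ω) (+-identityʳ n))))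
    -- Reading `v` turns the prefixpoint `q` into a prefixpoint `zs` for `v ++ y`; reading `y`
    -- carries the bound for `zs` back to `q`.
    least′ : ∀ q → length q ≡ suc i → pass w n q ≤ˢ q → Ω′ ≤ˢ q
    least′ q lq p with run v q | length-run v q | round i q lq | run-mono v p
    ... | []     | l | e | p′ with trans l lq
    ... | ()
    least′ q lq p | z ∷ zs | l | e | p′ = ≤ˢ-trans (run-mono y (m≤m+n n z ∷ least zs (suc-injective (trans l lq)) post)) (subst (_≤ˢ q) e p)
      where
      post : pass (v ++ y) n zs ≤ˢ zs
      post = ≤ˢ-trans (tl-mono (run-mono (v ++ y) (m≤m+n n z ∷ ≤ˢ-refl)))
        (subst (λ a → tl a ≤ˢ zs) (trans (cong (run v) e) (sym (run-++ v y _))) (tl-mono p′))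
    -- Reading `v` and reading `y` lose at most one particle for each letter `suc i`. Together these
    -- letters number `n`, as many as the particles supplied, so neither estimate can be strict.
    total : sum Ω′ ≡ sum Ω + count (suc i) v
    total = ≤-antisym up down
      where
      up : sum Ω′ ≤ sum Ω + count (suc i) v
      up = subst (λ z → sum Ω′ ≤ sum z + count (suc i) v) back (sum-run-≥ v Ω′ (suc i) len′ (Letters-0∉ Lv))
      down : sum Ω + count (suc i) v ≤ sum Ω′
      down = +-cancelʳ-≤ (count (suc i) y) _ _ (subst (_≤ sum Ω′ + count (suc i) y)
        (trans (cong (_+ sum Ω) (trans (sym (con′ i)) (count-++ (suc i) v y))) (lem (count (suc i) v) _ _))
        (sum-run-≥ y (n ∷ Ω) (suc i) (cong suc len) (Letters-0∉ Ly)))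
        where
        lem : ∀ a b c → a + b + c ≡ c + a + b
        lem = ℕR.solve-∀

  -- The weight of every part of `la` rises by one, which adds `length v + length y`. The additional
  -- waiting particles account for `length v`, so that `length y` is left for the cocharge.
  cc-base : Content w (x ∷ la) → cc w ≡ length y + cc (v ++ y)
  cc-base con with cc-charge w (x ∷ la) dec con | cc-charge (v ++ y) la (dec ∘ suc) con′
  ... | c , ch , t | c′ , ch′ , t′ = +-cancelʳ-≡ (sumFrom 1 N c) (cc w) _ (begin
    cc w + sumFrom 1 N c
      ≡⟨ cong (λ z → cc w + (z + sumFrom 1 N c)) (sym c0) ⟩
    cc w + (c 0 + sumFrom 1 N c)
      ≡⟨ t ⟩
    sumFrom 1 N (λ j → j * nth (x ∷ la) j)
      ≡⟨ sumFrom-const 0 N _ ⟩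
    sumFrom 0 N (λ j → nth la j + j * nth la j)
      ≡⟨ sumFrom-+ 0 N (nth la) _ ⟩
    sumFrom 0 N (nth la) + sumFrom 0 N (λ j → j * nth la j)
      ≡⟨ cong₂ _+_ size (sym t′) ⟩
    (length v + length y) + (cc (v ++ y) + sumFrom 0 N c′)
      ≡⟨ lem (length v) (length y) _ _ ⟩
    length y + cc (v ++ y) + (sumFrom 0 N c′ + length v)
      ≡⟨ cong (length y + cc (v ++ y) +_) (sym charges) ⟩
    length y + cc (v ++ y) + sumFrom 1 N c ∎)
    where
    N = length la
    c0 : c 0 ≡ 0
    c0 with ch 0
    ... | [] , _ , s = sym s
    c-suc : ∀ i → c (suc i) ≡ c′ i + count (suc i) v
    c-suc i = let (Ω , lf , s) = ch′ i; (Ω′ , lf′ , s′) = lfp i Ω lf; (Ω″ , lf″ , s″) = ch (suc i) in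
      trans (sym s″) (trans (cong sum (Lfp-unique lf″ lf′)) (trans s′ (cong (_+ count (suc i) v) s)))
    charges : sumFrom 1 N c ≡ sumFrom 0 N c′ + length v
    charges = trans (sumFrom-const 0 N c) (trans (sumFrom-cong 0 N (λ j _ _ → c-suc j))
      (trans (sumFrom-+ 0 N c′ _) (cong (sumFrom 0 N c′ +_) (sumFrom-count N v Lv))))
    size : sumFrom 0 N (nth la) ≡ length v + length y
    size = trans (sumFrom-cong 0 N (λ j _ _ → trans (sym (con′ j)) (count-++ (suc j) v y)))
      (trans (sumFrom-+ 0 N (λ j → count (suc j) v) _) (cong₂ _+_ (sumFrom-count N v Lv) (sumFrom-count N y Ly)))
    lem : ∀ a b c d → (a + b) + (c + d) ≡ b + c + (d + a)
    lem = ℕR.solve-∀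

-- Row insertion

infix 4 _≈_
-- Action and content are all that `cc-run` looks at. The relation contains the Knuth relations and
-- is compatible with concatenation.
_≈_ : List ℕ → List ℕ → Set
w ≈ w′ = (∀ s → run w s ≡ run w′ s) × w ↭ w′

≈-refl : ∀ {w} → w ≈ w
≈-refl = (λ s → refl) , ↭-refl

≈-trans : ∀ {u v w} → u ≈ v → v ≈ w → u ≈ w
≈-trans (e , p) (e′ , p′) = (λ s → trans (e s) (e′ s)) , ↭-trans p p′

≈-reflexive : ∀ {u v} → u ≡ v → u ≈ v
≈-reflexive refl = ≈-refl

≈-++ˡ : ∀ u {v w} → v ≈ w → u ++ v ≈ u ++ w
≈-++ˡ u (e , p) = (λ s → trans (run-++ u _ s) (trans (cong (run u) (e s)) (sym (run-++ u _ s)))) , PermP.++⁺ˡ u p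

≈-++ʳ : ∀ {v w} u → v ≈ w → v ++ u ≈ w ++ u
≈-++ʳ {v} {w} u (e , p) = (λ s → trans (run-++ v u s) (trans (e (run u s)) (sym (run-++ w u s)))) , PermP.++⁺ʳ u p

≈-∷ : ∀ x {v w} → v ≈ w → x ∷ v ≈ x ∷ w
≈-∷ x = ≈-++ˡ (x ∷ [])

↭-count : ∀ {w w′} i → w ↭ w′ → count i w ≡ count i w′
↭-count i p = PermP.↭-length (PermP.filter-↭ (i ≟_) p)

data Sorted : List ℕ → Set where
  []  : Sorted []
  _∷_ : ∀ {x xs} → All (x ≤_) xs → Sorted xs → Sorted (x ∷ xs)

sorted-++ˡ : ∀ xs {ys} → Sorted (xs ++ ys) → Sorted xs
sorted-++ˡ []       s       = []
sorted-++ˡ (x ∷ xs) (p ∷ s) = AllP.++⁻ˡ xs p ∷ sorted-++ˡ xs s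

sorted-++ : ∀ {k xs ys} → Sorted xs → All (_≤ k) xs → All (k ≤_) ys → Sorted ys → Sorted (xs ++ ys)
sorted-++ []      []        q t = t
sorted-++ (p ∷ s) (le ∷ les) q t = AllP.++⁺ p (All.map (≤-trans le) q) ∷ sorted-++ s les q t

slide-right : ∀ {c} x S → c < x → Sorted (x ∷ S) → x ∷ S ++ c ∷ [] ≈ x ∷ c ∷ S
slide-right {c} x []      c<x s                  = ≈-refl
slide-right {c} x (y ∷ S) c<x ((x≤y ∷ _) ∷ s) =
  ≈-trans (≈-∷ x (slide-right y S (<-≤-trans c<x x≤y) s))
          ((λ st → knuth₁ c<x x≤y (run S st)) , prep x (swap y c ↭-refl))

slide-left : ∀ {x} A c → c < x → Sorted (A ++ c ∷ []) → A ++ x ∷ c ∷ [] ≈ x ∷ A ++ c ∷ []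
slide-left []          c c<x s = ≈-refl
slide-left {x} (a ∷ A) c c<x (p ∷ s) = ≈-trans (≈-∷ a (slide-left A c c<x s)) (head A (p ∷ s))
  where
  below : ∀ A → Sorted (A ++ c ∷ []) → All (_< x) (A ++ c ∷ [])
  below []      s       = c<x ∷ []
  below (d ∷ A) (q ∷ s) = <-≤-trans (s≤s (All.head (AllP.++⁻ʳ A q))) c<x ∷ below A s
  head : ∀ A → Sorted (a ∷ A ++ c ∷ []) → a ∷ x ∷ A ++ c ∷ [] ≈ x ∷ a ∷ A ++ c ∷ []
  head []      ((a≤c ∷ _) ∷ _) = (λ st → knuth₂ a≤c c<x st) , swap a x ↭-refl
  head (d ∷ A) ((a≤d ∷ _) ∷ t) = (λ st → knuth₂ a≤d (All.head (below (d ∷ A) t)) (run (A ++ c ∷ []) st)) , swap a x ↭-refl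

-- Insertion of one letter: `knuth₁` moves `c` leftwards through the entries after `x`, and `knuth₂`
-- moves the bumped `x` out through the entries before `c`.
bump-one : ∀ A x S c → c < x → Sorted (A ++ c ∷ []) → Sorted (x ∷ S) → A ++ x ∷ S ++ c ∷ [] ≈ x ∷ A ++ c ∷ S
bump-one A x S c c<x sA sS = ≈-trans (≈-++ˡ A (slide-right x S c<x sS))
  (≈-trans (≈-reflexive (sym (LP.++-assoc A (x ∷ c ∷ []) S)))
  (≈-trans (≈-++ʳ S (slide-left A c c<x sA)) (≈-reflexive (cong (x ∷_) (LP.++-assoc A (c ∷ []) S)))))

replicate-sorted : ∀ n x {S} → All (x ≤_) S → Sorted S → Sorted (replicate n x ++ S)
replicate-sorted zero    x p s = s
replicate-sorted (suc n) x p s = AllP.++⁺ (AllP.replicate⁺ n ≤-refl) p ∷ replicate-sorted n x p s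

-- The letters of `C` are inserted one by one. Each bumps the first `x` that is left and then counts
-- as a part of `A`.
bump : ∀ A x y R C → All (_< x) C → Sorted (A ++ C) → All (x ≤_) R → Sorted R →
  A ++ replicate (length C + y) x ++ R ++ C ≈ replicate (length C) x ++ A ++ C ++ replicate y x ++ R
bump A x y R []      lt sA xR sR = ≈-reflexive (cong (λ z → A ++ replicate y x ++ z) (LP.++-identityʳ R))
bump A x y R (c ∷ C) (c<x ∷ lt) sA xR sR =
  ≈-trans (≈-reflexive eq₁) (≈-trans (≈-++ʳ C (bump-one A x S c c<x sA₁ sS))
  (≈-trans (≈-reflexive eq₂) (≈-trans (≈-∷ x (bump (A ++ c ∷ []) x y R C lt (subst Sorted (sym (LP.++-assoc A (c ∷ []) C)) sA) xR sR)) (≈-reflexive eq₃))))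
  where
  S = replicate (length C + y) x ++ R
  sS : Sorted (x ∷ S)
  sS = replicate-sorted (suc (length C + y)) x xR sR
  sA₁ : Sorted (A ++ c ∷ [])
  sA₁ = sorted-++ˡ (A ++ c ∷ []) (subst Sorted (sym (LP.++-assoc A (c ∷ []) C)) sA)
  eq₁ : A ++ x ∷ replicate (length C + y) x ++ R ++ c ∷ C ≡ (A ++ x ∷ S ++ c ∷ []) ++ C
  eq₁ = sym (trans (LP.++-assoc A _ C) (cong (λ z → A ++ x ∷ z) (trans (LP.++-assoc S (c ∷ []) C) (LP.++-assoc (replicate (length C + y) x) R (c ∷ C)))))
  eq₂ : (x ∷ A ++ c ∷ S) ++ C ≡ x ∷ (A ++ c ∷ []) ++ replicate (length C + y) x ++ R ++ C
  eq₂ = cong (x ∷_) (trans (LP.++-assoc A (c ∷ S) C) (trans (cong (λ z → A ++ c ∷ z) (LP.++-assoc (replicate (length C + y) x) R C)) (sym (LP.++-assoc A (c ∷ []) _))))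
  eq₃ : x ∷ replicate (length C) x ++ (A ++ c ∷ []) ++ C ++ replicate y x ++ R ≡ x ∷ replicate (length C) x ++ A ++ c ∷ C ++ replicate y x ++ R
  eq₃ = cong (λ z → x ∷ replicate (length C) x ++ z) (LP.++-assoc A (c ∷ []) _)

-- The row with v₀ letters k, v₁ letters suc k, …
wd : ℕ → List ℕ → List ℕ
wd k []      = []
wd k (m ∷ v) = replicate m k ++ wd (suc k) v

wd-≥ : ∀ k v → All (k ≤_) (wd k v)
wd-≥ k []      = []
wd-≥ k (m ∷ v) = AllP.++⁺ (AllP.replicate⁺ m ≤-refl) (All.map <⇒≤ (wd-≥ (suc k) v))

wd-sorted : ∀ k v → Sorted (wd k v)
wd-sorted k []      = []
wd-sorted k (m ∷ v) = replicate-sorted m k (All.map <⇒≤ (wd-≥ (suc k) v)) (wd-sorted (suc k) v)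

data Cut : ℕ → ℕ → Set where
  within : ∀ m y → Cut m (m + y)
  beyond : ∀ m x → Cut (m + suc x) m

cut : ∀ c r → Cut c r
cut zero    r       = within zero r
cut (suc c) zero    = beyond zero c
cut (suc c) (suc r) with cut c r
... | within m y = within (suc m) y
... | beyond m x = beyond (suc m) x

-- Row insertion of a row B into a row R, both given by multiplicities.  Scanning the letters upwards,
-- c inserted letters are waiting to bump; the result is the bumped row, the new row and the number of
-- letters that bump nothing.
row : ℕ → List ℕ → List ℕ → List ℕ × List ℕ × ℕ
row c (r ∷ R) (b ∷ B) = let (B′ , R′ , p) = row ((c ∸ r) + b) R B in (c ⊓ r) ∷ B′ , ((r ∸ c) + b) ∷ R′ , p
row c _       _       = [] , [] , c

-- The inverse of `row`, from the largest letter downwards. The local rule is its own inverse: one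
-- of `r ∸ c` and `c ∸ r` is zero, so `b` is the minimum of `(r ∸ c) + b` and `(c ∸ r) + b`, and the
-- two differences recover `r` and `c`.
unrow : ℕ → List ℕ → List ℕ → List ℕ × List ℕ × ℕ
unrow p (m ∷ B′) (r ∷ R′) = let (R , B , c) = unrow p B′ R′ in ((r ∸ c) + m) ∷ R , (c ⊓ r) ∷ B , (c ∸ r) + m
unrow p _        _        = [] , [] , p

replicate-++ : ∀ m n (x : ℕ) → replicate m x ++ replicate n x ≡ replicate (m + n) x
replicate-++ zero    n x = refl
replicate-++ (suc m) n x = cong (x ∷_) (replicate-++ m n x)

split-at : ∀ m {n} (C : List ℕ) → length C ≡ m + n → ∃[ C₁ ] ∃[ C₂ ] (C ≡ C₁ ++ C₂ × length C₁ ≡ m × length C₂ ≡ n)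
split-at zero    C       e = [] , C , refl , refl , e
split-at (suc m) (c ∷ C) e with split-at m C (suc-injective e)
... | C₁ , C₂ , refl , l₁ , l₂ = c ∷ C₁ , C₂ , refl , cong suc l₁ , l₂

lo-⊓ : ∀ m y → m ⊓ (m + y) ≡ m
lo-⊓ m y = m≤n⇒m⊓n≡m (m≤m+n m y)
lo-c : ∀ m y → m ∸ (m + y) ≡ 0
lo-c m y = m≤n⇒m∸n≡0 (m≤m+n m y)
lo-r : ∀ m y → (m + y) ∸ m ≡ y
lo-r = m+n∸m≡n
hi-⊓ : ∀ m x → (m + x) ⊓ m ≡ m
hi-⊓ m x = m≥n⇒m⊓n≡n (m≤m+n m x)

unrow-row : ∀ c R B → length R ≡ length B → let (B′ , R′ , p) = row c R B in unrow p B′ R′ ≡ (R , B , c)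
unrow-row c []      []      e = refl
unrow-row c (r ∷ R) (b ∷ B) e rewrite unrow-row ((c ∸ r) + b) R B (suc-injective e) with cut c r
... | within m y rewrite lo-c m y | lo-r m y | lo-⊓ m y | +-comm y b | lo-⊓ b y | lo-r b y | lo-c b y =
  cong (λ z → z ∷ R , b ∷ B , m) (+-comm y m)
... | beyond m x rewrite hi-⊓ m (suc x) | lo-c m (suc x) | lo-r m (suc x) | +-comm (suc x) b | lo-c b (suc x) | lo-r b (suc x) | hi-⊓ b (suc x) =
  cong (λ z → m ∷ R , b ∷ B , z) (+-comm (suc x) m)

row-unrow : ∀ p B′ R′ → length B′ ≡ length R′ → let (R , B , c) = unrow p B′ R′ in row c R B ≡ (B′ , R′ , p)
row-unrow p []       []       e = refl
row-unrow p (m ∷ B′) (r ∷ R′) e with unrow p B′ R′ | row-unrow p B′ R′ (suc-injective e)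
... | R , B , c | ih with cut c r
... | within b y rewrite lo-c b y | lo-r b y | lo-⊓ b y | +-comm y m | lo-c m y | lo-⊓ m y | lo-r m y | ih =
  cong (λ z → m ∷ B′ , z ∷ R′ , p) (+-comm y b)
... | beyond b x rewrite hi-⊓ b (suc x) | lo-c b (suc x) | lo-r b (suc x) | +-comm (suc x) m | lo-r m (suc x) | hi-⊓ m (suc x) | lo-c m (suc x) | +-comm (suc x) b | ih = refl

row-length : ∀ c R B → length R ≡ length B → length (proj₁ (row c R B)) ≡ length R × length (proj₁ (proj₂ (row c R B))) ≡ length R
row-length c []      []      e = refl , refl
row-length c (r ∷ R) (b ∷ B) e = let (x , y) = row-length ((c ∸ r) + b) R B (suc-injective e) in cong suc x , cong suc y

unrow-length : ∀ p B R → length B ≡ length R → length (proj₁ (unrow p B R)) ≡ length B × length (proj₁ (proj₂ (unrow p B R))) ≡ length B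
unrow-length p []      []      e = refl , refl
unrow-length p (b ∷ B) (r ∷ R) e = let (x , y) = unrow-length p B R (suc-injective e) in cong suc x , cong suc y

-- `A` and `C` hold the letters below `k` in the row under construction: `A` those already settled,
-- `C` the `c` inserted ones that still wait to bump. In the case `beyond` only a first portion of
-- `C` finds letters `k` to bump.
row-≈ : ∀ k c R B A C → length R ≡ length B → length C ≡ c → All (_< k) A → All (_< k) C → Sorted (A ++ C) →
  let (B′ , R′ , p) = row c R B in A ++ wd k R ++ C ++ wd k B ≈ wd k B′ ++ A ++ C ++ wd k R′
row-≈ k c []      []      A C e l ltA lt s = ≈-refl
row-≈ k c (r ∷ R) (b ∷ B) A C e l ltA lt s with cut c r
row-≈ k .(length C) (.(length C + y) ∷ R) (b ∷ B) A C e refl ltA lt s | within .(length C) y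
  rewrite lo-c (length C) y | lo-r (length C) y | lo-⊓ (length C) y =
  ≈-trans (≈-reflexive eq₁) (≈-trans (≈-++ʳ (K b ++ wd (suc k) B) (bump A k y (wd (suc k) R) C lt s (All.map <⇒≤ (wd-≥ (suc k) R)) (wd-sorted (suc k) R)))
  (≈-trans (≈-reflexive eq₂) (≈-trans (≈-++ˡ (K m) (row-≈ (suc k) b R B (A ++ C ++ K y) (K b) (suc-injective e) (LP.length-replicate b) ltA′ (AllP.replicate⁺ b ≤-refl) s′))
  (≈-reflexive eq₃))))
  where
  m = length C
  K = λ n → replicate n k
  ltAC = AllP.++⁺ ltA lt
  ltA′ : All (_< suc k) (A ++ C ++ K y)
  ltA′ = AllP.++⁺ (All.map m≤n⇒m≤1+n ltA) (AllP.++⁺ (All.map m≤n⇒m≤1+n lt) (AllP.replicate⁺ y ≤-refl))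
  s′ : Sorted ((A ++ C ++ K y) ++ K b)
  s′ = subst Sorted (sym (trans (LP.++-assoc A (C ++ K y) (K b)) (trans (cong (A ++_) (LP.++-assoc C (K y) (K b))) (sym (LP.++-assoc A C _)))))
         (sorted-++ s (All.map <⇒≤ ltAC) (AllP.++⁺ (AllP.replicate⁺ y ≤-refl) (AllP.replicate⁺ b ≤-refl))
           (replicate-sorted y k (AllP.replicate⁺ b ≤-refl) (subst Sorted (LP.++-identityʳ (K b)) (replicate-sorted b k [] []))))
  B′ = proj₁ (row b R B)
  R′ = proj₁ (proj₂ (row b R B))
  eq₁ : A ++ (K (m + y) ++ wd (suc k) R) ++ C ++ K b ++ wd (suc k) B ≡ (A ++ K (m + y) ++ wd (suc k) R ++ C) ++ K b ++ wd (suc k) B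
  eq₁ = sym (trans (LP.++-assoc A _ _) (cong (A ++_) (trans (LP.++-assoc (K (m + y)) _ _) (trans (cong (K (m + y) ++_) (LP.++-assoc (wd (suc k) R) C _)) (sym (LP.++-assoc (K (m + y)) _ _))))))
  eq₂ : (K m ++ A ++ C ++ K y ++ wd (suc k) R) ++ K b ++ wd (suc k) B ≡ K m ++ (A ++ C ++ K y) ++ wd (suc k) R ++ K b ++ wd (suc k) B
  eq₂ = trans (LP.++-assoc (K m) _ _) (cong (K m ++_) (trans (LP.++-assoc A _ _) (trans (cong (A ++_) (trans (LP.++-assoc C _ _) (trans (cong (C ++_) (LP.++-assoc (K y) _ _)) (sym (LP.++-assoc C (K y) _))))) (sym (LP.++-assoc A (C ++ K y) _)))))
  eq₃ : K m ++ wd (suc k) B′ ++ (A ++ C ++ K y) ++ K b ++ wd (suc k) R′ ≡ (K m ++ wd (suc k) B′) ++ A ++ C ++ K (y + b) ++ wd (suc k) R′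
  eq₃ = trans (cong (λ z → K m ++ wd (suc k) B′ ++ z) (trans (LP.++-assoc A _ _) (cong (A ++_) (trans (LP.++-assoc C _ _) (cong (C ++_) (trans (sym (LP.++-assoc (K y) (K b) _)) (cong (_++ wd (suc k) R′) (replicate-++ y b k)))))))) (sym (LP.++-assoc (K m) (wd (suc k) B′) _))
row-≈ k .(m + suc x) (.m ∷ R) (b ∷ B) A C e l ltA lt s | beyond m x with split-at m C l
row-≈ k .(length C₁ + suc x) (.(length C₁) ∷ R) (b ∷ B) A .(C₁ ++ C₂) e l ltA lt s | beyond .(length C₁) x | C₁ , C₂ , refl , refl , l₂
  rewrite hi-⊓ (length C₁) (suc x) | lo-c (length C₁) (suc x) | lo-r (length C₁) (suc x) =
  ≈-trans (≈-reflexive eq₁) (≈-trans (≈-++ʳ (C₂ ++ K b ++ wd (suc k) B) (bump A k 0 (wd (suc k) R) C₁ (AllP.++⁻ˡ C₁ lt) (sorted-++ˡ (A ++ C₁) s₁) (All.map <⇒≤ (wd-≥ (suc k) R)) (wd-sorted (suc k) R)))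
  (≈-trans (≈-reflexive eq₂) (≈-trans (≈-++ˡ (K m) (row-≈ (suc k) (suc x + b) R B (A ++ C₁) (C₂ ++ K b) (suc-injective e) len′ ltA′ lt′ s′))
  (≈-reflexive eq₃))))
  where
  m = length C₁
  K = λ n → replicate n k
  s₁ : Sorted ((A ++ C₁) ++ C₂)
  s₁ = subst Sorted (sym (LP.++-assoc A C₁ C₂)) s
  len′ : length (C₂ ++ K b) ≡ suc x + b
  len′ = trans (LP.length-++ C₂) (cong₂ _+_ l₂ (LP.length-replicate b))
  ltA′ : All (_< suc k) (A ++ C₁)
  ltA′ = AllP.++⁺ (All.map m≤n⇒m≤1+n ltA) (All.map m≤n⇒m≤1+n (AllP.++⁻ˡ C₁ lt))
  lt′ : All (_< suc k) (C₂ ++ K b)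
  lt′ = AllP.++⁺ (All.map m≤n⇒m≤1+n (AllP.++⁻ʳ C₁ lt)) (AllP.replicate⁺ b ≤-refl)
  s′ : Sorted ((A ++ C₁) ++ C₂ ++ K b)
  s′ = subst Sorted (LP.++-assoc (A ++ C₁) C₂ (K b))
         (sorted-++ s₁ (All.map <⇒≤ (subst (All (_< k)) (sym (LP.++-assoc A C₁ C₂)) (AllP.++⁺ ltA lt))) (AllP.replicate⁺ b ≤-refl)
           (subst Sorted (LP.++-identityʳ (K b)) (replicate-sorted b k [] [])))
  V = wd (suc k) B
  W = wd (suc k) R
  B′ = wd (suc k) (proj₁ (row (suc x + b) R B))
  R′ = wd (suc k) (proj₁ (proj₂ (row (suc x + b) R B)))
  assoc₁ : ∀ (a p q c d r v : List ℕ) → a ++ (p ++ q) ++ (c ++ d) ++ r ++ v ≡ (a ++ p ++ q ++ c) ++ d ++ r ++ v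
  assoc₁ a p q c d r v = solve (LP.++-monoid ℕ)
  eq₁ : A ++ (K m ++ W) ++ (C₁ ++ C₂) ++ K b ++ V ≡ (A ++ K (m + 0) ++ W ++ C₁) ++ C₂ ++ K b ++ V
  eq₁ = trans (assoc₁ A (K m) W C₁ C₂ (K b) V) (cong (λ n → (A ++ K n ++ W ++ C₁) ++ C₂ ++ K b ++ V) (sym (+-identityʳ m)))
  assoc₂ : ∀ (p a c w d r v : List ℕ) → (p ++ a ++ c ++ w) ++ d ++ r ++ v ≡ p ++ (a ++ c) ++ w ++ (d ++ r) ++ v
  assoc₂ p a c w d r v = solve (LP.++-monoid ℕ)
  eq₂ : (K m ++ A ++ C₁ ++ W) ++ C₂ ++ K b ++ V ≡ K m ++ (A ++ C₁) ++ W ++ (C₂ ++ K b) ++ V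
  eq₂ = assoc₂ (K m) A C₁ W C₂ (K b) V
  assoc₃ : ∀ (p q a c d r v : List ℕ) → p ++ q ++ (a ++ c) ++ (d ++ r) ++ v ≡ (p ++ q) ++ a ++ (c ++ d) ++ r ++ v
  assoc₃ p q a c d r v = solve (LP.++-monoid ℕ)
  eq₃ : K m ++ B′ ++ (A ++ C₁) ++ (C₂ ++ K b) ++ R′ ≡ (K m ++ B′) ++ A ++ (C₁ ++ C₂) ++ K b ++ R′
  eq₃ = assoc₃ (K m) B′ A C₁ C₂ (K b) R′

row-sum : ∀ c R B → length R ≡ length B → let (B′ , R′ , p) = row c R B in
  c + sum B ≡ sum B′ + p × sum R′ + c ≡ sum R + p
row-sum c []      []      e = +-identityʳ c , refl
row-sum c (r ∷ R) (b ∷ B) e with row-sum ((c ∸ r) + b) R B (suc-injective e) | cut c r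
... | x , y | within m z rewrite lo-c m z | lo-r m z | lo-⊓ m z =
  trans (cong (m +_) x) (sym (+-assoc m _ _)) ,
  trans (lem z b _ m) (trans (cong ((m + z) +_) y) (sym (+-assoc (m + z) _ _)))
  where
  lem : ∀ z b r m → z + b + r + m ≡ m + z + (r + b)
  lem = ℕR.solve-∀
... | x , y | beyond m z rewrite hi-⊓ m (suc z) | lo-c m (suc z) | lo-r m (suc z) =
  trans (lem m (suc z) b (sum B)) (trans (cong (m +_) x) (sym (+-assoc m _ _))) ,
  trans (lem′ b _ m (suc z)) (trans (cong (m +_) y) (sym (+-assoc m _ _)))
  where
  lem : ∀ m z b s → m + z + (b + s) ≡ m + (z + b + s)
  lem = ℕR.solve-∀
  lem′ : ∀ b r m z → b + r + (m + z) ≡ m + (r + (z + b))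
  lem′ = ℕR.solve-∀

row-≤ : ∀ c R B → sum (proj₁ (row c R B)) ≤ sum R
row-≤ c []      B       = z≤n
row-≤ c (r ∷ R) []      = z≤n
row-≤ c (r ∷ R) (b ∷ B) = +-mono-≤ (m⊓n≤n c r) (row-≤ ((c ∸ r) + b) R B)

-- Column strictness of a row L placed below a row U; k is the number of entries of U minus the number
-- of entries of L among the letters already scanned.
Dom : ℕ → List ℕ → List ℕ → Set
Dom k []      []      = ⊤
Dom k (u ∷ U) (l ∷ L) = ∃[ d ] (k ≡ l + d × Dom (d + u) U L)
Dom k _       _       = ⊥

-- Every bumped letter is displaced by a waiting one, which is smaller and enters the upper row; so
-- the waiting letters provide the slack that the lower row uses up.
row-dom : ∀ c k R B → length R ≡ length B → c ≤ k → let (B′ , R′ , p) = row c R B in Dom k R′ B′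
row-dom c k []      []      e c≤k = tt
row-dom c k (r ∷ R) (b ∷ B) e c≤k with m≤n⇒∃[o]m+o≡n c≤k
... | d , refl with cut c r
... | within m y rewrite lo-c m y | lo-r m y | lo-⊓ m y =
  d , refl , row-dom b _ R B (suc-injective e) (subst (b ≤_) (+-assoc d y b) (m≤n+m b (d + y)))
... | beyond m x rewrite hi-⊓ m (suc x) | lo-c m (suc x) | lo-r m (suc x) =
  suc x + d , +-assoc m (suc x) d , row-dom (suc x + b) _ R B (suc-injective e) (+-monoˡ-≤ b (m≤m+n (suc x) d))

-- For `k ≡ 0` no letter is left waiting below the smallest one, so reverse bumping ends where an
-- insertion can begin.
unrow-start : ∀ p k B′ R′ → Dom k R′ B′ → p + sum B′ ≤ k + sum R′ → proj₂ (proj₂ (unrow p B′ R′)) ≤ k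
unrow-start p k []       []       D le = subst₂ _≤_ (+-identityʳ p) (+-identityʳ k) le
unrow-start p .(m + d) (m ∷ B′) (r ∷ R′) (d , refl , D) le
  with unrow p B′ R′ | unrow-start p (d + r) B′ R′ D
         (+-cancelˡ-≤ m _ _ (subst₂ _≤_ (lem p m (sum B′)) (lem′ m d r (sum R′)) le))
  where
  lem : ∀ p m s → p + (m + s) ≡ m + (p + s)
  lem = ℕR.solve-∀
  lem′ : ∀ m d r s → m + d + (r + s) ≡ m + (d + r + s)
  lem′ = ℕR.solve-∀
... | R , B , c | ih with cut c r
... | within b y rewrite lo-c b y = m≤m+n m d
... | beyond b x rewrite lo-r b (suc x) = subst (suc x + m ≤_) (+-comm d m) (+-monoˡ-≤ m (+-cancelʳ-≤ b _ _ (subst (_≤ d + b) (+-comm b (suc x)) ih)))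

data Cut′ : ℕ → ℕ → ℕ → Set where
  within : ∀ m y d → Cut′ m (m + y) d
  beyond : ∀ m x g → Cut′ (m + suc x) m (suc x + g)

cut′ : ∀ c r d → c ≤ r + d → Cut′ c r d
cut′ c r d le with cut c r
... | within m y = within m y d
... | beyond m x with m≤n⇒∃[o]m+o≡n (+-cancelˡ-≤ m (suc x) d le)
... | g , refl = beyond m x g

-- Invariant: kP + c₂ ≡ kT + c, where kT and kP are the slacks before and after insertion.
rows-dom : ∀ c c₂ kT kP R B Q → length R ≡ length B → length Q ≡ length B → Dom kT R Q → c₂ ≤ kT → kP + c₂ ≡ kT + c →
  Dom kP (proj₁ (proj₂ (row c R B))) (proj₁ (proj₂ (row c₂ Q (proj₁ (row c R B)))))
  × proj₂ (proj₂ (row c₂ Q (proj₁ (row c R B)))) + sum Q ≤ kT + sum R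
rows-dom c c₂ kT kP []      []      []      e e′ D le eq = tt , +-monoˡ-≤ 0 le
rows-dom c c₂ .(q + d) kP (r ∷ R) (b ∷ B) (q ∷ Q) e e′ (d , refl , D) le eq with cut c r | cut′ c₂ q d le
... | within m y | within _ z d rewrite lo-c m y | lo-r m y | lo-⊓ m y | lo-c c₂ z | lo-r c₂ z =
  let (D′ , s) = rows-dom b m (d + (m + y)) (d + (y + b)) R B Q (suc-injective e) (suc-injective e′) D
                   (≤-trans (m≤m+n m y) (m≤n+m _ d)) (lem₁ d y b m) in
  (d , +-cancelʳ-≡ c₂ _ _ (trans eq (lem₂ c₂ z d m)) , D′) , subst₂ _≤_ (lem₃ (c₂ + z) _ (sum Q)) (lem₄ (c₂ + z) d (m + y) (sum R)) (+-monoʳ-≤ (c₂ + z) s)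
  where
  lem₁ : ∀ d y b m → d + (y + b) + m ≡ d + (m + y) + b
  lem₁ = ℕR.solve-∀
  lem₂ : ∀ c z d m → c + z + d + m ≡ (z + m) + d + c
  lem₂ = ℕR.solve-∀
  lem₃ : ∀ q p s → q + (p + s) ≡ p + (q + s)
  lem₃ = ℕR.solve-∀
  lem₄ : ∀ q d r s → q + (d + r + s) ≡ q + d + (r + s)
  lem₄ = ℕR.solve-∀
... | within m y | beyond q x g rewrite lo-c m y | lo-r m y | lo-⊓ m y | lo-c q (suc x) | lo-r q (suc x) =
  let (D′ , s) = rows-dom b (suc x + m) (suc x + g + (m + y)) (g + (y + b)) R B Q (suc-injective e) (suc-injective e′) D
                   (subst (suc x + m ≤_) (lem₅ (suc x) m g y) (m≤m+n (suc x + m) (g + y))) (lem₁ g y b (suc x) m) in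
  (g , +-cancelʳ-≡ (q + suc x) _ _ (trans eq (lem₂ q (suc x) g m)) , D′) , subst₂ _≤_ (lem₃ q _ (sum Q)) (lem₄ q (suc x + g) (m + y) (sum R)) (+-monoʳ-≤ q s)
  where
  lem₁ : ∀ g y b x m → g + (y + b) + (x + m) ≡ x + g + (m + y) + b
  lem₁ = ℕR.solve-∀
  lem₂ : ∀ q x g m → q + (x + g) + m ≡ m + g + (q + x)
  lem₂ = ℕR.solve-∀
  lem₃ : ∀ q p s → q + (p + s) ≡ p + (q + s)
  lem₃ = ℕR.solve-∀
  lem₄ : ∀ q d r s → q + (d + r + s) ≡ q + d + (r + s)
  lem₄ = ℕR.solve-∀
  lem₅ : ∀ x m g y → x + m + (g + y) ≡ x + g + (m + y)
  lem₅ = ℕR.solve-∀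
... | beyond m w | within _ z d rewrite hi-⊓ m (suc w) | lo-c m (suc w) | lo-r m (suc w) | lo-c c₂ z | lo-r c₂ z =
  let (D′ , s) = rows-dom (suc w + b) m (d + m) (d + suc w + b) R B Q (suc-injective e) (suc-injective e′) D
                   (m≤n+m m d) (lem₁ d (suc w) b m) in
  (d + suc w , +-cancelʳ-≡ c₂ _ _ (trans eq (lem₂ c₂ z d m (suc w))) , D′) , subst₂ _≤_ (lem₃ (c₂ + z) _ (sum Q)) (lem₄ (c₂ + z) d m (sum R)) (+-monoʳ-≤ (c₂ + z) s)
  where
  lem₁ : ∀ d x b m → d + x + b + m ≡ d + m + (x + b)
  lem₁ = ℕR.solve-∀
  lem₂ : ∀ c z d m x → c + z + d + (m + x) ≡ (z + m) + (d + x) + c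
  lem₂ = ℕR.solve-∀
  lem₃ : ∀ q p s → q + (p + s) ≡ p + (q + s)
  lem₃ = ℕR.solve-∀
  lem₄ : ∀ q d r s → q + (d + r + s) ≡ q + d + (r + s)
  lem₄ = ℕR.solve-∀
... | beyond m w | beyond q x g rewrite hi-⊓ m (suc w) | lo-c m (suc w) | lo-r m (suc w) | lo-c q (suc x) | lo-r q (suc x) =
  let (D′ , s) = rows-dom (suc w + b) (suc x + m) (suc x + g + m) (g + suc w + b) R B Q (suc-injective e) (suc-injective e′) D
                   (+-monoˡ-≤ m (m≤m+n (suc x) g)) (lem₁ g (suc w) b (suc x) m) in
  (g + suc w , +-cancelʳ-≡ (q + suc x) _ _ (trans eq (lem₂ q (suc x) g m (suc w))) , D′) , subst₂ _≤_ (lem₃ q _ (sum Q)) (lem₄ q (suc x + g) m (sum R)) (+-monoʳ-≤ q s)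
  where
  lem₁ : ∀ g w b x m → g + w + b + (x + m) ≡ x + g + m + (w + b)
  lem₁ = ℕR.solve-∀
  lem₂ : ∀ q x g m w → q + (x + g) + (m + w) ≡ m + (g + w) + (q + x)
  lem₂ = ℕR.solve-∀
  lem₃ : ∀ q p s → q + (p + s) ≡ p + (q + s)
  lem₃ = ℕR.solve-∀
  lem₄ : ∀ q d r s → q + (d + r + s) ≡ q + d + (r + s)
  lem₄ = ℕR.solve-∀

-- The same invariant for the inverse, with a and c the numbers of waiting letters in the two rows.
unrows-dom : ∀ p p₂ kP R′ Q′ B₂ → length B₂ ≡ length Q′ → Dom kP R′ Q′ → p + sum Q′ ≤ kP + sum R′ →
  let (Q , B₁ , a) = unrow p₂ B₂ Q′; (R , B , c) = unrow p B₁ R′ in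
  c ≤ kP × (∀ kT → kT + c ≡ kP + a → Dom kT R Q)
unrows-dom p p₂ kP []       []       []       e D le = subst₂ _≤_ (+-identityʳ p) (+-identityʳ kP) le , λ _ _ → tt
unrows-dom p p₂ .(q′ + d) (p₁ ∷ R′) (q′ ∷ Q′) (m₂ ∷ B₂) e (d , refl , D) le
  with unrow p₂ B₂ Q′ | unrows-dom p p₂ (d + p₁) R′ Q′ B₂ (suc-injective e) D
         (+-cancelˡ-≤ q′ _ _ (subst₂ _≤_ (lem p q′ (sum Q′)) (lem′ q′ d p₁ (sum R′)) le))
  where
  lem : ∀ p m s → p + (m + s) ≡ m + (p + s)
  lem = ℕR.solve-∀
  lem′ : ∀ m d r s → m + d + (r + s) ≡ m + (d + r + s)
  lem′ = ℕR.solve-∀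
... | Q , B₁ , a | ih with unrow p B₁ R′
... | R , B , c with cut a q′ | cut′ c p₁ d (subst (c ≤_) (+-comm d p₁) (proj₁ ih))
... | within m y | within b z d rewrite lo-c m y | lo-r m y | lo-⊓ m y | lo-c b z | lo-r b z =
  subst (m ≤_) (sym (+-assoc m y d)) (m≤m+n m (y + d)) , λ kT eq →
  d , +-cancelʳ-≡ m _ _ (trans eq (lem₁ m y d m₂)) , proj₂ ih (d + (z + m)) (lem₂ d z m b)
  where
  lem₁ : ∀ m y d x → m + y + d + x ≡ y + x + d + m
  lem₁ = ℕR.solve-∀
  lem₂ : ∀ d z m b → d + (z + m) + b ≡ d + (b + z) + m
  lem₂ = ℕR.solve-∀
... | within m y | beyond b w g rewrite lo-c m y | lo-r m y | lo-⊓ m y | lo-c b (suc w) | lo-r b (suc w) =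
  subst (suc w + m ≤_) (lem₀ (suc w) m y g) (m≤m+n (suc w + m) (y + g)) , λ kT eq →
  g , +-cancelʳ-≡ (suc w + m) _ _ (trans eq (lem₁ m y (suc w) g m₂)) , proj₂ ih (g + m) (lem₂ g m b (suc w))
  where
  lem₀ : ∀ w m y g → w + m + (y + g) ≡ m + y + (w + g)
  lem₀ = ℕR.solve-∀
  lem₁ : ∀ m y w g x → m + y + (w + g) + x ≡ y + x + g + (w + m)
  lem₁ = ℕR.solve-∀
  lem₂ : ∀ g m b w → g + m + (b + w) ≡ w + g + b + m
  lem₂ = ℕR.solve-∀
... | beyond m x | within b z d rewrite hi-⊓ m (suc x) | lo-c m (suc x) | lo-r m (suc x) | lo-c b z | lo-r b z =
  m≤m+n m d , λ kT eq →
  d + suc x , +-cancelʳ-≡ m _ _ (trans eq (lem₁ m d (suc x) m₂)) , proj₂ ih (d + suc x + (z + m)) (lem₂ d (suc x) z m b)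
  where
  lem₁ : ∀ m d x y → m + d + (x + y) ≡ y + (d + x) + m
  lem₁ = ℕR.solve-∀
  lem₂ : ∀ d x z m b → d + x + (z + m) + b ≡ d + (b + z) + (m + x)
  lem₂ = ℕR.solve-∀
... | beyond m x | beyond b w g rewrite hi-⊓ m (suc x) | lo-c m (suc x) | lo-r m (suc x) | lo-c b (suc w) | lo-r b (suc w) =
  subst (suc w + m ≤_) (lem₀ (suc w) m g) (m≤m+n (suc w + m) g) , λ kT eq →
  g + suc x , +-cancelʳ-≡ (suc w + m) _ _ (trans eq (lem₁ m (suc w) g (suc x) m₂)) , proj₂ ih (g + suc x + m) (lem₂ g (suc x) m b (suc w))
  where
  lem₀ : ∀ w m g → w + m + g ≡ m + (w + g)
  lem₀ = ℕR.solve-∀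
  lem₁ : ∀ m w g x y → m + (w + g) + (x + y) ≡ y + (g + x) + (w + m)
  lem₁ = ℕR.solve-∀
  lem₂ : ∀ g x m b w → g + x + m + (b + w) ≡ w + g + b + (m + x)
  lem₂ = ℕR.solve-∀

-- Tableaux as lists of multiplicity vectors, and the Pieri rule

∧-true⁻ : ∀ {a b} → a ∧ b ≡ true → a ≡ true × b ≡ true
∧-true⁻ {true} {true} e = refl , refl

∧-true⁺ : ∀ {a b} → a ≡ true → b ≡ true → a ∧ b ≡ true
∧-true⁺ refl refl = refl

≤ᵇ-true⁻ : ∀ {m n} → (m ≤ᵇ n) ≡ true → m ≤ n
≤ᵇ-true⁻ {m} e = ≤ᵇ⇒≤ m _ (subst T (sym e) tt)

≤ᵇ-true⁺ : ∀ {m n} → m ≤ n → (m ≤ᵇ n) ≡ true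
≤ᵇ-true⁺ {zero}          le = refl
≤ᵇ-true⁺ {suc m} {suc n} le = <⇒<ᵇ-true le

domᵇ : ℕ → List ℕ → List ℕ → Bool
domᵇ k []      []      = true
domᵇ k (u ∷ U) (l ∷ L) = (l ≤ᵇ k) ∧ domᵇ ((k ∸ l) + u) U L
domᵇ k _       _       = false

domᵇ⁻ : ∀ k U L → domᵇ k U L ≡ true → Dom k U L
domᵇ⁻ k []      []      e = tt
domᵇ⁻ k (u ∷ U) (l ∷ L) e with ∧-true⁻ {l ≤ᵇ k} e
... | le , e′ = k ∸ l , sym (m+[n∸m]≡n (≤ᵇ-true⁻ {l} le)) , domᵇ⁻ _ U L e′

domᵇ⁺ : ∀ k U L → Dom k U L → domᵇ k U L ≡ true
domᵇ⁺ k [] [] D = refl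
domᵇ⁺ .(l + d) (u ∷ U) (l ∷ L) (d , refl , D) =
  ∧-true⁺ (≤ᵇ-true⁺ (m≤m+n l d)) (trans (cong (λ z → domᵇ (z + u) U L) (m+n∸m≡n l d)) (domᵇ⁺ _ U L D))

tabᵇ : List (List ℕ) → Bool
tabᵇ []          = true
tabᵇ (R ∷ [])    = true
tabᵇ (R ∷ Q ∷ T) = domᵇ 0 R Q ∧ tabᵇ (Q ∷ T)

mats : ℕ → List ℕ → List (List (List ℕ))
mats N []      = [] ∷ []
mats N (k ∷ κ) = concatMap (λ R → map (R ∷_) (mats N κ)) (vecs N k)

tabs : ℕ → List ℕ → List (List (List ℕ))
tabs N κ = filter (λ T → Data.Bool._≟_ (tabᵇ T) true) (mats N κ)

Under : List ℕ → List (List ℕ) → Set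
Under R []      = ⊤
Under R (Q ∷ _) = Dom 0 R Q

IsTab : ℕ → List ℕ → List (List ℕ) → Set
IsTab N []      []      = ⊤
IsTab N (k ∷ κ) (R ∷ T) = length R ≡ N × sum R ≡ k × Under R T × IsTab N κ T
IsTab N _       _       = ⊥

module Mats (N : ℕ) (κ : List ℕ) = Bind {List ℕ} _∷_ ∷-inj (λ _ → mats N κ)

mats-unique : ∀ N κ → Unique (mats N κ)
mats-unique N []      = [] ∷ []
mats-unique N (k ∷ κ) = Mats.bind-unique N κ (vecs-unique N k) (λ _ → mats-unique N κ)

tabs-unique : ∀ N κ → Unique (tabs N κ)
tabs-unique N κ = UP.filter⁺ _ (mats-unique N κ)

mats⁻ : ∀ N κ {T} → T ∈ mats N κ → tabᵇ T ≡ true → IsTab N κ T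
mats⁻ N []      (here refl) e = tt
mats⁻ N (k ∷ κ) T∈ e with Mats.bind⁻ N κ {vecs N k} T∈
... | R , T , R∈ , T∈′ , refl with vecs⁻ {N} {k} R∈ | T | T∈′ | e
... | l , s | []    | T∈ | e = l , s , tt , mats⁻ N κ T∈ refl
... | l , s | Q ∷ T | T∈ | e with ∧-true⁻ {domᵇ 0 R Q} e
... | d , e′ = l , s , domᵇ⁻ 0 R Q d , mats⁻ N κ T∈ e′

mats⁺ : ∀ N κ {T} → IsTab N κ T → T ∈ mats N κ × tabᵇ T ≡ true
mats⁺ N []      {[]}    t = here refl , refl
mats⁺ N (k ∷ κ) {R ∷ T} (refl , refl , u , t) =
  Mats.bind⁺ N κ (vecs⁺ R) (proj₁ (mats⁺ N κ t)) , under T u (proj₂ (mats⁺ N κ t))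
  where
  under : ∀ T → Under R T → tabᵇ T ≡ true → tabᵇ (R ∷ T) ≡ true
  under []      u e = refl
  under (Q ∷ T) u e = ∧-true⁺ (domᵇ⁺ 0 R Q u) e

tabs⁻ : ∀ {N κ T} → T ∈ tabs N κ → IsTab N κ T
tabs⁻ {N} {κ} T∈ with ∈-filter⁻ (λ T → Data.Bool._≟_ (tabᵇ T) true) {xs = mats N κ} T∈
... | T∈′ , e = mats⁻ N κ T∈′ e

tabs⁺ : ∀ {N κ T} → IsTab N κ T → T ∈ tabs N κ
tabs⁺ {N} {κ} t = ∈-filter⁺ (λ T → Data.Bool._≟_ (tabᵇ T) true) (proj₁ (mats⁺ N κ t)) (proj₂ (mats⁺ N κ t))

wT : List (List ℕ) → List ℕ
wT []      = []
wT (R ∷ T) = wT T ++ wd 1 R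

-- A row is added at the bottom even if it is empty. The shape thus always gets one part longer, and
-- shapes with trailing zeros can be indexed by vectors of fixed length.
ins : List (List ℕ) → List ℕ → List (List ℕ)
ins []      B = B ∷ []
ins (R ∷ T) B = let (B′ , R′ , _) = row 0 R B in R′ ∷ ins T B′

-- The old shape `κ` is what makes insertion reversible: `sum R′ ∸ k` letters came to rest at the
-- end of this row without bumping anything, and `unrow` starts with them.
del : List ℕ → List (List ℕ) → List (List ℕ) × List ℕ
del []      (B ∷ _)  = [] , B
del (k ∷ κ) (R′ ∷ P) = let (T , B′) = del κ P; (R , B , _) = unrow (sum R′ ∸ k) B′ R′ in R ∷ T , B
del _       []       = [] , []

data Inter : List ℕ → List ℕ → Set where
  last : ∀ {v} → Inter (v ∷ []) []
  next : ∀ {v w ν k κ} → k ≤ v → w ≤ k → Inter (w ∷ ν) κ → Inter (v ∷ w ∷ ν) (k ∷ κ)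

inter : List ℕ → List ℕ → Bool
inter (v ∷ [])     []      = true
inter (v ∷ w ∷ ν) (k ∷ κ) = (k ≤ᵇ v) ∧ (w ≤ᵇ k) ∧ inter (w ∷ ν) κ
inter _            _       = false

inter⁻ : ∀ ν κ → inter ν κ ≡ true → Inter ν κ
inter⁻ (v ∷ [])    []      e = last
inter⁻ (v ∷ w ∷ ν) (k ∷ κ) e with ∧-true⁻ {k ≤ᵇ v} e
... | a , e′ with ∧-true⁻ {w ≤ᵇ k} e′
... | b , e″ = next (≤ᵇ-true⁻ {k} a) (≤ᵇ-true⁻ {w} b) (inter⁻ (w ∷ ν) κ e″)

inter⁺ : ∀ {ν κ} → Inter ν κ → inter ν κ ≡ true
inter⁺ last         = refl
inter⁺ (next a b i) = ∧-true⁺ (≤ᵇ-true⁺ a) (∧-true⁺ (≤ᵇ-true⁺ b) (inter⁺ i))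

ins-≈ : ∀ N κ T B → IsTab N κ T → length B ≡ N → wT T ++ wd 1 B ≈ wT (ins T B)
ins-≈ N []      []      B t lB = ≈-refl
ins-≈ N (k ∷ κ) (R ∷ T) B (lR , _ , _ , t) lB =
  ≈-trans (≈-reflexive (LP.++-assoc (wT T) (wd 1 R) (wd 1 B)))
  (≈-trans (≈-++ˡ (wT T) (row-≈ 1 0 R B [] [] (trans lR (sym lB)) refl [] [] []))
  (≈-trans (≈-reflexive (sym (LP.++-assoc (wT T) (wd 1 B′) (wd 1 R′))))
    (≈-++ʳ (wd 1 R′) (ins-≈ N κ T B′ t (trans (proj₁ (row-length 0 R B (trans lR (sym lB)))) lR)))))
  where
  B′ = proj₁ (row 0 R B)
  R′ = proj₁ (proj₂ (row 0 R B))

ins-tab : ∀ N κ T B → IsTab N κ T → length B ≡ N →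
  IsTab N (map sum (ins T B)) (ins T B) × Inter (map sum (ins T B)) κ × sum (map sum (ins T B)) ≡ sum κ + sum B
ins-tab N []      []      B t lB = (lB , refl , tt , tt) , last , +-identityʳ (sum B)
ins-tab N (.(sum R) ∷ κ) (R ∷ T) B (lR , refl , u , t) lB =
  (trans (proj₂ (row-length 0 R B e)) lR , refl , proj₁ (head κ T u t) , proj₁ ih) ,
  proj₂ (head κ T u t) (proj₁ (proj₂ ih)) ,
  total
  where
  e = trans lR (sym lB)
  B′ = proj₁ (row 0 R B)
  R′ = proj₁ (proj₂ (row 0 R B))
  p = proj₂ (proj₂ (row 0 R B))
  sums = row-sum 0 R B e
  lB′ : length B′ ≡ N
  lB′ = trans (proj₁ (row-length 0 R B e)) lR
  sumR′ : sum R′ ≡ sum R + p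
  sumR′ = trans (sym (+-identityʳ _)) (proj₂ sums)
  ih = ins-tab N κ T B′ t lB′
  head : ∀ κ T → Under R T → IsTab N κ T →
    Under R′ (ins T B′) × (Inter (map sum (ins T B′)) κ → Inter (sum R′ ∷ map sum (ins T B′)) (sum R ∷ κ))
  head []      []      u t = row-dom 0 0 R B e z≤n , next (subst (sum R ≤_) (sym sumR′) (m≤m+n (sum R) p)) (row-≤ 0 R B)
  head (k ∷ κ) (Q ∷ T) u (lQ , _ , _ , _) with rows-dom 0 0 0 0 R B Q e (trans lQ (sym lB)) u z≤n refl
  ... | d , le = d , next (subst (sum R ≤_) (sym sumR′) (m≤m+n (sum R) p))
    (subst (_≤ sum R) (trans (+-comm _ (sum Q)) (trans (sym (proj₂ (row-sum 0 Q B′ (trans lQ (sym lB′))))) (+-identityʳ _))) le)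
  total : sum R′ + sum (map sum (ins T B′)) ≡ sum R + sum κ + sum B
  total = begin
    sum R′ + sum (map sum (ins T B′)) ≡⟨ cong₂ _+_ sumR′ (proj₂ (proj₂ ih)) ⟩
    sum R + p + (sum κ + sum B′)      ≡⟨ lem (sum R) p (sum κ) (sum B′) ⟩
    sum R + sum κ + (sum B′ + p)      ≡⟨ cong (sum R + sum κ +_) (sym (proj₁ sums)) ⟩
    sum R + sum κ + sum B             ∎
    where
    lem : ∀ a b c d → a + b + (c + d) ≡ a + c + (d + b)
    lem = ℕR.solve-∀

del-ins : ∀ N κ T B → IsTab N κ T → length B ≡ N → del κ (ins T B) ≡ (T , B)
del-ins N []      []      B t lB = refl
del-ins N (.(sum R) ∷ κ) (R ∷ T) B (lR , refl , u , t) lB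
  with row 0 R B | unrow-row 0 R B (trans lR (sym lB)) | row-length 0 R B (trans lR (sym lB)) | row-sum 0 R B (trans lR (sym lB))
... | B′ , R′ , p | un | l , _ | _ , s
  rewrite del-ins N κ T B′ t (trans l lR)
        | trans (cong (_∸ sum R) (trans (sym (+-identityʳ (sum R′))) s)) (m+n∸m≡n (sum R) p) | un = refl

-- Reverse bumping leaves no letter waiting in the top row. In the induction, `unrows-dom` needs
-- this for the row below the one being treated.
Start : List ℕ → List (List ℕ) → Set
Start (k ∷ κ) (R′ ∷ P) = proj₂ (proj₂ (unrow (sum R′ ∸ k) (proj₂ (del κ P)) R′)) ≡ 0
Start _       _        = ⊤

del-tab : ∀ N ν κ P → IsTab N ν P → Inter ν κ → let (T , B) = del κ P in
  IsTab N κ T × length B ≡ N × sum κ + sum B ≡ sum ν × ins T B ≡ P × Start κ P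
del-tab N (v ∷ []) [] (B ∷ []) (lB , refl , _) last = tt , lB , sym (+-identityʳ _) , refl , tt
del-tab N (.(sum R′) ∷ w ∷ ν) (k ∷ κ) (R′ ∷ P) (lR′ , refl , u , t) (next k≤v w≤k i) =
  (trans (proj₁ lens) lB′ , sumR , proj₁ (proj₂ key) , proj₁ ih) ,
  trans (proj₂ lens) lB′ , total ,
  cong₂ _∷_ (cong (λ z → proj₁ (proj₂ z)) row₀) (trans (cong (λ z → ins (proj₁ (del κ P)) (proj₁ z)) row₀) (proj₁ (proj₂ (proj₂ (proj₂ ih))))) ,
  c≡0
  where
  ih = del-tab N (w ∷ ν) κ P t i
  p = sum R′ ∸ k
  B′ = proj₂ (del κ P)
  lB′ = proj₁ (proj₂ ih)
  R = proj₁ (unrow p B′ R′)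
  B = proj₁ (proj₂ (unrow p B′ R′))
  c = proj₂ (proj₂ (unrow p B′ R′))
  lens = unrow-length p B′ R′ (trans lB′ (sym lR′))
  slack : p + w ≤ sum R′
  slack = ≤-trans (+-monoʳ-≤ p w≤k) (≤-reflexive (m∸n+n≡m k≤v))
  key : c ≤ 0 × Under R (proj₁ (del κ P)) × ⊤
  key = head w ν κ P t i u slack (proj₂ (proj₂ (proj₂ (proj₂ ih)))) lB′
    where
    head : ∀ w ν κ P → IsTab N (w ∷ ν) P → Inter (w ∷ ν) κ → Under R′ P → p + w ≤ sum R′ → Start κ P → length (proj₂ (del κ P)) ≡ N →
      proj₂ (proj₂ (unrow p (proj₂ (del κ P)) R′)) ≤ 0 × Under (proj₁ (unrow p (proj₂ (del κ P)) R′)) (proj₁ (del κ P)) × ⊤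
    head .(sum B) ν []      (B ∷ P)  (lB , refl , _) i u le st _ = unrow-start p 0 B R′ u le , tt , tt
    head .(sum Q′) (x ∷ ν) (k′ ∷ κ) (Q′ ∷ P) (lQ , refl , _ , t) (next _ _ i) u le st _ with
      unrows-dom p (sum Q′ ∸ k′) 0 R′ Q′ (proj₂ (del κ P)) (trans (proj₁ (proj₂ (del-tab N (x ∷ ν) κ P t i))) (sym lQ)) u le
    ... | c≤ , d = c≤ , d 0 (trans (n≤0⇒n≡0 c≤) (sym st)) , tt
  c≡0 : c ≡ 0
  c≡0 = n≤0⇒n≡0 (proj₁ key)
  row₀ : row 0 R B ≡ (B′ , R′ , p)
  row₀ = trans (cong (λ z → row z R B) (sym c≡0)) (row-unrow p B′ R′ (trans lB′ (sym lR′)))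
  sums = row-sum 0 R B (trans (proj₁ lens) (sym (proj₂ lens)))
  s₁ : sum B ≡ sum B′ + p
  s₁ = trans (proj₁ sums) (cong (λ z → sum (proj₁ z) + proj₂ (proj₂ z)) row₀)
  s₂ : sum R′ ≡ sum R + p
  s₂ = trans (sym (+-identityʳ _)) (trans (cong (λ z → sum (proj₁ (proj₂ z)) + 0) (sym row₀)) (trans (proj₂ sums) (cong (λ z → sum R + proj₂ (proj₂ z)) row₀)))
  sumR : sum R ≡ k
  sumR = +-cancelʳ-≡ p (sum R) k (trans (sym s₂) (sym (m+[n∸m]≡n k≤v)))
  total : k + sum κ + sum B ≡ sum R′ + (w + sum ν)
  total = begin
    k + sum κ + sum B           ≡⟨ cong (k + sum κ +_) s₁ ⟩
    k + sum κ + (sum B′ + p)    ≡⟨ lem k (sum κ) (sum B′) p ⟩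
    (k + p) + (sum κ + sum B′)  ≡⟨ cong₂ _+_ (m+[n∸m]≡n k≤v) (proj₁ (proj₂ (proj₂ ih))) ⟩
    sum R′ + (w + sum ν)        ∎
    where
    lem : ∀ a b c d → a + b + (c + d) ≡ a + d + (b + c)
    lem = ℕR.solve-∀

inter-length : ∀ {ν κ} → Inter ν κ → length ν ≡ suc (length κ)
inter-length last         = refl
inter-length (next _ _ i) = cong suc (inter-length i)

tab-shape : ∀ {N} ν P → IsTab N ν P → map sum P ≡ ν
tab-shape []      []      t = refl
tab-shape (k ∷ ν) (R ∷ P) (_ , refl , _ , t) = cong (sum R ∷_) (tab-shape ν P t)

-- The Schur function of shape `ν` in `N` noncommuting letters, evaluated by `f` on its words.
S : ℕ → List ℕ → (List ℕ → ℤ) → ℤ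
S N ν f = ∑ (mats N ν) (λ P → tabᵇ P ▹ f (wT P))

S-tabs : ∀ N ν f → S N ν f ≡ ∑ (tabs N ν) (λ P → f (wT P))
S-tabs N ν f = sym (∑-filterᵇ tabᵇ (mats N ν) (λ P → f (wT P)))

,-inj : ∀ {A B : Set} {x x′ : A} {y y′ : B} → (x , y) ≡ (x′ , y′) → x ≡ x′ × y ≡ y′
,-inj refl = refl , refl

-- `ins` and `del` match the pairs of a tableau and a row with the tableaux whose shape exceeds `κ`
-- by a horizontal strip, and by `ins-≈` the value of `f` does not notice the insertion.
pieri : ∀ N κ b (f : List ℕ → ℤ) → (∀ {u v} → u ≈ v → f u ≡ f v) →
  S N κ (λ w → ∑ (vecs N b) (λ B → f (w ++ wd 1 B))) ≡
  ∑ (vecs (suc (length κ)) (sum κ + b)) (λ ν → inter ν κ ▹ S N ν f)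
pieri N κ b f f-≈ = begin
  S N κ (λ w → ∑ (vecs N b) (λ B → f (w ++ wd 1 B)))
    ≡⟨ S-tabs N κ (λ w → ∑ (vecs N b) (λ B → f (w ++ wd 1 B))) ⟩
  ∑ (tabs N κ) (λ T → ∑ (vecs N b) (λ B → f (wT T ++ wd 1 B)))
    ≡⟨ ∑-bindmap _,_ (λ _ → vecs N b) (tabs N κ) _ ⟨
  ∑ (X.bind (tabs N κ)) (λ z → f (wT (proj₁ z) ++ wd 1 (proj₂ z)))
    ≡⟨ ∑-bij (X.bind (tabs N κ)) (Y.bind shapes) (λ z → map sum (ins (proj₁ z) (proj₂ z)) , ins (proj₁ z) (proj₂ z)) (del κ ∘ proj₂)
         (X.bind-unique (tabs-unique N κ) (λ _ → vecs-unique N b)) (Y.bind-unique {shapes} (UP.filter⁺ _ (vecs-unique (suc (length κ)) (sum κ + b))) (tabs-unique N))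
         to from same ⟩
  ∑ (Y.bind shapes) (λ z → f (wT (proj₂ z)))
    ≡⟨ ∑-bindmap _,_ (tabs N) shapes _ ⟩
  ∑ shapes (λ ν → ∑ (tabs N ν) (λ P → f (wT P)))
    ≡⟨ ∑-filterᵇ (λ ν → inter ν κ) (vecs (suc (length κ)) (sum κ + b)) _ ⟩
  ∑ (vecs (suc (length κ)) (sum κ + b)) (λ ν → inter ν κ ▹ ∑ (tabs N ν) (λ P → f (wT P)))
    ≡⟨ ∑-cong (vecs (suc (length κ)) (sum κ + b)) (λ ν → cong (inter ν κ ▹_) (sym (S-tabs N ν f))) ⟩
  ∑ (vecs (suc (length κ)) (sum κ + b)) (λ ν → inter ν κ ▹ S N ν f) ∎
  where
  module X = Bind _,_ ,-inj (λ (_ : List (List ℕ)) → vecs N b)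
  module Y = Bind _,_ ,-inj (tabs N)
  shapes = filter (λ ν → Data.Bool._≟_ (inter ν κ) true) (vecs (suc (length κ)) (sum κ + b))
  pair : ∀ {z} → z ∈ X.bind (tabs N κ) → IsTab N κ (proj₁ z) × length (proj₂ z) ≡ N × sum (proj₂ z) ≡ b
  pair {z} m with X.bind⁻ {tabs N κ} m
  ... | T , B , T∈ , B∈ , refl = tabs⁻ {N} {κ} T∈ , vecs⁻ {N} {b} B∈
  to : ∀ {z} → z ∈ X.bind (tabs N κ) → (map sum (ins (proj₁ z) (proj₂ z)) , ins (proj₁ z) (proj₂ z)) ∈ Y.bind shapes × del κ (ins (proj₁ z) (proj₂ z)) ≡ z
  to {T , B} m with pair m
  ... | t , lB , refl with ins-tab N κ T B t lB
  ... | t′ , i , s =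
    Y.bind⁺ (∈-filter⁺ _ (subst₂ (λ n m → map sum (ins T B) ∈ vecs n m) (inter-length i) s (vecs⁺ _)) (inter⁺ i)) (tabs⁺ t′) , del-ins N κ T B t lB
  from : ∀ {z} → z ∈ Y.bind shapes → del κ (proj₂ z) ∈ X.bind (tabs N κ) × (map sum (ins (proj₁ (del κ (proj₂ z))) (proj₂ (del κ (proj₂ z)))) , ins (proj₁ (del κ (proj₂ z))) (proj₂ (del κ (proj₂ z)))) ≡ z
  from {z} m with Y.bind⁻ {shapes} m
  ... | ν , P , ν∈ , P∈ , refl with ∈-filter⁻ (λ ν → Data.Bool._≟_ (inter ν κ) true) {xs = vecs (suc (length κ)) (sum κ + b)} ν∈
  ... | ν∈′ , iᵇ with inter⁻ ν κ iᵇ | vecs⁻ {suc (length κ)} {sum κ + b} ν∈′ | tabs⁻ {N} {ν} P∈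
  ... | i | _ , s | t with del-tab N ν κ P t i
  ... | t′ , lB , s′ , e , _ =
    X.bind⁺ (tabs⁺ t′) (subst₂ (λ n m → proj₂ (del κ P) ∈ vecs n m) lB (+-cancelˡ-≡ (sum κ) _ _ (trans s′ s)) (vecs⁺ _)) ,
    cong₂ _,_ (trans (cong (map sum) e) (tab-shape ν P t)) e
  same : ∀ {z} → z ∈ X.bind (tabs N κ) → f (wT (proj₁ z) ++ wd 1 (proj₂ z)) ≡ f (wT (ins (proj₁ z) (proj₂ z)))
  same {T , B} m with pair m
  ... | t , lB , _ = f-≈ (ins-≈ N κ T B t lB)

-- Horizontal and vertical strips

⊕-cancelˡ : ∀ a b c → a ⊕ b ≡ a ⊕ c → b ≡ c
⊕-cancelˡ a b c e = trans (sym (lem a b)) (trans (cong (⊖ a ⊕_) e) (lem a c))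
  where
  lem : ∀ a b → ⊖ a ⊕ (a ⊕ b) ≡ b
  lem = ℤR.solve-∀

^ᶻ-⊗ : ∀ a b n → (a ⊗ b) ^ᶻ n ≡ a ^ᶻ n ⊗ b ^ᶻ n
^ᶻ-⊗ a b zero    = refl
^ᶻ-⊗ a b (suc n) = trans (cong ((a ⊗ b) ⊗_) (^ᶻ-⊗ a b n)) (lem a b (a ^ᶻ n) (b ^ᶻ n))
  where
  lem : ∀ a b c d → (a ⊗ b) ⊗ (c ⊗ d) ≡ (a ⊗ c) ⊗ (b ⊗ d)
  lem = ℤR.solve-∀

downTo : ℕ → List ℕ
downTo zero    = 0 ∷ []
downTo (suc b) = suc b ∷ downTo b

downTo⁻ : ∀ {b a} → a ∈ downTo b → a ≤ b
downTo⁻ {zero}  (here refl) = z≤n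
downTo⁻ {suc b} (here refl) = ≤-refl
downTo⁻ {suc b} (there m)   = m≤n⇒m≤1+n (downTo⁻ m)

downTo⁺ : ∀ {a b} → a ≤ b → a ∈ downTo b
downTo⁺ {b = zero}  z≤n = here refl
downTo⁺ {b = suc b} le with m≤n⇒m<n∨m≡n le
... | inj₁ (s≤s lt) = there (downTo⁺ lt)
... | inj₂ refl     = here refl

above : ℕ → ℕ → List ℕ
above zero    x = []
above (suc d) x = suc (d + x) ∷ above d x

above⁻ : ∀ {d x a} → a ∈ above d x → x < a × a ≤ d + x
above⁻ {suc d} {x} (here refl) = s≤s (m≤n+m x d) , ≤-refl
above⁻ {suc d}     (there m)   = let (a , b) = above⁻ {d} m in a , m≤n⇒m≤1+n b

∑-downTo : ∀ d x f → ∑ (downTo (d + x)) f ≡ ∑ (above d x) f ⊕ ∑ (downTo x) f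
∑-downTo zero    x f = sym (ℤP.+-identityˡ _)
∑-downTo (suc d) x f = trans (cong (f (suc (d + x)) ⊕_) (∑-downTo d x f)) (sym (ℤP.+-assoc (f (suc (d + x))) _ _))

strip : ℕ → List ℕ
strip zero    = 0 ∷ []
strip (suc b) = suc b ∷ b ∷ []

strip-≤ : ∀ {b a} → a ∈ strip b → a ≤ b
strip-≤ {zero}  (here refl)         = z≤n
strip-≤ {suc b} (here refl)         = ≤-refl
strip-≤ {suc b} (there (here refl)) = n≤1+n b

Invariant : (List ℕ → ℤ) → Set
Invariant Φ = ∀ xs x y zs → Φ (xs ++ x ∷ y ∷ zs) ≡ Φ (xs ++ y ∷ x ∷ zs)

invariant-∷ : ∀ {Φ} a → Invariant Φ → Invariant (Φ ∘ (a ∷_))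
invariant-∷ a inv xs = inv (a ∷ xs)

invariant-↭ : ∀ {Φ α β} → Invariant Φ → α ↭ β → Φ α ≡ Φ β
invariant-↭ inv Perm.refl = refl
invariant-↭ {Φ} inv (prep x p) = invariant-↭ {Φ ∘ (x ∷_)} (invariant-∷ {Φ} x inv) p
invariant-↭ {Φ} inv (swap {zs} x y p) =
  trans (inv [] x y zs) (invariant-↭ {λ z → Φ (y ∷ x ∷ z)} (λ xs → inv (y ∷ x ∷ xs)) p)
invariant-↭ {Φ} inv (Perm.trans p q) = trans (invariant-↭ {Φ} inv p) (invariant-↭ {Φ} inv q)

data Desc : List ℕ → Set where
  []  : Desc []
  _∷_ : ∀ {x xs} → All (_≤ x) xs → Desc xs → Desc (x ∷ xs)

insertDesc : ∀ x {xs} → Desc xs → ∃[ ys ] (x ∷ xs ↭ ys × Desc ys)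
insertDesc x [] = x ∷ [] , ↭-refl , [] ∷ []
insertDesc x {y ∷ ys} (p ∷ s) with ≤-total y x
... | inj₁ y≤x = x ∷ y ∷ ys , ↭-refl , (y≤x ∷ All.map (λ q → ≤-trans q y≤x) p) ∷ p ∷ s
... | inj₂ x≤y with insertDesc x s
... | zs , r , d = y ∷ zs , ↭-trans (swap x y ↭-refl) (prep y r) , PermP.All-resp-↭ r (x≤y ∷ p) ∷ d

sortDesc : ∀ xs → ∃[ ys ] (xs ↭ ys × Desc ys)
sortDesc [] = [] , ↭-refl , []
sortDesc (x ∷ xs) with sortDesc xs
... | ys , p , s with insertDesc x s
... | zs , q , d = zs , ↭-trans (prep x p) q , d

invariant-sorted : ∀ {Φ Ψ} → Invariant Φ → Invariant Ψ → (∀ β → Desc β → Φ β ≡ Ψ β) → ∀ β → Φ β ≡ Ψ β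
invariant-sorted {Φ} {Ψ} iΦ iΨ e β with sortDesc β
... | γ , p , d = trans (invariant-↭ {Φ} iΦ p) (trans (e γ d) (sym (invariant-↭ {Ψ} iΨ p)))

[[_]] : Bool → ℕ
[[ true ]]  = 1
[[ false ]] = 0

-- Statistics of a pair of rows, the row of length b above the row of length y, when they are cut down to
-- a and j.
hpair epair : ℕ → ℕ → ℕ → ℕ → ℕ
hpair b a y j = ((y ⊓ a) ∸ j) + ((b ⊓ (j ∸ 1)) ∸ a)
epair b a y j = [[ (j <ᵇ y) ∧ (y ≤ᵇ b) ]] + [[ (a <ᵇ b) ∧ (b <ᵇ y) ]]

module Strips (t : ℤ) where

  times : (ℕ → ℕ → ℤ) → (ℕ → ℕ → ℕ) → ℕ → ℕ → ℤ
  times w p y j = w y j ⊗ t ^ᶻ p y j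

  module Sub (ch : ℕ → List ℕ) (pr : ℕ → ℕ → ℕ → ℕ → ℕ) where

    -- The weight `w` accumulates the interaction with the rows already treated. In this way a
    -- product over all pairs of rows becomes a recursion along the list.
    K : (ℕ → ℕ → ℤ) → (List ℕ → ℤ) → List ℕ → ℤ
    K w Φ []      = Φ []
    K w Φ (b ∷ β) = ∑ (ch b) (λ a → w b a ⊗ K (times w (pr b a)) (Φ ∘ (a ∷_)) β)

    _⊑_ : List ℕ → List ℕ → Set
    _⊑_ = Pointwise (λ a b → a ∈ ch b)

    K-cong : ∀ {w w′ Φ Φ′} β → All (λ y → ∀ {j} → j ∈ ch y → w y j ≡ w′ y j) β →
             (∀ α → α ⊑ β → Φ α ≡ Φ′ α) → K w Φ β ≡ K w′ Φ′ β
    K-cong []      []      eΦ = eΦ [] []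
    K-cong (b ∷ β) (e ∷ es) eΦ = ∑-cong∈ (ch b) λ {a} a∈ →
      cong₂ _⊗_ (e a∈) (K-cong β (All.map (λ {y} f {j} j∈ → cong (_⊗ t ^ᶻ pr b a y j) (f j∈)) es) (λ α s → eΦ (a ∷ α) (a∈ ∷ s)))

    K-cong-w : ∀ {w w′} Φ β → All (λ y → ∀ {j} → j ∈ ch y → w y j ≡ w′ y j) β → K w Φ β ≡ K w′ Φ β
    K-cong-w Φ β e = K-cong β e (λ _ _ → refl)

    K-cong-Φ : ∀ w {Φ Φ′} β → (∀ α → α ⊑ β → Φ α ≡ Φ′ α) → K w Φ β ≡ K w Φ′ β
    K-cong-Φ w β e = K-cong β (All.tabulate (λ _ _ → refl)) e

    K-⊕ : ∀ w Φ Ψ β → K w (λ α → Φ α ⊕ Ψ α) β ≡ K w Φ β ⊕ K w Ψ β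
    K-⊕ w Φ Ψ []      = refl
    K-⊕ w Φ Ψ (b ∷ β) = trans (∑-cong (ch b) (λ a → trans (cong (w b a ⊗_) (K-⊕ _ _ _ β)) (ℤP.*-distribˡ-+ (w b a) _ _)))
                              (∑-⊕ (ch b) _ _)

    K-⊗ : ∀ w c Φ β → K w (λ α → c ⊗ Φ α) β ≡ c ⊗ K w Φ β
    K-⊗ w c Φ []      = refl
    K-⊗ w c Φ (b ∷ β) = trans (∑-cong (ch b) (λ a → trans (cong (w b a ⊗_) (K-⊗ _ c _ β)) (lem (w b a) c _)))
                              (∑-⊗ (ch b) c _)
      where
      lem : ∀ a b c → a ⊗ (b ⊗ c) ≡ b ⊗ (a ⊗ c)
      lem = ℤR.solve-∀

    K-∑ : ∀ {A : Set} w (xs : List A) (F : A → List ℕ → ℤ) β → K w (λ α → ∑ xs (λ x → F x α)) β ≡ ∑ xs (λ x → K w (F x) β)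
    K-∑ w xs F []      = refl
    K-∑ w xs F (b ∷ β) = trans (∑-cong (ch b) (λ a → trans (cong (w b a ⊗_) (K-∑ _ xs _ β)) (sym (∑-⊗ xs (w b a) _))))
                               (∑-swap (ch b) xs _)

    term : (ℕ → ℕ → ℤ) → (List ℕ → ℤ) → List ℕ → ℕ → ℕ → ℕ → ℕ → ℤ
    term w Φ zs x i y j = w x i ⊗ (times w (pr x i) y j ⊗ K (times (times w (pr x i)) (pr y j)) (λ α → Φ (i ∷ j ∷ α)) zs)

    K-two : ∀ w Φ x y zs → K w Φ (x ∷ y ∷ zs) ≡ ∑ (ch x) (λ i → ∑ (ch y) (λ j → term w Φ zs x i y j))
    K-two w Φ x y zs = ∑-cong (ch x) (λ i → sym (∑-⊗ (ch y) (w x i) _))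

    term-swap : ∀ w {Φ} zs x i y j → Invariant Φ → pr x i y j ≡ pr y j x i → term w Φ zs x i y j ≡ term w Φ zs y j x i
    term-swap w {Φ} zs x i y j inv e =
      trans (cong₂ (λ n k → w x i ⊗ ((w y j ⊗ t ^ᶻ n) ⊗ k)) e
               (K-cong zs (All.tabulate (λ {z} _ {k} _ → lem (w z k) (t ^ᶻ pr x i z k) (t ^ᶻ pr y j z k))) (λ α _ → inv [] i j α)))
            (lem′ (w x i) (w y j) _ _)
      where
      lem : ∀ a b c → (a ⊗ b) ⊗ c ≡ (a ⊗ c) ⊗ b
      lem = ℤR.solve-∀
      lem′ : ∀ a b c d → a ⊗ ((b ⊗ c) ⊗ d) ≡ b ⊗ ((a ⊗ c) ⊗ d)
      lem′ = ℤR.solve-∀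

  pw : ℤ → ℕ → ℕ → ℤ
  pw u b a = u ^ᶻ (b ∸ a)

  open module HS = Sub downTo hpair using () renaming (K to HK) public
  open module ES = Sub strip epair using () renaming (K to EK) public

  H E : ℤ → (List ℕ → ℤ) → List ℕ → ℤ
  H u = HK (pw u)
  E u = EK (pw u)

  H-full : ∀ u b γ Φ → All (_≤ b) γ → HK (times (pw u) (hpair b b)) Φ γ ≡ H (t ⊗ u) Φ γ
  H-full u b γ Φ le = HS.K-cong-w Φ γ (All.map (λ {y} y≤b {j} j∈ → trans (cong (λ n → u ^ᶻ (y ∸ j) ⊗ t ^ᶻ n) (exponent y≤b (downTo⁻ j∈)))
    (trans (ℤP.*-comm (u ^ᶻ (y ∸ j)) _) (sym (^ᶻ-⊗ t u (y ∸ j))))) le)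
    where
    exponent : ∀ {y j} → y ≤ b → j ≤ y → hpair b b y j ≡ y ∸ j
    exponent {y} {j} y≤b j≤y = trans (cong₂ (λ m n → (m ∸ j) + n) (m≤n⇒m⊓n≡m y≤b) (m≤n⇒m∸n≡0 (m⊓n≤m b (j ∸ 1)))) (+-identityʳ _)

  H-zero : ∀ u Φ γ → All (_≤ 0) γ → H u Φ (0 ∷ γ) ≡ H (t ⊗ u) (Φ ∘ (0 ∷_)) γ
  H-zero u Φ γ le = trans (ℤP.+-identityʳ _) (trans (ℤP.*-identityˡ _) (H-full u 0 γ _ le))

  -- If the longest row is kept, every cell cut from another row forms a pair with it, which turns
  -- `u` into `t ⊗ u`. Otherwise its last cell can be removed beforehand for a factor `u`; no pair
  -- changes, as no other row is longer.
  H-suc : ∀ u Φ b γ → All (_≤ suc b) γ → H u Φ (suc b ∷ γ) ≡ H (t ⊗ u) (Φ ∘ (suc b ∷_)) γ ⊕ u ⊗ H u Φ (b ∷ γ)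
  H-suc u Φ b γ le = cong₂ _⊕_
    (trans (cong (λ n → u ^ᶻ n ⊗ HK (times (pw u) (hpair (suc b) (suc b))) (Φ ∘ (suc b ∷_)) γ) (n∸n≡0 b)) (trans (ℤP.*-identityˡ _) (H-full u (suc b) γ _ le)))
    (trans (∑-cong∈ (downTo b) (λ {a} a∈ → trans (cong₂ (λ n z → u ^ᶻ n ⊗ z) (+-∸-assoc 1 (downTo⁻ a∈))
             (HS.K-cong-w _ γ (All.map (λ {y} y≤ {j} j∈ → cong (λ n → u ^ᶻ (y ∸ j) ⊗ t ^ᶻ (((y ⊓ a) ∸ j) + (n ∸ a))) (same y≤ (downTo⁻ j∈))) le)))
             (ℤP.*-assoc u (u ^ᶻ (b ∸ a)) _)))
      (∑-⊗ (downTo b) u _))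
    where
    same : ∀ {y j} → y ≤ suc b → j ≤ y → suc b ⊓ (j ∸ 1) ≡ b ⊓ (j ∸ 1)
    same {y} {j} y≤ j≤ = trans (m≥n⇒m⊓n≡n (m≤n⇒m≤1+n j≤b)) (sym (m≥n⇒m⊓n≡n j≤b))
      where
      j≤b : j ∸ 1 ≤ b
      j≤b = ∸-monoˡ-≤ 1 (≤-trans j≤ y≤)

  epair-≤ : ∀ {b a y j} → y ≤ b → j ∈ strip y → epair b a y j ≡ y ∸ j
  epair-≤ {b} {a} {y} {j} y≤b j∈ = trans (cong₂ (λ p q → [[ (j <ᵇ y) ∧ p ]] + [[ (a <ᵇ b) ∧ q ]]) (≤ᵇ-true⁺ y≤b) (≤⇒≮ᵇ y≤b))
    (trans (cong₂ (λ p q → [[ p ]] + [[ q ]]) (BP.∧-identityʳ _) (BP.∧-zeroʳ (a <ᵇ b))) (trans (+-identityʳ _) (go j∈)))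
    where
    go : ∀ {y j} → j ∈ strip y → [[ j <ᵇ y ]] ≡ y ∸ j
    go {zero}  (here refl)         = refl
    go {suc y} (here refl)         = trans (cong [[_]] (≤⇒≮ᵇ (≤-refl {y}))) (sym (n∸n≡0 y))
    go {suc y} (there (here refl)) = trans (cong [[_]] (<⇒<ᵇ-true (n<1+n y))) (sym (trans (+-∸-assoc 1 (≤-refl {y})) (cong suc (n∸n≡0 y))))

  E-full : ∀ u b a γ Φ → All (_≤ b) γ → EK (times (pw u) (epair b a)) Φ γ ≡ E (t ⊗ u) Φ γ
  E-full u b a γ Φ le = ES.K-cong-w Φ γ (All.map (λ {y} y≤b {j} j∈ → trans (cong (λ n → u ^ᶻ (y ∸ j) ⊗ t ^ᶻ n) (epair-≤ {b} {a} y≤b j∈))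
    (trans (ℤP.*-comm (u ^ᶻ (y ∸ j)) _) (sym (^ᶻ-⊗ t u (y ∸ j))))) le)

  E-zero : ∀ u Φ γ → All (_≤ 0) γ → E u Φ (0 ∷ γ) ≡ E (t ⊗ u) (Φ ∘ (0 ∷_)) γ
  E-zero u Φ γ le = trans (ℤP.+-identityʳ _) (trans (ℤP.*-identityˡ _) (E-full u 0 0 γ _ le))

  E-suc : ∀ u Φ b γ → All (_≤ suc b) γ →
    E u Φ (suc b ∷ γ) ≡ E (t ⊗ u) (Φ ∘ (suc b ∷_)) γ ⊕ u ⊗ E (t ⊗ u) (Φ ∘ (b ∷_)) γ
  E-suc u Φ b γ le = cong₂ _⊕_
    (trans (cong (λ n → u ^ᶻ n ⊗ EK (times (pw u) (epair (suc b) (suc b))) (Φ ∘ (suc b ∷_)) γ) (n∸n≡0 b))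
           (trans (ℤP.*-identityˡ _) (E-full u (suc b) (suc b) γ _ le)))
    (trans (ℤP.+-identityʳ _) (cong₂ _⊗_ (trans (cong (u ^ᶻ_) (trans (+-∸-assoc 1 (≤-refl {b})) (cong suc (n∸n≡0 b)))) (ℤP.*-identityʳ u)) (E-full u (suc b) b γ _ le)))

  ⊑-bounded : ∀ {b α γ} → α ES.⊑ γ → All (_≤ b) γ → All (_≤ b) α
  ⊑-bounded []      []         = []
  ⊑-bounded (a ∷ s) (le ∷ les) = ≤-trans (strip-≤ a) le ∷ ⊑-bounded s les

  -- Telescoping: the second term of `H-suc` cancels the contribution of the shortened first row in
  -- `E (⊖ u)`. What remains is the same statement for `t ⊗ u` and one row less.
  E-H-sorted : ∀ β u Φ → Desc β → E (⊖ u) (H u Φ) β ≡ Φ β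
  E-H-sorted [] u Φ d = refl
  E-H-sorted (zero ∷ γ) u Φ (le ∷ d) = begin
    E (⊖ u) (H u Φ) (0 ∷ γ)                       ≡⟨ E-zero (⊖ u) (H u Φ) γ le ⟩
    E (t ⊗ ⊖ u) (H u Φ ∘ (0 ∷_)) γ                ≡⟨ cong (λ z → E z (H u Φ ∘ (0 ∷_)) γ) (sym (ℤP.neg-distribʳ-* t u)) ⟩
    E (⊖ (t ⊗ u)) (H u Φ ∘ (0 ∷_)) γ              ≡⟨ ES.K-cong-Φ _ γ (λ α s → H-zero u Φ α (⊑-bounded s le)) ⟩
    E (⊖ (t ⊗ u)) (H (t ⊗ u) (Φ ∘ (0 ∷_))) γ      ≡⟨ E-H-sorted γ (t ⊗ u) (Φ ∘ (0 ∷_)) d ⟩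
    Φ (0 ∷ γ)                                     ∎
  E-H-sorted (suc b ∷ γ) u Φ (le ∷ d) = begin
    E (⊖ u) (H u Φ) (suc b ∷ γ)
      ≡⟨ E-suc (⊖ u) (H u Φ) b γ le ⟩
    E (t ⊗ ⊖ u) (H u Φ ∘ (suc b ∷_)) γ ⊕ ⊖ u ⊗ E (t ⊗ ⊖ u) (H u Φ ∘ (b ∷_)) γ
      ≡⟨ cong (E (t ⊗ ⊖ u) (H u Φ ∘ (suc b ∷_)) γ ⊕_) (sym (ES.K-⊗ _ (⊖ u) (H u Φ ∘ (b ∷_)) γ)) ⟩
    E (t ⊗ ⊖ u) (H u Φ ∘ (suc b ∷_)) γ ⊕ E (t ⊗ ⊖ u) (λ α → ⊖ u ⊗ H u Φ (b ∷ α)) γ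
      ≡⟨ sym (ES.K-⊕ _ (H u Φ ∘ (suc b ∷_)) (λ α → ⊖ u ⊗ H u Φ (b ∷ α)) γ) ⟩
    E (t ⊗ ⊖ u) (λ α → H u Φ (suc b ∷ α) ⊕ ⊖ u ⊗ H u Φ (b ∷ α)) γ
      ≡⟨ cong (λ z → E z (λ α → H u Φ (suc b ∷ α) ⊕ ⊖ u ⊗ H u Φ (b ∷ α)) γ) (sym (ℤP.neg-distribʳ-* t u)) ⟩
    E (⊖ (t ⊗ u)) (λ α → H u Φ (suc b ∷ α) ⊕ ⊖ u ⊗ H u Φ (b ∷ α)) γ
      ≡⟨ ES.K-cong-Φ _ γ (λ α s → trans (cong (_⊕ ⊖ u ⊗ H u Φ (b ∷ α)) (H-suc u Φ b α (⊑-bounded s le))) (lem (H (t ⊗ u) (Φ ∘ (suc b ∷_)) α) u (H u Φ (b ∷ α)))) ⟩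
    E (⊖ (t ⊗ u)) (H (t ⊗ u) (Φ ∘ (suc b ∷_))) γ
      ≡⟨ E-H-sorted γ (t ⊗ u) (Φ ∘ (suc b ∷_)) d ⟩
    Φ (suc b ∷ γ) ∎
    where
    lem : ∀ a u c → a ⊕ u ⊗ c ⊕ ⊖ u ⊗ c ≡ a
    lem = ℤR.solve-∀

  -- If two rows can both be cut down to `i` and to `j`, their original lengths may be exchanged
  -- while the cuts stay in place. This replaces the symmetry of the pair statistic, which fails for
  -- `hpair` in this range.
  Exchangeable : (ℕ → ℕ → ℤ) → Set
  Exchangeable w = ∀ {x y i j} → i ≤ x → i ≤ y → j ≤ x → j ≤ y → w x i ⊗ w y j ≡ w y i ⊗ w x j

  ∸-exchange : ∀ {x y i j} → i ≤ x → i ≤ y → j ≤ x → j ≤ y → (x ∸ i) + (y ∸ j) ≡ (y ∸ i) + (x ∸ j)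
  ∸-exchange {x} {y} {i} {j} ix iy jx jy = +-cancelʳ-≡ (i + j) _ _
    (trans (total x y ix jy) (trans (+-comm x y) (sym (total y x iy jx))))
    where
    lem : ∀ a b i j → a + b + (i + j) ≡ (a + i) + (b + j)
    lem = ℕR.solve-∀
    total : ∀ x y → i ≤ x → j ≤ y → (x ∸ i) + (y ∸ j) + (i + j) ≡ x + y
    total x y p q = trans (lem (x ∸ i) (y ∸ j) i j) (cong₂ _+_ (m∸n+n≡m p) (m∸n+n≡m q))

  ⊓∸ : ∀ x a i → (x ⊓ a) ∸ i ≡ (x ⊓ a) ∸ (i ⊓ a)
  ⊓∸ x a i with ≤-total i a
  ... | inj₁ i≤a = cong ((x ⊓ a) ∸_) (sym (m≤n⇒m⊓n≡m i≤a))
  ... | inj₂ a≤i = trans (m≤n⇒m∸n≡0 (≤-trans (m⊓n≤n x a) a≤i))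
    (sym (m≤n⇒m∸n≡0 (≤-trans (m⊓n≤n x a) (≤-reflexive (sym (m≥n⇒m⊓n≡n a≤i))))))

  cut-exchange : ∀ a {x y i j} → i ≤ x → i ≤ y → j ≤ x → j ≤ y → ((x ⊓ a) ∸ i) + ((y ⊓ a) ∸ j) ≡ ((y ⊓ a) ∸ i) + ((x ⊓ a) ∸ j)
  cut-exchange a {x} {y} {i} {j} ix iy jx jy = trans (cong₂ _+_ (⊓∸ x a i) (⊓∸ y a j))
    (trans (∸-exchange (⊓-monoˡ-≤ a ix) (⊓-monoˡ-≤ a iy) (⊓-monoˡ-≤ a jx) (⊓-monoˡ-≤ a jy))
      (sym (cong₂ _+_ (⊓∸ y a i) (⊓∸ x a j))))

  pw-exchangeable : ∀ u → Exchangeable (pw u)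
  pw-exchangeable u {x} {y} {i} {j} p q r s = trans (sym (ℤP.^-distribˡ-+-* u (x ∸ i) (y ∸ j)))
    (trans (cong (u ^ᶻ_) (∸-exchange p q r s)) (ℤP.^-distribˡ-+-* u (y ∸ i) (x ∸ j)))

  private
    times-lem : ∀ a b c d → (a ⊗ b) ⊗ (c ⊗ d) ≡ (a ⊗ c) ⊗ (b ⊗ d)
    times-lem = ℤR.solve-∀
    sum-lem : ∀ a b c d → a + b + (c + d) ≡ (a + c) + (b + d)
    sum-lem = ℕR.solve-∀

  times-exchangeable : ∀ {w} b a → Exchangeable w → Exchangeable (times w (hpair b a))
  times-exchangeable {w} b a ex {x} {y} {i} {j} p q r s =
    trans (times-lem (w x i) _ (w y j) _)
    (trans (cong₂ _⊗_ (ex p q r s)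
      (trans (sym (ℤP.^-distribˡ-+-* t (hpair b a x i) (hpair b a y j))) (trans (cong (t ^ᶻ_) exponents) (ℤP.^-distribˡ-+-* t (hpair b a y i) (hpair b a x j)))))
      (times-lem (w y i) (w x j) _ _))
    where
    exponents : hpair b a x i + hpair b a y j ≡ hpair b a y i + hpair b a x j
    exponents = trans (sum-lem ((x ⊓ a) ∸ i) _ _ _) (trans (cong (_+ (((b ⊓ (i ∸ 1)) ∸ a) + ((b ⊓ (j ∸ 1)) ∸ a))) (cut-exchange a p q r s))
                  (sum-lem ((y ⊓ a) ∸ i) _ _ _))

  below-exchangeable : ∀ {x y i j} → i ≤ x → i ≤ y → j ≤ x → j ≤ y → ∀ z k →
    hpair x i z k + hpair y j z k ≡ hpair y i z k + hpair x j z k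
  below-exchangeable {x} {y} {i} {j} p q r s z k = trans (sum-lem ((z ⊓ i) ∸ k) _ _ _)
    (trans (cong ((((z ⊓ i) ∸ k) + ((z ⊓ j) ∸ k)) +_) (cut-exchange (k ∸ 1) p q r s)) (sym (sum-lem ((z ⊓ i) ∸ k) _ _ _)))

  term-exchange : ∀ w {Φ} zs {x i y j} → Exchangeable w → i ≤ x → i ≤ y → j ≤ x → j ≤ y →
    HS.term w Φ zs x i y j ≡ HS.term w Φ zs y i x j
  term-exchange w zs {x} {i} {y} {j} ex p q r s =
    trans (assoc (w x i) (w y j) _ _) (trans (cong₂ _⊗_ (cong₂ _⊗_ (ex p q r s) (cong (t ^ᶻ_) pairs))
      (HS.K-cong-w _ zs (All.tabulate (λ {z} _ {k} _ →
        trans (ℤP.*-assoc (w z k) _ _) (trans (cong (w z k ⊗_) (trans (sym (ℤP.^-distribˡ-+-* t (hpair x i z k) (hpair y j z k)))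
          (trans (cong (t ^ᶻ_) (below-exchangeable p q r s z k)) (ℤP.^-distribˡ-+-* t (hpair y i z k) (hpair x j z k))))) (sym (ℤP.*-assoc (w z k) _ _)))))))
      (sym (assoc (w y i) (w x j) _ _)))
    where
    assoc : ∀ a b c d → a ⊗ ((b ⊗ c) ⊗ d) ≡ ((a ⊗ b) ⊗ c) ⊗ d
    assoc = ℤR.solve-∀
    pairs : hpair x i y j ≡ hpair y i x j
    pairs = cong₂ (λ m n → (m ∸ j) + (n ∸ i)) (trans (m≥n⇒m⊓n≡n q) (sym (m≥n⇒m⊓n≡n p)))
              (trans (m≥n⇒m⊓n≡n (≤-trans (m∸n≤m j 1) r)) (sym (m≥n⇒m⊓n≡n (≤-trans (m∸n≤m j 1) s))))

  -- If the longer row keeps more than `x` cells, the two rows are exchanged together with their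
  -- cuts. In the remaining terms both cuts fit either row, and only the lengths are exchanged.
  HK-swap-≤ : ∀ w {Φ} d x zs → Exchangeable w → Invariant Φ → HK w Φ (x ∷ d + x ∷ zs) ≡ HK w Φ (d + x ∷ x ∷ zs)
  HK-swap-≤ w {Φ} d x zs ex inv = begin
    HK w Φ (x ∷ y ∷ zs)
      ≡⟨ HS.K-two w Φ x y zs ⟩
    ∑ (downTo x) (λ i → ∑ (downTo y) (λ j → HS.term w Φ zs x i y j))
      ≡⟨ ∑-cong (downTo x) (λ i → ∑-downTo d x _) ⟩
    ∑ (downTo x) (λ i → ∑ (above d x) (λ j → HS.term w Φ zs x i y j) ⊕ ∑ (downTo x) (λ j → HS.term w Φ zs x i y j))
      ≡⟨ ∑-⊕ (downTo x) _ _ ⟩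
    ∑ (downTo x) (λ i → ∑ (above d x) (λ j → HS.term w Φ zs x i y j)) ⊕ ∑ (downTo x) (λ i → ∑ (downTo x) (λ j → HS.term w Φ zs x i y j))
      ≡⟨ cong₂ _⊕_ (trans (∑-swap (downTo x) (above d x) _) (∑-cong∈ (above d x) (λ {j} j∈ → ∑-cong∈ (downTo x) (λ {i} i∈ →
           term-swap′ (downTo⁻ i∈) (above⁻ {d} j∈)))))
           (∑-cong∈ (downTo x) (λ i∈ → ∑-cong∈ (downTo x) (λ j∈ → term-exchange w {Φ} zs ex (downTo⁻ i∈) (≤-trans (downTo⁻ i∈) x≤y) (downTo⁻ j∈) (≤-trans (downTo⁻ j∈) x≤y)))) ⟩
    ∑ (above d x) (λ j → ∑ (downTo x) (λ i → HS.term w Φ zs y j x i)) ⊕ ∑ (downTo x) (λ i → ∑ (downTo x) (λ j → HS.term w Φ zs y i x j))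
      ≡⟨ sym (∑-downTo d x _) ⟩
    ∑ (downTo y) (λ j → ∑ (downTo x) (λ i → HS.term w Φ zs y j x i))
      ≡⟨ sym (HS.K-two w Φ y x zs) ⟩
    HK w Φ (y ∷ x ∷ zs) ∎
    where
    y = d + x
    x≤y : x ≤ y
    x≤y = m≤n+m x d
    term-swap′ : ∀ {i j} → i ≤ x → x < j × j ≤ y → HS.term w Φ zs x i y j ≡ HS.term w Φ zs y j x i
    term-swap′ {i} {j} i≤x (x<j , j≤y) = HS.term-swap w {Φ} zs x i y j inv
      (trans (cong₂ _+_ (m≤n⇒m∸n≡0 (≤-trans (m⊓n≤n y i) (≤-trans i≤x (<⇒≤ x<j)))) (cong (_∸ i) (m≤n⇒m⊓n≡m (∸-monoˡ-≤ 1 x<j))))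
      (trans (sym (+-identityʳ _)) (sym (cong₂ _+_ (cong (_∸ i) (m≤n⇒m⊓n≡m (<⇒≤ x<j)))
        (m≤n⇒m∸n≡0 (≤-trans (m⊓n≤n y (i ∸ 1)) (≤-trans (m∸n≤m i 1) (≤-trans i≤x (<⇒≤ x<j)))))))))

  HK-invariant : ∀ w {Φ} → Exchangeable w → Invariant Φ → Invariant (HK w Φ)
  HK-invariant w {Φ} ex inv (b ∷ xs) x y zs = ∑-cong (downTo b) (λ a → cong (w b a ⊗_)
    (HK-invariant (times w (hpair b a)) {Φ ∘ (a ∷_)} (times-exchangeable {w} b a ex) (invariant-∷ {Φ} a inv) xs x y zs))
  HK-invariant w {Φ} ex inv [] x y zs with ≤-total x y
  ... | inj₁ x≤y = subst (λ y → HK w Φ (x ∷ y ∷ zs) ≡ HK w Φ (y ∷ x ∷ zs)) (m∸n+n≡m x≤y) (HK-swap-≤ w {Φ} (y ∸ x) x zs ex inv)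
  ... | inj₂ y≤x = sym (subst (λ x → HK w Φ (y ∷ x ∷ zs) ≡ HK w Φ (x ∷ y ∷ zs)) (m∸n+n≡m y≤x) (HK-swap-≤ w {Φ} (x ∸ y) y zs ex inv))

  H-invariant : ∀ u {Φ} → Invariant Φ → Invariant (H u Φ)
  H-invariant u {Φ} = HK-invariant (pw u) {Φ} (pw-exchangeable u)

  epair-swap : ∀ {x y} i j → x ≢ y → epair x i y j ≡ epair y j x i
  epair-swap {x} {y} i j x≢y = trans (cong₂ (λ p q → [[ (j <ᵇ y) ∧ p ]] + [[ (i <ᵇ x) ∧ q ]]) (flip y x (λ e → x≢y (sym e))) (sym (flip x y x≢y)))
    (+-comm [[ (j <ᵇ y) ∧ (y <ᵇ x) ]] _)
    where
    flip : ∀ m n → m ≢ n → (m ≤ᵇ n) ≡ (m <ᵇ n)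
    flip zero    zero    ne = ⊥-elim (ne refl)
    flip zero    (suc n) ne = refl
    flip (suc m) zero    ne = refl
    flip (suc zero)    (suc n) ne = flip zero n (ne ∘ cong suc)
    flip (suc (suc m)) (suc n) ne = flip (suc m) n (ne ∘ cong suc)

  EK-invariant : ∀ w {Φ} → Invariant Φ → Invariant (EK w Φ)
  EK-invariant w {Φ} inv (b ∷ xs) x y zs = ∑-cong (strip b) (λ a → cong (w b a ⊗_) (EK-invariant (times w (epair b a)) {Φ ∘ (a ∷_)} (invariant-∷ {Φ} a inv) xs x y zs))
  EK-invariant w {Φ} inv [] x y zs with x ≟ y
  ... | yes refl = refl
  ... | no x≢y = trans (ES.K-two w Φ x y zs)
    (trans (∑-cong (strip x) (λ i → ∑-cong (strip y) (λ j → ES.term-swap w {Φ} zs x i y j inv (epair-swap i j x≢y))))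
    (trans (∑-swap (strip x) (strip y) _) (sym (ES.K-two w Φ y x zs))))

  E-H : ∀ u Φ → Invariant Φ → ∀ β → E (⊖ u) (H u Φ) β ≡ Φ β
  E-H u Φ inv = invariant-sorted {E (⊖ u) (H u Φ)} {Φ} (EK-invariant (pw (⊖ u)) {H u Φ} (H-invariant u {Φ} inv)) inv (λ β d → E-H-sorted β u Φ d)

  Unital : (ℕ → ℕ → ℤ) → Set
  Unital w = ∀ y → w y y ≡ 1ℤ

  epair-unit : ∀ b y → epair b b y y ≡ 0
  epair-unit b y = cong₂ (λ p q → [[ p ∧ (y ≤ᵇ b) ]] + [[ q ∧ (b <ᵇ y) ]]) (≤⇒≮ᵇ (≤-refl {y})) (≤⇒≮ᵇ (≤-refl {b}))

  ⊑-sum : ∀ {α β} → α ES.⊑ β → sum α ≤ sum β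
  ⊑-sum []      = z≤n
  ⊑-sum (a ∷ s) = +-mono-≤ (strip-≤ a) (⊑-sum s)

  -- The coefficient of Φ β in EK w Φ β is 1, and the other terms involve smaller shapes only.
  EK-top : ∀ w {Φ Ψ} β → Unital w → (∀ α → sum α < sum β → Φ α ≡ Ψ α) → EK w Φ β ⊕ Ψ β ≡ EK w Ψ β ⊕ Φ β
  EK-top w {Φ} {Ψ} [] un e = ℤP.+-comm (Φ []) (Ψ [])
  EK-top w {Φ} {Ψ} (zero ∷ β) un e = trans (cong (_⊕ Ψ (0 ∷ β)) (unit Φ)) (trans (EK-top (times w (epair 0 0)) β un′ (λ α lt → e (0 ∷ α) lt)) (cong (_⊕ Φ (0 ∷ β)) (sym (unit Ψ))))
    where
    un′ : Unital (times w (epair 0 0))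
    un′ y = cong₂ _⊗_ (un y) (cong (t ^ᶻ_) (epair-unit 0 y))
    unit : ∀ Φ → EK w Φ (0 ∷ β) ≡ EK (times w (epair 0 0)) (Φ ∘ (0 ∷_)) β
    unit Φ = trans (ℤP.+-identityʳ _) (trans (cong (_⊗ EK (times w (epair 0 0)) (Φ ∘ (0 ∷_)) β) (un 0)) (ℤP.*-identityˡ _))
  EK-top w {Φ} {Ψ} (suc b ∷ β) un e = trans (cong (_⊕ Ψ (suc b ∷ β)) (unit Φ)) (trans (lem (low Φ) (up Φ) (Ψ (suc b ∷ β)))
    (trans (cong₂ _⊕_ lows (EK-top (times w (epair (suc b) (suc b))) β un′ (λ α lt → e (suc b ∷ α) (+-monoʳ-< (suc b) lt)))) (trans (sym (lem (low Ψ) (up Ψ) (Φ (suc b ∷ β)))) (cong (_⊕ Φ (suc b ∷ β)) (sym (unit Ψ))))))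
    where
    un′ : Unital (times w (epair (suc b) (suc b)))
    un′ y = cong₂ _⊗_ (un y) (cong (t ^ᶻ_) (epair-unit (suc b) y))
    low : (List ℕ → ℤ) → ℤ
    low Φ = w (suc b) b ⊗ EK (times w (epair (suc b) b)) (Φ ∘ (b ∷_)) β ⊕ 0ℤ
    lows : low Φ ≡ low Ψ
    lows = cong (λ z → w (suc b) b ⊗ z ⊕ 0ℤ) (ES.K-cong-Φ _ β (λ α s → e (b ∷ α) (s≤s (+-monoʳ-≤ b (⊑-sum s)))))
    up : (List ℕ → ℤ) → ℤ
    up Φ = EK (times w (epair (suc b) (suc b))) (Φ ∘ (suc b ∷_)) β
    unit : ∀ Φ → EK w Φ (suc b ∷ β) ≡ up Φ ⊕ low Φ
    unit Φ = cong (_⊕ low Φ) (trans (cong (_⊗ up Φ) (un (suc b))) (ℤP.*-identityˡ _))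
    lem : ∀ l k p → k ⊕ l ⊕ p ≡ l ⊕ (k ⊕ p)
    lem = ℤR.solve-∀

  E-cancel : ∀ u {Φ Ψ} → (∀ β → E u Φ β ≡ E u Ψ β) → ∀ β → Φ β ≡ Ψ β
  E-cancel u {Φ} {Ψ} e β = go (suc (sum β)) β ≤-refl
    where
    go : ∀ n β → sum β < n → Φ β ≡ Ψ β
    go (suc n) β lt = sym (⊕-cancelˡ (E u Φ β) (Ψ β) (Φ β)
      (trans (EK-top (pw u) β (λ y → cong (u ^ᶻ_) (n∸n≡0 y)) (λ α lt′ → go n α (<-≤-trans lt′ (s≤s⁻¹ lt)))) (cong (_⊕ Φ β) (sym (e β)))))

-- Commutation of the vertical and horizontal strip operators

module Blocks (t : ℤ) where
  open Strips t

  -- G k U V is the sum over words of k letters a and b of Uᵃ Vᵇ t^(number of pairs a … a, b … a and b … b).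
  G : ℕ → ℤ → ℤ → ℤ
  G zero    U V = 1ℤ
  G (suc k) U V = U ⊗ G k (t ⊗ U) V ⊕ V ⊗ G k (t ⊗ U) (t ⊗ V)

  G-homogeneous : ∀ k U V → G k (t ⊗ U) (t ⊗ V) ≡ t ^ᶻ k ⊗ G k U V
  G-homogeneous zero    U V = refl
  G-homogeneous (suc k) U V = trans (cong₂ (λ x y → (t ⊗ U) ⊗ x ⊕ (t ⊗ V) ⊗ y) (G-homogeneous k (t ⊗ U) V) (G-homogeneous k (t ⊗ U) (t ⊗ V)))
    (lem t U V (t ^ᶻ k) _ _)
    where
    lem : ∀ t U V s x y → (t ⊗ U) ⊗ (s ⊗ x) ⊕ (t ⊗ V) ⊗ (s ⊗ y) ≡ (t ⊗ s) ⊗ (U ⊗ x ⊕ V ⊗ y)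
    lem = ℤR.solve-∀

  -- The definition splits off the first letter, this identity the last one. Up to `G-homogeneous`
  -- the two recursions differ by exchanging the two letters, whence `G-sym`.
  G-last : ∀ k U V → G (suc k) U V ≡ t ^ᶻ k ⊗ U ⊗ G k U V ⊕ V ⊗ G k U (t ⊗ V)
  G-last zero U V = lem U V
    where
    lem : ∀ U V → U ⊗ 1ℤ ⊕ V ⊗ 1ℤ ≡ 1ℤ ⊗ U ⊗ 1ℤ ⊕ V ⊗ 1ℤ
    lem = ℤR.solve-∀
  G-last (suc k) U V = trans (cong₂ (λ x y → U ⊗ x ⊕ V ⊗ y) (G-last k (t ⊗ U) V) (G-last k (t ⊗ U) (t ⊗ V)))
    (lem t U V (t ^ᶻ k) (G k (t ⊗ U) V) (G k (t ⊗ U) (t ⊗ V)) (G k (t ⊗ U) (t ⊗ (t ⊗ V))))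
    where
    lem : ∀ t U V s x y z → U ⊗ (s ⊗ (t ⊗ U) ⊗ x ⊕ V ⊗ y) ⊕ V ⊗ (s ⊗ (t ⊗ U) ⊗ y ⊕ (t ⊗ V) ⊗ z) ≡
      (t ⊗ s) ⊗ U ⊗ (U ⊗ x ⊕ V ⊗ y) ⊕ V ⊗ (U ⊗ y ⊕ (t ⊗ V) ⊗ z)
    lem = ℤR.solve-∀

  G-sym : ∀ k U V → G k U V ≡ G k V U
  G-sym zero    U V = refl
  G-sym (suc k) U V = trans (G-last k U V) (trans (lem (t ^ᶻ k) U V (G k U V) (G k U (t ⊗ V)))
    (sym (cong₂ (λ x y → V ⊗ x ⊕ U ⊗ y) (G-sym k (t ⊗ V) U) (trans (G-homogeneous k V U) (cong (t ^ᶻ k ⊗_) (G-sym k V U))))))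
    where
    lem : ∀ s U V x y → s ⊗ U ⊗ x ⊕ V ⊗ y ≡ V ⊗ y ⊕ U ⊗ (s ⊗ x)
    lem = ℤR.solve-∀

  ev : ℕ → List ℤ → ℤ → ℤ → ℤ
  ev k []       U V = 0ℤ
  ev k (c ∷ cs) U V = c ⊗ G k U V ⊕ ev (suc k) cs U V

  -- Symmetry alone does not pass through the recursion of `block`, because its shortening step
  -- treats `U` and `P` differently. Lying in the span of the symmetric `G k` does: that step sends
  -- `G k` to `G (suc k)`.
  Spanned : (ℤ → ℤ → ℤ) → Set
  Spanned F = ∃[ cs ] (∀ U V → F U V ≡ ev 0 cs U V)

  ev-sym : ∀ k cs U V → ev k cs U V ≡ ev k cs V U
  ev-sym k []       U V = refl
  ev-sym k (c ∷ cs) U V = cong₂ (λ x y → c ⊗ x ⊕ y) (G-sym k U V) (ev-sym (suc k) cs U V)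

  spanned-sym : ∀ {F} → Spanned F → ∀ U V → F U V ≡ F V U
  spanned-sym (cs , e) U V = trans (e U V) (trans (ev-sym 0 cs U V) (sym (e V U)))

  spanned-const : ∀ c → Spanned (λ _ _ → c)
  spanned-const c = c ∷ [] , λ U V → sym (trans (ℤP.+-identityʳ _) (ℤP.*-identityʳ c))

  addL : List ℤ → List ℤ → List ℤ
  addL []       ds       = ds
  addL (c ∷ cs) []       = c ∷ cs
  addL (c ∷ cs) (d ∷ ds) = c ⊕ d ∷ addL cs ds

  ev-add : ∀ k cs ds U V → ev k (addL cs ds) U V ≡ ev k cs U V ⊕ ev k ds U V
  ev-add k []       ds       U V = sym (ℤP.+-identityˡ _)
  ev-add k (c ∷ cs) []       U V = sym (ℤP.+-identityʳ _)
  ev-add k (c ∷ cs) (d ∷ ds) U V = trans (cong ((c ⊕ d) ⊗ G k U V ⊕_) (ev-add (suc k) cs ds U V)) (lem c d (G k U V) _ _)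
    where
    lem : ∀ c d g x y → (c ⊕ d) ⊗ g ⊕ (x ⊕ y) ≡ (c ⊗ g ⊕ x) ⊕ (d ⊗ g ⊕ y)
    lem = ℤR.solve-∀

  spanned-⊕ : ∀ {F F′} → Spanned F → Spanned F′ → Spanned (λ U V → F U V ⊕ F′ U V)
  spanned-⊕ (cs , e) (ds , e′) = addL cs ds , λ U V → trans (cong₂ _⊕_ (e U V) (e′ U V)) (sym (ev-add 0 cs ds U V))

  ev-⊗ : ∀ k c cs U V → ev k (map (c ⊗_) cs) U V ≡ c ⊗ ev k cs U V
  ev-⊗ k c []       U V = sym (ℤP.*-zeroʳ c)
  ev-⊗ k c (d ∷ cs) U V = trans (cong ((c ⊗ d) ⊗ G k U V ⊕_) (ev-⊗ (suc k) c cs U V)) (lem c d (G k U V) _)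
    where
    lem : ∀ c d g x → (c ⊗ d) ⊗ g ⊕ c ⊗ x ≡ c ⊗ (d ⊗ g ⊕ x)
    lem = ℤR.solve-∀

  spanned-⊗ : ∀ c {F} → Spanned F → Spanned (λ U V → c ⊗ F U V)
  spanned-⊗ c (cs , e) = map (c ⊗_) cs , λ U V → trans (cong (c ⊗_) (e U V)) (sym (ev-⊗ 0 c cs U V))

  scaleL : ℕ → List ℤ → List ℤ
  scaleL k []       = []
  scaleL k (c ∷ cs) = c ⊗ t ^ᶻ k ∷ scaleL (suc k) cs

  ev-scale : ∀ k cs U V → ev k cs (t ⊗ U) (t ⊗ V) ≡ ev k (scaleL k cs) U V
  ev-scale k []       U V = refl
  ev-scale k (c ∷ cs) U V = cong₂ _⊕_ (trans (cong (c ⊗_) (G-homogeneous k U V)) (sym (ℤP.*-assoc c _ _))) (ev-scale (suc k) cs U V)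

  spanned-scale : ∀ {F} → Spanned F → Spanned (λ U V → F (t ⊗ U) (t ⊗ V))
  spanned-scale (cs , e) = scaleL 0 cs , λ U V → trans (e (t ⊗ U) (t ⊗ V)) (ev-scale 0 cs U V)

  ev-step : ∀ k cs U V → U ⊗ ev k cs (t ⊗ U) V ⊕ V ⊗ ev k cs (t ⊗ U) (t ⊗ V) ≡ ev (suc k) cs U V
  ev-step k []       U V = cong₂ _⊕_ (ℤP.*-zeroʳ U) (ℤP.*-zeroʳ V)
  ev-step k (c ∷ cs) U V = trans (lem U V c _ _ _ _) (cong (c ⊗ G (suc k) U V ⊕_) (ev-step (suc k) cs U V))
    where
    lem : ∀ U V c x y z w → U ⊗ (c ⊗ x ⊕ y) ⊕ V ⊗ (c ⊗ z ⊕ w) ≡ c ⊗ (U ⊗ x ⊕ V ⊗ z) ⊕ (U ⊗ y ⊕ V ⊗ w)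
    lem = ℤR.solve-∀

  spanned-step : ∀ {F} → Spanned F → Spanned (λ U V → U ⊗ F (t ⊗ U) V ⊕ V ⊗ F (t ⊗ U) (t ⊗ V))
  spanned-step (cs , e) = 0ℤ ∷ cs , λ U V → trans (cong₂ (λ x y → U ⊗ x ⊕ V ⊗ y) (e _ _) (e _ _))
    (trans (ev-step 0 cs U V) (sym (trans (cong (_⊕ ev 1 cs U V) (ℤP.*-zeroˡ 1ℤ)) (ℤP.+-identityˡ _))))

  -- Both steps of E u ∘ E v processed together, row by row.  A row is kept, or shortened by the first
  -- step only (factor U), by the second step only (factor P), or by both.  The state (U, P, X) refers to the
  -- current block of rows of length c.  Decoupling it from (u, v) exposes the symmetry.
  mutual
    Y : ℕ → ℤ → ℤ → ℤ → ℤ → ℤ → (List ℕ → ℤ) → List ℕ → ℤ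
    Y c u v U P X Φ []      = Φ []
    Y c u v U P X Φ (b ∷ γ) = if b ≡ᵇ c then block b u v U P X Φ γ else block b u v u v 1ℤ Φ γ

    block : ℕ → ℤ → ℤ → ℤ → ℤ → ℤ → (List ℕ → ℤ) → List ℕ → ℤ
    block zero u v U P X Φ γ = X ⊗ Y 0 (t ⊗ u) (t ⊗ v) (t ⊗ U) (t ⊗ P) X (Φ ∘ (0 ∷_)) γ
    block (suc b) u v U P X Φ γ =
      X ⊗ Y (suc b) (t ⊗ u) (t ⊗ v) (t ⊗ U) (t ⊗ P) X (Φ ∘ (suc b ∷_)) γ
      ⊕ (U ⊗ Y (suc b) (t ⊗ u) (t ⊗ v) (t ⊗ U) P X (Φ ∘ (b ∷_)) γ
         ⊕ P ⊗ Y (suc b) (t ⊗ u) (t ⊗ v) (t ⊗ U) (t ⊗ P) X (Φ ∘ (b ∷_)) γ)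
      ⊕ both b u v U P X Φ γ

    both : ℕ → ℤ → ℤ → ℤ → ℤ → ℤ → (List ℕ → ℤ) → List ℕ → ℤ
    both zero    u v U P X Φ γ = 0ℤ
    both (suc b) u v U P X Φ γ = (u ⊗ v) ⊗ Y (suc (suc b)) (t ⊗ u) (t ⊗ v) (t ⊗ U) (t ⊗ P) (t ⊗ X) (Φ ∘ (b ∷_)) γ

  mutual
    Y-spanned : ∀ c u v X Φ β → Spanned (λ U P → Y c u v U P X Φ β)
    Y-spanned c u v X Φ []      = spanned-const (Φ [])
    Y-spanned c u v X Φ (b ∷ γ) with b ≡ᵇ c
    ... | true  = block-spanned b u v X Φ γ
    ... | false = spanned-const (block b u v u v 1ℤ Φ γ)

    block-spanned : ∀ b u v X Φ γ → Spanned (λ U P → block b u v U P X Φ γ)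
    block-spanned zero    u v X Φ γ = spanned-⊗ X (spanned-scale (Y-spanned 0 (t ⊗ u) (t ⊗ v) X (Φ ∘ (0 ∷_)) γ))
    block-spanned (suc b) u v X Φ γ = spanned-⊕ (spanned-⊕
      (spanned-⊗ X (spanned-scale (Y-spanned (suc b) (t ⊗ u) (t ⊗ v) X (Φ ∘ (suc b ∷_)) γ)))
      (spanned-step (Y-spanned (suc b) (t ⊗ u) (t ⊗ v) X (Φ ∘ (b ∷_)) γ)))
      (both-spanned b u v X Φ γ)

    both-spanned : ∀ b u v X Φ γ → Spanned (λ U P → both b u v U P X Φ γ)
    both-spanned zero    u v X Φ γ = spanned-const 0ℤ
    both-spanned (suc b) u v X Φ γ = spanned-⊗ (u ⊗ v) (spanned-scale (Y-spanned (suc (suc b)) (t ⊗ u) (t ⊗ v) (t ⊗ X) (Φ ∘ (b ∷_)) γ))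

  mutual
    -- With `U` and `P` held fixed, exchanging `u` and `v` respects the recursion. Only at the
    -- beginning of a new block, where `U` and `P` are reset to `u` and `v`, is the symmetry in `U`
    -- and `P` used.
    Y-comm : ∀ c u v U P X Φ β → Y c u v U P X Φ β ≡ Y c v u U P X Φ β
    Y-comm c u v U P X Φ []      = refl
    Y-comm c u v U P X Φ (b ∷ γ) with b ≡ᵇ c
    ... | true  = block-comm b u v U P X Φ γ
    ... | false = trans (block-comm b u v u v 1ℤ Φ γ) (spanned-sym (block-spanned b v u 1ℤ Φ γ) u v)

    block-comm : ∀ b u v U P X Φ γ → block b u v U P X Φ γ ≡ block b v u U P X Φ γ
    block-comm zero    u v U P X Φ γ = cong (X ⊗_) (Y-comm 0 (t ⊗ u) (t ⊗ v) _ _ X _ γ)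
    block-comm (suc b) u v U P X Φ γ = cong₂ _⊕_ (cong₂ _⊕_ (cong (X ⊗_) (Y-comm (suc b) (t ⊗ u) (t ⊗ v) _ _ X _ γ))
      (cong₂ _⊕_ (cong (U ⊗_) (Y-comm (suc b) (t ⊗ u) (t ⊗ v) _ _ X _ γ)) (cong (P ⊗_) (Y-comm (suc b) (t ⊗ u) (t ⊗ v) _ _ X _ γ))))
      (both-comm b u v U P X Φ γ)

    both-comm : ∀ b u v U P X Φ γ → both b u v U P X Φ γ ≡ both b v u U P X Φ γ
    both-comm zero    u v U P X Φ γ = refl
    both-comm (suc b) u v U P X Φ γ = cong₂ _⊗_ (ℤP.*-comm u v) (Y-comm (suc (suc b)) (t ⊗ u) (t ⊗ v) _ _ _ _ γ)

  -- In a sorted shape only rows of length at most `c` are still to come, and these data determine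
  -- the weights on them. On shorter rows the weights are powers; for rows that reach the second
  -- step with length `c` they depend on how the earlier rows of the block were cut.
  record State (c : ℕ) (u v P X : ℤ) (w₁ w₂ : ℕ → ℕ → ℤ) : Set where
    constructor state
    field
      first   : ∀ {y j} → y ≤ c → j ∈ strip y → w₁ y j ≡ u ^ᶻ (y ∸ j)
      keep    : w₂ c c ≡ X
      shorten : ∀ {b} → c ≡ suc b → w₂ c b ≡ P
      second  : ∀ {y j} → y < c → j ∈ strip y → w₂ y j ≡ v ^ᶻ (y ∸ j)
  open State

  1+n∸n : ∀ b → suc b ∸ b ≡ 1
  1+n∸n b = trans (+-∸-assoc 1 (≤-refl {b})) (cong suc (n∸n≡0 b))

  state-next : ∀ {c b u v P X w₁ w₂} → State c u v P X w₁ w₂ → b < c → State b u v v 1ℤ w₁ w₂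
  state-next {b = b} {v = v} S b<c = state (λ y≤b → first S (≤-trans y≤b (<⇒≤ b<c)))
    (trans (second S b<c (∈-refl b)) (cong (v ^ᶻ_) (n∸n≡0 b)))
    (λ { {b′} refl → trans (second S b<c (there (here refl))) (trans (cong (v ^ᶻ_) (1+n∸n b′)) (ℤP.*-identityʳ v)) })
    (λ y<b → second S (<-trans y<b b<c))
    where
    ∈-refl : ∀ b → b ∈ strip b
    ∈-refl zero    = here refl
    ∈-refl (suc b) = here refl

  private
    scaled : ∀ {u n w b a y j} → w ≡ u ^ᶻ n → y ≤ b → j ∈ strip y → n ≡ y ∸ j → w ⊗ t ^ᶻ epair b a y j ≡ (t ⊗ u) ^ᶻ (y ∸ j)
    scaled {u} {w = w} {b} {a} {y} {j} refl y≤b j∈ refl = trans (cong (λ n → u ^ᶻ (y ∸ j) ⊗ t ^ᶻ n) (epair-≤ {b} {a} y≤b j∈))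
      (trans (ℤP.*-comm (u ^ᶻ (y ∸ j)) _) (sym (^ᶻ-⊗ t u (y ∸ j))))

    unscaled : ∀ {w z n} → n ≡ 0 → w ≡ z → w ⊗ t ^ᶻ n ≡ z
    unscaled refl e = trans (ℤP.*-identityʳ _) e

    once : ∀ {w z n} → n ≡ 1 → w ≡ z → w ⊗ t ^ᶻ n ≡ t ⊗ z
    once {w} refl e = trans (cong (w ⊗_) (ℤP.*-identityʳ t)) (trans (ℤP.*-comm w t) (cong (t ⊗_) e))

    ∈-self : ∀ b → b ∈ strip b
    ∈-self zero    = here refl
    ∈-self (suc b) = here refl

    <ᵇ-suc : ∀ n → (n <ᵇ suc n) ≡ true
    <ᵇ-suc zero    = refl
    <ᵇ-suc (suc n) = <ᵇ-suc n

  state-kept : ∀ {b a c u v P X w₁ w₂} → State b u v P X w₁ w₂ → State b (t ⊗ u) (t ⊗ v) (t ⊗ P) X (times w₁ (epair b a)) (times w₂ (epair b c))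
  state-kept {b} {a} {c} S = state (λ y≤ j∈ → scaled {a = a} (first S y≤ j∈) y≤ j∈ refl)
    (unscaled (trans (epair-≤ {b} {c} {b} ≤-refl (∈-self b)) (n∸n≡0 b)) (keep S))
    (λ { {b′} refl → once (trans (epair-≤ {b} {c} {b} ≤-refl (there (here refl))) (1+n∸n b′)) (shorten S refl) })
    (λ y< j∈ → scaled {a = c} (second S y< j∈) (<⇒≤ y<) j∈ refl)

  -- Cut by the first step only, the row enters the second step shorter than a row of length `suc b`
  -- and is kept there, so it has no effect on `P` and `X`.
  state-shortened : ∀ {b u v P X w₁ w₂} → State (suc b) u v P X w₁ w₂ →
    State (suc b) (t ⊗ u) (t ⊗ v) P X (times w₁ (epair (suc b) b)) (times w₂ (epair b b))
  state-shortened {b} S = state (λ y≤ j∈ → scaled {a = b} (first S y≤ j∈) y≤ j∈ refl)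
    (unscaled (pairs (suc b)) (keep S)) (λ { refl → unscaled (pairs b) (shorten S refl) })
    (λ y< j∈ → scaled {a = b} (second S y< j∈) (s≤s⁻¹ y<) j∈ refl)
    where
    pairs : ∀ j → epair b b (suc b) j ≡ 0
    pairs j = trans (cong₂ (λ p q → [[ (j <ᵇ suc b) ∧ p ]] + [[ q ∧ (b <ᵇ suc b) ]]) (>⇒≰ᵇ (n<1+n b)) (≤⇒≮ᵇ (≤-refl {b}))) (cong (λ p → [[ p ]] + 0) (BP.∧-zeroʳ (j <ᵇ suc b)))

  -- The second step has shortened a row that is already shorter than the rows kept by the first
  -- step. Each later one of these earns a factor `t`, whether the second step keeps or shortens it.
  state-both : ∀ {b u v P X w₁ w₂} → State (suc (suc b)) u v P X w₁ w₂ →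
    State (suc (suc b)) (t ⊗ u) (t ⊗ v) (t ⊗ P) (t ⊗ X) (times w₁ (epair (suc (suc b)) (suc b))) (times w₂ (epair (suc b) b))
  state-both {b} S = state (λ y≤ j∈ → scaled {a = suc b} (first S y≤ j∈) y≤ j∈ refl)
    (once (pairs (suc (suc b))) (keep S)) (λ { refl → once (pairs (suc b)) (shorten S refl) })
    (λ y< j∈ → scaled {a = b} (second S y< j∈) (s≤s⁻¹ y<) j∈ refl)
    where
    pairs : ∀ j → epair (suc b) b (suc (suc b)) j ≡ 1
    pairs j = trans (cong₂ (λ p q → [[ (j <ᵇ suc (suc b)) ∧ p ]] + [[ q ]]) (≤⇒≮ᵇ (≤-refl {b})) (cong₂ _∧_ (<ᵇ-suc b) (<ᵇ-suc b))) (cong (λ p → [[ p ]] + 1) (BP.∧-zeroʳ (j <ᵇ suc (suc b))))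

  EK-two : ∀ w₁ w₂ Φ b γ → EK w₁ (EK w₂ Φ) (b ∷ γ) ≡
    ∑ (strip b) (λ a → ∑ (strip a) (λ c → (w₁ b a ⊗ w₂ a c) ⊗ EK (times w₁ (epair b a)) (EK (times w₂ (epair a c)) (Φ ∘ (c ∷_))) γ))
  EK-two w₁ w₂ Φ b γ = ∑-cong (strip b) λ a → begin
    w₁ b a ⊗ EK (times w₁ (epair b a)) (λ α → ∑ (strip a) (λ c → w₂ a c ⊗ EK (times w₂ (epair a c)) (Φ ∘ (c ∷_)) α)) γ
      ≡⟨ cong (w₁ b a ⊗_) (trans (ES.K-∑ (times w₁ (epair b a)) (strip a) _ γ)
           (∑-cong (strip a) (λ c → ES.K-⊗ (times w₁ (epair b a)) (w₂ a c) (EK (times w₂ (epair a c)) (Φ ∘ (c ∷_))) γ))) ⟩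
    w₁ b a ⊗ ∑ (strip a) (λ c → w₂ a c ⊗ EK (times w₁ (epair b a)) (EK (times w₂ (epair a c)) (Φ ∘ (c ∷_))) γ)
      ≡⟨ sym (∑-⊗ (strip a) (w₁ b a) _) ⟩
    ∑ (strip a) (λ c → w₁ b a ⊗ (w₂ a c ⊗ EK (times w₁ (epair b a)) (EK (times w₂ (epair a c)) (Φ ∘ (c ∷_))) γ))
      ≡⟨ ∑-cong (strip a) (λ c → sym (ℤP.*-assoc (w₁ b a) (w₂ a c) _)) ⟩
    ∑ (strip a) (λ c → (w₁ b a ⊗ w₂ a c) ⊗ EK (times w₁ (epair b a)) (EK (times w₂ (epair a c)) (Φ ∘ (c ∷_))) γ) ∎

  mutual
    -- For the actual operators the parameter `U` of `Y` coincides with `u`: a row cut by the first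
    -- step only has weight `u`.
    EK-Y : ∀ {c u v P X w₁ w₂} Φ β → State c u v P X w₁ w₂ → Desc (c ∷ β) → EK w₁ (EK w₂ Φ) β ≡ Y c u v u P X Φ β
    EK-Y Φ [] S d = refl
    EK-Y {c} {u} {v} {P} {X} Φ (b ∷ γ) S ((b≤c ∷ _) ∷ d) with b ≡ᵇ c in eq
    ... | true  = EK-block b Φ γ (subst (λ c → State c u v P X _ _) (sym (≡ᵇ-true⇒≡ eq)) S) d
    ... | false = EK-block b Φ γ (state-next S (≤∧≢⇒< b≤c (≡ᵇ-false⇒≢ eq))) d

    EK-block : ∀ {u v P X w₁ w₂} b Φ γ → State b u v P X w₁ w₂ → Desc (b ∷ γ) → EK w₁ (EK w₂ Φ) (b ∷ γ) ≡ block b u v u P X Φ γ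
    EK-block {u} {v} {P} {X} {w₁} {w₂} zero Φ γ S d = trans (EK-two w₁ w₂ Φ 0 γ)
      (trans (trans (ℤP.+-identityʳ _) (ℤP.+-identityʳ _))
        (cong₂ _⊗_ (trans (cong₂ _⊗_ (first S z≤n (here refl)) (keep S)) (ℤP.*-identityˡ X))
          (EK-Y (Φ ∘ (0 ∷_)) γ (state-kept {a = 0} {c = 0} S) d)))
    EK-block {u} {v} {P} {X} {w₁} {w₂} (suc zero) Φ γ S d = trans (EK-two w₁ w₂ Φ 1 γ)
      (trans (lem (F 1 1) (F 1 0) (F 0 0))
        (cong₂ (λ x y → x ⊕ y ⊕ 0ℤ)
          (cong₂ _⊗_ (trans (cong₂ _⊗_ (first S ≤-refl (here refl)) (keep S)) (ℤP.*-identityˡ X)) (EK-Y _ γ (state-kept {a = 1} {c = 1} S) d))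
          (cong₂ _⊕_
            (cong₂ _⊗_ (trans (cong₂ _⊗_ (trans (first S ≤-refl (there (here refl))) (ℤP.*-identityʳ u)) (second S ≤-refl (here refl))) (ℤP.*-identityʳ u)) (EK-Y _ γ (state-shortened S) d))
            (cong₂ _⊗_ (trans (cong₂ _⊗_ (first S ≤-refl (here refl)) (shorten S refl)) (ℤP.*-identityˡ P)) (EK-Y _ γ (state-kept {a = 1} {c = 0} S) d)))))
      where
      F : ℕ → ℕ → ℤ
      F a c = (w₁ 1 a ⊗ w₂ a c) ⊗ EK (times w₁ (epair 1 a)) (EK (times w₂ (epair a c)) (Φ ∘ (c ∷_))) γ
      lem : ∀ p q r → (p ⊕ (q ⊕ 0ℤ)) ⊕ ((r ⊕ 0ℤ) ⊕ 0ℤ) ≡ p ⊕ (r ⊕ q) ⊕ 0ℤ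
      lem = ℤR.solve-∀
    EK-block {u} {v} {P} {X} {w₁} {w₂} (suc (suc b)) Φ γ S d = trans (EK-two w₁ w₂ Φ B γ)
      (trans (lem (F B B) (F B (suc b)) (F (suc b) (suc b)) (F (suc b) b))
        (cong₂ _⊕_ (cong₂ _⊕_
          (cong₂ _⊗_ (trans (cong₂ _⊗_ full (keep S)) (ℤP.*-identityˡ X)) (EK-Y _ γ (state-kept {a = B} {c = B} S) d))
          (cong₂ _⊕_
            (cong₂ _⊗_ (trans (cong₂ _⊗_ less (trans (second S ≤-refl (here refl)) (cong (v ^ᶻ_) (n∸n≡0 b)))) (ℤP.*-identityʳ u)) (EK-Y _ γ (state-shortened S) d))
            (cong₂ _⊗_ (trans (cong₂ _⊗_ full (shorten S refl)) (ℤP.*-identityˡ P)) (EK-Y _ γ (state-kept {a = B} {c = suc b} S) d))))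
          (cong₂ _⊗_ (cong₂ _⊗_ less (trans (second S ≤-refl (there (here refl))) (trans (cong (v ^ᶻ_) (1+n∸n b)) (ℤP.*-identityʳ v)))) (EK-Y _ γ (state-both S) d))))
      where
      B = suc (suc b)
      full : w₁ B B ≡ 1ℤ
      full = trans (first S ≤-refl (here refl)) (cong (u ^ᶻ_) (n∸n≡0 B))
      less : w₁ B (suc b) ≡ u
      less = trans (first S ≤-refl (there (here refl))) (trans (cong (u ^ᶻ_) (1+n∸n (suc b))) (ℤP.*-identityʳ u))
      F : ℕ → ℕ → ℤ
      F a c = (w₁ B a ⊗ w₂ a c) ⊗ EK (times w₁ (epair B a)) (EK (times w₂ (epair a c)) (Φ ∘ (c ∷_))) γ
      lem : ∀ p q r s → (p ⊕ (q ⊕ 0ℤ)) ⊕ ((r ⊕ (s ⊕ 0ℤ)) ⊕ 0ℤ) ≡ p ⊕ (r ⊕ q) ⊕ s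
      lem = ℤR.solve-∀

  E-E-sorted : ∀ u v Φ β → Desc β → E u (E v Φ) β ≡ E v (E u Φ) β
  E-E-sorted u v Φ []      d = refl
  E-E-sorted u v Φ (b ∷ γ) d = begin
    E u (E v Φ) (b ∷ γ)      ≡⟨ EK-block b Φ γ (initial u v) d ⟩
    block b u v u v 1ℤ Φ γ   ≡⟨ block-comm b u v u v 1ℤ Φ γ ⟩
    block b v u u v 1ℤ Φ γ   ≡⟨ spanned-sym (block-spanned b v u 1ℤ Φ γ) u v ⟩
    block b v u v u 1ℤ Φ γ   ≡⟨ sym (EK-block b Φ γ (initial v u) d) ⟩
    E v (E u Φ) (b ∷ γ)      ∎
    where
    initial : ∀ u v → State b u v v 1ℤ (pw u) (pw v)
    initial u v = state (λ _ _ → refl) (cong (v ^ᶻ_) (n∸n≡0 b))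
      (λ { {b′} refl → trans (cong (v ^ᶻ_) (1+n∸n b′)) (ℤP.*-identityʳ v) }) (λ _ _ → refl)

  E-invariant : ∀ u {Φ} → Invariant Φ → Invariant (E u Φ)
  E-invariant u {Φ} = EK-invariant (pw u) {Φ}

  E-E : ∀ u v Φ → Invariant Φ → ∀ β → E u (E v Φ) β ≡ E v (E u Φ) β
  E-E u v Φ inv = invariant-sorted {E u (E v Φ)} {E v (E u Φ)} (E-invariant u {E v Φ} (E-invariant v {Φ} inv))
    (E-invariant v {E u Φ} (E-invariant u {Φ} inv)) (E-E-sorted u v Φ)

  E-ext : ∀ u {Φ Ψ} → (∀ β → Φ β ≡ Ψ β) → ∀ β → E u Φ β ≡ E u Ψ β
  E-ext u e β = ES.K-cong-Φ (pw u) β (λ α _ → e α)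

  -- Applying both inverses gives `Φ` on either side. The inverses commute by `E-E`, and they can be
  -- cancelled.
  H-H : ∀ u v Φ → Invariant Φ → ∀ β → H u (H v Φ) β ≡ H v (H u Φ) β
  H-H u v Φ inv = E-cancel (⊖ u) (E-cancel (⊖ v) λ β → begin
    E (⊖ v) (E (⊖ u) (H u (H v Φ))) β   ≡⟨ E-ext (⊖ v) (E-H u (H v Φ) (H-invariant v {Φ} inv)) β ⟩
    E (⊖ v) (H v Φ) β                   ≡⟨ E-H v Φ inv β ⟩
    Φ β                                 ≡⟨ sym (E-H u Φ inv β) ⟩
    E (⊖ u) (H u Φ) β                   ≡⟨ sym (E-ext (⊖ u) (E-H v (H u Φ) (H-invariant u {Φ} inv)) β) ⟩
    E (⊖ u) (E (⊖ v) (H v (H u Φ))) β   ≡⟨ E-E (⊖ u) (⊖ v) (H v (H u Φ)) (H-invariant v {H u Φ} (H-invariant u {Φ} inv)) β ⟩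
    E (⊖ v) (E (⊖ u) (H v (H u Φ))) β   ∎)

-- Coefficients in t

pol : ℕ → (ℕ → ℤ) → ℤ → ℤ
pol zero    c u = 0ℤ
pol (suc D) c u = c 0 ⊕ u ⊗ pol D (c ∘ suc) u

pol-cong : ∀ D {c d} u → (∀ k → c k ≡ d k) → pol D c u ≡ pol D d u
pol-cong zero    u e = refl
pol-cong (suc D) u e = cong₂ (λ x y → x ⊕ u ⊗ y) (e 0) (pol-cong D u (e ∘ suc))

pol-zero : ∀ D u → pol D (λ _ → 0ℤ) u ≡ 0ℤ
pol-zero zero    u = refl
pol-zero (suc D) u = trans (ℤP.+-identityˡ _) (trans (cong (u ⊗_) (pol-zero D u)) (ℤP.*-zeroʳ u))

pol-monomial : ∀ D e x u → e < D → pol D (λ k → (e ≡ᵇ k) ▹ x) u ≡ u ^ᶻ e ⊗ x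
pol-monomial (suc D) zero    x u lt = trans (cong (λ z → x ⊕ u ⊗ z) (pol-zero D u)) (trans (cong (x ⊕_) (ℤP.*-zeroʳ u)) (trans (ℤP.+-identityʳ x) (sym (ℤP.*-identityˡ x))))
pol-monomial (suc D) (suc e) x u (s≤s lt) = trans (ℤP.+-identityˡ _) (trans (cong (u ⊗_) (pol-monomial D e x u lt)) (sym (ℤP.*-assoc u _ x)))

pol-⊕ : ∀ D c d u → pol D (λ k → c k ⊕ d k) u ≡ pol D c u ⊕ pol D d u
pol-⊕ zero    c d u = refl
pol-⊕ (suc D) c d u = trans (cong (λ z → c 0 ⊕ d 0 ⊕ u ⊗ z) (pol-⊕ D _ _ u)) (lem (c 0) (d 0) u _ _)
  where
  lem : ∀ a b u x y → a ⊕ b ⊕ u ⊗ (x ⊕ y) ≡ (a ⊕ u ⊗ x) ⊕ (b ⊕ u ⊗ y)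
  lem = ℤR.solve-∀

pol-⊖ : ∀ D c d u → pol D (λ k → c k ⊕ ⊖ d k) u ≡ pol D c u ⊕ ⊖ pol D d u
pol-⊖ zero    c d u = refl
pol-⊖ (suc D) c d u = trans (cong (λ z → c 0 ⊕ ⊖ d 0 ⊕ u ⊗ z) (pol-⊖ D _ _ u)) (lem (c 0) (d 0) u _ _)
  where
  lem : ∀ a b u x y → a ⊕ ⊖ b ⊕ u ⊗ (x ⊕ ⊖ y) ≡ (a ⊕ u ⊗ x) ⊕ ⊖ (b ⊕ u ⊗ y)
  lem = ℤR.solve-∀

pol-∑ : {A : Set} → ∀ D (xs : List A) (c : A → ℕ → ℤ) u → pol D (λ k → ∑ xs (λ x → c x k)) u ≡ ∑ xs (λ x → pol D (c x) u)
pol-∑ D []       c u = pol-zero D u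
pol-∑ D (x ∷ xs) c u = trans (pol-⊕ D (c x) _ u) (cong (pol D (c x) u ⊕_) (pol-∑ D xs c u))

-- If d ⊕ u ⊗ p vanishes at u = ∣ d ∣ + 1, then u divides d, so d = 0.
pol-vanish : ∀ D c → (∀ n → pol D c (pos (suc n)) ≡ 0ℤ) → ∀ k → k < D → c k ≡ 0ℤ
pol-vanish (suc D) c e = λ { zero _ → c₀ ; (suc k) (s≤s lt) → pol-vanish D (c ∘ suc) rest k lt }
  where
  open Data.Integer using (∣_∣)
  small : ∀ m q → m ≡ suc m * q → m ≡ 0
  small m zero    eq = trans eq (*-zeroʳ (suc m))
  small m (suc q) eq = ⊥-elim (<-irrefl eq (m≤m*n (suc m) (suc q)))
  c₀ : c 0 ≡ 0ℤ
  c₀ = ℤP.∣i∣≡0⇒i≡0 (small ∣ c 0 ∣ ∣ pol D (c ∘ suc) u ∣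
    (trans (cong ∣_∣ (trans (lem (c 0) (u ⊗ pol D (c ∘ suc) u)) (trans (cong (_⊕ ⊖ (u ⊗ pol D (c ∘ suc) u)) (e ∣ c 0 ∣)) (ℤP.+-identityˡ (⊖ (u ⊗ pol D (c ∘ suc) u))))))
    (trans (ℤP.∣-i∣≡∣i∣ (u ⊗ pol D (c ∘ suc) u)) (ℤP.abs-* u (pol D (c ∘ suc) u)))))
    where
    u = pos (suc ∣ c 0 ∣)
    lem : ∀ a b → a ≡ a ⊕ b ⊕ ⊖ b
    lem = ℤR.solve-∀
  rest : ∀ n → pol D (c ∘ suc) (pos (suc n)) ≡ 0ℤ
  rest n = ℤP.*-cancelˡ-≡ (pos (suc n)) _ 0ℤ (trans (sym (ℤP.+-identityˡ _))
    (trans (cong (_⊕ pos (suc n) ⊗ pol D (c ∘ suc) (pos (suc n))) (sym c₀)) (trans (e n) (sym (ℤP.*-zeroʳ (pos (suc n)))))))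

pol-injective : ∀ D c d → (∀ n → pol D c (pos (suc n)) ≡ pol D d (pos (suc n))) → ∀ k → k < D → c k ≡ d k
pol-injective D c d e k lt = ℤP.i-j≡0⇒i≡j (c k) (d k) (pol-vanish D (λ k → c k ⊕ ⊖ d k)
  (λ n → trans (pol-⊖ D c d _) (trans (cong (λ z → z ⊕ ⊖ pol D d (pos (suc n))) (e n)) (ℤP.i≡j⇒i-j≡0 {pol D d (pos (suc n))} refl))) k lt)

≡ᵇ-+ : ∀ k m n → (k + m ≡ᵇ k + n) ≡ (m ≡ᵇ n)
≡ᵇ-+ zero    m n = refl
≡ᵇ-+ (suc k) m n = ≡ᵇ-+ k m n

▹-cong : ∀ b {x y} → (b ≡ true → x ≡ y) → b ▹ x ≡ b ▹ y
▹-cong true  e = e refl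
▹-cong false e = refl

▹-false : ∀ {b} x → b ≡ false → b ▹ x ≡ 0ℤ
▹-false x refl = refl

>⇒≡ᵇ-false : ∀ {m n} → n < m → (m ≡ᵇ n) ≡ false
>⇒≡ᵇ-false lt = ≢⇒≡ᵇ-false (λ e → <-irrefl (sym e) lt)

∑-downTo-splits : ∀ r m f → (∀ a → a < m → f a ≡ 0ℤ) → ∑ (downTo (r + m)) f ≡ ∑ (splits r) (λ p → f (proj₂ p + m))
∑-downTo-splits zero zero    f z = refl
∑-downTo-splits zero (suc m) f z = cong (f (suc m) ⊕_) (trans (∑-cong∈ (downTo m) (λ a∈ → z _ (s≤s (downTo⁻ a∈)))) (∑-0 (downTo m)))
∑-downTo-splits (suc r) m f z = cong (f (suc (r + m)) ⊕_) (trans (∑-downTo-splits r m f z) (sym (∑-map _ (splits r) _)))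

∑-downTo-0 : ∀ b f → (∀ a → f (suc a) ≡ 0ℤ) → ∑ (downTo b) f ≡ f 0
∑-downTo-0 zero    f z = ℤP.+-identityʳ _
∑-downTo-0 (suc b) f z = trans (cong₂ _⊕_ (z b) (∑-downTo-0 b f z)) (ℤP.+-identityˡ _)

-- Strips of fixed size and the recursion for tabloids

module Shapes (t : ℤ) where
  open Strips t
  open Blocks t

  one : ℕ → ℕ → ℤ
  one _ _ = 1ℤ

  -- The coefficient of `u ^ᶻ r` in `H u`, by `H-pol`.
  Hr : ℕ → (List ℕ → ℤ) → List ℕ → ℤ
  Hr r Φ β = HK one (λ α → (sum β ≡ᵇ r + sum α) ▹ Φ α) β

  ⊑-down : ∀ {b α γ} → α HS.⊑ γ → All (_≤ b) γ → All (_≤ b) α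
  ⊑-down []      []         = []
  ⊑-down (a ∷ s) (le ∷ les) = ≤-trans (downTo⁻ a) le ∷ ⊑-down s les

  ⊑-sum-down : ∀ {α β} → α HS.⊑ β → sum α ≤ sum β
  ⊑-sum-down []      = z≤n
  ⊑-sum-down (a ∷ s) = +-mono-≤ (downTo⁻ a) (⊑-sum-down s)

  HK-pw : ∀ u w Φ β → HK (λ y j → w y j ⊗ pw u y j) Φ β ≡ HK w (λ α → u ^ᶻ (sum β ∸ sum α) ⊗ Φ α) β
  HK-pw u w Φ []      = sym (ℤP.*-identityˡ (Φ []))
  HK-pw u w Φ (b ∷ β) = ∑-cong∈ (downTo b) λ {a} a∈ → begin
    (w b a ⊗ pw u b a) ⊗ HK (times (λ y j → w y j ⊗ pw u y j) (hpair b a)) (Φ ∘ (a ∷_)) β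
      ≡⟨ cong ((w b a ⊗ pw u b a) ⊗_) (trans (HS.K-cong-w _ β (All.tabulate (λ {y} _ {j} _ → swap₃ (w y j) (pw u y j) _))) (HK-pw u (times w (hpair b a)) _ β)) ⟩
    (w b a ⊗ pw u b a) ⊗ HK (times w (hpair b a)) (λ α → u ^ᶻ (sum β ∸ sum α) ⊗ Φ (a ∷ α)) β
      ≡⟨ trans (ℤP.*-assoc (w b a) _ _) (cong (w b a ⊗_) (sym (HS.K-⊗ _ (pw u b a) _ β))) ⟩
    w b a ⊗ HK (times w (hpair b a)) (λ α → pw u b a ⊗ (u ^ᶻ (sum β ∸ sum α) ⊗ Φ (a ∷ α))) β
      ≡⟨ cong (w b a ⊗_) (HS.K-cong-Φ _ β (λ α s → trans (sym (ℤP.*-assoc (pw u b a) _ _)) (cong (_⊗ Φ (a ∷ α))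
           (trans (sym (ℤP.^-distribˡ-+-* u (b ∸ a) _)) (cong (u ^ᶻ_) (exponent (downTo⁻ a∈) (⊑-sum-down s))))))) ⟩
    w b a ⊗ HK (times w (hpair b a)) (λ α → u ^ᶻ (b + sum β ∸ (a + sum α)) ⊗ Φ (a ∷ α)) β ∎
    where
    swap₃ : ∀ x y z → (x ⊗ y) ⊗ z ≡ (x ⊗ z) ⊗ y
    swap₃ = ℤR.solve-∀
    exponent : ∀ {a b m n} → a ≤ b → m ≤ n → (b ∸ a) + (n ∸ m) ≡ b + n ∸ (a + m)
    exponent {a} {b} {m} {n} a≤b m≤n = sym (trans (cong₂ (λ x y → x + y ∸ (a + m)) (sym (m∸n+n≡m a≤b)) (sym (m∸n+n≡m m≤n)))
      (trans (cong (_∸ (a + m)) (lem (b ∸ a) a (n ∸ m) m)) (m+n∸n≡m _ (a + m))))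
      where
      lem : ∀ x a y m → (x + a) + (y + m) ≡ (x + y) + (a + m)
      lem = ℕR.solve-∀

  HK-pol : ∀ w D (c : List ℕ → ℕ → ℤ) u β → HK w (λ α → pol D (c α) u) β ≡ pol D (λ r → HK w (λ α → c α r) β) u
  HK-pol w zero    c u β = trans (HS.K-⊗ w 0ℤ (λ _ → 0ℤ) β) refl
  HK-pol w (suc D) c u β = trans (HS.K-⊕ w (λ α → c α 0) _ β)
    (cong (HK w (λ α → c α 0) β ⊕_) (trans (HS.K-⊗ w u _ β) (cong (u ⊗_) (HK-pol w D (λ α → c α ∘ suc) u β))))

  H-pol : ∀ D u Φ β → sum β < D → H u Φ β ≡ pol D (λ r → Hr r Φ β) u
  H-pol D u Φ β lt = begin
    H u Φ β                                                 ≡⟨ HS.K-cong-w Φ β (All.tabulate (λ _ _ → sym (ℤP.*-identityˡ _))) ⟩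
    HK (λ y j → 1ℤ ⊗ pw u y j) Φ β                          ≡⟨ HK-pw u one Φ β ⟩
    HK one (λ α → u ^ᶻ (sum β ∸ sum α) ⊗ Φ α) β             ≡⟨ HS.K-cong-Φ one β (λ α s → trans (sym (pol-monomial D _ (Φ α) u (≤-<-trans (m∸n≤m (sum β) (sum α)) lt)))
                                                                 (pol-cong D u (λ r → cong (_▹ Φ α) (shift r (⊑-sum-down s))))) ⟩
    HK one (λ α → pol D (λ r → (sum β ≡ᵇ r + sum α) ▹ Φ α) u) β ≡⟨ HK-pol one D (λ α r → (sum β ≡ᵇ r + sum α) ▹ Φ α) u β ⟩
    pol D (λ r → Hr r Φ β) u                                ∎
    where
    shift : ∀ r {m n} → m ≤ n → (n ∸ m ≡ᵇ r) ≡ (n ≡ᵇ r + m)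
    shift r {m} {n} le = trans (sym (≡ᵇ-+ m (n ∸ m) r)) (cong₂ _≡ᵇ_ (m+[n∸m]≡n le) (+-comm m r))

  Hr-cong : ∀ r {Φ Ψ} β → (∀ α → α HS.⊑ β → sum β ≡ r + sum α → Φ α ≡ Ψ α) → Hr r Φ β ≡ Hr r Ψ β
  Hr-cong r β e = HS.K-cong-Φ one β (λ α s → ▹-cong (sum β ≡ᵇ r + sum α) (λ c → e α s (≡ᵇ-true⇒≡ c)))

  Hr-pol : ∀ s D (c : List ℕ → ℕ → ℤ) u β → Hr s (λ α → pol D (c α) u) β ≡ pol D (λ r → Hr s (λ α → c α r) β) u
  Hr-pol s D c u β = trans (HS.K-cong-Φ one β (λ α _ → pol-▹ D (sum β ≡ᵇ s + sum α) (c α) u)) (HK-pol one D (λ α r → (sum β ≡ᵇ s + sum α) ▹ c α r) u β)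
    where
    pol-▹ : ∀ D b c u → b ▹ pol D c u ≡ pol D (λ r → b ▹ c r) u
    pol-▹ D true  c u = refl
    pol-▹ D false c u = sym (pol-zero D u)

  -- The coefficients in the two variables of `H-H` are extracted one after the other. `D` exceeds
  -- the size of every shape involved and both `r` and `s`.
  Hr-Hr : ∀ r s Φ → Invariant Φ → ∀ β → Hr r (Hr s Φ) β ≡ Hr s (Hr r Φ) β
  Hr-Hr r s Φ inv β = pol-injective D (λ s → Hr r (Hr s Φ) β) (λ s → Hr s (Hr r Φ) β) (λ n → begin
    pol D (λ s → Hr r (Hr s Φ) β) (pos (suc n)) ≡⟨ sym (Hr-pol r D (λ α s → Hr s Φ α) (pos (suc n)) β) ⟩
    Hr r (λ α → pol D (λ s → Hr s Φ α) (pos (suc n))) β ≡⟨ Hr-cong r β (λ α sub _ → sym (H-pol D (pos (suc n)) Φ α (bound sub))) ⟩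
    Hr r (H (pos (suc n)) Φ) β                  ≡⟨ outer (pos (suc n)) ⟩
    H (pos (suc n)) (Hr r Φ) β                  ≡⟨ H-pol D (pos (suc n)) (Hr r Φ) β (s≤s (m≤m+n _ _)) ⟩
    pol D (λ s → Hr s (Hr r Φ) β) (pos (suc n)) ∎) s (s≤s (≤-trans (m≤n+m s r) (m≤n+m (r + s) (sum β))))
    where
    D = suc (sum β + (r + s))
    bound : ∀ {α} → α HS.⊑ β → sum α < D
    bound sub = s≤s (≤-trans (⊑-sum-down sub) (m≤m+n _ _))
    outer : ∀ v → Hr r (H v Φ) β ≡ H v (Hr r Φ) β
    outer v = pol-injective D (λ r → Hr r (H v Φ) β) (λ r → H v (Hr r Φ) β) (λ n → begin
      pol D (λ r → Hr r (H v Φ) β) (pos (suc n)) ≡⟨ sym (H-pol D (pos (suc n)) (H v Φ) β (s≤s (m≤m+n _ _))) ⟩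
      H (pos (suc n)) (H v Φ) β                  ≡⟨ H-H (pos (suc n)) v Φ inv β ⟩
      H v (H (pos (suc n)) Φ) β                  ≡⟨ HS.K-cong-Φ _ β (λ α sub → H-pol D (pos (suc n)) Φ α (bound sub)) ⟩
      H v (λ α → pol D (λ r → Hr r Φ α) (pos (suc n))) β ≡⟨ HK-pol (pw v) D (λ α r → Hr r Φ α) (pos (suc n)) β ⟩
      pol D (λ r → H v (Hr r Φ) β) (pos (suc n)) ∎) r (s≤s (≤-trans (m≤m+n r s) (m≤n+m (r + s) (sum β))))

  Hr-invariant : ∀ r {Φ} → Invariant Φ → Invariant (Hr r Φ)
  Hr-invariant r {Φ} inv xs x y zs = trans
    (HK-invariant one {λ α → (sum (xs ++ x ∷ y ∷ zs) ≡ᵇ r + sum α) ▹ Φ α} (λ _ _ _ _ → refl)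
      (λ as i j bs → cong₂ (λ m z → (sum (xs ++ x ∷ y ∷ zs) ≡ᵇ r + m) ▹ z) (sum-swap as i j bs) (inv as i j bs)) xs x y zs)
    (HS.K-cong-Φ one (xs ++ y ∷ x ∷ zs) (λ α _ → cong (λ m → (m ≡ᵇ r + sum α) ▹ Φ α) (sum-swap xs x y zs)))
    where
    sum-swap : ∀ xs x y zs → sum (xs ++ x ∷ y ∷ zs) ≡ sum (xs ++ y ∷ x ∷ zs)
    sum-swap []       x y zs = trans (sym (+-assoc x y _)) (trans (cong (_+ sum zs) (+-comm x y)) (+-assoc y x _))
    sum-swap (a ∷ xs) x y zs = cong (a +_) (sum-swap xs x y zs)

  FF : List ℕ → List ℕ → ℤ
  FF β []      = (sum β ≡ᵇ 0) ▹ 1ℤ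
  FF β (r ∷ τ) = Hr r (λ α → FF α τ) β

  FF-invariant : ∀ τ → Invariant (λ β → FF β τ)
  FF-invariant []      xs x y zs = cong (λ m → (m ≡ᵇ 0) ▹ 1ℤ) (LAP.sum-↭ (PermP.++⁺ˡ xs (swap x y ↭-refl)))
  FF-invariant (r ∷ τ) = Hr-invariant r {λ α → FF α τ} (FF-invariant τ)

  FF-↭ : ∀ β {τ τ′} → τ ↭ τ′ → FF β τ ≡ FF β τ′
  FF-↭ β Perm.refl        = refl
  FF-↭ β (prep r p)       = Hr-cong r β (λ α _ _ → FF-↭ α p)
  FF-↭ β (swap {τ} r s p) = trans (Hr-Hr r s (λ α → FF α τ) (FF-invariant τ) β) (Hr-cong s β (λ α _ _ → Hr-cong r α (λ α _ _ → FF-↭ α p)))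
  FF-↭ β (Perm.trans p q) = trans (FF-↭ β p) (FF-↭ β q)

  Hr-⊗ : ∀ r c Φ β → Hr r (λ α → c ⊗ Φ α) β ≡ c ⊗ Hr r Φ β
  Hr-⊗ r c Φ β = trans (HS.K-cong-Φ one β (λ α _ → sym (▹-⊗ (sum β ≡ᵇ r + sum α) c (Φ α)))) (HS.K-⊗ one c _ β)

  Hr-∑ : ∀ {A : Set} r (xs : List A) (F : A → List ℕ → ℤ) β → Hr r (λ α → ∑ xs (λ x → F x α)) β ≡ ∑ xs (λ x → Hr r (F x) β)
  Hr-∑ r xs F β = trans (HS.K-cong-Φ one β (λ α _ → sym (∑-▹ xs (sum β ≡ᵇ r + sum α) _))) (HS.K-∑ one xs _ β)

  -- A strip of size `r` cannot cut the first row below `m`, and no other row is longer than `m`. So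
  -- each of the `j` cells cut elsewhere forms a pair with the end of the first row, and the first
  -- row contributes no further pairs.
  FF-peel : ∀ m r ρ μ → All (_≤ m) ρ →
    FF (m + r ∷ ρ) (r ∷ μ) ≡ ∑ (splits r) (λ p → t ^ᶻ proj₂ p ⊗ Hr (proj₂ p) (λ α → FF (m + proj₂ p ∷ α) μ) ρ)
  FF-peel m r ρ μ le = trans (cong (λ n → FF (n ∷ ρ) (r ∷ μ)) (+-comm m r))
    (trans (∑-downTo-splits r m _ (λ a lt → trans (ℤP.*-identityˡ _) (trans (HS.K-cong-Φ _ ρ (λ α s → ▹-false _ (low a lt α s))) (HS.K-⊗ _ 0ℤ (λ _ → 0ℤ) ρ))))
      (∑-cong (splits r) (λ p → body (proj₂ p))))
    where
    low : ∀ a → a < m → ∀ α → α HS.⊑ ρ → (r + m + sum ρ ≡ᵇ r + (a + sum α)) ≡ false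
    low a lt α s = trans (cong (_≡ᵇ r + (a + sum α)) (+-assoc r m (sum ρ))) (trans (≡ᵇ-+ r (m + sum ρ) (a + sum α))
      (>⇒≡ᵇ-false (+-mono-<-≤ lt (⊑-sum-down s))))
    body : ∀ j → 1ℤ ⊗ HK (times one (hpair (r + m) (j + m))) (λ α → (r + m + sum ρ ≡ᵇ r + (j + m + sum α)) ▹ FF (j + m ∷ α) μ) ρ ≡
      t ^ᶻ j ⊗ Hr j (λ α → FF (m + j ∷ α) μ) ρ
    body j = begin
      1ℤ ⊗ HK (times one (hpair (r + m) (j + m))) (λ α → (r + m + sum ρ ≡ᵇ r + (j + m + sum α)) ▹ FF (j + m ∷ α) μ) ρ
        ≡⟨ ℤP.*-identityˡ _ ⟩
      HK (times one (hpair (r + m) (j + m))) (λ α → (r + m + sum ρ ≡ᵇ r + (j + m + sum α)) ▹ FF (j + m ∷ α) μ) ρ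
        ≡⟨ HS.K-cong ρ (All.map (λ y≤m {k} j∈ → cong (λ n → 1ℤ ⊗ t ^ᶻ n) (pairs y≤m (downTo⁻ j∈))) le)
             (λ α _ → cong₂ (λ b n → b ▹ FF (n ∷ α) μ) (cond α) (+-comm j m)) ⟩
      HK (λ y k → 1ℤ ⊗ pw t y k) (λ α → (sum ρ ≡ᵇ j + sum α) ▹ FF (m + j ∷ α) μ) ρ
        ≡⟨ HK-pw t one _ ρ ⟩
      HK one (λ α → t ^ᶻ (sum ρ ∸ sum α) ⊗ ((sum ρ ≡ᵇ j + sum α) ▹ FF (m + j ∷ α) μ)) ρ
        ≡⟨ HS.K-cong-Φ one ρ (λ α _ → trans (▹-⊗ (sum ρ ≡ᵇ j + sum α) (t ^ᶻ (sum ρ ∸ sum α)) (FF (m + j ∷ α) μ)) (▹-cong (sum ρ ≡ᵇ j + sum α)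
             (λ e → cong (λ n → t ^ᶻ n ⊗ FF (m + j ∷ α) μ) (trans (cong (_∸ sum α) (≡ᵇ-true⇒≡ {sum ρ} e)) (m+n∸n≡m j (sum α)))))) ⟩
      Hr j (λ α → t ^ᶻ j ⊗ FF (m + j ∷ α) μ) ρ
        ≡⟨ Hr-⊗ j (t ^ᶻ j) _ ρ ⟩
      t ^ᶻ j ⊗ Hr j (λ α → FF (m + j ∷ α) μ) ρ ∎
      where
      pairs : ∀ {y k} → y ≤ m → k ≤ y → hpair (r + m) (j + m) y k ≡ y ∸ k
      pairs {y} {k} y≤m k≤y = trans (cong₂ (λ a b → (a ∸ k) + b) (m≤n⇒m⊓n≡m (≤-trans y≤m (m≤n+m m j)))
        (m≤n⇒m∸n≡0 (≤-trans (m⊓n≤n (r + m) (k ∸ 1)) (≤-trans (m∸n≤m k 1) (≤-trans k≤y (≤-trans y≤m (m≤n+m m j))))))) (+-identityʳ _)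
      cond : ∀ α → (r + m + sum ρ ≡ᵇ r + (j + m + sum α)) ≡ (sum ρ ≡ᵇ j + sum α)
      cond α = trans (cong₂ _≡ᵇ_ (+-assoc r m (sum ρ)) (cong (r +_) (lem j m (sum α)))) (trans (≡ᵇ-+ r (m + sum ρ) _) (≡ᵇ-+ m (sum ρ) _))
        where
        lem : ∀ j m a → j + m + a ≡ m + (j + a)
        lem = ℕR.solve-∀

  HK-empty : ∀ w β → (∀ y → w y 0 ≡ 1ℤ) → HK w (λ α → (sum α ≡ᵇ 0) ▹ 1ℤ) β ≡ 1ℤ
  HK-empty w []      e = refl
  HK-empty w (b ∷ β) e = trans (∑-downTo-0 b _ (λ a → trans (cong (w b (suc a) ⊗_) (HS.K-⊗ _ 0ℤ (λ _ → 0ℤ) β)) (ℤP.*-zeroʳ (w b (suc a)))))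
    (cong₂ _⊗_ (e b) (HK-empty _ β (λ y → cong₂ _⊗_ (e y) (cong (t ^ᶻ_) (cong₂ _+_ (⊓-zeroʳ y) (⊓-zeroʳ b))))))

  FF-single : ∀ β r → FF β (r ∷ []) ≡ (sum β ≡ᵇ r) ▹ 1ℤ
  FF-single β r = begin
    HK one (λ α → (sum β ≡ᵇ r + sum α) ▹ (sum α ≡ᵇ 0) ▹ 1ℤ) β   ≡⟨ HS.K-cong-Φ one β (λ α _ → trans (▹-comm (sum β ≡ᵇ r + sum α) (sum α ≡ᵇ 0) 1ℤ) (trans
        (▹-cong (sum α ≡ᵇ 0) (λ e → cong (λ n → (sum β ≡ᵇ n) ▹ 1ℤ) (trans (cong (r +_) (≡ᵇ-true⇒≡ {sum α} e)) (+-identityʳ r)))) (trans (▹-comm (sum α ≡ᵇ 0) (sum β ≡ᵇ r) 1ℤ) (▹-as-⊗ (sum β ≡ᵇ r) _)))) ⟩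
    HK one (λ α → ((sum β ≡ᵇ r) ▹ 1ℤ) ⊗ ((sum α ≡ᵇ 0) ▹ 1ℤ)) β ≡⟨ HS.K-⊗ one ((sum β ≡ᵇ r) ▹ 1ℤ) _ β ⟩
    ((sum β ≡ᵇ r) ▹ 1ℤ) ⊗ HK one (λ α → (sum α ≡ᵇ 0) ▹ 1ℤ) β   ≡⟨ cong (((sum β ≡ᵇ r) ▹ 1ℤ) ⊗_) (HK-empty one β (λ _ → refl)) ⟩
    ((sum β ≡ᵇ r) ▹ 1ℤ) ⊗ 1ℤ                                   ≡⟨ ℤP.*-identityʳ _ ⟩
    (sum β ≡ᵇ r) ▹ 1ℤ                                          ∎
    where
    ▹-as-⊗ : ∀ b x → b ▹ x ≡ (b ▹ 1ℤ) ⊗ x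
    ▹-as-⊗ true  x = sym (ℤP.*-identityˡ x)
    ▹-as-⊗ false x = refl

  HK-keep : ∀ w Φ β → (∀ y → w y y ≡ 1ℤ) → HK w (λ α → (sum β ≡ᵇ sum α) ▹ Φ α) β ≡ Φ β
  HK-keep w Φ []      e = refl
  HK-keep w Φ (b ∷ β) e = trans keep (trans (cong₂ _⊗_ (e b)
      (trans (HS.K-cong-Φ _ β (λ α _ → cong (_▹ Φ (b ∷ α)) (≡ᵇ-+ b (sum β) (sum α)))) (HK-keep _ (Φ ∘ (b ∷_)) β
        (λ y → cong₂ _⊗_ (e y) (cong (t ^ᶻ_) (cong₂ _+_ (m≤n⇒m∸n≡0 (m⊓n≤m y b)) (m≤n⇒m∸n≡0 (m⊓n≤m b (y ∸ 1)))))))))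
      (ℤP.*-identityˡ _))
    where
    F : ℕ → ℤ
    F a = w b a ⊗ HK (times w (hpair b a)) (λ α → (b + sum β ≡ᵇ a + sum α) ▹ Φ (a ∷ α)) β
    keep : ∑ (downTo b) F ≡ F b
    keep = trans (∑-downTo-splits 0 b F (λ a lt → trans (cong (w b a ⊗_) (trans (HS.K-cong-Φ _ β (λ α s → ▹-false _ (>⇒≡ᵇ-false (+-mono-<-≤ lt (⊑-sum-down s)))))
      (HS.K-⊗ _ 0ℤ (λ _ → 0ℤ) β))) (ℤP.*-zeroʳ (w b a)))) (ℤP.+-identityʳ _)

  Hr-zero : ∀ Φ β → Hr 0 Φ β ≡ Φ β
  Hr-zero Φ β = HK-keep one Φ β (λ _ → refl)

  Hr-vanish : ∀ r Φ β → (∀ α → sum β ≡ r + sum α → Φ α ≡ 0ℤ) → Hr r Φ β ≡ 0ℤ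
  Hr-vanish r Φ β e = trans (Hr-cong r β (λ α _ → e α)) (Hr-⊗ r 0ℤ (λ _ → 0ℤ) β)

  -- The tabloid counterpart of a word prefix without 1: strips of sizes `σ` have been cut from the
  -- rows below the first, at the cost of `t` for each cell.
  FV : List ℕ → ℕ → List ℕ → List ℕ → ℤ
  FV ρ m []      μ = FF (m ∷ ρ) μ
  FV ρ m (s ∷ σ) μ = t ^ᶻ s ⊗ Hr s (λ α → FV α m σ μ) ρ

  FV-peel : ∀ ρ m r σ μ → All (_≤ m) ρ → FV ρ (m + r) σ (r ∷ μ) ≡ ∑ (splits r) (λ p → FV ρ (m + proj₂ p) (σ ++ proj₂ p ∷ []) μ)
  FV-peel ρ m r []      μ le = FF-peel m r ρ μ le
  FV-peel ρ m r (s ∷ σ) μ le = trans (cong (t ^ᶻ s ⊗_) (trans (Hr-cong s ρ (λ α sub _ → FV-peel α m r σ μ (⊑-down sub le)))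
    (Hr-∑ s (splits r) (λ p α → FV α (m + proj₂ p) (σ ++ proj₂ p ∷ []) μ) ρ))) (sym (∑-⊗ (splits r) (t ^ᶻ s) _))

  FV-↭ : ∀ ρ m σ {μ μ′} → μ ↭ μ′ → FV ρ m σ μ ≡ FV ρ m σ μ′
  FV-↭ ρ m []      p = FF-↭ (m ∷ ρ) p
  FV-↭ ρ m (s ∷ σ) p = cong (t ^ᶻ s ⊗_) (Hr-cong s ρ (λ α _ _ → FV-↭ α m σ p))

  FV-drop : ∀ ρ m σ μ → FV ρ m (σ ++ 0 ∷ []) μ ≡ FV ρ m σ μ
  FV-drop ρ m []      μ = trans (ℤP.*-identityˡ _) (Hr-zero _ ρ)
  FV-drop ρ m (s ∷ σ) μ = cong (t ^ᶻ s ⊗_) (Hr-cong s ρ (λ α _ _ → FV-drop α m σ μ))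

  FV-vanish : ∀ ρ m σ μ → sum ρ < sum σ → FV ρ m σ μ ≡ 0ℤ
  FV-vanish ρ m (s ∷ σ) μ lt = trans (cong (t ^ᶻ s ⊗_) (Hr-vanish s _ ρ (λ α e → FV-vanish α m σ μ (+-cancelˡ-< s _ _ (subst (_< s + sum σ) e lt))))) (ℤP.*-zeroʳ (t ^ᶻ s))

  FV-base : ∀ ρ x y σ → FV ρ x σ (x + y ∷ []) ≡ t ^ᶻ sum σ ⊗ FF ρ (y ∷ σ)
  FV-base ρ x y σ = trans (go ρ σ) (cong (t ^ᶻ sum σ ⊗_) (FF-↭ ρ (PermP.++-comm σ (y ∷ []))))
    where
    go : ∀ ρ σ → FV ρ x σ (x + y ∷ []) ≡ t ^ᶻ sum σ ⊗ FF ρ (σ ++ y ∷ [])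
    go ρ []      = trans (FF-single (x ∷ ρ) (x + y)) (trans (cong (_▹ 1ℤ) (≡ᵇ-+ x (sum ρ) y)) (sym (trans (ℤP.*-identityˡ _) (FF-single ρ y))))
    go ρ (s ∷ σ) = trans (cong (t ^ᶻ s ⊗_) (trans (Hr-cong s ρ (λ α _ _ → go α σ)) (Hr-⊗ s (t ^ᶻ sum σ) _ ρ)))
      (trans (sym (ℤP.*-assoc (t ^ᶻ s) _ _)) (cong (_⊗ FF ρ (s ∷ σ ++ y ∷ [])) (sym (ℤP.^-distribˡ-+-* t s (sum σ)))))

  FV-base-< : ∀ ρ x r σ → r < x → FV ρ x σ (r ∷ []) ≡ 0ℤ
  FV-base-< ρ x r []      lt = trans (FF-single (x ∷ ρ) r) (▹-false 1ℤ (>⇒≡ᵇ-false (<-≤-trans lt (m≤m+n x (sum ρ)))))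
  FV-base-< ρ x r (s ∷ σ) lt = trans (cong (t ^ᶻ s ⊗_) (Hr-vanish s _ ρ (λ α _ → FV-base-< α x r σ lt))) (ℤP.*-zeroʳ (t ^ᶻ s))

-- Sums over words

contentOk⁻ : ∀ i la w → contentOk i la w ≡ true → ∀ j → j < length la → count (i + j) w ≡ nth la j
contentOk⁻ i (m ∷ la) w e zero    lt = trans (cong (λ k → count k w) (+-identityʳ i)) (≡ᵇ-true⇒≡ (proj₁ (∧-true⁻ e)))
contentOk⁻ i (m ∷ la) w e (suc j) (s≤s lt) =
  trans (cong (λ k → count k w) (+-suc i j)) (contentOk⁻ (suc i) la w (proj₂ (∧-true⁻ {count i w ≡ᵇ m} e)) j lt)

contentOk⁺ : ∀ i la w → (∀ j → j < length la → count (i + j) w ≡ nth la j) → contentOk i la w ≡ true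
contentOk⁺ i []       w e = refl
contentOk⁺ i (m ∷ la) w e = ∧-true⁺ (trans (cong (_≡ᵇ m) (trans (cong (λ k → count k w) (sym (+-identityʳ i))) (e 0 z<s))) (≡ᵇ-refl m))
  (contentOk⁺ (suc i) la w (λ j lt → trans (cong (λ k → count k w) (sym (+-suc i j))) (e (suc j) (s<s lt))))

Good : List ℕ → List ℕ → Set
Good la w = Letters (length la) w × Content w la

letters-count : ∀ {N w} j → Letters N w → N ≤ j → count (suc j) w ≡ 0
letters-count {N} {w} j l N≤j = count-∉ (suc j) w (λ m → <⇒≱ (s≤s N≤j) (proj₂ (All.lookup l m)))

abstract
  good? : ∀ la w → Dec (Good la w)
  good? la w with All.all? (λ x → (1 ≤? x) ×-dec (x ≤? length la)) w | contentOk 1 la w in eq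
  ... | no ¬l | _     = no (¬l ∘ proj₁)
  ... | yes l | true  = yes (l , λ j → [ contentOk⁻ 1 la w eq j , (λ le → trans (letters-count j l le) (sym (nth-out la j le))) ]′ (<-≤-connex j (length la)))
  ... | yes l | false = no (λ (_ , c) → absurd (trans (sym eq) (contentOk⁺ 1 la w (λ j _ → c j))))
    where
    absurd : false ≡ true → ⊥
    absurd ()

count-map-suc : ∀ i w → count (suc i) (map suc w) ≡ count i w
count-map-suc i []      = refl
count-map-suc i (x ∷ w) with i ≟ x
... | yes refl = trans (count-∷-≡ (suc i) (map suc w)) (trans (cong suc (count-map-suc i w)) (sym (count-∷-≡ i w)))
... | no  i≢x  = trans (count-∷-≢ (map suc w) (i≢x ∘ suc-injective)) (trans (count-map-suc i w) (sym (count-∷-≢ w i≢x)))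

count-replicate-≡ : ∀ i n → count i (replicate n i) ≡ n
count-replicate-≡ i zero    = refl
count-replicate-≡ i (suc n) = trans (count-∷-≡ i (replicate n i)) (cong suc (count-replicate-≡ i n))

count-replicate-≢ : ∀ {i x} n → i ≢ x → count i (replicate n x) ≡ 0
count-replicate-≢         zero    ne = refl
count-replicate-≢ {i} {x} (suc n) ne = trans (count-∷-≢ (replicate n x) ne) (count-replicate-≢ n ne)

wd-suc : ∀ k v → wd (suc k) v ≡ map suc (wd k v)
wd-suc k []      = refl
wd-suc k (m ∷ v) = trans (cong₂ _++_ (sym (LP.map-replicate suc m k)) (wd-suc (suc k) v)) (sym (LP.map-++ suc (replicate m k) _))

wd-letters : ∀ k v → All (λ x → k ≤ x × x < k + length v) (wd k v)
wd-letters k []      = []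
wd-letters k (m ∷ v) = AllP.++⁺ (AllP.replicate⁺ m (≤-refl , m<m+n k z<s))
  (All.map (λ {x} (p , q) → <⇒≤ p , subst (x <_) (sym (+-suc k (length v))) q) (wd-letters (suc k) v))

wd-length : ∀ k v → length (wd k v) ≡ sum v
wd-length k []      = refl
wd-length k (m ∷ v) = trans (LP.length-++ (replicate m k)) (cong₂ _+_ (LP.length-replicate m) (wd-length (suc k) v))

Letters-vec : ∀ {N r v} → v ∈ vecs N r → Letters N (wd 1 v) × length (wd 1 v) ≡ r
Letters-vec {N} {r} {v} m with vecs⁻ {N} {r} m
... | refl , refl = All.map (λ (p , q) → p , s≤s⁻¹ q) (wd-letters 1 v) , wd-length 1 v

WS : ℕ → List ℕ → (List ℕ → ℤ) → ℤ
WS N []      f = f []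
WS N (r ∷ τ) f = ∑ (vecs N r) (λ B → WS N τ (λ w → f (wd 1 B ++ w)))

WS-cong : ∀ N τ {f f′} → (∀ w → Letters N w → length w ≡ sum τ → f w ≡ f′ w) → WS N τ f ≡ WS N τ f′
WS-cong N []      e = e [] [] refl
WS-cong N (r ∷ τ) e = ∑-cong∈ (vecs N r) λ {B} B∈ → WS-cong N τ λ w l s →
  e (wd 1 B ++ w) (AllP.++⁺ (proj₁ (Letters-vec {N} {r} B∈)) l) (trans (LP.length-++ (wd 1 B)) (cong₂ _+_ (proj₂ (Letters-vec {N} {r} B∈)) s))

WS-∑ : ∀ {A : Set} N τ (xs : List A) (F : A → List ℕ → ℤ) → WS N τ (λ w → ∑ xs (λ x → F x w)) ≡ ∑ xs (λ x → WS N τ (F x))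
WS-∑ N []      xs F = refl
WS-∑ N (r ∷ τ) xs F = trans (∑-cong (vecs N r) (λ B → WS-∑ N τ xs (λ x w → F x (wd 1 B ++ w)))) (∑-swap (vecs N r) xs _)

WS-⊗ : ∀ N τ c f → WS N τ (λ w → c ⊗ f w) ≡ c ⊗ WS N τ f
WS-⊗ N []      c f = refl
WS-⊗ N (r ∷ τ) c f = trans (∑-cong (vecs N r) (λ B → WS-⊗ N τ c _)) (∑-⊗ (vecs N r) c _)

WS-zero : ∀ N τ {f} → (∀ w → Letters N w → length w ≡ sum τ → f w ≡ 0ℤ) → WS N τ f ≡ 0ℤ
WS-zero N τ e = trans (WS-cong N τ e) (WS-⊗ N τ 0ℤ (λ _ → 0ℤ))

WS-++ : ∀ N σ τ f → WS N (σ ++ τ) f ≡ WS N σ (λ y → WS N τ (λ w → f (y ++ w)))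
WS-++ N []      τ f = refl
WS-++ N (r ∷ σ) τ f = ∑-cong (vecs N r) (λ B → trans (WS-++ N σ τ _)
  (WS-cong N σ (λ y _ _ → WS-cong N τ (λ w _ _ → cong f (sym (LP.++-assoc (wd 1 B) y w))))))

Knuth : (List ℕ → ℤ) → Set
Knuth f = ∀ {u v} → u ≈ v → f u ≡ f v

-- By `pieri` both sides are sums over shapes with two rows `v` and `w`. As `v + w` is `a + b`, the
-- conditions `w ≤ a ≤ v` and `w ≤ b ≤ v` are equivalent.
two-rows : ∀ N a b f → Knuth f →
  ∑ (vecs N a) (λ A → ∑ (vecs N b) (λ B → f (wd 1 A ++ wd 1 B))) ≡ ∑ (vecs N b) (λ B → ∑ (vecs N a) (λ A → f (wd 1 B ++ wd 1 A)))
two-rows N a b f kn = trans (shapes a b) (trans (trans (cong (λ n → ∑ (vecs 2 n) (λ ν → inter ν (a ∷ []) ▹ S N ν f)) (+-comm a b))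
    (∑-cong∈ (vecs 2 (b + a)) (λ {ν} m → cong (_▹ S N ν f) (sym-inter ν (vecs⁻ {2} {b + a} m))))) (sym (shapes b a)))
  where
  shapes : ∀ a b → ∑ (vecs N a) (λ A → ∑ (vecs N b) (λ B → f (wd 1 A ++ wd 1 B))) ≡ ∑ (vecs 2 (a + b)) (λ ν → inter ν (a ∷ []) ▹ S N ν f)
  shapes a b = trans (sym (trans (∑-bindmap _∷_ (λ _ → [] ∷ []) (vecs N a) (λ P → tabᵇ P ▹ ∑ (vecs N b) (λ B → f (wT P ++ wd 1 B)))) (∑-cong (vecs N a) (λ A → ℤP.+-identityʳ _))))
    (trans (pieri N (a ∷ []) b f kn) (cong (λ n → ∑ (vecs 2 (n + b)) (λ ν → inter ν (a ∷ []) ▹ S N ν f)) (+-identityʳ a)))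
  sym-inter : ∀ ν → length ν ≡ 2 × sum ν ≡ b + a → inter ν (a ∷ []) ≡ inter ν (b ∷ [])
  sym-inter (v ∷ w ∷ []) (refl , s) = trans (cong₂ (λ p q → p ∧ q ∧ true) (flip a b v w (trans (cong (v +_) (sym (+-identityʳ w))) (trans s (+-comm b a))))
      (sym (flip b a v w (trans (cong (v +_) (sym (+-identityʳ w))) s)))) (lem (w ≤ᵇ b) (b ≤ᵇ v))
    where
    lem : ∀ x y → x ∧ y ∧ true ≡ y ∧ x ∧ true
    lem true  y = refl
    lem false y = sym (BP.∧-zeroʳ y)
    flip : ∀ a b v w → v + w ≡ a + b → (a ≤ᵇ v) ≡ (w ≤ᵇ b)
    flip a b v w e with a ≤ᵇ v in p | w ≤ᵇ b in q
    ... | true  | true  = refl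
    ... | false | false = refl
    ... | true  | false = trans (sym (≤ᵇ-true⁺ (+-cancelˡ-≤ a w b (≤-trans (+-monoˡ-≤ w (≤ᵇ-true⁻ {a} p)) (≤-reflexive e))))) q
    ... | false | true  = trans (sym p) (≤ᵇ-true⁺ (+-cancelʳ-≤ b a v (≤-trans (≤-reflexive (sym e)) (+-monoʳ-≤ v (≤ᵇ-true⁻ {w} q)))))

WS-↭ : ∀ N {τ τ′} f → Knuth f → τ ↭ τ′ → WS N τ f ≡ WS N τ′ f
WS-↭ N f kn Perm.refl = refl
WS-↭ N f kn (prep r p) = ∑-cong (vecs N r) (λ B → WS-↭ N _ (λ e → kn (≈-++ˡ (wd 1 B) e)) p)
WS-↭ N f kn (swap {τ} {τ′} r s p) = trans
  (trans (∑-cong (vecs N r) (λ A → ∑-cong (vecs N s) (λ B → WS-cong N τ (λ w _ _ → cong f (sym (LP.++-assoc (wd 1 A) (wd 1 B) w))))))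
  (trans (two-rows N r s (λ u → WS N τ (λ w → f (u ++ w))) (λ e → WS-cong N τ (λ w _ _ → kn (≈-++ʳ w e))))
    (∑-cong (vecs N s) (λ B → ∑-cong (vecs N r) (λ A → WS-cong N τ (λ w _ _ → cong f (LP.++-assoc (wd 1 B) (wd 1 A) w)))))))
  (∑-cong (vecs N s) (λ B → ∑-cong (vecs N r) (λ A → WS-↭ N _ (λ e → kn (≈-++ˡ (wd 1 B) (≈-++ˡ (wd 1 A) e))) p)))
WS-↭ N f kn (Perm.trans p q) = trans (WS-↭ N f kn p) (WS-↭ N f kn q)

-- The rules that determine the sums

∑-splits-at : ∀ x y f → (∀ b j → b ≢ x → f (b , j) ≡ 0ℤ) → ∑ (splits (x + y)) f ≡ f (x , y)
∑-splits-at zero zero    f z = ℤP.+-identityʳ _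
∑-splits-at zero (suc y) f z = trans (cong (f (0 , suc y) ⊕_) (trans (∑-map _ (splits y) f) (trans (∑-cong (splits y) (λ p → z (suc (proj₁ p)) (proj₂ p) (λ ()))) (∑-0 (splits y)))))
  (ℤP.+-identityʳ _)
∑-splits-at (suc x) y f z = trans (cong (_⊕ ∑ (map _ (splits (x + y))) f) (z 0 (suc (x + y)) (λ ()))) (trans (ℤP.+-identityˡ _)
  (trans (∑-map _ (splits (x + y)) f) (∑-splits-at x y _ (λ b j ne → z (suc b) j (ne ∘ suc-injective)))))

∑-splits-last : ∀ R {f f′} → (∀ b j → f (b , suc j) ≡ f′ (b , suc j)) → ∑ (splits R) f ≡ ∑ (splits R) f′ → f (R , 0) ≡ f′ (R , 0)
∑-splits-last zero    {f} {f′} e s = trans (sym (ℤP.+-identityʳ _)) (trans s (ℤP.+-identityʳ _))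
∑-splits-last (suc R) {f} {f′} e s = ∑-splits-last R (λ b j → e (suc b) j) (trans (sym (∑-map _ (splits R) f)) (trans
  (⊕-cancelˡ (f (0 , suc R)) _ _ (trans s (cong (_⊕ ∑ (map _ (splits R)) f′) (sym (e 0 R))))) (∑-map _ (splits R) f′)))

-- In `X m σ μ` the number `m` is the current length of the first row, `μ` lists the blocks still to
-- be treated, and `σ` what the treated blocks took out of the other rows. These have `K` cells and
-- length at most `c`; the condition `c ≤ m` keeps the content a partition.
record Family (c K : ℕ) (X : ℕ → List ℕ → List ℕ → ℤ) : Set where
  field
    peel   : ∀ m r σ μ → c ≤ m → X (m + r) σ (r ∷ μ) ≡ ∑ (splits r) (λ p → X (m + proj₂ p) (σ ++ proj₂ p ∷ []) μ)
    perm   : ∀ m σ {μ μ′} → c ≤ m → μ ↭ μ′ → X m σ μ ≡ X m σ μ′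
    drop   : ∀ m σ μ → X m (σ ++ 0 ∷ []) μ ≡ X m σ μ
    vanish : ∀ m σ μ → K < sum σ → X m σ μ ≡ 0ℤ

-- X m σ μ is the term j = 0 of the expansion of X (m + R) σ (R ∷ μ), R = ∣μ∣.  There R can be moved to
-- the end, and then all of μ can be peeled off.
family-unique : ∀ {c K X Y} → Family c K X → Family c K Y → (∀ x σ r → c ≤ x → X x σ (r ∷ []) ≡ Y x σ (r ∷ [])) →
  ∀ m σ μ → c ≤ m → X m σ μ ≡ Y m σ μ
family-unique {c} {K} {X} {Y} FX FY base m σ μ c≤m = go (suc K) m σ μ (m≤n+m (suc K) (sum σ)) c≤m
  where
  open Family
  sum-∷ʳ : ∀ σ j → sum (σ ++ j ∷ []) ≡ sum σ + j
  sum-∷ʳ σ j = trans (LAP.sum-++ σ (j ∷ [])) (cong (sum σ +_) (+-identityʳ j))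
  -- `c + sum τ ≤ x` keeps the first part at least `c` while all of `τ` is peeled. This is why the
  -- additional block has size `sum μ`.
  peeled : ∀ R τ x σ → c + sum τ ≤ x → X x σ (τ ++ R ∷ []) ≡ Y x σ (τ ++ R ∷ [])
  peeled R []      x σ le = base x σ R (subst (_≤ x) (+-identityʳ c) le)
  peeled R (r ∷ τ) x σ le = subst (λ x → X x σ (r ∷ τ ++ R ∷ []) ≡ Y x σ (r ∷ τ ++ R ∷ [])) (m∸n+n≡m (≤-trans (m≤m+n r (sum τ)) (≤-trans (m≤n+m _ c) le)))
    (trans (peel FX x′ r σ _ c≤) (trans (∑-cong (splits r) (λ p → peeled R τ (x′ + proj₂ p) _ (≤-trans le′ (m≤m+n x′ (proj₂ p))))) (sym (peel FY x′ r σ _ c≤))))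
    where
    x′ = x ∸ r
    le′ : c + sum τ ≤ x′
    le′ = ≤-trans (≤-reflexive (sym (trans (cong (_∸ r) (lem c r (sum τ))) (m+n∸m≡n r _)))) (∸-monoˡ-≤ r le)
      where
      lem : ∀ c r s → c + (r + s) ≡ r + (c + s)
      lem = ℕR.solve-∀
    c≤ : c ≤ x′
    c≤ = ≤-trans (m≤m+n c (sum τ)) le′
  -- Every term with `j > 0` enlarges `sum σ`; `d` bounds how often this can happen before the sum
  -- exceeds `K`.
  go : ∀ d m σ μ → K < sum σ + d → c ≤ m → X m σ μ ≡ Y m σ μ
  go zero    m σ μ lt c≤ = trans (vanish FX m σ μ lt′) (sym (vanish FY m σ μ lt′))
    where lt′ = subst (K <_) (+-identityʳ _) lt
  go (suc d) m σ μ lt c≤ = trans (trans (sym (drop FX m σ μ)) (cong (λ n → X n (σ ++ 0 ∷ []) μ) (sym (+-identityʳ m))))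
    (trans (∑-splits-last R later sums) (trans (cong (λ n → Y n (σ ++ 0 ∷ []) μ) (+-identityʳ m)) (drop FY m σ μ)))
    where
    R = sum μ
    later : ∀ b j → X (m + suc j) (σ ++ suc j ∷ []) μ ≡ Y (m + suc j) (σ ++ suc j ∷ []) μ
    later b j = go d _ _ μ (<-≤-trans lt (≤-trans (≤-reflexive (+-suc (sum σ) d)) (≤-trans (s≤s (m≤n+m _ j))
      (≤-reflexive (trans (lem (sum σ) d j) (cong (_+ d) (sym (sum-∷ʳ σ (suc j))))))))) (≤-trans c≤ (m≤m+n m (suc j)))
      where
      lem : ∀ s d j → suc (j + (s + d)) ≡ s + suc j + d
      lem = ℕR.solve-∀
    c≤R : c ≤ m + R
    c≤R = ≤-trans c≤ (m≤m+n m R)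
    rot : R ∷ μ ↭ μ ++ R ∷ []
    rot = PermP.++-comm (R ∷ []) μ
    sums : ∑ (splits R) (λ p → X (m + proj₂ p) (σ ++ proj₂ p ∷ []) μ) ≡ ∑ (splits R) (λ p → Y (m + proj₂ p) (σ ++ proj₂ p ∷ []) μ)
    sums = trans (sym (peel FX m R σ μ c≤)) (trans (perm FX (m + R) σ c≤R rot) (trans (peeled R μ (m + R) σ (+-monoˡ-≤ R c≤))
      (trans (sym (perm FY (m + R) σ c≤R rot)) (peel FY m R σ μ c≤))))

decreasing-∷ : ∀ {m la} → nth la 0 ≤ m → Decreasing la → Decreasing (m ∷ la)
decreasing-∷ le dec zero    = le
decreasing-∷ le dec (suc j) = dec j

sumFrom-nth : ∀ κ la f → (∀ j → f (κ + j) ≡ nth la j) → sumFrom κ (length la) f ≡ sum la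
sumFrom-nth κ []       f e = refl
sumFrom-nth κ (m ∷ la) f e = cong₂ _+_ (trans (cong f (sym (+-identityʳ κ))) (e 0)) (sumFrom-nth (suc κ) la f (λ j → trans (cong f (sym (+-suc κ j))) (e (suc j))))

good-↭ : ∀ la {u v} → u ↭ v → Good la u → Good la v
good-↭ la p (l , c) = PermP.All-resp-↭ p l , λ j → trans (↭-count (suc j) (↭-sym p)) (c j)

letters-suc : ∀ {N w} → Letters N w → Letters (suc N) (map suc w)
letters-suc l = AllP.map⁺ (All.map (λ (p , q) → z<s , s≤s q) l)

1∉suc : ∀ {N} {w : List ℕ} → Letters N w → 1 ∉ map suc w
1∉suc l m with ∈-map⁻ suc m
... | zero , x∈ , refl = Letters-0∉ l x∈

-- The word sums obey the rules

module Words (t : ℤ) where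
  open Shapes t

  g : List ℕ → List ℕ → ℤ
  g la w = does (good? la w) ▹ t ^ᶻ cc w

  g-good : ∀ la w → Good la w → g la w ≡ t ^ᶻ cc w
  g-good la w G with good? la w
  ... | yes _ = refl
  ... | no ¬G = ⊥-elim (¬G G)

  g-bad : ∀ la w → ¬ Good la w → g la w ≡ 0ℤ
  g-bad la w ¬G with good? la w
  ... | yes G = ⊥-elim (¬G G)
  ... | no _  = refl

  g-eq : ∀ la la′ w w′ → (Good la w → Good la′ w′) → (Good la′ w′ → Good la w) → (Good la w → cc w ≡ cc w′) → g la w ≡ g la′ w′
  g-eq la la′ w w′ to from e with good? la w
  ... | yes G = trans (cong (t ^ᶻ_) (e G)) (sym (g-good la′ w′ (to G)))
  ... | no ¬G = sym (g-bad la′ w′ (¬G ∘ from))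

  g-knuth : ∀ la → Decreasing la → Knuth (g la)
  g-knuth la dec {u} {v} (r , p) = g-eq la la u v (good-↭ la p) (good-↭ la (↭-sym p)) (λ G → cc-run u v la dec (proj₂ G) (proj₂ (good-↭ la p G)) r)

  g-peel : ∀ la n y v → nth la 0 ≤ n → Decreasing la → 1 ∉ y → g (suc n ∷ la) (y ++ 1 ∷ v) ≡ g (n ∷ la) (y ++ v)
  g-peel la n y v le dec 1∉ = g-eq (suc n ∷ la) (n ∷ la) (y ++ 1 ∷ v) (y ++ v) to from (λ G → cc-peel y v n la 1∉ (decreasing-∷ le dec) (proj₂ G))
    where
    to : Good (suc n ∷ la) (y ++ 1 ∷ v) → Good (n ∷ la) (y ++ v)
    to (l , c) = AllP.++⁺ (AllP.++⁻ˡ y l) (All.tail (AllP.++⁻ʳ y l)) ,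
      λ { zero → suc-injective (trans (sym (count-mid-≡ 1 y v)) (c 0)) ; (suc j) → trans (sym (count-mid-≢ y v (λ ()))) (c (suc j)) }
    from : Good (n ∷ la) (y ++ v) → Good (suc n ∷ la) (y ++ 1 ∷ v)
    from (l , c) = AllP.++⁺ (AllP.++⁻ˡ y l) ((≤-refl , s≤s z≤n) ∷ AllP.++⁻ʳ y l) ,
      λ { zero → trans (count-mid-≡ 1 y v) (cong suc (c 0)) ; (suc j) → trans (count-mid-≢ y v (λ ())) (c (suc j)) }

  g-peels : ∀ la n b y v → nth la 0 ≤ n → Decreasing la → 1 ∉ y → g (n + b ∷ la) (y ++ replicate b 1 ++ v) ≡ g (n ∷ la) (y ++ v)
  g-peels la n zero    y v le dec 1∉ = cong (λ n → g (n ∷ la) (y ++ v)) (+-identityʳ n)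
  g-peels la n (suc b) y v le dec 1∉ = trans (cong (λ n → g (n ∷ la) (y ++ 1 ∷ replicate b 1 ++ v)) (+-suc n b))
    (trans (g-peel la (n + b) y (replicate b 1 ++ v) (≤-trans le (m≤m+n n b)) dec 1∉) (g-peels la n b y v le dec 1∉))

  count-rotated : ∀ j y x v → count (suc (suc j)) (map suc y ++ replicate x 1 ++ map suc v) ≡ count (suc j) (v ++ y)
  count-rotated j y x v = begin
    count (suc (suc j)) (map suc y ++ replicate x 1 ++ map suc v)
      ≡⟨ trans (count-++ (suc (suc j)) (map suc y) _) (cong (count (suc (suc j)) (map suc y) +_) (count-++ (suc (suc j)) (replicate x 1) _)) ⟩
    count (suc (suc j)) (map suc y) + (count (suc (suc j)) (replicate x 1) + count (suc (suc j)) (map suc v))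
      ≡⟨ cong₂ _+_ (count-map-suc (suc j) y) (cong₂ _+_ (count-replicate-≢ x (λ ())) (count-map-suc (suc j) v)) ⟩
    count (suc j) y + count (suc j) v
      ≡⟨ trans (+-comm (count (suc j) y) _) (sym (count-++ (suc j) v y)) ⟩
    count (suc j) (v ++ y) ∎

  count-ones : ∀ y x v → 1 ∉ map suc y → 1 ∉ map suc v → count 1 (map suc y ++ replicate x 1 ++ map suc v) ≡ x
  count-ones y x v 1∉y 1∉v = trans (count-++ 1 (map suc y) _) (trans (cong₂ _+_ (count-∉ 1 _ 1∉y) (trans (count-++ 1 (replicate x 1) _)
    (cong₂ _+_ (count-replicate-≡ 1 x) (count-∉ 1 _ 1∉v)))) (+-identityʳ x))

  g-base : ∀ la x y v → nth la 0 ≤ x → Decreasing la → Letters (length la) y → Letters (length la) v →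
    g (x ∷ la) (map suc y ++ replicate x 1 ++ map suc v) ≡ t ^ᶻ length y ⊗ g la (v ++ y)
  g-base la x y v le dec Ly Lv with good? la (v ++ y)
  ... | no ¬G = trans (g-bad (x ∷ la) (map suc y ++ replicate x 1 ++ map suc v) (λ (l , c) → ¬G (AllP.++⁺ Lv Ly , λ j → trans (sym (count-rotated j y x v)) (c (suc j))))) (sym (ℤP.*-zeroʳ (t ^ᶻ length y)))
  ... | yes (l , c) = trans (g-good (x ∷ la) (map suc y ++ replicate x 1 ++ map suc v) (l′ , c′)) (trans (cong (t ^ᶻ_) (Base.cc-base x la y v Ly Lv (decreasing-∷ le dec) c c′)) (ℤP.^-distribˡ-+-* t (length y) _))
    where
    l′ : Letters (suc (length la)) (map suc y ++ replicate x 1 ++ map suc v)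
    l′ = AllP.++⁺ (letters-suc Ly) (AllP.++⁺ (AllP.replicate⁺ x (≤-refl , s≤s z≤n)) (letters-suc Lv))
    c′ : Content (map suc y ++ replicate x 1 ++ map suc v) (x ∷ la)
    c′ zero    = count-ones y x v (1∉suc Ly) (1∉suc Lv)
    c′ (suc j) = trans (count-rotated j y x v) (c j)

  -- The prefix `map suc y` collects what the peeled blocks have left behind; all `m` letters 1 of
  -- the content lie in the blocks `μ`.
  V : List ℕ → ℕ → List ℕ → List ℕ → ℤ
  V la m σ μ = WS (length la) σ (λ y → WS (suc (length la)) μ (λ u → g (m ∷ la) (map suc y ++ u)))

  module _ (la : List ℕ) (dec : Decreasing la) where
    private
      N = length la

    V-first : ∀ n r σ μ → V la n σ (r ∷ μ) ≡ ∑ (splits r) (λ p → WS N σ (λ y → ∑ (vecs N (proj₂ p)) (λ v →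
      WS (suc N) μ (λ w → g (n ∷ la) (map suc y ++ (replicate (proj₁ p) 1 ++ map suc (wd 1 v)) ++ w)))))
    V-first n r σ μ = trans (WS-cong N σ (λ y _ _ → trans (∑-vecs N r _) (∑-cong (splits r) (λ p → ∑-cong (vecs N (proj₂ p)) (λ v →
      WS-cong (suc N) μ (λ w _ _ → cong (λ z → g (n ∷ la) (map suc y ++ (replicate (proj₁ p) 1 ++ z) ++ w)) (wd-suc 1 v)))))))
      (WS-∑ N σ (splits r) _)

    V-peel : ∀ m r σ μ → nth la 0 ≤ m → V la (m + r) σ (r ∷ μ) ≡ ∑ (splits r) (λ p → V la (m + proj₂ p) (σ ++ proj₂ p ∷ []) μ)
    V-peel m r σ μ le = trans (V-first (m + r) r σ μ) (∑-cong∈ (splits r) (λ {p} p∈ → sym (trans (WS-++ N σ (proj₂ p ∷ []) _)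
      (WS-cong N σ (λ y Ly _ → ∑-cong (vecs N (proj₂ p)) (λ v → WS-cong (suc N) μ (λ w _ _ → word (proj₁ p) (proj₂ p) y v w (splits⁻ p∈) (1∉suc Ly))))))))
      where
      word : ∀ b j y v w → b + j ≡ r → 1 ∉ map suc y →
        g (m + j ∷ la) (map suc (y ++ wd 1 v ++ []) ++ w) ≡ g (m + r ∷ la) (map suc y ++ (replicate b 1 ++ map suc (wd 1 v)) ++ w)
      word b j y v w refl 1∉ = begin
        g (m + j ∷ la) (map suc (y ++ wd 1 v ++ []) ++ w)
          ≡⟨ cong (g (m + j ∷ la)) (trans (cong (_++ w) (trans (LP.map-++ suc y _) (cong (λ z → map suc y ++ map suc z) (LP.++-identityʳ (wd 1 v))))) (LP.++-assoc (map suc y) _ w)) ⟩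
        g (m + j ∷ la) (map suc y ++ map suc (wd 1 v) ++ w)
          ≡⟨ sym (g-peels la (m + j) b (map suc y) _ (≤-trans le (m≤m+n m j)) dec 1∉) ⟩
        g (m + j + b ∷ la) (map suc y ++ replicate b 1 ++ map suc (wd 1 v) ++ w)
          ≡⟨ cong₂ (λ n z → g (n ∷ la) (map suc y ++ z)) (trans (+-assoc m j b) (cong (m +_) (+-comm j b))) (sym (LP.++-assoc (replicate b 1) _ w)) ⟩
        g (m + (b + j) ∷ la) (map suc y ++ (replicate b 1 ++ map suc (wd 1 v)) ++ w) ∎

    V-perm : ∀ m σ {μ μ′} → nth la 0 ≤ m → μ ↭ μ′ → V la m σ μ ≡ V la m σ μ′
    V-perm m σ le p = WS-cong N σ (λ y _ _ → WS-↭ (suc N) _ (λ e → g-knuth (m ∷ la) (decreasing-∷ le dec) (≈-++ˡ (map suc y) e)) p)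

    ∑-vecs-0 : ∀ N f → ∑ (vecs N 0) f ≡ f (replicate N 0)
    ∑-vecs-0 zero    f = ℤP.+-identityʳ _
    ∑-vecs-0 (suc N) f = trans (∑-vecs N 0 f) (trans (ℤP.+-identityʳ _) (∑-vecs-0 N _))

    wd-zeros : ∀ k N → wd k (replicate N 0) ≡ []
    wd-zeros k zero    = refl
    wd-zeros k (suc N) = wd-zeros (suc k) N

    V-drop : ∀ m σ μ → V la m (σ ++ 0 ∷ []) μ ≡ V la m σ μ
    V-drop m σ μ = trans (WS-++ N σ (0 ∷ []) _) (WS-cong N σ (λ y _ _ → trans (∑-vecs-0 N _)
      (cong (λ z → WS (suc N) μ (λ u → g (m ∷ la) (map suc z ++ u))) (trans (cong (λ z → y ++ z ++ []) (wd-zeros 1 N)) (LP.++-identityʳ y)))))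

    V-vanish : ∀ m σ μ → sum la < sum σ → V la m σ μ ≡ 0ℤ
    V-vanish m σ μ lt = WS-zero N σ (λ y Ly ly → WS-zero (suc N) μ (λ u Lu _ → g-bad (m ∷ la) (map suc y ++ u) (λ (l , c) → <⇒≱ lt (subst (_≤ sum la) ly
      (subst (_≤ sum la) (sumFrom-count N y Ly) (subst (sumFrom 0 N (λ j → count (suc j) y) ≤_) (sumFrom-nth 0 la _ (λ j → refl))
        (sumFrom-mono 0 N (λ j → subst (count (suc j) y ≤_) (trans (sym (cong (_+ count (suc (suc j)) u) (count-map-suc (suc j) y)))
          (trans (sym (count-++ (suc (suc j)) (map suc y) u)) (c (suc j)))) (m≤m+n _ _)))))))))
      where
      sumFrom-mono : ∀ κ h {f f′} → (∀ j → f j ≤ f′ j) → sumFrom κ h f ≤ sumFrom κ h f′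
      sumFrom-mono κ zero    e = z≤n
      sumFrom-mono κ (suc h) e = +-mono-≤ (e κ) (sumFrom-mono (suc κ) h e)

    V-last-≢ : ∀ x b σ j → b ≢ x → WS N σ (λ y → ∑ (vecs N j) (λ v → g (x ∷ la) (map suc y ++ (replicate b 1 ++ map suc (wd 1 v)) ++ []))) ≡ 0ℤ
    V-last-≢ x b σ j ne = WS-zero N σ (λ y Ly _ → trans (∑-cong∈ (vecs N j) (λ {v} v∈ → g-bad (x ∷ la) (map suc y ++ (replicate b 1 ++ map suc (wd 1 v)) ++ []) (λ (l , c) → ne (trans
      (sym (trans (cong (λ z → count 1 (map suc y ++ z)) (LP.++-identityʳ _)) (count-ones y b (wd 1 v) (1∉suc Ly) (1∉suc (proj₁ (Letters-vec {N} {j} v∈)))))) (c 0)))))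
      (∑-0 (vecs N j)))

    V-base-< : ∀ x r σ → r < x → V la x σ (r ∷ []) ≡ 0ℤ
    V-base-< x r σ lt = trans (V-first x r σ []) (trans (∑-cong∈ (splits r) (λ {p} p∈ → V-last-≢ x (proj₁ p) σ (proj₂ p)
      (λ e → <-irrefl refl (<-≤-trans (subst (r <_) (sym e) lt) (subst (proj₁ p ≤_) (splits⁻ p∈) (m≤m+n (proj₁ p) (proj₂ p))))))) (∑-0 (splits r)))

    V-base : ∀ x y σ → nth la 0 ≤ x → V la x σ (x + y ∷ []) ≡ t ^ᶻ sum σ ⊗ WS N (y ∷ σ) (g la)
    V-base x y σ le = begin
      V la x σ (x + y ∷ [])
        ≡⟨ trans (V-first x (x + y) σ []) (∑-splits-at x y _ (λ b j → V-last-≢ x b σ j)) ⟩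
      WS N σ (λ z → ∑ (vecs N y) (λ v → g (x ∷ la) (map suc z ++ (replicate x 1 ++ map suc (wd 1 v)) ++ [])))
        ≡⟨ WS-cong N σ (λ z Lz lz → trans (∑-cong∈ (vecs N y) (λ {v} v∈ → trans (cong (λ u → g (x ∷ la) (map suc z ++ u)) (LP.++-identityʳ _))
             (trans (g-base la x z (wd 1 v) le dec Lz (proj₁ (Letters-vec {N} {y} v∈))) (cong (λ n → t ^ᶻ n ⊗ g la (wd 1 v ++ z)) lz))))
             (∑-⊗ (vecs N y) (t ^ᶻ sum σ) _)) ⟩
      WS N σ (λ z → t ^ᶻ sum σ ⊗ ∑ (vecs N y) (λ v → g la (wd 1 v ++ z)))
        ≡⟨ trans (WS-⊗ N σ (t ^ᶻ sum σ) _) (cong (t ^ᶻ sum σ ⊗_) (WS-∑ N σ (vecs N y) (λ v z → g la (wd 1 v ++ z)))) ⟩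
      t ^ᶻ sum σ ⊗ WS N (y ∷ σ) (g la) ∎

    V-family : Family (nth la 0) (sum la) (V la)
    V-family = record { peel = V-peel ; perm = V-perm ; drop = V-drop ; vanish = V-vanish }

  decreasing-bounded : ∀ la {m} → Decreasing la → nth la 0 ≤ m → All (_≤ m) la
  decreasing-bounded []       dec le = []
  decreasing-bounded (x ∷ la) dec le = le ∷ decreasing-bounded la (dec ∘ suc) (≤-trans (dec 0) le)

  FV-family : ∀ la → Decreasing la → Family (nth la 0) (sum la) (FV la)
  FV-family la dec = record { peel = λ m r σ μ le → FV-peel la m r σ μ (decreasing-bounded la dec le) ; perm = λ m σ _ → FV-↭ la m σ
    ; drop = FV-drop la ; vanish = FV-vanish la }

  -- Induction on the rows: with a single block left, `V-base` rotates the word and lowers its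
  -- letters, which removes the first row, and `FV-base` does the same for tabloids.
  WS-FF : ∀ la → Decreasing la → ∀ τ → WS (length la) τ (g la) ≡ FF la τ
  WS-FF [] dec []          = g-good [] [] ([] , λ _ → refl)
  WS-FF [] dec (zero ∷ τ)  = trans (ℤP.+-identityʳ _) (WS-FF [] dec τ)
  WS-FF [] dec (suc r ∷ τ) = refl
  WS-FF (m ∷ la) dec τ = family-unique (V-family la (dec ∘ suc)) (FV-family la (dec ∘ suc)) base m [] τ (dec 0)
    where
    base : ∀ x σ r → nth la 0 ≤ x → V la x σ (r ∷ []) ≡ FV la x σ (r ∷ [])
    base x σ r le with x ≤? r
    ... | no x≰r = trans (V-base-< la (dec ∘ suc) x r σ (≰⇒> x≰r)) (sym (FV-base-< la x r σ (≰⇒> x≰r)))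
    ... | yes x≤r = subst (λ r → V la x σ (r ∷ []) ≡ FV la x σ (r ∷ [])) (m+[n∸m]≡n x≤r)
      (trans (V-base la (dec ∘ suc) x (r ∸ x) σ le) (trans (cong (t ^ᶻ sum σ ⊗_) (WS-FF la (dec ∘ suc) (r ∸ x ∷ σ))) (sym (FV-base la x (r ∸ x) σ))))

-- The statistic of a tabloid

-- lookup2 reads a row by a local function that cannot be named from outside, and whose lambda-lifted
-- arguments (the whole row and the original index) stay fixed during its recursion, so that no induction
-- on lookup2 alone can reach it.  It is recovered by unification.  In `capture`, the equations for T₁ and
-- T₂ are postponed because i and j are still unknown; by then lookup2 has unfolded to the local function
-- applied to A and C twice each, and once A and C are known only the recursion arguments get evaluated.  So T₁ and T₂
-- differ precisely in pair₁ and pair₂, in the lifted arguments; cong! abstracts over that difference, and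
-- matching its result with cong F e yields the local function as F.
pair₁ pair₂ : ℕ → List ℕ → ℕ → List ℕ × ℕ
pair₁ z zs d = z ∷ zs , d
pair₂ z zs d = z ∷ zs , d

rowPart : List ℕ × ℕ → List ℕ
rowPart (x , c) = x

indexPart : List ℕ × ℕ → ℕ
indexPart (x , c) = c

data Same {A : Set} (a : A) : {B : Set} → B → Set₁ where
  identical : Same a a

capture : ∀ (w v : ℕ) xs (T₁ T₂ : ℕ → ℕ → Maybe ℕ) (i j : ℕ) (A₁ A₂ : List ℕ) (C₁ C₂ : ℕ) (k₁ k₂ : List ℕ × ℕ) →
  T₁ i j ≡ lookup2 (A₁ ∷ xs) 0 C₁ → T₂ i j ≡ lookup2 (A₂ ∷ xs) 0 C₂ →
  A₁ ≡ rowPart k₁ → A₂ ≡ rowPart k₂ → C₁ ≡ indexPart k₁ → C₂ ≡ indexPart k₂ →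
  i ≡ w → j ≡ v → T₁ w v ≡ T₂ w v → T₁ w v ≡ T₂ w v
capture _ _ _ _ _ _ _ _ _ _ _ _ _ _ _ _ _ _ _ _ _ q = q

Captured : ∀ w v z zs d xs → pair₁ z zs d ≡ pair₂ z zs d → (List ℕ × ℕ → Maybe ℕ) → Set₁
Captured w v z zs d xs e F =
  let q = capture w v xs _ _ _ _ _ _ _ _ (pair₁ z zs d) (pair₂ z zs d) refl refl refl refl refl refl refl refl (cong! e)
  in Same q (cong F e)

captured : ∀ w v z zs d xs e → Σ _ (Captured w v z zs d xs e)
captured w v z zs d xs e = _ , identical

lookup2-local : (z : ℕ) (zs : List ℕ) (d : ℕ) (xs : List (List ℕ)) → List ℕ × ℕ → Maybe ℕ
lookup2-local z zs d xs = proj₁ (captured 0 0 z zs d xs refl)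

at : List ℕ → ℕ → Maybe ℕ
at []       c       = nothing
at (y ∷ ys) zero    = just y
at (y ∷ ys) (suc c) = at ys c

lookup2-local-at : ∀ z zs d xs p → lookup2-local z zs d xs p ≡ at (z ∷ zs) d
lookup2-local-at z zs        zero    xs p = refl
lookup2-local-at z []        (suc d) xs p = refl
lookup2-local-at z (z′ ∷ zs) (suc d) xs p = lookup2-local-at z′ zs d xs p

lookup2-at : ∀ x xs c → lookup2 (x ∷ xs) zero c ≡ at x c
lookup2-at []       xs c = refl
lookup2-at (y ∷ ys) xs c = lookup2-local-at y ys c xs (y ∷ ys , c)

countLess : ℕ → List ℕ → ℕ
countLess i []      = 0
countLess i (k ∷ y) = [[ k <ᵇ i ]] + countLess i y

-- Below the row of the smaller entry the larger one may stand in the same column; otherwise it must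
-- be one column further to the left.
delay : Bool → ℕ
delay true  = 0
delay false = 1

countLess-0 : ∀ i y → All (i ≤_) y → countLess i y ≡ 0
countLess-0 i []      []       = refl
countLess-0 i (k ∷ y) (p ∷ ps) = cong₂ _+_ (cong [[_]] (≤⇒≮ᵇ p)) (countLess-0 i y ps)

cnt : {A : Set} → (A → Bool) → List A → ℕ
cnt P xs = length (filter (λ q → Data.Bool._≟_ (P q) true) xs)

cnt-∷ : ∀ {A : Set} (P : A → Bool) x xs → cnt P (x ∷ xs) ≡ [[ P x ]] + cnt P xs
cnt-∷ P x xs with P x
... | true  = refl
... | false = refl

cnt-++ : ∀ {A : Set} (P : A → Bool) xs ys → cnt P (xs ++ ys) ≡ cnt P xs + cnt P ys
cnt-++ P xs ys = trans (cong length (LP.filter-++ (λ q → Data.Bool._≟_ (P q) true) xs ys)) (LP.length-++ (filter _ xs))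

column-test : ∀ b c₁ c → (((c₁ ≡ᵇ c) ∧ b) ∨ (c₁ <ᵇ c)) ≡ (c₁ + delay b <ᵇ c + 1)
column-test true  c₁ c = trans (cong (_∨ (c₁ <ᵇ c)) (BP.∧-identityʳ (c₁ ≡ᵇ c))) (trans (le c₁ c) (cong₂ _<ᵇ_ (sym (+-identityʳ c₁)) (sym (+-comm c 1))))
  where
  le : ∀ m n → (m ≡ᵇ n) ∨ (m <ᵇ n) ≡ (m <ᵇ suc n)
  le zero    zero    = refl
  le zero    (suc n) = refl
  le (suc m) zero    = refl
  le (suc m) (suc n) = le m n
column-test false c₁ c = trans (cong (_∨ (c₁ <ᵇ c)) (BP.∧-zeroʳ (c₁ ≡ᵇ c))) (cong₂ _<ᵇ_ (sym (+-comm c₁ 1)) (sym (+-comm c 1)))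

-- In a weakly increasing row only the last entry smaller than i can pass the test on the right neighbour.
row-hits : ∀ θ r₁ c₁ i r₂ c y → Sorted y → (∀ d → lookup2 θ r₂ (suc c + d) ≡ at y (suc d)) →
  cnt (wPair θ (r₁ , c₁ , i)) (rowCells r₂ c y) ≡ [[ (0 <ᵇ countLess i y) ∧ (c₁ + delay (r₂ <ᵇ r₁) <ᵇ c + countLess i y) ]]
row-hits θ r₁ c₁ i r₂ c []      s e = refl
row-hits θ r₁ c₁ i r₂ c (k ∷ []) s e
  rewrite cnt-∷ (wPair θ (r₁ , c₁ , i)) (r₂ , c , k) [] | trans (cong (lookup2 θ r₂) (sym (+-identityʳ (suc c)))) (e 0) | column-test (r₂ <ᵇ r₁) c₁ c
  with k <ᵇ i
... | true  = trans (+-identityʳ _) (cong [[_]] (BP.∧-identityʳ _))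
... | false = refl
row-hits θ r₁ c₁ i r₂ c (k ∷ j ∷ y) ((k≤j ∷ ps) ∷ s) e
  rewrite cnt-∷ (wPair θ (r₁ , c₁ , i)) (r₂ , c , k) (rowCells r₂ (suc c) (j ∷ y))
        | row-hits θ r₁ c₁ i r₂ (suc c) (j ∷ y) s (λ d → trans (cong (lookup2 θ r₂) (sym (+-suc (suc c) d))) (e (suc d)))
        | trans (cong (lookup2 θ r₂) (sym (+-identityʳ (suc c)))) (e 0) | column-test (r₂ <ᵇ r₁) c₁ c
  with k <? i | j <? i
... | no k≮i | _
  rewrite ≮⇒<ᵇ-false k≮i | ≮⇒<ᵇ-false (≤⇒≯ (≤-trans (≮⇒≥ k≮i) k≤j)) | countLess-0 i y (All.map (≤-trans (≮⇒≥ k≮i)) ps) = refl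
... | yes k<i | yes j<i
  rewrite <⇒<ᵇ-true k<i | <⇒<ᵇ-true j<i | >⇒≰ᵇ j<i =
  trans (cong (λ z → [[ z ]] + [[ c₁ + delay (r₂ <ᵇ r₁) <ᵇ suc (c + suc (countLess i y)) ]]) (BP.∧-zeroʳ (c₁ + delay (r₂ <ᵇ r₁) <ᵇ c + 1))) (cong (λ n → [[ c₁ + delay (r₂ <ᵇ r₁) <ᵇ n ]]) (sym (+-suc c _)))
... | yes k<i | no j≮i with s
... | qs ∷ _
  rewrite <⇒<ᵇ-true k<i | ≮⇒<ᵇ-false j≮i | ≤ᵇ-true⁺ (≮⇒≥ j≮i) | countLess-0 i y (All.map (≤-trans (≮⇒≥ j≮i)) qs) =
  trans (+-identityʳ _) (cong [[_]] (BP.∧-identityʳ _))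

hits : ℕ → ℕ → ℕ → ℕ → List (List ℕ) → ℕ
hits r₁ c₁ i r []       = 0
hits r₁ c₁ i r (y ∷ ys) = [[ c₁ + delay (r <ᵇ r₁) <ᵇ countLess i y ]] + hits r₁ c₁ i (suc r) ys

∧-positive : ∀ m n → (0 <ᵇ n) ∧ (m <ᵇ n) ≡ (m <ᵇ n)
∧-positive m zero    = refl
∧-positive m (suc n) = refl

cnt-hits : ∀ θ r₁ c₁ i r ys → All Sorted ys → (∀ j d → lookup2 θ (r + j) d ≡ lookup2 ys j d) →
  cnt (wPair θ (r₁ , c₁ , i)) (cellsFrom r ys) ≡ hits r₁ c₁ i r ys
cnt-hits θ r₁ c₁ i r []       []       e = refl
cnt-hits θ r₁ c₁ i r (y ∷ ys) (s ∷ ss) e = trans (cnt-++ (wPair θ (r₁ , c₁ , i)) (rowCells r 0 y) _)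
  (cong₂ _+_ (trans (row-hits θ r₁ c₁ i r 0 y s (λ d → trans (cong (λ n → lookup2 θ n (suc d)) (sym (+-identityʳ r))) (trans (e 0 (suc d)) (lookup2-at y ys (suc d)))))
                    (cong [[_]] (∧-positive _ (countLess i y))))
             (cnt-hits θ r₁ c₁ i (suc r) ys ss (λ j d → trans (cong (λ n → lookup2 θ n d) (sym (+-suc r j))) (e (suc j) d))))

-- An entry `i` can form a pair only with the last smaller entry of `y`, whose column is
-- `countLess i y ∸ 1`. So a single inequality decides, with `δ` equal to 0 if `x` lies below `y`
-- and to 1 otherwise.
pc : ℕ → ℕ → List ℕ → List ℕ → ℕ
pc δ c []      y = 0
pc δ c (i ∷ x) y = [[ c + δ <ᵇ countLess i y ]] + pc δ (suc c) x y

W : List (List ℕ) → ℕ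
W []      = 0
W (x ∷ θ) = pc 1 0 x x + (sum (map (pc 1 0 x) θ) + (sum (map (λ y → pc 0 0 y x) θ) + W θ))

sum-map-+ : ∀ {A : Set} (f h : A → ℕ) xs → sum (map (λ x → f x + h x) xs) ≡ sum (map f xs) + sum (map h xs)
sum-map-+ f h []       = refl
sum-map-+ f h (x ∷ xs) = trans (cong ((f x + h x) +_) (sum-map-+ f h xs)) (lem (f x) (h x) _ _)
  where
  lem : ∀ a b c d → a + b + (c + d) ≡ (a + c) + (b + d)
  lem = ℕR.solve-∀

sum-map-++ : ∀ {A : Set} (f : A → ℕ) xs ys → sum (map f (xs ++ ys)) ≡ sum (map f xs) + sum (map f ys)
sum-map-++ f xs ys = trans (cong sum (LP.map-++ f xs ys)) (LAP.sum-++ (map f xs) (map f ys))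

hitsAt : ℕ → List (List ℕ) → Cell → ℕ
hitsAt r ys (r₁ , c , i) = hits r₁ c i r ys

hits-above : ∀ r₁ c x r ys → r₁ ≤ r → sum (map (hitsAt r ys) (rowCells r₁ c x)) ≡ sum (map (pc 1 c x) ys)
hits-above r₁ c x r []       le = trans (lem c x) refl
  where
  lem : ∀ c x → sum (map (hitsAt r []) (rowCells r₁ c x)) ≡ 0
  lem c []      = refl
  lem c (i ∷ x) = lem (suc c) x
hits-above r₁ c x r (y ∷ ys) le = trans (sum-map-+ (λ { (r₁ , c , i) → [[ c + delay (r <ᵇ r₁) <ᵇ countLess i y ]] }) (hitsAt (suc r) ys) (rowCells r₁ c x))
  (cong₂ _+_ (lem c x) (hits-above r₁ c x (suc r) ys (m≤n⇒m≤1+n le)))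
  where
  lem : ∀ c x → sum (map (λ { (r₁ , c , i) → [[ c + delay (r <ᵇ r₁) <ᵇ countLess i y ]] }) (rowCells r₁ c x)) ≡ pc 1 c x y
  lem c []      = refl
  lem c (i ∷ x) = cong₂ _+_ (cong (λ b → [[ c + delay b <ᵇ countLess i y ]]) (≤⇒≮ᵇ le)) (lem (suc c) x)

hits-below : ∀ r r₁ x ys → r < r₁ →
  sum (map (λ { (r₁ , c , i) → [[ c + delay (r <ᵇ r₁) <ᵇ countLess i x ]] }) (cellsFrom r₁ ys)) ≡ sum (map (λ y → pc 0 0 y x) ys)
hits-below r r₁ x []       lt = refl
hits-below r r₁ x (y ∷ ys) lt = trans (sum-map-++ _ (rowCells r₁ 0 y) _) (cong₂ _+_ (lem 0 y) (hits-below r (suc r₁) x ys (m<n⇒m<1+n lt)))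
  where
  lem : ∀ c y → sum (map (λ { (r₁ , c , i) → [[ c + delay (r <ᵇ r₁) <ᵇ countLess i x ]] }) (rowCells r₁ c y)) ≡ pc 0 c y x
  lem c []      = refl
  lem c (i ∷ y) = cong₂ _+_ (cong (λ b → [[ c + delay b <ᵇ countLess i x ]]) (<⇒<ᵇ-true lt)) (lem (suc c) y)

hits-W : ∀ r θ → sum (map (hitsAt r θ) (cellsFrom r θ)) ≡ W θ
hits-W r []      = refl
hits-W r (x ∷ θ) = trans (sum-map-++ (hitsAt r (x ∷ θ)) (rowCells r 0 x) (cellsFrom (suc r) θ))
  (trans (cong₂ _+_ (hits-above r 0 x r (x ∷ θ) ≤-refl)
    (trans (sum-map-+ (λ { (r₁ , c , i) → [[ c + delay (r <ᵇ r₁) <ᵇ countLess i x ]] }) (hitsAt (suc r) θ) (cellsFrom (suc r) θ))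
      (cong₂ _+_ (hits-below r (suc r) x θ ≤-refl) (hits-W (suc r) θ))))
    (+-assoc (pc 1 0 x x) _ _))

wStat-W : ∀ θ → All Sorted θ → wStat θ ≡ W θ
wStat-W θ s = trans (cong sum (LP.map-cong (λ { (r₁ , c , i) → cnt-hits θ r₁ c i 0 θ s (λ _ _ → refl) }) (cells θ))) (hits-W 0 θ)

countLess-append : ∀ {i h} b y → i ≤ h → countLess i (y ++ replicate b h) ≡ countLess i y
countLess-append         zero    []      le = refl
countLess-append {i} {h} (suc b) []      le = cong₂ _+_ (cong [[_]] (≤⇒≮ᵇ le)) (countLess-append b [] le)
countLess-append {i}     b       (k ∷ y) le = cong ([[ k <ᵇ i ]] +_) (countLess-append b y le)

countLess-all : ∀ {h} b y → All (_< h) y → countLess h (y ++ replicate b h) ≡ length y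
countLess-all {h} b []      []       = countLess-append {h} {h} b [] ≤-refl
countLess-all     b (k ∷ y) (p ∷ ps) = cong₂ _+_ (cong [[_]] (<⇒<ᵇ-true p)) (countLess-all b y ps)

pc-++ : ∀ δ c x z y → pc δ c (x ++ z) y ≡ pc δ c x y + pc δ (c + length x) z y
pc-++ δ c []      z y = cong (λ c → pc δ c z y) (sym (+-identityʳ c))
pc-++ δ c (i ∷ x) z y = trans (cong ([[ c + δ <ᵇ countLess i y ]] +_) (trans (pc-++ δ (suc c) x z y)
  (cong (λ n → pc δ (suc c) x y + pc δ n z y) (sym (+-suc c (length x)))))) (sym (+-assoc [[ c + δ <ᵇ countLess i y ]] _ _))

pc-old : ∀ δ c x {h} b y → All (_< h) x → pc δ c x (y ++ replicate b h) ≡ pc δ c x y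
pc-old δ c []      b y []       = refl
pc-old δ c (i ∷ x) b y (p ∷ ps) = cong₂ _+_ (cong (λ n → [[ c + δ <ᵇ n ]]) (countLess-append b y (<⇒≤ p))) (pc-old δ (suc c) x b y ps)

pc-replicate : ∀ δ c b h y → pc δ c (replicate b h) y ≡ ((c + b) ⊓ (countLess h y ∸ δ)) ∸ c
pc-replicate δ c zero    h y = sym (m≤n⇒m∸n≡0 (≤-trans (m⊓n≤m (c + 0) _) (≤-reflexive (+-identityʳ c))))
pc-replicate δ c (suc b) h y = trans (cong ([[ c + δ <ᵇ L ]] +_) (pc-replicate δ (suc c) b h y)) (trans (go (c <? L ∸ δ)) (cong (λ n → (n ⊓ (L ∸ δ)) ∸ c) (sym (+-suc c b))))
  where
  L = countLess h y
  go : Dec (c < L ∸ δ) → [[ c + δ <ᵇ L ]] + ((suc c + b) ⊓ (L ∸ δ) ∸ suc c) ≡ (suc (c + b) ⊓ (L ∸ δ)) ∸ c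
  go (yes lt) = trans (cong (λ z → [[ z ]] + ((suc c + b) ⊓ (L ∸ δ) ∸ suc c)) (<⇒<ᵇ-true (subst (_≤ L) (cong suc (+-comm δ c)) (≤-trans (≤-reflexive (+-comm (suc δ) c)) le′))))
    (trans (sym (+-∸-assoc 1 (⊓-glb (s≤s (m≤m+n c b)) lt))) refl)
    where
    le′ : c + suc δ ≤ L
    le′ = subst (_≤ L) (sym (+-suc c δ)) (≤-trans (+-monoˡ-≤ δ lt) (≤-reflexive (m∸n+n≡m (<⇒≤ (m∸n≢0⇒n<m {L} {δ} (λ e → <⇒≱ lt (subst (_≤ c) (sym e) z≤n)))))))
  go (no nl) = trans (cong₂ (λ z n → [[ z ]] + n) (≤⇒≮ᵇ (≤-trans (m≤n+m∸n L δ) (≤-trans (≤-reflexive (+-comm δ _)) (+-monoˡ-≤ δ (≮⇒≥ nl))))) (m≤n⇒m∸n≡0 (≤-trans (m⊓n≤n (suc c + b) _) (≤-trans (≮⇒≥ nl) (n≤1+n c)))))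
    (sym (m≤n⇒m∸n≡0 (≤-trans (m⊓n≤n (suc (c + b)) _) (≮⇒≥ nl))))

stretch : ℕ → ℕ → List ℕ → List ℕ
stretch h L r = r ++ replicate (L ∸ length r) h

-- The old entries do not notice the new maximal letters, and for each new letter all old entries of
-- `y` are smaller. For the two values of `δ` the gain is one of the two summands of `hpair`.
pc-stretch : ∀ δ {h} B x B′ y → All (_< h) x → All (_< h) y → length x ≤ B →
  pc δ 0 (stretch h B x) (stretch h B′ y) ≡ pc δ 0 x y + ((B ⊓ (length y ∸ δ)) ∸ length x)
pc-stretch δ {h} B x B′ y px py le = trans (pc-++ δ 0 x _ (stretch h B′ y)) (cong₂ _+_ (pc-old δ 0 x _ y px)
  (trans (pc-replicate δ (length x) (B ∸ length x) h (stretch h B′ y))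
    (cong₂ (λ m n → (m ⊓ (n ∸ δ)) ∸ length x) (m+[n∸m]≡n le) (countLess-all (B′ ∸ length y) y py))))

extend : ℕ → List ℕ → List (List ℕ) → List (List ℕ)
extend h (L ∷ la) (r ∷ θ) = stretch h L r ∷ extend h la θ
extend h _        _       = []

cross : ℕ → ℕ → List ℕ → List ℕ → ℕ
cross b a (y ∷ β) (j ∷ α) = hpair b a y j + cross b a β α
cross b a _       _       = 0

stat : List ℕ → List ℕ → ℕ
stat (b ∷ β) (a ∷ α) = cross b a β α + stat β α
stat _       _       = 0

data Fits (h : ℕ) : List ℕ → List (List ℕ) → Set where
  []  : Fits h [] []
  _∷_ : ∀ {L la r θ} → length r ≤ L × All (_< h) r → Fits h la θ → Fits h (L ∷ la) (r ∷ θ)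

-- New pairs consist of a new letter as the larger entry and an old one in another row: within one
-- row the new letters stand to the right of all old entries.
W-extend : ∀ {h la θ} → Fits h la θ → W (extend h la θ) ≡ W θ + stat la (map length θ)
W-extend [] = refl
W-extend {h} {L ∷ la} {r ∷ θ} ((le , p) ∷ F) = trans (cong₂ _+_ self (trans (cong (down +_) (cong (up +_) (W-extend F))) (trans (sym (+-assoc down up _)) (cong (_+ (W θ + stat la (map length θ))) (crossings F)))))
  (lem (pc 1 0 r r) (sum (map (pc 1 0 r) θ)) (sum (map (λ y → pc 0 0 y r) θ)) (cross L (length r) la (map length θ)) (W θ) (stat la (map length θ)))
  where
  down = sum (map (pc 1 0 (stretch h L r)) (extend h la θ))
  up = sum (map (λ y → pc 0 0 y (stretch h L r)) (extend h la θ))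
  self : pc 1 0 (stretch h L r) (stretch h L r) ≡ pc 1 0 r r
  self = trans (pc-stretch 1 L r L r p p le) (trans (cong (pc 1 0 r r +_) (m≤n⇒m∸n≡0 (≤-trans (m⊓n≤n L _) (m∸n≤m (length r) 1)))) (+-identityʳ _))
  lem : ∀ a b c d e f → a + (b + c + d + (e + f)) ≡ a + (b + (c + e)) + (d + f)
  lem = ℕR.solve-∀
  lem′ : ∀ a b c d x y → (a + c) + (b + d) ≡ (a + b) + (c + d)
  lem′ = ℕR.solve-∀
  crossings : ∀ {la θ} → Fits h la θ → sum (map (pc 1 0 (stretch h L r)) (extend h la θ)) + sum (map (λ y → pc 0 0 y (stretch h L r)) (extend h la θ)) ≡
    sum (map (pc 1 0 r) θ) + sum (map (λ y → pc 0 0 y r) θ) + cross L (length r) la (map length θ)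
  crossings [] = refl
  crossings {B ∷ la} {y ∷ θ} ((le′ , p′) ∷ F) = trans (mix (pc 1 0 (stretch h L r) (stretch h B y)) _ (pc 0 0 (stretch h B y) (stretch h L r)) _)
    (trans (cong₂ _+_ (cong₂ _+_ (pc-stretch 1 L r B y p p′ le) (pc-stretch 0 B y L r p′ p le′)) (crossings F))
      (mix′ (pc 1 0 r y) ((L ⊓ (length y ∸ 1)) ∸ length r) (pc 0 0 y r) ((B ⊓ length r) ∸ length y) _ _ _))
    where
    mix : ∀ a b c d → a + b + (c + d) ≡ (a + c) + (b + d)
    mix = ℕR.solve-∀
    mix′ : ∀ a b c d e f g → (a + b + (c + d)) + (e + f + g) ≡ a + e + (c + f) + (d + b + g)
    mix′ = ℕR.solve-∀

-- Fillings according to the cells of the largest letter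

shapes : List ℕ → List (List ℕ)
shapes []       = [] ∷ []
shapes (b ∷ β) = concatMap (λ a → map (a ∷_) (shapes β)) (downTo b)

∑-downTo-suc : ∀ L f → ∑ (downTo (suc L)) f ≡ ∑ (downTo L) (f ∘ suc) ⊕ f 0
∑-downTo-suc zero    f = lem (f 1) (f 0)
  where
  lem : ∀ a b → a ⊕ (b ⊕ 0ℤ) ≡ (a ⊕ 0ℤ) ⊕ b
  lem = ℤR.solve-∀
∑-downTo-suc (suc L) f = trans (cong (f (suc (suc L)) ⊕_) (∑-downTo-suc L f)) (sym (ℤP.+-assoc (f (suc (suc L))) _ _))

upTo-∷ʳ : ∀ n → upTo (suc n) ≡ upTo n ++ n ∷ []
upTo-∷ʳ n = sym (LP.upTo-∷ʳ n)

between-∷ʳ : ∀ {lo hi} → lo ≤ suc hi → between lo (suc hi) ≡ between lo hi ++ suc hi ∷ []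
between-∷ʳ {lo} {hi} le = trans (cong (λ n → map (lo +_) (upTo n)) (+-∸-assoc 1 le))
  (trans (cong (map (lo +_)) (upTo-∷ʳ (suc hi ∸ lo))) (trans (LP.map-++ (lo +_) (upTo (suc hi ∸ lo)) _) (cong (λ n → between lo hi ++ n ∷ []) (m+[n∸m]≡n le))))

between-empty : ∀ hi → between (suc hi) hi ≡ []
between-empty hi = cong (λ n → map (suc hi +_) (upTo n)) (n∸n≡0 hi)

between⁻ : ∀ {lo hi x} → x ∈ between lo hi → lo ≤ x × x ≤ hi
between⁻ {lo} {hi} x∈ with ∈-map⁻ (lo +_) x∈
... | k , k∈ , refl = m≤m+n lo k , s≤s⁻¹ (subst (_≤ suc hi) (+-suc lo k) (subst (lo + suc k ≤_) (m+[n∸m]≡n (<⇒≤ (m∸n≢0⇒n<m {suc hi} {lo} (λ e → <⇒≱ k< (subst (_≤ k) (sym e) z≤n))))) (+-monoʳ-≤ lo k<)))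
  where
  k< : k < suc hi ∸ lo
  k< = ∈-upTo⁻ k∈

∑-incRows-top : ∀ L hi (f : List ℕ → ℤ) → ∑ (downTo L) (λ a → ∑ (incRows a (suc hi) hi) (λ r → f (r ++ replicate (L ∸ a) (suc hi)))) ≡ f (replicate L (suc hi))
∑-incRows-top L hi f = trans (∑-downTo-0 L _ (λ a → cong (λ bs → ∑ (concatMap (λ x → map (x ∷_) (incRows a x hi)) bs) (λ r → f (r ++ replicate (L ∸ suc a) (suc hi)))) (between-empty hi))) (ℤP.+-identityʳ _)

∑-incRows : ∀ L {lo hi} (f : List ℕ → ℤ) → lo ≤ suc hi →
  ∑ (incRows L lo (suc hi)) f ≡ ∑ (downTo L) (λ a → ∑ (incRows a lo hi) (λ r → f (r ++ replicate (L ∸ a) (suc hi))))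
∑-incRows zero    f le = sym (ℤP.+-identityʳ _)
∑-incRows (suc L) {lo} {hi} f le = begin
  ∑ (incRows (suc L) lo (suc hi)) f
    ≡⟨ trans (∑-bindmap _∷_ (λ x → incRows L x (suc hi)) (between lo (suc hi)) f) (trans (cong (λ bs → ∑ bs F) (between-∷ʳ le)) (∑-++ (between lo hi) _ F)) ⟩
  ∑ (between lo hi) F ⊕ (F (suc hi) ⊕ 0ℤ)
    ≡⟨ cong₂ _⊕_ (trans (∑-cong∈ (between lo hi) (λ {x} x∈ → ∑-incRows L (f ∘ (x ∷_)) (m≤n⇒m≤1+n (proj₂ (between⁻ {lo} x∈))))) (∑-swap (between lo hi) (downTo L) _))
         (trans (ℤP.+-identityʳ _) (trans (∑-incRows L (f ∘ (suc hi ∷_)) ≤-refl) (∑-incRows-top L hi (f ∘ (suc hi ∷_))))) ⟩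
  ∑ (downTo L) (λ a → ∑ (between lo hi) (λ x → ∑ (incRows a x hi) (λ r → f (x ∷ r ++ replicate (L ∸ a) (suc hi))))) ⊕ f (replicate (suc L) (suc hi))
    ≡⟨ cong₂ _⊕_ (∑-cong (downTo L) (λ a → sym (∑-bindmap _∷_ (λ x → incRows a x hi) (between lo hi) _))) (sym (ℤP.+-identityʳ _)) ⟩
  ∑ (downTo L) (λ a → ∑ (incRows (suc a) lo hi) (λ r → f (r ++ replicate (L ∸ a) (suc hi)))) ⊕ ∑ (incRows 0 lo hi) (λ r → f (r ++ replicate (suc L) (suc hi)))
    ≡⟨ sym (∑-downTo-suc L (λ a → ∑ (incRows a lo hi) (λ r → f (r ++ replicate (suc L ∸ a) (suc hi))))) ⟩
  ∑ (downTo (suc L)) (λ a → ∑ (incRows a lo hi) (λ r → f (r ++ replicate (suc L ∸ a) (suc hi)))) ∎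
  where
  F : ℕ → ℤ
  F x = ∑ (incRows L x (suc hi)) (λ r → f (x ∷ r))

data Filling (hi : ℕ) : List ℕ → List (List ℕ) → Set where
  []  : Filling hi [] []
  _∷_ : ∀ {L la r θ} → length r ≡ L × All (_≤ hi) r × Sorted r × All (1 ≤_) r → Filling hi la θ → Filling hi (L ∷ la) (r ∷ θ)

incRows⁻ : ∀ L {lo hi r} → r ∈ incRows L lo hi → length r ≡ L × All (_≤ hi) r × Sorted r × All (lo ≤_) r
incRows⁻ zero    (here refl) = refl , [] , [] , []
incRows⁻ (suc L) {lo} {hi} r∈ with Bind.bind⁻ _∷_ ∷-inj (λ x → incRows L x hi) {between lo hi} r∈
... | x , r , x∈ , r∈′ , refl with incRows⁻ L r∈′ | between⁻ {lo} x∈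
... | l , u , s , lw | p , q = cong suc l , q ∷ u , lw ∷ s , p ∷ All.map (≤-trans p) lw

rowFillings⁻ : ∀ la {hi θ} → θ ∈ rowFillings la hi → Filling hi la θ
rowFillings⁻ []       (here refl) = []
rowFillings⁻ (L ∷ la) {hi} θ∈ with Bind.bind⁻ _∷_ ∷-inj (λ _ → rowFillings la hi) {incRows L 1 hi} θ∈
... | r , θ , r∈ , θ∈′ , refl = incRows⁻ L r∈ ∷ rowFillings⁻ la θ∈′

∑-rowFillings : ∀ la hi f → ∑ (rowFillings la (suc hi)) f ≡
  ∑ (shapes la) (λ α → ∑ (rowFillings α hi) (λ θ → f (extend (suc hi) la θ)))
∑-rowFillings []       hi f = trans (lem (f [])) refl
  where
  lem : ∀ a → a ⊕ 0ℤ ≡ (a ⊕ 0ℤ) ⊕ 0ℤ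
  lem = ℤR.solve-∀
∑-rowFillings (L ∷ la) hi f = begin
  ∑ (rowFillings (L ∷ la) (suc hi)) f
    ≡⟨ trans (∑-bindmap _∷_ (λ _ → rowFillings la (suc hi)) (incRows L 1 (suc hi)) f) (∑-incRows L _ (s≤s z≤n)) ⟩
  ∑ (downTo L) (λ a → ∑ (incRows a 1 hi) (λ r → ∑ (rowFillings la (suc hi)) (λ θ → f ((r ++ replicate (L ∸ a) (suc hi)) ∷ θ))))
    ≡⟨ ∑-cong (downTo L) (λ a → trans (∑-cong∈ (incRows a 1 hi) (λ {r} r∈ → trans (∑-rowFillings la hi _)
         (∑-cong (shapes la) (λ α → ∑-cong (rowFillings α hi) (λ θ → cong (λ n → f ((r ++ replicate (L ∸ n) (suc hi)) ∷ extend (suc hi) la θ)) (sym (proj₁ (incRows⁻ a r∈)))))))) (∑-swap (incRows a 1 hi) (shapes la) _)) ⟩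
  ∑ (downTo L) (λ a → ∑ (shapes la) (λ α → ∑ (incRows a 1 hi) (λ r → ∑ (rowFillings α hi) (λ θ → f (stretch (suc hi) L r ∷ extend (suc hi) la θ)))))
    ≡⟨ ∑-cong (downTo L) (λ a → ∑-cong (shapes la) (λ α → sym (∑-bindmap _∷_ (λ _ → rowFillings α hi) (incRows a 1 hi) _))) ⟩
  ∑ (downTo L) (λ a → ∑ (shapes la) (λ α → ∑ (rowFillings (a ∷ α) hi) (λ θ → f (extend (suc hi) (L ∷ la) θ))))
    ≡⟨ sym (∑-bindmap _∷_ (λ _ → shapes la) (downTo L) _) ⟩
  ∑ (shapes (L ∷ la)) (λ α → ∑ (rowFillings α hi) (λ θ → f (extend (suc hi) (L ∷ la) θ))) ∎

shapes⁻ : ∀ β {α} → α ∈ shapes β → Pointwise _≤_ α β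
shapes⁻ []      (here refl) = []
shapes⁻ (b ∷ β) α∈ with Bind.bind⁻ _∷_ ∷-inj (λ _ → shapes β) {downTo b} α∈
... | a , α , a∈ , α∈′ , refl = downTo⁻ a∈ ∷ shapes⁻ β α∈′

filling-fits : ∀ {hi la α θ} → Pointwise _≤_ α la → Filling hi α θ → Fits (suc hi) la θ
filling-fits []        []                          = []
filling-fits (le ∷ ls) ((refl , u , _ , _) ∷ F) = (le , All.map s≤s u) ∷ filling-fits ls F

filling-shape : ∀ {hi α θ} → Filling hi α θ → map length θ ≡ α
filling-shape []             = refl
filling-shape ((l , _) ∷ F) = cong₂ _∷_ l (filling-shape F)

filling-sorted : ∀ {hi α θ} → Filling hi α θ → All Sorted θ
filling-sorted []                      = []
filling-sorted ((_ , _ , s , _) ∷ F) = s ∷ filling-sorted F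

extend-count-old : ∀ {h la θ} j → Fits h la θ → j ≢ h → count j (concat (extend h la θ)) ≡ count j (concat θ)
extend-count-old j [] ne = refl
extend-count-old {h} {L ∷ la} {r ∷ θ} j (_ ∷ F) ne = trans (count-++ j (stretch h L r) _) (trans (cong₂ _+_
  (trans (count-++ j r _) (trans (cong (count j r +_) (count-replicate-≢ (L ∸ length r) ne)) (+-identityʳ _))) (extend-count-old j F ne)) (sym (count-++ j r _)))

extend-count-new : ∀ {h la θ} → Fits h la θ → count h (concat (extend h la θ)) + sum (map length θ) ≡ sum la
extend-count-new [] = refl
extend-count-new {h} {L ∷ la} {r ∷ θ} ((le , p) ∷ F) = trans (cong (_+ (length r + sum (map length θ))) (trans (count-++ h (stretch h L r) _)
    (cong (_+ count h (concat (extend h la θ))) (trans (count-++ h r _) (cong₂ _+_ (count-∉ h r (λ m → <-irrefl refl (All.lookup p m))) (count-replicate-≡ h (L ∸ length r)))))))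
  (trans (lem (L ∸ length r) _ (length r) _) (cong₂ _+_ (m∸n+n≡m le) (extend-count-new F)))
  where
  lem : ∀ a b c d → a + b + (c + d) ≡ (a + c) + (b + d)
  lem = ℕR.solve-∀

contentOk-∷ʳ : ∀ i mu m ws → contentOk i (mu ++ m ∷ []) ws ≡ contentOk i mu ws ∧ (count (i + length mu) ws ≡ᵇ m)
contentOk-∷ʳ i []       m ws = trans (BP.∧-identityʳ _) (cong (λ k → count k ws ≡ᵇ m) (sym (+-identityʳ i)))
contentOk-∷ʳ i (x ∷ mu) m ws = trans (cong ((count i ws ≡ᵇ x) ∧_) (trans (contentOk-∷ʳ (suc i) mu m ws)
  (cong (λ k → contentOk (suc i) mu ws ∧ (count k ws ≡ᵇ m)) (sym (+-suc i (length mu)))))) (sym (BP.∧-assoc (count i ws ≡ᵇ x) _ _))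

contentOk-cong : ∀ i mu u v → (∀ j → j < i + length mu → count j u ≡ count j v) → contentOk i mu u ≡ contentOk i mu v
contentOk-cong i []       u v e = refl
contentOk-cong i (x ∷ mu) u v e = cong₂ (λ n b → (n ≡ᵇ x) ∧ b) (e i (m<m+n i z<s)) (contentOk-cong (suc i) mu u v (λ j lt → e j (subst (j <_) (sym (+-suc i (length mu))) lt)))

module Tabloids (t : ℤ) where
  open Strips t
  open Shapes t

  psum : (ℕ → ℕ → ℕ) → List ℕ → List ℕ → ℕ
  psum p (y ∷ β) (j ∷ α) = p y j + psum p β α
  psum p _       _       = 0

  psum-+ : ∀ p q β α → psum (λ y j → p y j + q y j) β α ≡ psum p β α + psum q β α
  psum-+ p q []      α       = refl
  psum-+ p q (y ∷ β) []      = refl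
  psum-+ p q (y ∷ β) (j ∷ α) = trans (cong ((p y j + q y j) +_) (psum-+ p q β α)) (lem (p y j) (q y j) _ _)
    where
    lem : ∀ a b c d → a + b + (c + d) ≡ (a + c) + (b + d)
    lem = ℕR.solve-∀

  psum-cross : ∀ b a β α → psum (hpair b a) β α ≡ cross b a β α
  psum-cross b a []      α       = refl
  psum-cross b a (y ∷ β) []      = refl
  psum-cross b a (y ∷ β) (j ∷ α) = cong (hpair b a y j +_) (psum-cross b a β α)

  HK-shapes : ∀ p Φ β → HK (λ y j → t ^ᶻ p y j) Φ β ≡ ∑ (shapes β) (λ α → t ^ᶻ (psum p β α + stat β α) ⊗ Φ α)
  HK-shapes p Φ []      = sym (trans (ℤP.+-identityʳ _) (ℤP.*-identityˡ _))
  HK-shapes p Φ (b ∷ β) = trans (∑-cong (downTo b) (λ a → begin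
    t ^ᶻ p b a ⊗ HK (times (λ y j → t ^ᶻ p y j) (hpair b a)) (Φ ∘ (a ∷_)) β
      ≡⟨ cong (t ^ᶻ p b a ⊗_) (trans (HS.K-cong-w (Φ ∘ (a ∷_)) β (All.tabulate (λ {y} _ {j} _ → sym (ℤP.^-distribˡ-+-* t (p y j) (hpair b a y j)))))
           (HK-shapes (λ y j → p y j + hpair b a y j) (Φ ∘ (a ∷_)) β)) ⟩
    t ^ᶻ p b a ⊗ ∑ (shapes β) (λ α → t ^ᶻ (psum (λ y j → p y j + hpair b a y j) β α + stat β α) ⊗ Φ (a ∷ α))
      ≡⟨ sym (∑-⊗ (shapes β) (t ^ᶻ p b a) _) ⟩
    ∑ (shapes β) (λ α → t ^ᶻ p b a ⊗ (t ^ᶻ (psum (λ y j → p y j + hpair b a y j) β α + stat β α) ⊗ Φ (a ∷ α)))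
      ≡⟨ ∑-cong (shapes β) (λ α → trans (sym (ℤP.*-assoc (t ^ᶻ p b a) _ _)) (cong (_⊗ Φ (a ∷ α)) (trans (sym (ℤP.^-distribˡ-+-* t (p b a) _))
           (cong (t ^ᶻ_) (trans (cong (λ n → p b a + (n + stat β α)) (trans (psum-+ p (hpair b a) β α) (cong (psum p β α +_) (psum-cross b a β α)))) (lem (p b a) (psum p β α) _ _)))))) ⟩
    ∑ (shapes β) (λ α → t ^ᶻ (psum p (b ∷ β) (a ∷ α) + stat (b ∷ β) (a ∷ α)) ⊗ Φ (a ∷ α)) ∎))
    (sym (∑-bindmap _∷_ (λ _ → shapes β) (downTo b) _))
    where
    lem : ∀ a b c d → a + (b + c + d) ≡ (a + b) + (c + d)
    lem = ℕR.solve-∀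

  psum-0 : ∀ β α → psum (λ _ _ → 0) β α ≡ 0
  psum-0 []      α       = refl
  psum-0 (y ∷ β) []      = refl
  psum-0 (y ∷ β) (j ∷ α) = psum-0 β α

  Hr-shapes : ∀ r Φ β → Hr r Φ β ≡ ∑ (shapes β) (λ α → t ^ᶻ stat β α ⊗ ((sum β ≡ᵇ r + sum α) ▹ Φ α))
  Hr-shapes r Φ β = trans (HK-shapes (λ _ _ → 0) (λ α → (sum β ≡ᵇ r + sum α) ▹ Φ α) β)
    (∑-cong (shapes β) (λ α → cong (λ n → t ^ᶻ (n + stat β α) ⊗ ((sum β ≡ᵇ r + sum α) ▹ Φ α)) (psum-0 β α)))

  fillingSum : List ℕ → List ℕ → ℤ
  fillingSum la mu = ∑ (rowFillings la (length mu)) (λ θ → contentOk 1 mu (concat θ) ▹ t ^ᶻ W θ)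

  fillingSum-[] : ∀ la → fillingSum la [] ≡ FF la []
  fillingSum-[] []           = refl
  fillingSum-[] (zero ∷ la)  = trans (∑-bindmap _∷_ (λ _ → rowFillings la 0) ([] ∷ []) _) (trans (ℤP.+-identityʳ _)
    (trans (∑-cong∈ (rowFillings la 0) (λ {θ} θ∈ → cong (t ^ᶻ_) (trans (cong₂ _+_ (empty θ) (cong (_+ W θ) (ups (rowFillings⁻ la θ∈)))) refl))) (fillingSum-[] la)))
    where
    empty : ∀ θ → sum (map (pc 1 0 []) θ) ≡ 0
    empty []      = refl
    empty (y ∷ θ) = empty θ
    ups : ∀ {la θ} → Filling 0 la θ → sum (map (λ y → pc 0 0 y []) θ) ≡ 0
    ups [] = refl
    ups {θ = [] ∷ θ} (_ ∷ F) = ups F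
    ups {θ = (x ∷ r) ∷ θ} ((_ , le ∷ _ , _ , ge ∷ _) ∷ F) = ⊥-elim (<⇒≱ ge le)
  fillingSum-[] (suc L ∷ la) = refl

  -- The cells of the largest letter are the strip cut off by `Hr m`, and `W-extend` provides its
  -- weight.
  fillingSum-∷ʳ : ∀ la mu m → fillingSum la (mu ++ m ∷ []) ≡ Hr m (λ α → fillingSum α mu) la
  fillingSum-∷ʳ la mu m = begin
    ∑ (rowFillings la (length (mu ++ m ∷ []))) (λ θ → contentOk 1 (mu ++ m ∷ []) (concat θ) ▹ t ^ᶻ W θ)
      ≡⟨ trans (cong (λ n → ∑ (rowFillings la n) (λ θ → contentOk 1 (mu ++ m ∷ []) (concat θ) ▹ t ^ᶻ W θ)) (trans (LP.length-++ mu) (+-comm hi 1)))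
           (∑-rowFillings la hi _) ⟩
    ∑ (shapes la) (λ α → ∑ (rowFillings α hi) (λ θ → contentOk 1 (mu ++ m ∷ []) (concat (extend (suc hi) la θ)) ▹ t ^ᶻ W (extend (suc hi) la θ)))
      ≡⟨ ∑-cong∈ (shapes la) (λ {α} α∈ → trans (∑-cong∈ (rowFillings α hi) (λ {θ} θ∈ → body α θ (shapes⁻ la α∈) (rowFillings⁻ α θ∈)))
           (trans (∑-⊗ (rowFillings α hi) (t ^ᶻ stat la α) _) (cong (t ^ᶻ stat la α ⊗_) (∑-▹ (rowFillings α hi) (sum la ≡ᵇ m + sum α) _)))) ⟩
    ∑ (shapes la) (λ α → t ^ᶻ stat la α ⊗ ((sum la ≡ᵇ m + sum α) ▹ fillingSum α mu))
      ≡⟨ sym (Hr-shapes m (λ α → fillingSum α mu) la) ⟩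
    Hr m (λ α → fillingSum α mu) la ∎
    where
    hi = length mu
    body : ∀ α θ → Pointwise _≤_ α la → Filling hi α θ → contentOk 1 (mu ++ m ∷ []) (concat (extend (suc hi) la θ)) ▹ t ^ᶻ W (extend (suc hi) la θ) ≡
      t ^ᶻ stat la α ⊗ ((sum la ≡ᵇ m + sum α) ▹ contentOk 1 mu (concat θ) ▹ t ^ᶻ W θ)
    body α θ le F = begin
      contentOk 1 (mu ++ m ∷ []) (concat (extend (suc hi) la θ)) ▹ t ^ᶻ W (extend (suc hi) la θ)
        ≡⟨ cong₂ _▹_ (trans (contentOk-∷ʳ 1 mu m _) (cong₂ _∧_ (contentOk-cong 1 mu _ (concat θ) (λ j lt → extend-count-old j fits (λ e → <-irrefl e lt))) content))
             (trans (cong (t ^ᶻ_) (trans (W-extend fits) (cong (λ z → W θ + stat la z) (filling-shape F)))) (ℤP.^-distribˡ-+-* t (W θ) _)) ⟩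
      (contentOk 1 mu (concat θ) ∧ (sum la ≡ᵇ m + sum α)) ▹ (t ^ᶻ W θ ⊗ t ^ᶻ stat la α)
        ≡⟨ cong₂ _▹_ (BP.∧-comm (contentOk 1 mu (concat θ)) _) (ℤP.*-comm (t ^ᶻ W θ) _) ⟩
      ((sum la ≡ᵇ m + sum α) ∧ contentOk 1 mu (concat θ)) ▹ (t ^ᶻ stat la α ⊗ t ^ᶻ W θ)
        ≡⟨ sym (▹-⊗ ((sum la ≡ᵇ m + sum α) ∧ contentOk 1 mu (concat θ)) (t ^ᶻ stat la α) (t ^ᶻ W θ)) ⟩
      t ^ᶻ stat la α ⊗ (((sum la ≡ᵇ m + sum α) ∧ contentOk 1 mu (concat θ)) ▹ t ^ᶻ W θ)
        ≡⟨ cong (t ^ᶻ stat la α ⊗_) (▹-∧ (sum la ≡ᵇ m + sum α) _ _) ⟩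
      t ^ᶻ stat la α ⊗ ((sum la ≡ᵇ m + sum α) ▹ contentOk 1 mu (concat θ) ▹ t ^ᶻ W θ) ∎
      where
      fits = filling-fits le F
      c = count (suc hi) (concat (extend (suc hi) la θ))
      content : (c ≡ᵇ m) ≡ (sum la ≡ᵇ m + sum α)
      content = sym (trans (cong₂ _≡ᵇ_ (trans (sym (trans (cong (c +_) (cong sum (sym (filling-shape F)))) (extend-count-new fits))) (+-comm c (sum α))) (+-comm m (sum α))) (≡ᵇ-+ (sum α) c m))

  -- `FF` starts with the head of its list, whereas the largest letter belongs to the last part of
  -- the content. Hence the reversal, which `tabloids-FF` undoes by the symmetry `FF-↭`.
  fillingSum-FF : ∀ ν la → fillingSum la (reverse ν) ≡ FF la ν
  fillingSum-FF []      la = fillingSum-[] la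
  fillingSum-FF (m ∷ ν) la = trans (cong (fillingSum la) (LP.unfold-reverse m ν)) (trans (fillingSum-∷ʳ la (reverse ν) m) (Hr-cong m la (λ α _ _ → fillingSum-FF ν α)))

  tabloids-FF : ∀ la mu → ∑ (tabloids la mu) (λ θ → t ^ᶻ wStat θ) ≡ FF la mu
  tabloids-FF la mu = begin
    ∑ (tabloids la mu) (λ θ → t ^ᶻ wStat θ)
      ≡⟨ ∑-filterᵇ (hasContent mu) (rowFillings la (length mu)) _ ⟩
    ∑ (rowFillings la (length mu)) (λ θ → hasContent mu θ ▹ t ^ᶻ wStat θ)
      ≡⟨ ∑-cong∈ (rowFillings la (length mu)) (λ {θ} θ∈ → cong (λ n → hasContent mu θ ▹ t ^ᶻ n) (wStat-W θ (filling-sorted (rowFillings⁻ la θ∈)))) ⟩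
    fillingSum la mu
      ≡⟨ cong (fillingSum la) (sym (LP.reverse-involutive mu)) ⟩
    fillingSum la (reverse (reverse mu))
      ≡⟨ fillingSum-FF (reverse mu) la ⟩
    FF la (reverse mu)
      ≡⟨ FF-↭ la (PermP.↭-reverse mu) ⟩
    FF la mu ∎

-- Kostka numbers

between-∷ : ∀ {lo hi} → lo ≤ hi → between lo hi ≡ lo ∷ between (suc lo) hi
between-∷ {lo} {hi} le = trans (cong (λ n → map (lo +_) (upTo n)) (+-∸-assoc 1 le)) (cong₂ _∷_ (+-identityʳ lo)
  (trans (LP.map-applyUpTo suc (lo +_) (hi ∸ lo)) (trans (applyUpTo-cong (hi ∸ lo) (+-suc lo)) (sym (LP.map-upTo (suc lo +_) (hi ∸ lo))))))
  where
  applyUpTo-cong : ∀ {f h : ℕ → ℕ} n → (∀ x → f x ≡ h x) → Data.List.applyUpTo f n ≡ Data.List.applyUpTo h n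
  applyUpTo-cong zero    e = refl
  applyUpTo-cong (suc n) e = cong₂ _∷_ (e 0) (applyUpTo-cong n (e ∘ suc))

∑-incRows-low : ∀ L {lo hi} (f : List ℕ → ℤ) → lo ≤ hi →
  ∑ (incRows L lo hi) f ≡ ∑ (splits L) (λ p → ∑ (incRows (proj₂ p) (suc lo) hi) (λ r → f (replicate (proj₁ p) lo ++ r)))
∑-incRows-low zero    f le = sym (ℤP.+-identityʳ _)
∑-incRows-low (suc L) {lo} {hi} f le = begin
  ∑ (incRows (suc L) lo hi) f
    ≡⟨ trans (∑-bindmap _∷_ (λ x → incRows L x hi) (between lo hi) f) (cong (λ bs → ∑ bs F) (between-∷ le)) ⟩
  F lo ⊕ ∑ (between (suc lo) hi) F
    ≡⟨ trans (ℤP.+-comm (F lo) _) (cong₂ _⊕_ (sym (∑-bindmap _∷_ (λ x → incRows L x hi) (between (suc lo) hi) f)) (trans (∑-incRows-low L (f ∘ (lo ∷_)) le) (sym (∑-map _ (splits L) _)))) ⟩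
  ∑ (splits (suc L)) (λ p → ∑ (incRows (proj₂ p) (suc lo) hi) (λ r → f (replicate (proj₁ p) lo ++ r))) ∎
  where
  F : ℕ → ℤ
  F x = ∑ (incRows L x hi) (λ r → f (x ∷ r))

∑-incRows-vecs : ∀ d {lo hi} L (f : List ℕ → ℤ) → lo + d ≡ suc hi → ∑ (incRows L lo hi) f ≡ ∑ (vecs d L) (f ∘ wd lo)
∑-incRows-vecs zero    {lo} {hi} zero    f e = refl
∑-incRows-vecs zero    {lo} {hi} (suc L) f e =
  cong (λ bs → ∑ (concatMap (λ x → map (x ∷_) (incRows L x hi)) bs) f) (trans (cong (λ lo → between lo hi) (trans (sym (+-identityʳ lo)) e)) (between-empty hi))
∑-incRows-vecs (suc d) {lo} {hi} L f e = trans (∑-incRows-low L f (s≤s⁻¹ (subst (lo <_) e (m<m+n lo z<s))))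
  (trans (∑-cong (splits L) (λ p → ∑-incRows-vecs d (proj₂ p) (λ r → f (replicate (proj₁ p) lo ++ r)) (trans (sym (+-suc lo d)) e))) (sym (∑-vecs d L (f ∘ wd lo))))

∑-rowFillings-mats : ∀ N ν (f : List (List ℕ) → ℤ) → ∑ (rowFillings ν N) f ≡ ∑ (mats N ν) (λ P → f (map (wd 1) P))
∑-rowFillings-mats N []      f = refl
∑-rowFillings-mats N (L ∷ ν) f = trans (∑-bindmap _∷_ (λ _ → rowFillings ν N) (incRows L 1 N) f)
  (trans (∑-incRows-vecs N L (λ r → ∑ (rowFillings ν N) (λ θ → f (r ∷ θ))) refl) (trans (∑-cong (vecs N L) (λ R → ∑-rowFillings-mats N ν (λ θ → f (wd 1 R ∷ θ))))
    (sym (∑-bindmap _∷_ (λ _ → mats N ν) (vecs N L) _))))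

-- A holds the entries of the upper row smaller than j, of which one is used up by each entry j of the lower row.
strictBelow-dom : ∀ j A U L → All (_< j) A → length U ≡ length L → strictBelow (A ++ wd j U) (wd j L) ≡ domᵇ (length A) U L
strictBelow-dom j A []      []      lt e = refl
strictBelow-dom j A (u ∷ U) (l ∷ L) lt e = go A l lt
  where
  go : ∀ A l → All (_< j) A → strictBelow (A ++ replicate u j ++ wd (suc j) U) (replicate l j ++ wd (suc j) L) ≡ domᵇ (length A) (u ∷ U) (l ∷ L)
  go A zero lt = trans (cong (λ z → strictBelow z (wd (suc j) L)) (sym (LP.++-assoc A (replicate u j) _)))
    (trans (strictBelow-dom (suc j) (A ++ replicate u j) U L (AllP.++⁺ (All.map m<n⇒m<1+n lt) (AllP.replicate⁺ u ≤-refl)) (suc-injective e))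
      (cong (λ n → domᵇ n U L) (trans (LP.length-++ A) (cong (length A +_) (LP.length-replicate u)))))
  go [] (suc l) lt = stuck (replicate u j ++ wd (suc j) U) (AllP.++⁺ (AllP.replicate⁺ u ≤-refl) (All.map <⇒≤ (wd-≥ (suc j) U)))
    where
    stuck : ∀ as → All (j ≤_) as → strictBelow as (j ∷ replicate l j ++ wd (suc j) L) ≡ false
    stuck []       []      = refl
    stuck (a ∷ as) (p ∷ _) = cong (_∧ strictBelow as (replicate l j ++ wd (suc j) L)) (≤⇒≮ᵇ p)
  go (a ∷ A) (suc l) (p ∷ lt) = trans (cong₂ _∧_ (<⇒<ᵇ-true p) (go A l lt)) (cong (_∧ domᵇ ((length A ∸ l) + u) U L) (sym (≤ᵇ-suc l (length A))))
    where
    ≤ᵇ-suc : ∀ m n → (suc m ≤ᵇ suc n) ≡ (m ≤ᵇ n)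
    ≤ᵇ-suc zero    n = refl
    ≤ᵇ-suc (suc m) n = refl

colStrict-tab : ∀ N P → All (λ R → length R ≡ N) P → colStrict (map (wd 1) P) ≡ tabᵇ P
colStrict-tab N []          _            = refl
colStrict-tab N (R ∷ [])    _            = refl
colStrict-tab N (R ∷ Q ∷ P) (e ∷ e′ ∷ es) = cong₂ _∧_ (strictBelow-dom 1 [] R Q [] (trans e (sym e′))) (colStrict-tab N (Q ∷ P) (e′ ∷ es))

mats-lengths : ∀ N κ {P} → P ∈ mats N κ → All (λ R → length R ≡ N) P
mats-lengths N []      (here refl) = []
mats-lengths N (k ∷ κ) P∈ with Mats.bind⁻ N κ {vecs N k} P∈
... | R , P , R∈ , P∈′ , refl = proj₁ (vecs⁻ {N} {k} R∈) ∷ mats-lengths N κ P∈′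

readingWord-∷ : ∀ r θ → readingWord (r ∷ θ) ≡ readingWord θ ++ r
readingWord-∷ r θ = trans (cong concat (LP.unfold-reverse r θ)) (trans (sym (LP.concat-++ (reverse θ) (r ∷ []))) (cong (readingWord θ ++_) (LP.++-identityʳ r)))

readingWord-wT : ∀ P → readingWord (map (wd 1) P) ≡ wT P
readingWord-wT []      = refl
readingWord-wT (R ∷ P) = trans (readingWord-∷ (wd 1 R) (map (wd 1) P)) (cong (_++ wd 1 R) (readingWord-wT P))

readingWord-∷ʳ-[] : ∀ θ → readingWord (θ ++ [] ∷ []) ≡ readingWord θ
readingWord-∷ʳ-[] []      = refl
readingWord-∷ʳ-[] (r ∷ θ) = trans (readingWord-∷ r (θ ++ [] ∷ [])) (trans (cong (_++ r) (readingWord-∷ʳ-[] θ)) (sym (readingWord-∷ r θ)))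

readingWord-↭ : ∀ θ → concat θ ↭ readingWord θ
readingWord-↭ []      = ↭-refl
readingWord-↭ (r ∷ θ) = ↭-trans (PermP.++⁺ˡ r (readingWord-↭ θ)) (↭-trans (PermP.++-comm r (readingWord θ)) (Perm.↭-reflexive (sym (readingWord-∷ r θ))))

contentOk-↭ : ∀ i mu {u v} → u ↭ v → contentOk i mu u ≡ contentOk i mu v
contentOk-↭ i mu {u} {v} p = contentOk-cong i mu u v (λ j _ → ↭-count j p)

SS : ℕ → List ℕ → (List ℕ → ℤ) → ℤ
SS N ν f = ∑ (rowFillings ν N) (λ θ → colStrict θ ▹ f (readingWord θ))

SS-S : ∀ N ν f → SS N ν f ≡ S N ν f
SS-S N ν f = trans (∑-rowFillings-mats N ν (λ θ → colStrict θ ▹ f (readingWord θ)))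
  (∑-cong∈ (mats N ν) (λ {P} P∈ → cong₂ _▹_ (colStrict-tab N P (mats-lengths N ν P∈)) (cong f (readingWord-wT P))))

∑-rowFillings-0 : ∀ ν N (F : List (List ℕ) → ℤ) → ∑ (rowFillings (ν ++ 0 ∷ []) N) F ≡ ∑ (rowFillings ν N) (λ θ → F (θ ++ [] ∷ []))
∑-rowFillings-0 []      N F = refl
∑-rowFillings-0 (L ∷ ν) N F = trans (∑-bindmap _∷_ (λ _ → rowFillings (ν ++ 0 ∷ []) N) (incRows L 1 N) F)
  (trans (∑-cong (incRows L 1 N) (λ r → ∑-rowFillings-0 ν N (F ∘ (r ∷_)))) (sym (∑-bindmap _∷_ (λ _ → rowFillings ν N) (incRows L 1 N) _)))

colStrict-∷ʳ-[] : ∀ θ → colStrict (θ ++ [] ∷ []) ≡ colStrict θ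
colStrict-∷ʳ-[] []          = refl
colStrict-∷ʳ-[] ([] ∷ [])      = refl
colStrict-∷ʳ-[] ((x ∷ r) ∷ []) = refl
colStrict-∷ʳ-[] (r ∷ s ∷ θ) = cong (strictBelow r s ∧_) (colStrict-∷ʳ-[] (s ∷ θ))

SS-0 : ∀ N ν f → SS N (ν ++ 0 ∷ []) f ≡ SS N ν f
SS-0 N ν f = trans (∑-rowFillings-0 ν N (λ θ → colStrict θ ▹ f (readingWord θ)))
  (∑-cong (rowFillings ν N) (λ θ → cong₂ (λ b w → b ▹ f w) (colStrict-∷ʳ-[] θ) (readingWord-∷ʳ-[] θ)))

strictBelow-length : ∀ as bs → strictBelow as bs ≡ true → length bs ≤ length as
strictBelow-length as       []       e = z≤n
strictBelow-length (a ∷ as) (b ∷ bs) e = s≤s (strictBelow-length as bs (proj₂ (∧-true⁻ {a <ᵇ b} e)))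

strictBelow-≥ : ∀ {k} as bs → strictBelow as bs ≡ true → All (k ≤_) as → All (suc k ≤_) bs
strictBelow-≥ as       []       e ps       = []
strictBelow-≥ (a ∷ as) (b ∷ bs) e (p ∷ ps) = ≤-<-trans p (<ᵇ⇒< a b (subst T (sym (proj₁ (∧-true⁻ {a <ᵇ b} e))) tt)) ∷ strictBelow-≥ as bs (proj₂ (∧-true⁻ {a <ᵇ b} e)) ps

column-decreasing : ∀ {hi ν θ} → Filling hi ν θ → colStrict θ ≡ true → Linked _≥_ ν
column-decreasing []                                    e = []
column-decreasing (_ ∷ [])                              e = [-]
column-decreasing {θ = r ∷ s ∷ θ} ((refl , _) ∷ (refl , q) ∷ F) e =
  strictBelow-length r s (proj₁ (∧-true⁻ {strictBelow r s} e)) ∷ column-decreasing ((refl , q) ∷ F) (proj₂ (∧-true⁻ {strictBelow r s} e))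

last0 : List ℕ → Bool
last0 []          = true
last0 (x ∷ [])    = x ≡ᵇ 0
last0 (x ∷ y ∷ ν) = last0 (y ∷ ν)

-- If the last row is not empty, the first column meets all rows, and its entries grow by at least
-- one from row to row.
column-height : ∀ {hi} k L ν r θ → Filling hi (L ∷ ν) (r ∷ θ) → colStrict (r ∷ θ) ≡ true → All (k ≤_) r → last0 (L ∷ ν) ≡ false →
  0 < length r × length ν + k ≤ hi
column-height k zero    []      []      [] (_ ∷ []) e ps ()
column-height k (suc L) []      (x ∷ r) [] ((_ , q ∷ _ , _) ∷ []) e (p ∷ ps) l = z<s , ≤-trans p q
column-height {hi} k L (M ∷ ν) r (s ∷ θ) (_ ∷ F) e ps l with ∧-true⁻ {strictBelow r s} e
... | e₁ , e₂ with column-height (suc k) M ν s θ F e₂ (strictBelow-≥ r s e₁ ps) l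
... | 0<s , h = ≤-trans 0<s (strictBelow-length r s e₁) , subst (_≤ hi) (+-suc (length ν) k) h

column-bound : ∀ {hi ν θ} → Filling hi ν θ → colStrict θ ≡ true → last0 ν ≡ false → length ν ≤ hi
column-bound {hi} {L ∷ ν} {r ∷ θ} (p ∷ F) e l = subst (_≤ hi) (+-comm (length ν) 1) (proj₂ (column-height 1 L ν r θ (p ∷ F) e (proj₂ (proj₂ (proj₂ p))) l))

SS-vanish : ∀ N ν f → (∀ {θ} → Filling N ν θ → colStrict θ ≡ true → ⊥) → SS N ν f ≡ 0ℤ
SS-vanish N ν f absurd = trans (∑-cong∈ (rowFillings ν N) (λ {θ} θ∈ → bad θ (rowFillings⁻ ν θ∈))) (∑-0 (rowFillings ν N))
  where
  bad : ∀ θ → Filling N ν θ → colStrict θ ▹ f (readingWord θ) ≡ 0ℤ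
  bad θ F with colStrict θ in e
  ... | true  = ⊥-elim (absurd F e)
  ... | false = refl

content : List ℕ → List ℕ → ℤ
content mu w = contentOk 1 mu w ▹ 1ℤ

kostkaℤ : List ℕ → List ℕ → ℤ
kostkaℤ ν mu = SS (length mu) ν (content mu)

∑-length : ∀ {A : Set} (xs : List A) → ∑ xs (λ _ → 1ℤ) ≡ pos (length xs)
∑-length []       = refl
∑-length (x ∷ xs) = cong (1ℤ ⊕_) (∑-length xs)

∑-ssyt : ∀ ν mu (f : List ℕ → ℤ) → ∑ (ssyt ν mu) (f ∘ readingWord) ≡ SS (length mu) ν (λ w → contentOk 1 mu w ▹ f w)
∑-ssyt ν mu f = trans (∑-filterᵇ colStrict (tabloids ν mu) (f ∘ readingWord)) (trans (∑-filterᵇ (hasContent mu) (rowFillings ν (length mu)) _)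
  (∑-cong (rowFillings ν (length mu)) (λ θ → trans (▹-comm (hasContent mu θ) (colStrict θ) _) (cong (λ b → colStrict θ ▹ b ▹ f (readingWord θ)) (contentOk-↭ 1 mu (readingWord-↭ θ))))))

kostka-ℤ : ∀ ν mu → pos (kostka ν mu) ≡ kostkaℤ ν mu
kostka-ℤ ν mu = trans (sym (∑-length (ssyt ν mu))) (∑-ssyt ν mu (λ _ → 1ℤ))

-- For `α` inside `ν`: the removed cells lie in different columns, so that `ν` exceeds `α` by a
-- horizontal strip.
lower : List ℕ → List ℕ → Bool
lower (v ∷ w ∷ ν) (a ∷ α) = (w ≤ᵇ a) ∧ lower (w ∷ ν) α
lower _           _       = true

-- No entry of the lower row may stand below a new maximal one, nor may it extend past the upper
-- row. So the lower row, new entries included, must end within the old entries of the upper one.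
strictBelow-stretch : ∀ {h} V r w s → All (_< h) r → All (_< h) s → length s ≤ w →
  strictBelow (stretch h V r) (stretch h w s) ≡ (w ≤ᵇ length r) ∧ strictBelow r s
strictBelow-stretch {h} V r w s pr ps le = trans (go (V ∸ length r) (w ∸ length s) r s pr ps) (cong (λ n → (n ≤ᵇ length r) ∧ strictBelow r s) (m+[n∸m]≡n le))
  where
  all-h : ∀ a b → strictBelow (replicate a h) (replicate b h) ≡ (b ≤ᵇ 0) ∧ true
  all-h a       zero    = refl
  all-h zero    (suc b) = refl
  all-h (suc a) (suc b) = cong (_∧ strictBelow (replicate a h) (replicate b h)) (≤⇒≮ᵇ (≤-refl {h}))
  ≤ᵇ-suc : ∀ m n → (suc m ≤ᵇ suc n) ≡ (m ≤ᵇ n)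
  ≤ᵇ-suc zero    n = refl
  ≤ᵇ-suc (suc m) n = refl
  go : ∀ a b r s → All (_< h) r → All (_< h) s → strictBelow (r ++ replicate a h) (s ++ replicate b h) ≡ (length s + b ≤ᵇ length r) ∧ strictBelow r s
  go a b       []      []      _        _        = all-h a b
  go a zero    (x ∷ r) []      _        _        = refl
  go a (suc b) (x ∷ r) []      (p ∷ pr) _        = trans (cong₂ _∧_ (<⇒<ᵇ-true p) (go a b r [] pr [])) (cong (_∧ true) (sym (≤ᵇ-suc b (length r))))
  go zero    b []      (y ∷ s) _        (q ∷ ps) = refl
  go (suc a) b []      (y ∷ s) _        (q ∷ ps) = cong (_∧ strictBelow (replicate a h) (s ++ replicate b h)) (≤⇒≮ᵇ (<⇒≤ q))
  go a b       (x ∷ r) (y ∷ s) (p ∷ pr) (q ∷ ps) = trans (cong ((x <ᵇ y) ∧_) (go a b r s pr ps)) (trans (swap∧ (x <ᵇ y) (length s + b ≤ᵇ length r) (strictBelow r s))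
    (cong (_∧ ((x <ᵇ y) ∧ strictBelow r s)) (sym (≤ᵇ-suc (length s + b) (length r)))))
    where
    swap∧ : ∀ x y z → x ∧ (y ∧ z) ≡ y ∧ (x ∧ z)
    swap∧ true  y z = refl
    swap∧ false y z = sym (BP.∧-zeroʳ y)

colStrict-extend : ∀ {h ν θ} → Fits h ν θ → colStrict (extend h ν θ) ≡ lower ν (map length θ) ∧ colStrict θ
colStrict-extend []       = refl
colStrict-extend (_ ∷ []) = refl
colStrict-extend {h} {v ∷ w ∷ ν} {r ∷ s ∷ θ} ((le , p) ∷ (le′ , p′) ∷ F) =
  trans (cong₂ _∧_ (strictBelow-stretch v r w s p p′ le′) (colStrict-extend ((le′ , p′) ∷ F))) (lem (w ≤ᵇ length r) (strictBelow r s) _ _)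
  where
  lem : ∀ a b c d → (a ∧ b) ∧ (c ∧ d) ≡ (a ∧ c) ∧ (b ∧ d)
  lem true  true  c d = refl
  lem true  false c d = sym (BP.∧-zeroʳ c)
  lem false b     c d = refl

kostkaℤ-∷ʳ : ∀ ν mu m → kostkaℤ ν (mu ++ m ∷ []) ≡ ∑ (shapes ν) (λ α → (sum ν ≡ᵇ m + sum α) ▹ lower ν α ▹ kostkaℤ α mu)
kostkaℤ-∷ʳ ν mu m = begin
  ∑ (rowFillings ν (length (mu ++ m ∷ []))) (λ θ → colStrict θ ▹ content (mu ++ m ∷ []) (readingWord θ))
    ≡⟨ trans (cong (λ n → ∑ (rowFillings ν n) (λ θ → colStrict θ ▹ content (mu ++ m ∷ []) (readingWord θ))) (trans (LP.length-++ mu) (+-comm hi 1)))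
         (∑-rowFillings ν hi _) ⟩
  ∑ (shapes ν) (λ α → ∑ (rowFillings α hi) (λ θ → colStrict (extend (suc hi) ν θ) ▹ content (mu ++ m ∷ []) (readingWord (extend (suc hi) ν θ))))
    ≡⟨ ∑-cong∈ (shapes ν) (λ {α} α∈ → trans (∑-cong∈ (rowFillings α hi) (λ {θ} θ∈ → body α θ (shapes⁻ ν α∈) (rowFillings⁻ α θ∈)))
         (trans (∑-▹ (rowFillings α hi) (sum ν ≡ᵇ m + sum α) _) (cong ((sum ν ≡ᵇ m + sum α) ▹_) (∑-▹ (rowFillings α hi) (lower ν α) _)))) ⟩
  ∑ (shapes ν) (λ α → (sum ν ≡ᵇ m + sum α) ▹ lower ν α ▹ kostkaℤ α mu) ∎
  where
  hi = length mu
  body : ∀ α θ → Pointwise _≤_ α ν → Filling hi α θ → colStrict (extend (suc hi) ν θ) ▹ content (mu ++ m ∷ []) (readingWord (extend (suc hi) ν θ)) ≡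
    (sum ν ≡ᵇ m + sum α) ▹ lower ν α ▹ colStrict θ ▹ content mu (readingWord θ)
  body α θ le F = begin
    colStrict (extend (suc hi) ν θ) ▹ contentOk 1 (mu ++ m ∷ []) (readingWord (extend (suc hi) ν θ)) ▹ 1ℤ
      ≡⟨ cong₂ (λ a b → a ▹ b ▹ 1ℤ) (trans (colStrict-extend fits) (cong (λ z → lower ν z ∧ colStrict θ) (filling-shape F)))
           (trans (sym (contentOk-↭ 1 (mu ++ m ∷ []) (readingWord-↭ (extend (suc hi) ν θ)))) (trans (contentOk-∷ʳ 1 mu m _)
             (cong₂ _∧_ (trans (contentOk-cong 1 mu _ (concat θ) (λ j lt → extend-count-old j fits (λ e → <-irrefl e lt))) (contentOk-↭ 1 mu (readingWord-↭ θ))) new))) ⟩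
    (lower ν α ∧ colStrict θ) ▹ (contentOk 1 mu (readingWord θ) ∧ (sum ν ≡ᵇ m + sum α)) ▹ 1ℤ
      ≡⟨ trans (▹-∧ (lower ν α) (colStrict θ) _) (trans (cong (λ z → lower ν α ▹ colStrict θ ▹ z) (trans (cong (_▹ 1ℤ) (BP.∧-comm (contentOk 1 mu (readingWord θ)) _)) (▹-∧ (sum ν ≡ᵇ m + sum α) _ 1ℤ)))
           (trans (cong (lower ν α ▹_) (▹-comm (colStrict θ) (sum ν ≡ᵇ m + sum α) _)) (▹-comm (lower ν α) (sum ν ≡ᵇ m + sum α) _))) ⟩
    (sum ν ≡ᵇ m + sum α) ▹ lower ν α ▹ colStrict θ ▹ content mu (readingWord θ) ∎
    where
    fits = filling-fits le F
    c = count (suc hi) (concat (extend (suc hi) ν θ))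
    new : (c ≡ᵇ m) ≡ (sum ν ≡ᵇ m + sum α)
    new = sym (trans (cong₂ _≡ᵇ_ (trans (sym (trans (cong (c +_) (cong sum (sym (filling-shape F)))) (extend-count-new fits))) (+-comm c (sum α))) (+-comm m (sum α))) (≡ᵇ-+ (sum α) c m))

dropLast : List ℕ → List ℕ
dropLast []          = []
dropLast (x ∷ [])    = []
dropLast (x ∷ y ∷ ν) = x ∷ dropLast (y ∷ ν)

dropLast-∷ʳ : ∀ κ → dropLast (κ ++ 0 ∷ []) ≡ κ
dropLast-∷ʳ []          = refl
dropLast-∷ʳ (x ∷ [])    = refl
dropLast-∷ʳ (x ∷ y ∷ κ) = cong (x ∷_) (dropLast-∷ʳ (y ∷ κ))

last0-∷ʳ : ∀ κ → last0 (κ ++ 0 ∷ []) ≡ true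
last0-∷ʳ []          = refl
last0-∷ʳ (x ∷ [])    = refl
last0-∷ʳ (x ∷ y ∷ κ) = last0-∷ʳ (y ∷ κ)

dropLast-0 : ∀ x α → last0 (x ∷ α) ≡ true → dropLast (x ∷ α) ++ 0 ∷ [] ≡ x ∷ α
dropLast-0 zero []      e = refl
dropLast-0 x    (y ∷ α) e = cong (x ∷_) (dropLast-0 y α e)

sum-∷ʳ-0 : ∀ κ → sum (κ ++ 0 ∷ []) ≡ sum κ
sum-∷ʳ-0 κ = trans (LAP.sum-++ κ (0 ∷ [])) (+-identityʳ _)

shapes⁺ : ∀ {α β} → Pointwise _≤_ α β → α ∈ shapes β
shapes⁺ []                           = here refl
shapes⁺ {β = b ∷ β} (le ∷ p) = Bind.bind⁺ _∷_ ∷-inj (λ _ → shapes β) {downTo b} (downTo⁺ le) (shapes⁺ p)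

downTo-unique : ∀ b → Unique (downTo b)
downTo-unique zero    = [] ∷ []
downTo-unique (suc b) = All.tabulate (λ m e → <-irrefl (sym e) (s≤s (downTo⁻ m))) ∷ downTo-unique b

shapes-unique : ∀ β → Unique (shapes β)
shapes-unique []      = [] ∷ []
shapes-unique (b ∷ β) = Bind.bind-unique _∷_ ∷-inj (λ _ → shapes β) (downTo-unique b) (λ _ → shapes-unique β)

inter-shape : ∀ {ν κ} → Inter ν κ → Pointwise _≤_ (κ ++ 0 ∷ []) ν × lower ν (κ ++ 0 ∷ []) ≡ true
inter-shape last = z≤n ∷ [] , refl
inter-shape (next k≤v w≤k i) = let (p , l) = inter-shape i in k≤v ∷ p , ∧-true⁺ (≤ᵇ-true⁺ w≤k) l

shape-inter : ∀ ν α {x} → Pointwise _≤_ (x ∷ α) ν → lower ν (x ∷ α) ≡ true → Inter ν (dropLast (x ∷ α))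
shape-inter (v ∷ [])     []      p l = last
shape-inter (v ∷ [])     (y ∷ α) (_ ∷ ()) l
shape-inter (v ∷ w ∷ ν) (y ∷ α) {x} (le ∷ p) l with ∧-true⁻ {w ≤ᵇ x} l
... | w≤x , l′ = next le (≤ᵇ-true⁻ {w} w≤x) (shape-inter (w ∷ ν) α p l′)

∑-restrict : ∀ {A : Set} {P : A → Set} (P? : ∀ x → Dec (P x)) (xs : List A) {f : A → ℤ} →
  (∀ {x} → x ∈ xs → ¬ P x → f x ≡ 0ℤ) → ∑ xs f ≡ ∑ (filter P? xs) f
∑-restrict P? xs {f} z = trans (∑-cong∈ xs (λ {x} x∈ → go x x∈)) (sym (∑-filter P? xs f))
  where
  go : ∀ x → x ∈ xs → f x ≡ does (P? x) ▹ f x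
  go x x∈ with P? x
  ... | yes _ = refl
  ... | no ¬p = z x∈ ¬p

-- Without its largest letter the tableau has at most `length mu` rows, so the last part of the
-- remaining shape is zero. Dropping it leads to the vectors of length `length mu` indexed in
-- `WS-kostka′`.
kostka-inter : ∀ ν mu m → length ν ≡ suc (length mu) → sum ν ≡ sum mu + m →
  kostkaℤ ν (mu ++ m ∷ []) ≡ ∑ (vecs (length mu) (sum mu)) (λ κ → inter ν κ ▹ kostkaℤ κ mu)
kostka-inter ν mu m lν sν = begin
  kostkaℤ ν (mu ++ m ∷ [])
    ≡⟨ kostkaℤ-∷ʳ ν mu m ⟩
  ∑ (shapes ν) (λ α → (sum ν ≡ᵇ m + sum α) ▹ lower ν α ▹ kostkaℤ α mu)
    ≡⟨ ∑-cong∈ (shapes ν) (λ {α} α∈ → trans (cong (λ z → (sum ν ≡ᵇ m + sum α) ▹ lower ν α ▹ z) (flat α (trans (PW.Pointwise-length (shapes⁻ ν α∈)) lν)))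
         (trans (cong ((sum ν ≡ᵇ m + sum α) ▹_) (sym (▹-∧ (lower ν α) (last0 α) _))) (sym (▹-∧ (sum ν ≡ᵇ m + sum α) (lower ν α ∧ last0 α) _)))) ⟩
  ∑ (shapes ν) (λ α → P α ▹ kostkaℤ α mu)
    ≡⟨ sym (∑-filterᵇ P (shapes ν) _) ⟩
  ∑ (filter (λ α → Data.Bool._≟_ (P α) true) (shapes ν)) (λ α → kostkaℤ α mu)
    ≡⟨ ∑-bij (filter (λ α → Data.Bool._≟_ (P α) true) (shapes ν)) (filter (λ κ → Data.Bool._≟_ (inter ν κ) true) (vecs (length mu) (sum mu)))
         dropLast (_++ 0 ∷ []) (UP.filter⁺ _ (shapes-unique ν)) (UP.filter⁺ _ (vecs-unique (length mu) (sum mu))) to from same ⟩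
  ∑ (filter (λ κ → Data.Bool._≟_ (inter ν κ) true) (vecs (length mu) (sum mu))) (λ κ → kostkaℤ κ mu)
    ≡⟨ ∑-filterᵇ (inter ν) (vecs (length mu) (sum mu)) _ ⟩
  ∑ (vecs (length mu) (sum mu)) (λ κ → inter ν κ ▹ kostkaℤ κ mu) ∎
  where
  P : List ℕ → Bool
  P α = (sum ν ≡ᵇ m + sum α) ∧ (lower ν α ∧ last0 α)
  flat : ∀ α → length α ≡ suc (length mu) → kostkaℤ α mu ≡ last0 α ▹ kostkaℤ α mu
  flat α l with last0 α in e
  ... | true  = refl
  ... | false = SS-vanish (length mu) α (content mu) (λ F c → <-irrefl refl (subst (_≤ length mu) l (column-bound F c e)))
  good : ∀ {α} → α ∈ filter (λ α → Data.Bool._≟_ (P α) true) (shapes ν) → Inter ν (dropLast α) × dropLast α ++ 0 ∷ [] ≡ α × m + sum α ≡ sum ν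
  good {α} m∈ with ∈-filter⁻ (λ α → Data.Bool._≟_ (P α) true) {xs = shapes ν} m∈
  ... | α∈ , e with ∧-true⁻ {sum ν ≡ᵇ m + sum α} e | shapes⁻ ν α∈
  ... | s , e′ | pw with ∧-true⁻ {lower ν α} e′
  ... | l , z = go α (trans (PW.Pointwise-length pw) lν) pw l z (sym (≡ᵇ-true⇒≡ {sum ν} s))
    where
    go : ∀ α → length α ≡ suc (length mu) → Pointwise _≤_ α ν → lower ν α ≡ true → last0 α ≡ true → m + sum α ≡ sum ν →
      Inter ν (dropLast α) × dropLast α ++ 0 ∷ [] ≡ α × m + sum α ≡ sum ν
    go (x ∷ α) _ pw l z s = shape-inter ν α pw l , dropLast-0 x α z , s
  to : ∀ {α} → α ∈ filter (λ α → Data.Bool._≟_ (P α) true) (shapes ν) →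
    dropLast α ∈ filter (λ κ → Data.Bool._≟_ (inter ν κ) true) (vecs (length mu) (sum mu)) × dropLast α ++ 0 ∷ [] ≡ α
  to {α} m∈ with good m∈
  ... | i , e , s = ∈-filter⁺ _ (subst₂ (λ n r → dropLast α ∈ vecs n r) (suc-injective (trans (sym (inter-length i)) lν))
    (+-cancelˡ-≡ m _ _ (trans (cong (m +_) (trans (sym (sum-∷ʳ-0 (dropLast α))) (cong sum e))) (trans s (trans sν (+-comm (sum mu) m))))) (vecs⁺ (dropLast α))) (inter⁺ i) , e
  from : ∀ {κ} → κ ∈ filter (λ κ → Data.Bool._≟_ (inter ν κ) true) (vecs (length mu) (sum mu)) →
    κ ++ 0 ∷ [] ∈ filter (λ α → Data.Bool._≟_ (P α) true) (shapes ν) × dropLast (κ ++ 0 ∷ []) ≡ κ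
  from {κ} m∈ with ∈-filter⁻ (λ κ → Data.Bool._≟_ (inter ν κ) true) {xs = vecs (length mu) (sum mu)} m∈
  ... | κ∈ , i with inter-shape (inter⁻ ν κ i) | vecs⁻ {length mu} {sum mu} κ∈
  ... | pw , l | _ , s = ∈-filter⁺ _ (shapes⁺ pw) (∧-true⁺ (trans (cong (sum ν ≡ᵇ_) (trans (cong (m +_) (trans (sum-∷ʳ-0 κ) s)) (trans (+-comm m (sum mu)) (sym sν)))) (≡ᵇ-refl (sum ν)))
    (∧-true⁺ l (last0-∷ʳ κ))) , dropLast-∷ʳ κ
  same : ∀ {α} → α ∈ filter (λ α → Data.Bool._≟_ (P α) true) (shapes ν) → kostkaℤ α mu ≡ kostkaℤ (dropLast α) mu
  same {α} m∈ = trans (cong (λ α → kostkaℤ α mu) (sym (proj₁ (proj₂ (good m∈))))) (SS-0 (length mu) (dropLast α) (content mu))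

-- The Robinson-Schensted-Knuth correspondence in summed form: `pieri` inserts the last block, and
-- `kostka-inter` adds the corresponding largest letter to the recording tableau. The list is
-- reversed so that the recursion meets the last block at the head.
WS-kostka′ : ∀ N ρ f → Knuth f → WS N (reverse ρ) f ≡ ∑ (vecs (length (reverse ρ)) (sum (reverse ρ))) (λ ν → kostkaℤ ν (reverse ρ) ⊗ S N ν f)
WS-kostka′ N []      f kn = lem (f [])
  where
  lem : ∀ a → a ≡ (1ℤ ⊕ 0ℤ) ⊗ (a ⊕ 0ℤ) ⊕ 0ℤ
  lem = ℤR.solve-∀
WS-kostka′ N (m ∷ ρ) f kn = subst (λ z → WS N z f ≡ ∑ (vecs (length z) (sum z)) (λ ν → kostkaℤ ν z ⊗ S N ν f)) (sym (LP.unfold-reverse m ρ)) (begin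
  WS N (mu ++ m ∷ []) f
    ≡⟨ WS-++ N mu (m ∷ []) f ⟩
  WS N mu (λ w → ∑ (vecs N m) (λ B → f (w ++ wd 1 B ++ [])))
    ≡⟨ WS-cong N mu (λ w _ _ → ∑-cong (vecs N m) (λ B → cong (λ z → f (w ++ z)) (LP.++-identityʳ (wd 1 B)))) ⟩
  WS N mu f′
    ≡⟨ WS-kostka′ N ρ f′ (λ e → ∑-cong (vecs N m) (λ B → kn (≈-++ʳ (wd 1 B) e))) ⟩
  ∑ (vecs (length mu) (sum mu)) (λ κ → kostkaℤ κ mu ⊗ S N κ f′)
    ≡⟨ ∑-cong∈ (vecs (length mu) (sum mu)) (λ {κ} κ∈ → trans (cong (kostkaℤ κ mu ⊗_) (trans (pieri N κ m f kn)
         (cong₂ (λ l s → ∑ (vecs (suc l) (s + m)) (λ ν → inter ν κ ▹ S N ν f)) (proj₁ (vecs⁻ {length mu} {sum mu} κ∈)) (proj₂ (vecs⁻ {length mu} {sum mu} κ∈)))))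
         (sym (∑-⊗ shapes′ (kostkaℤ κ mu) _))) ⟩
  ∑ (vecs (length mu) (sum mu)) (λ κ → ∑ shapes′ (λ ν → kostkaℤ κ mu ⊗ (inter ν κ ▹ S N ν f)))
    ≡⟨ ∑-swap (vecs (length mu) (sum mu)) shapes′ _ ⟩
  ∑ shapes′ (λ ν → ∑ (vecs (length mu) (sum mu)) (λ κ → kostkaℤ κ mu ⊗ (inter ν κ ▹ S N ν f)))
    ≡⟨ ∑-cong∈ shapes′ (λ {ν} ν∈ → trans (∑-cong (vecs (length mu) (sum mu)) (λ κ → move (inter ν κ) (kostkaℤ κ mu) (S N ν f))) (trans (∑-⊗ (vecs (length mu) (sum mu)) (S N ν f) _)
         (trans (ℤP.*-comm (S N ν f) _) (cong (_⊗ S N ν f) (sym (kostka-inter ν mu m (proj₁ (vecs⁻ {suc (length mu)} {sum mu + m} ν∈)) (proj₂ (vecs⁻ {suc (length mu)} {sum mu + m} ν∈)))))))) ⟩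
  ∑ shapes′ (λ ν → kostkaℤ ν (mu ++ m ∷ []) ⊗ S N ν f)
    ≡⟨ cong₂ (λ l s → ∑ (vecs l s) (λ ν → kostkaℤ ν (mu ++ m ∷ []) ⊗ S N ν f)) (sym (trans (LP.length-++ mu) (+-comm (length mu) 1)))
         (sym (trans (LAP.sum-++ mu (m ∷ [])) (cong (sum mu +_) (+-identityʳ m)))) ⟩
  ∑ (vecs (length (mu ++ m ∷ [])) (sum (mu ++ m ∷ []))) (λ ν → kostkaℤ ν (mu ++ m ∷ []) ⊗ S N ν f) ∎)
  where
  mu = reverse ρ
  shapes′ = vecs (suc (length mu)) (sum mu + m)
  f′ : List ℕ → ℤ
  f′ w = ∑ (vecs N m) (λ B → f (w ++ wd 1 B))
  move : ∀ b x y → x ⊗ (b ▹ y) ≡ y ⊗ (b ▹ x)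
  move true  x y = ℤP.*-comm x y
  move false x y = trans (ℤP.*-zeroʳ x) (sym (ℤP.*-zeroʳ y))

WS-kostka : ∀ N mu f → Knuth f → WS N mu f ≡ ∑ (vecs (length mu) (sum mu)) (λ ν → kostkaℤ ν mu ⊗ S N ν f)
WS-kostka N mu f kn = subst (λ z → WS N z f ≡ ∑ (vecs (length z) (sum z)) (λ ν → kostkaℤ ν z ⊗ S N ν f)) (LP.reverse-involutive mu) (WS-kostka′ N (reverse mu) f kn)

-- From vectors with trailing zeros to partitions

IsPart : ℕ → ℕ → List ℕ → Set
IsPart n b p = sum p ≡ n × All (_> 0) p × Linked _≥_ p × All (_≤ b) p

part : ℕ → List ℕ → List ℕ
part k p = suc k ∷ p

part-inj : ∀ {k k′ p p′} → part k p ≡ part k′ p′ → k ≡ k′ × p ≡ p′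
part-inj refl = refl , refl

module Parts (f n : ℕ) = Bind part part-inj (λ k → partsLe f (n ∸ k) (suc k))

linked-∷ : ∀ {k p} → All (_≤ k) p → Linked _≥_ p → Linked _≥_ (k ∷ p)
linked-∷ []       l = [-]
linked-∷ (le ∷ _) l = le ∷ l

linked-bound : ∀ {k p} → Linked _≥_ (k ∷ p) → All (_≤ k) p
linked-bound [-]      = []
linked-bound (le ∷ l) = le ∷ All.map (λ q → ≤-trans q le) (linked-bound l)

linked-tail : ∀ {k p} → Linked _≥_ (k ∷ p) → Linked _≥_ p
linked-tail [-]     = []
linked-tail (_ ∷ l) = l

partsLe⁻ : ∀ f n b {p} → p ∈ partsLe f n b → IsPart n b p
partsLe⁻ zero    zero    b (here refl) = refl , [] , [] , []
partsLe⁻ (suc f) zero    b (here refl) = refl , [] , [] , []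
partsLe⁻ (suc f) (suc n) b p∈ with Parts.bind⁻ f n {upTo (suc n ⊓ b)} p∈
... | k , p , k∈ , p∈′ , refl with partsLe⁻ f (n ∸ k) (suc k) p∈′ | ∈-upTo⁻ k∈
... | s , a , l , le | k< = cong suc (trans (cong (k +_) s) (m+[n∸m]≡n (s≤s⁻¹ (<-≤-trans k< (m⊓n≤m (suc n) b))))) , z<s ∷ a , linked-∷ le l ,
  <-≤-trans k< (m⊓n≤n (suc n) b) ∷ All.map (λ q → ≤-trans q (<-≤-trans k< (m⊓n≤n (suc n) b))) le

partsLe⁺ : ∀ f n b {p} → n ≤ f → IsPart n b p → p ∈ partsLe f n b
partsLe⁺ zero    zero    b {[]} le i = here refl
partsLe⁺ (suc f) zero    b {[]} le i = here refl
partsLe⁺ zero    zero    b {zero ∷ p}  le (_ , () ∷ _ , _)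
partsLe⁺ (suc f) zero    b {zero ∷ p}  le (_ , () ∷ _ , _)
partsLe⁺ (suc f) (suc n) b {zero ∷ p}  le (_ , () ∷ _ , _)
partsLe⁺ (suc f) (suc n) b {suc k ∷ p} le (s , _ ∷ a , l , q ∷ _) =
  Parts.bind⁺ f n {upTo (suc n ⊓ b)} (∈-upTo⁺ (⊓-glb (≤-trans (m≤m+n (suc k) (sum p)) (≤-reflexive s)) q))
    (partsLe⁺ f (n ∸ k) (suc k) (≤-trans (m∸n≤m n k) (s≤s⁻¹ le)) (trans (sym (m+n∸m≡n k (sum p))) (cong (_∸ k) (suc-injective s)) , a , linked-tail l , linked-bound l))

partsLe-unique : ∀ f n b → Unique (partsLe f n b)
partsLe-unique zero    zero    b = [] ∷ []
partsLe-unique zero    (suc n) b = []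
partsLe-unique (suc f) zero    b = [] ∷ []
partsLe-unique (suc f) (suc n) b = Parts.bind-unique f n (UP.upTo⁺ (suc n ⊓ b)) (λ k → partsLe-unique f (n ∸ k) (suc k))

strip0 : List ℕ → List ℕ
strip0 []          = []
strip0 (zero ∷ ν)  = []
strip0 (suc x ∷ ν) = suc x ∷ strip0 ν

pad : ℕ → List ℕ → List ℕ
pad q p = p ++ replicate (q ∸ length p) 0

linked-zeros : ∀ ν → Linked _≥_ (0 ∷ ν) → ν ≡ replicate (length ν) 0
linked-zeros []      l = refl
linked-zeros (x ∷ ν) (z≤n ∷ l) = cong (0 ∷_) (linked-zeros ν l)

pad-strip0 : ∀ ν → Linked _≥_ ν → pad (length ν) (strip0 ν) ≡ ν
pad-strip0 []          l = refl
pad-strip0 (zero ∷ ν)  l = cong (0 ∷_) (sym (linked-zeros ν l))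
pad-strip0 (suc x ∷ ν) l = cong (suc x ∷_) (pad-strip0 ν (linked-tail l))

strip0-pad : ∀ p k → All (_> 0) p → strip0 (p ++ replicate k 0) ≡ p
strip0-pad []          zero    a       = refl
strip0-pad []          (suc k) a       = refl
strip0-pad (suc x ∷ p) k       (_ ∷ a) = cong (suc x ∷_) (strip0-pad p k a)

strip0-≤ : ∀ {b} ν → All (_≤ b) ν → All (_≤ b) (strip0 ν)
strip0-≤ []          a       = []
strip0-≤ (zero ∷ ν)  a       = []
strip0-≤ (suc x ∷ ν) (p ∷ a) = p ∷ strip0-≤ ν a

strip0-part : ∀ ν → Linked _≥_ ν → sum (strip0 ν) ≡ sum ν × All (_> 0) (strip0 ν) × Linked _≥_ (strip0 ν) × length (strip0 ν) ≤ length ν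
strip0-part []          l = refl , [] , [] , z≤n
strip0-part (zero ∷ ν)  l = trans (sym (sum-zeros (length ν))) (cong sum (sym (linked-zeros ν l))) , [] , [] , z≤n
strip0-part (suc x ∷ ν) l with strip0-part ν (linked-tail l)
... | s , a , l′ , n = cong (suc x +_) s , z<s ∷ a , linked-∷ (strip0-≤ ν (linked-bound l)) l′ , s≤s n

linked-pad : ∀ p k → Linked _≥_ p → Linked _≥_ (p ++ replicate k 0)
linked-pad []      zero    l = []
linked-pad []      (suc k) l = linked-∷ (AllP.replicate⁺ k z≤n) (linked-pad [] k [])
linked-pad (x ∷ p) k       l = linked-∷ (AllP.++⁺ (linked-bound l) (AllP.replicate⁺ k z≤n)) (linked-pad p k (linked-tail l))

sum-bound : ∀ p → All (_≤ sum p) p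
sum-bound []      = []
sum-bound (x ∷ p) = m≤m+n x (sum p) ∷ All.map (λ q → ≤-trans q (m≤n+m (sum p) x)) (sum-bound p)

-- Vectors that do not decrease contribute nothing. The others are the partitions with at most `q`
-- parts, padded by zeros, and longer partitions contribute nothing either.
∑-partitions : ∀ q n (X : List ℕ → ℤ) → (∀ ν → X (ν ++ 0 ∷ []) ≡ X ν) → (∀ ν → ¬ Linked _≥_ ν → X ν ≡ 0ℤ) →
  (∀ ν → All (_> 0) ν → q < length ν → X ν ≡ 0ℤ) → ∑ (vecs q n) X ≡ ∑ (partitions n) X
∑-partitions q n X X-0 X-linked X-long = begin
  ∑ (vecs q n) X
    ≡⟨ ∑-restrict L? (vecs q n) (λ {ν} _ → X-linked ν) ⟩
  ∑ (filter L? (vecs q n)) X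
    ≡⟨ ∑-bij (filter L? (vecs q n)) (filter Q? (partitions n)) strip0 (pad q) (UP.filter⁺ L? (vecs-unique q n)) (UP.filter⁺ Q? (partsLe-unique n n n)) to from
         (λ {ν} ν∈ → let (_ , e) = to ν∈ in trans (cong X (sym e)) (X-pad (strip0 ν) (q ∸ length (strip0 ν)))) ⟩
  ∑ (filter Q? (partitions n)) X
    ≡⟨ sym (∑-restrict Q? (partitions n) (λ {p} p∈ ¬q → X-long p (proj₁ (proj₂ (partsLe⁻ n n n p∈))) (≰⇒> ¬q))) ⟩
  ∑ (partitions n) X ∎
  where
  L? : ∀ ν → Dec (Linked _≥_ ν)
  L? = linked? _≥?_
  Q? : ∀ p → Dec (length p ≤ q)
  Q? p = length p ≤? q
  X-pad : ∀ p k → X (p ++ replicate k 0) ≡ X p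
  X-pad p zero    = cong X (LP.++-identityʳ p)
  X-pad p (suc k) = trans (cong X (sym (LP.++-assoc p (0 ∷ []) (replicate k 0)))) (trans (X-pad (p ++ 0 ∷ []) k) (X-0 p))
  to : ∀ {ν} → ν ∈ filter L? (vecs q n) → strip0 ν ∈ filter Q? (partitions n) × pad q (strip0 ν) ≡ ν
  to {ν} m with ∈-filter⁻ L? {xs = vecs q n} m
  ... | ν∈ , l with vecs⁻ {q} {n} ν∈ | strip0-part ν l
  ... | refl , refl | s , a , l′ , le =
    ∈-filter⁺ Q? (partsLe⁺ n n n ≤-refl (s , a , l′ , subst (λ n → All (_≤ n) (strip0 ν)) s (sum-bound (strip0 ν)))) le , pad-strip0 ν l
  from : ∀ {p} → p ∈ filter Q? (partitions n) → pad q p ∈ filter L? (vecs q n) × strip0 (pad q p) ≡ p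
  from {p} m with ∈-filter⁻ Q? {xs = partitions n} m
  ... | p∈ , le with partsLe⁻ n n n p∈
  ... | s , a , l , _ = ∈-filter⁺ L? (subst₂ (λ l r → pad q p ∈ vecs l r) len tot (vecs⁺ (pad q p))) (linked-pad p _ l) , strip0-pad p _ a
    where
    len : length (pad q p) ≡ q
    len = trans (LP.length-++ p) (trans (cong (length p +_) (LP.length-replicate (q ∸ length p))) (m+[n∸m]≡n le))
    tot : sum (pad q p) ≡ n
    tot = trans (LAP.sum-++ p _) (trans (cong (sum p +_) (sum-zeros (q ∸ length p))) (trans (+-identityʳ (sum p)) s))

last0-positive : ∀ {q} ν → All (_> 0) ν → q < length ν → last0 ν ≡ false
last0-positive (suc x ∷ [])    a        lt = refl
last0-positive (x ∷ y ∷ ν)     (_ ∷ a)  lt = last0-positive {0} (y ∷ ν) a z<s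

decreasing : ∀ {la} → Linked _≥_ la → Decreasing la
decreasing []       j       = z≤n
decreasing [-]      zero    = z≤n
decreasing [-]      (suc j) = z≤n
decreasing (le ∷ l) zero    = le
decreasing (le ∷ l) (suc j) = decreasing l j

pol-⊗ : ∀ D c f u → pol D (λ k → c ⊗ f k) u ≡ c ⊗ pol D f u
pol-⊗ zero    c f u = sym (ℤP.*-zeroʳ c)
pol-⊗ (suc D) c f u = trans (cong (λ z → c ⊗ f 0 ⊕ u ⊗ z) (pol-⊗ D c (f ∘ suc) u)) (lem c (f 0) u _)
  where
  lem : ∀ c x u y → c ⊗ x ⊕ u ⊗ (c ⊗ y) ≡ c ⊗ (x ⊕ u ⊗ y)
  lem = ℤR.solve-∀

genPoly-∑ : ∀ {A : Set} (xs : List A) s k → pos (genPoly xs s k) ≡ ∑ xs (λ x → (s x ≡ᵇ k) ▹ 1ℤ)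
genPoly-∑ xs s k = trans (sym (∑-length (filter (λ x → s x ≟ k) xs))) (∑-filter (λ x → s x ≟ k) xs (λ _ → 1ℤ))

genPoly-pol : ∀ {A : Set} (xs : List A) s D u → (∀ {x} → x ∈ xs → s x < D) → pol D (λ k → pos (genPoly xs s k)) u ≡ ∑ xs (λ x → u ^ᶻ s x)
genPoly-pol xs s D u lt = trans (pol-cong D u (genPoly-∑ xs s)) (trans (pol-∑ D xs (λ x k → (s x ≡ᵇ k) ▹ 1ℤ) u)
  (∑-cong∈ xs (λ {x} x∈ → trans (pol-monomial D (s x) 1ℤ u (lt x∈)) (ℤP.*-identityʳ _))))

∈-sum : ∀ {A : Set} (f : A → ℕ) {x xs} → x ∈ xs → f x ≤ sum (map f xs)
∈-sum f {xs = y ∷ xs} (here refl) = m≤m+n (f y) _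
∈-sum f {xs = y ∷ xs} (there m)   = ≤-trans (∈-sum f m) (m≤n+m _ (f y))

pos-sum : ∀ {A : Set} (f : A → ℕ) xs → pos (sum (map f xs)) ≡ ∑ xs (pos ∘ f)
pos-sum f []       = refl
pos-sum f (x ∷ xs) = trans (ℤP.pos-+ (f x) _) (cong (pos (f x) ⊕_) (pos-sum f xs))

wT-letters : ∀ N P → All (λ R → length R ≡ N) P → Letters N (wT P)
wT-letters N []      []         = []
wT-letters N (R ∷ P) (refl ∷ e) = AllP.++⁺ (wT-letters N P e) (All.map (λ (p , q) → p , s≤s⁻¹ q) (wd-letters 1 R))

-- The identity at an integer value of t

module Modified (t : ℤ) where
  open Shapes t
  open Words t
  open Tabloids t

  g-letters : ∀ la w → Letters (length la) w → contentOk 1 la w ▹ t ^ᶻ cc w ≡ g la w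
  g-letters la w l with contentOk 1 la w in e
  ... | true  = sym (g-good la w (l , λ j → [ contentOk⁻ 1 la w e j , (λ le → trans (letters-count j l le) (sym (nth-out la j le))) ]′ (<-≤-connex j (length la))))
  ... | false = sym (g-bad la w (λ (_ , c) → absurd (trans (sym e) (contentOk⁺ 1 la w (λ j _ → c j)))))
    where
    absurd : false ≡ true → ⊥
    absurd ()

  cocharge-S : ∀ ν la → ∑ (ssyt ν la) (λ T → t ^ᶻ cocharge T) ≡ S (length la) ν (g la)
  cocharge-S ν la = trans (∑-ssyt ν la (λ w → t ^ᶻ cc w)) (trans (SS-S (length la) ν (λ w → contentOk 1 la w ▹ t ^ᶻ cc w))
    (∑-cong∈ (mats (length la) ν) (λ {P} P∈ → cong (tabᵇ P ▹_) (g-letters la (wT P) (wT-letters (length la) P (mats-lengths (length la) ν P∈))))))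

  expansion : ∀ la mu → Linked _≥_ la →
    ∑ (partitions (sum mu)) (λ ν → pos (kostka ν mu) ⊗ ∑ (ssyt ν la) (λ T → t ^ᶻ cocharge T)) ≡ ∑ (tabloids la mu) (λ θ → t ^ᶻ wStat θ)
  expansion la mu l = begin
    ∑ (partitions (sum mu)) (λ ν → pos (kostka ν mu) ⊗ ∑ (ssyt ν la) (λ T → t ^ᶻ cocharge T))
      ≡⟨ ∑-cong (partitions (sum mu)) (λ ν → cong₂ _⊗_ (kostka-ℤ ν mu) (cocharge-S ν la)) ⟩
    ∑ (partitions (sum mu)) X
      ≡⟨ sym (∑-partitions (length mu) (sum mu) X
           (λ ν → cong₂ _⊗_ (SS-0 (length mu) ν (content mu)) (trans (sym (SS-S N (ν ++ 0 ∷ []) (g la))) (trans (SS-0 N ν (g la)) (SS-S N ν (g la)))))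
           (λ ν ¬l → vanish ν (λ F c → ¬l (column-decreasing F c)))
           (λ ν a lt → vanish ν (λ F c → <⇒≱ lt (column-bound F c (last0-positive ν a lt))))) ⟩
    ∑ (vecs (length mu) (sum mu)) X
      ≡⟨ sym (WS-kostka N mu (g la) (g-knuth la (decreasing l))) ⟩
    WS N mu (g la)
      ≡⟨ WS-FF la (decreasing l) mu ⟩
    FF la mu
      ≡⟨ sym (tabloids-FF la mu) ⟩
    ∑ (tabloids la mu) (λ θ → t ^ᶻ wStat θ) ∎
    where
    N = length la
    X : List ℕ → ℤ
    X ν = kostkaℤ ν mu ⊗ S N ν (g la)
    vanish : ∀ ν → (∀ {θ} → Filling (length mu) ν θ → colStrict θ ≡ true → ⊥) → X ν ≡ 0ℤ
    vanish ν no-tableau = trans (cong (_⊗ S N ν (g la)) (SS-vanish (length mu) ν (content mu) no-tableau)) (ℤP.*-zeroˡ (S N ν (g la)))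

theorem4p4 : (n : ℕ) (la mu : List ℕ) → IsPartition la → IsPartition mu →
             sum la ≡ n → sum mu ≡ n →
             (k : ℕ) → aCoeff n la mu k ≡ genPoly (tabloids la mu) wStat k
theorem4p4 n la mu (_ , l) _ _ refl k = ℤP.+-injective (pol-injective D (λ k → pos (aCoeff n la mu k)) (λ k → pos (genPoly (tabloids la mu) wStat k)) equal k (s≤s (m≤m+n k _)))
  where
  B : List ℕ → ℕ
  B ν = sum (map (suc ∘ cocharge) (ssyt ν la))
  -- `D` exceeds `k` and every exponent that occurs on either side, so the truncated polynomials are
  -- the full generating functions.
  D = suc (k + (sum (map B (partitions n)) + sum (map (suc ∘ wStat) (tabloids la mu))))
  below₁ : ∀ {ν T} → ν ∈ partitions n → T ∈ ssyt ν la → cocharge T < D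
  below₁ {ν} ν∈ T∈ = ≤-trans (∈-sum (suc ∘ cocharge) T∈) (≤-trans (∈-sum B ν∈) (≤-trans (m≤m+n _ _) (≤-trans (m≤n+m _ k) (n≤1+n _))))
  below₂ : ∀ {θ} → θ ∈ tabloids la mu → wStat θ < D
  below₂ θ∈ = ≤-trans (∈-sum (suc ∘ wStat) θ∈) (≤-trans (m≤n+m _ _) (≤-trans (m≤n+m _ k) (n≤1+n _)))
  equal : ∀ j → pol D (λ k → pos (aCoeff n la mu k)) (pos (suc j)) ≡ pol D (λ k → pos (genPoly (tabloids la mu) wStat k)) (pos (suc j))
  equal j = begin
    pol D (λ k → pos (aCoeff n la mu k)) t
      ≡⟨ trans (pol-cong D t (λ k → pos-sum (λ ν → Ktilde ν la k * kostka ν mu) (partitions n))) (pol-∑ D (partitions n) (λ ν k → pos (Ktilde ν la k * kostka ν mu)) t) ⟩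
    ∑ (partitions n) (λ ν → pol D (λ k → pos (Ktilde ν la k * kostka ν mu)) t)
      ≡⟨ ∑-cong∈ (partitions n) (λ {ν} ν∈ → trans (pol-cong D t (λ k → trans (ℤP.pos-* (Ktilde ν la k) (kostka ν mu)) (ℤP.*-comm (pos (Ktilde ν la k)) _)))
           (trans (pol-⊗ D (pos (kostka ν mu)) (λ k → pos (Ktilde ν la k)) t) (cong (pos (kostka ν mu) ⊗_) (genPoly-pol (ssyt ν la) cocharge D t (below₁ ν∈))))) ⟩
    ∑ (partitions n) (λ ν → pos (kostka ν mu) ⊗ ∑ (ssyt ν la) (λ T → t ^ᶻ cocharge T))
      ≡⟨ Modified.expansion t la mu l ⟩
    ∑ (tabloids la mu) (λ θ → t ^ᶻ wStat θ)
      ≡⟨ sym (genPoly-pol (tabloids la mu) wStat D t below₂) ⟩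
    pol D (λ k → pos (genPoly (tabloids la mu) wStat k)) t ∎
    where
    t = pos (suc j)
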